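{- Let $a<b$ be coprime positive integers and let $\mathbf r=(r_1,\dots,r_a)$ be nonnegative integers with $\sum_{i=1}^a i r_i=a$; set $k=\sum_{i=1}^a r_i$. Let $X$ be the set of $\pi\in\mathsf{NC}(a,b)$ having exactly $r_i$ blocks of $a,b$-rank $i$ for each $1\le i\le a$, and let $C=\mathbb{Z}_{b-1}$ act on $X$ by rotation. Then $(X,C,X(q))$ exhibits the cyclic sieving phenomenon, where $$X(q)=\mathsf{Krew}_q(a,b,\mathbf r)=\frac{[b-1]_q!}{[r_1]_q!\,[r_2]_q!\cdots[r_a]_q!\,[b-k]_q!}.$$
   Context: Let $a<b$ be coprime positive integers and $[b-1]=\{1,\dots,b-1\}$. An $a,b$-Dyck path is a lattice path from $(0,0)$ to $(b,a)$ using unit north and east steps that stays weakly above the line $y=\frac{a}{b}x$. A valley of such a path $D$ is a lattice point of $D$ immediately preceded by an east step and immediately followed by a north step. From each valley $P$ fire the laser $\ell(P)$: the segment of slope $\frac ab$ from $P$ going northeast until it first meets $D$ again. Label the east endpoints of the first $b-1$ east steps of $D$ from left to right by $1,\dots,b-1$, each label regarded as sitting slightly below its lattice point. The set partition $\pi(D)$ of $[b-1]$ declares $i\sim j$ iff labels $i,j$ are not separated by any valley laser. $\mathsf{NC}(a,b)=\{\pi(D): D\text{ an }a,b\text{ -Dyck path}\}$. Rotation: a generator of $\mathbb Z_{b-1}$ acts by $\mathtt{rot}$, the permutation $i\mapsto i+1$ ($i<b-1$), $b-1\mapsto1$, applied blockwise. Rank: for a noncrossing partition $\pi$ of $[b-1]$,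 order its blocks by $B'\preceq B$ iff $[\min B',\max B']\subseteq[\min B,\max B]$; the integers $\mathrm{rank}^{\pi}_{a,b}(B)$ are the unique integers with $\sum_{B'\preceq B}\mathrm{rank}^{\pi}_{a,b}(B')=\lceil(\max B-\min B+1)\frac ab\rceil$ for all blocks $B$. Notation: $[n]_q=1+q+\cdots+q^{n-1}$, $[n]_q!=[1]_q\cdots[n]_q$. Cyclic sieving: for a finite set $X$ acted on by a cyclic group $C=\langle c\rangle$ of order $n$ and a polynomial $X(q)$ with nonnegative integer coefficients, $(X,C,X(q))$ exhibits the cyclic sieving phenomenon if $X(\zeta^d)=|\{x\in X: c^d.x=x\}|$ for all $d\ge0$, where $\zeta$ is a primitive $n$-th root of unity. -}

module Defs where

open import Level using (0ℓ)
open import Data.Bool using (Bool; true; false; not; _∧_; _∨_; _xor_; if_then_else_)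
open import Data.Nat as ℕ using (ℕ; zero; suc; _+_; _*_; _∸_; _≤_; _<_; _<ᵇ_; _⊔_)
open import Data.Nat.DivMod using (_/_)
open import Data.Nat.Coprimality using (Coprime)
open import Data.Integer as ℤ using (ℤ; +_)
open import Data.Fin using (Fin; zero; suc; toℕ; fromℕ; inject₁)
open import Data.List as List using (List; []; _∷_; length; map; foldr; upTo; allFin; filterᵇ; take)
open import Data.Bool.ListAction using (all; any)
open import Data.List.Membership.Propositional using (_∈_)
open import Data.List.Relation.Unary.Unique.Propositional using (Unique)
open import Data.Vec as Vec using (Vec; tabulate; lookup)
open import Data.Product using (Σ; _×_; _,_; ∃)
open import Data.Sum using (_⊎_)
open import Relation.Nullary using (¬_; ⌊_⌋)
open import Relation.Binary.PropositionalEquality using (_≡_)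
open import Algebra.Bundles using (CommutativeRing)

-- Polynomials in q with natural-number coefficients (ascending lists)

Poly : Set
Poly = List ℕ

_+ₚ_ : Poly → Poly → Poly
[] +ₚ q = q
(c ∷ p) +ₚ [] = c ∷ p
(c ∷ p) +ₚ (d ∷ q) = (c + d) ∷ (p +ₚ q)

_*ₚ_ : Poly → Poly → Poly
[] *ₚ q = []
(c ∷ p) *ₚ q = map (c *_) q +ₚ (0 ∷ (p *ₚ q))

coeff : ℕ → Poly → ℕ
coeff i [] = 0
coeff zero (c ∷ p) = c
coeff (suc i) (c ∷ p) = coeff i p

_≈ₚ_ : Poly → Poly → Set
p ≈ₚ q = ∀ i → coeff i p ≡ coeff i q

qint : ℕ → Poly
qint n = List.replicate n 1

qfact : ℕ → Poly
qfact zero = 1 ∷ []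
qfact (suc n) = qint (suc n) *ₚ qfact n

prodₚ : List Poly → Poly
prodₚ = foldr _*ₚ_ (1 ∷ [])

-- numerator and denominator of Krew_q(a,b,r) = [b-1]_q! / ([r_1]_q! ... [r_a]_q! [b-k]_q!)
-- (r is indexed from 0: lookup r t = r_(t+1))
krewNum : ℕ → Poly
krewNum b = qfact (b ∸ 1)

krewDen : ∀ {a} → ℕ → Vec ℕ a → Poly
krewDen b r = prodₚ (Vec.toList (Vec.map qfact r)) *ₚ qfact (b ∸ Vec.sum r)

module RingEval (R : CommutativeRing 0ℓ 0ℓ) where
  open CommutativeRing R hiding (_+_; _*_)
  open CommutativeRing R using () renaming (_+_ to _⊕_; _*_ to _⊛_)

  ιℕ : ℕ → Carrier
  ιℕ zero = 0#
  ιℕ (suc n) = 1# ⊕ ιℕ n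

  pow : Carrier → ℕ → Carrier
  pow x zero = 1#
  pow x (suc n) = x ⊛ pow x n

  eval : Poly → Carrier → Carrier
  eval p x = foldr (λ c acc → ιℕ c ⊕ (x ⊛ acc)) 0# p

  IsChar0Domain : Set
  IsChar0Domain = (¬ (1# ≈ 0#))
                × (∀ x y → (x ⊛ y) ≈ 0# → x ≈ 0# ⊎ y ≈ 0#)
                × (∀ n → ¬ (ιℕ (suc n) ≈ 0#))

  IsPrimitiveRoot : ℕ → Carrier → Set
  IsPrimitiveRoot n ζ = (pow ζ n ≈ 1#) × (∀ j → 0 < j → j < n → ¬ (pow ζ j ≈ 1#))

data Step : Set where
  N E : Step

Path : Set
Path = List Step

countN countE : Path → ℕ
countN = List.length ∘' filterᵇ isN
  where
    isN : Step → Bool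
    isN N = true
    isN E = false
    _∘'_ : ∀ {A B C : Set} → (B → C) → (A → B) → A → C
    (f ∘' g) x = f (g x)
countE = λ p → List.length (filterᵇ isE p)
  where
    isE : Step → Bool
    isE N = false
    isE E = true

-- a,b-Dyck path: from (0,0) to (b,a) with unit N/E steps, weakly above y = (a/b) x
-- (every lattice point (x,y) on the path satisfies a*x ≤ b*y)
IsDyck : ℕ → ℕ → Path → Set
IsDyck a b D = countN D ≡ a × countE D ≡ b
             × (∀ n → a * countE (take n D) ≤ b * countN (take n D))

-- height (y-coordinate) of the j-th east step (j ≥ 1); 0 if there is none
eastHeight : Path → ℕ → ℕ
eastHeight D j = go 0 D j
  where
    go : ℕ → Path → ℕ → ℕ
    go h [] j = 0
    go h (N ∷ s) j = go (suc h) s j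
    go h (E ∷ s) zero = 0
    go h (E ∷ s) (suc zero) = h
    go h (E ∷ s) (suc (suc j)) = go h s (suc j)

valleys : Path → List (ℕ × ℕ)
valleys D = go 0 0 D
  where
    go : ℕ → ℕ → Path → List (ℕ × ℕ)
    go x h [] = []
    go x h (N ∷ s) = go x (suc h) s
    go x h (E ∷ []) = []
    go x h (E ∷ N ∷ s) = (suc x , h) ∷ go (suc x) h (N ∷ s)
    go x h (E ∷ E ∷ s) = go (suc x) h (E ∷ s)

-- label i (the east endpoint (i , y_i) of the i-th east step, sitting slightly
-- below it) lies strictly between the laser ℓ(P) from valley P = (x , y) and D.
-- The laser y' = y + (a/b)(x' - x) stays below D exactly while the east
-- endpoints (j , y_j), x < j, lie above it, i.e. a(j - x) < b(y_j - y); it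
-- first meets D on the first east step violating this.
underPath : ℕ → ℕ → Path → ℕ × ℕ → ℕ → Bool
underPath a b D (x , y) i =
  (x <ᵇ i) ∧ all (λ j → (a * (j ∸ x) + b * y) <ᵇ (b * eastHeight D j))
                 (map (λ t → x + suc t) (upTo (i ∸ x)))

separated : ℕ → ℕ → Path → ℕ → ℕ → Bool
separated a b D i j = any (λ P → underPath a b D P i xor underPath a b D P j) (valleys D)

-- set partitions of [m] are represented by their equivalence relation,
-- as an m×m Boolean matrix; Fin m index t stands for label t+1
Rel : ℕ → Set
Rel m = Vec (Vec Bool m) m

rel : ∀ {m} → Rel m → Fin m → Fin m → Bool
rel R i j = lookup (lookup R i) j

πD : ℕ → (b : ℕ) → Path → Rel (b ∸ 1)
πD a b D = tabulate λ i → tabulate λ j →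
  not (separated a b D (suc (toℕ i)) (suc (toℕ j)))

InNC : ℕ → (b : ℕ) → Rel (b ∸ 1) → Set
InNC a b π = ∃ λ D → IsDyck a b D × πD a b D ≡ π

rotInv : ∀ {m} → Fin m → Fin m
rotInv {suc n} zero = fromℕ n
rotInv {suc n} (suc i) = inject₁ i

rot : ∀ {m} → Rel m → Rel m
rot R = tabulate λ i → tabulate λ j → rel R (rotInv i) (rotInv j)

rotIter : ∀ {m} → ℕ → Rel m → Rel m
rotIter zero R = R
rotIter (suc d) R = rot (rotIter d R)

-- a block is represented by its minimal element
isMin : ∀ {m} → Rel m → Fin m → Bool
isMin {m} R i = all (λ j → not ((toℕ j <ᵇ toℕ i) ∧ rel R i j)) (allFin m)

blockMax : ∀ {m} → Rel m → Fin m → ℕ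
blockMax {m} R i = foldr (λ j acc → if rel R i j then toℕ j ⊔ acc else acc) (toℕ i) (allFin m)

nestedIn : ∀ {m} → Rel m → Fin m → Fin m → Bool
nestedIn R i' i = not (toℕ i' <ᵇ toℕ i) ∧ not (blockMax R i <ᵇ blockMax R i')

sumℤ : List ℤ → ℤ
sumℤ = foldr ℤ._+_ (+ 0)

ceilDiv : ℕ → ℕ → ℕ
ceilDiv n zero = 0
ceilDiv n (suc b) = (n + b) / suc b

-- rk gives the a,b-ranks of the blocks (read at block minima)
IsRankFn : ℕ → ℕ → ∀ {m} → Rel m → (Fin m → ℤ) → Set
IsRankFn a b {m} R rk = ∀ i → isMin R i ≡ true →
  sumℤ (map rk (filterᵇ (λ i' → isMin R i' ∧ nestedIn R i' i) (allFin m)))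
    ≡ + ceilDiv ((suc (blockMax R i) ∸ toℕ i) * a) b

blocksOfRank : ∀ {m} → Rel m → (Fin m → ℤ) → ℕ → ℕ
blocksOfRank {m} R rk t =
  length (filterᵇ (λ i → isMin R i ∧ ⌊ rk i ℤ.≟ + t ⌋) (allFin m))

HasRankProfile : (a b : ℕ) → Vec ℕ a → Rel (b ∸ 1) → Set
HasRankProfile a b r π = Σ (Fin (b ∸ 1) → ℤ) λ rk →
  IsRankFn a b π rk × (∀ (t : Fin a) → blocksOfRank π rk (suc (toℕ t)) ≡ lookup r t)

InX : (a b : ℕ) → Vec ℕ a → Rel (b ∸ 1) → Set
InX a b r π = InNC a b π × HasRankProfile a b r π

EnumeratesFixed : (a b : ℕ) → Vec ℕ a → ℕ → List (Rel (b ∸ 1)) → Set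
EnumeratesFixed a b r d L = Unique L
  × (∀ π → (π ∈ L → InX a b r π × rotIter d π ≡ π)
         × (InX a b r π × rotIter d π ≡ π → π ∈ L))

{-# OPTIONS --safe #-}

-- Encode a Dyck path by its run lengths n₁ … n_m (m = b - 1), with levels h_i = b (n₁ + … + n_i) - a i. Two labels lie
-- in the same block iff the nearest earlier position of smaller level is the same x; the block then starts at x + 1
-- and its rank is n_{x+1}. Read periodically, a run-length word knows the partition up to a choice of centre: the
-- centre may be moved through the complementary region (rotating the word) or around a block (moving the rank of
-- that block to another of its labels), and these moves realise rotation. A partition fixed by rotation by g, with
-- m = n g and n ≥ 2, has its centre either in a fixed region or in a fixed block; seen from there its word is
-- g-periodic, and every word of length g with the right content occurs exactly once. For n = 1 the cycle lemma
-- counts all partitions.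
--
-- On the algebraic side, Krew_q = M / [b] for a q-multinomial coefficient M. Since [b] divides [r_i] M and [b] M it
-- divides [gcd] M = M. The coefficients of M are unimodal by an sl₂ action on products of sets of 0/1-sequences, and
-- therefore (1 - q) M / (1 - q^b) has nonnegative coefficients. At a root of unity of order n ≥ 2 one extracts the
-- factors [n] from all q-factorials and is left with the multinomial coefficient of the quotients by n, or with 0.
module Submission where

-- The obstacle is that the word of a partition depends on where its reading starts: the rank of a
-- block is written at the first of its labels, so a block that meets the cut carries its rank
-- elsewhere after a rotation. Hence the word of a fixed partition is in general not periodic. It
-- becomes so when cut at the centre, and if the centre lies in a block, the rank `j` of that block
-- must first be taken out. In both cases the full word, of `b = n g + 1` letters with its final 0,
-- has `n` times the content of the period plus one extra letter `j` (0 for a region). As `n ≥ 2`,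
-- division with remainder by `n` fixes both `j` and the content of the period, and the same
-- quotients and remainders govern the value of `X` at a root of unity of order `n`. Coprimality
-- alone yields a quotient with integer coefficients; unimodality is there for their sign. Every
-- quotient is stated multiplied out and cancelled at the end: polynomials by factors with constant
-- term 1, ring elements by nonzero ones.

-- The commutative semiring of polynomials over the natural numbers.

module Polynomial where

  open import Defs
  open import Data.Nat using (ℕ; zero; suc; _+_; _*_; _<_; s≤s)
  open import Data.Nat.Properties
  open import Data.Nat.Tactic.RingSolver using (solve-∀)
  open import Data.List using ([]; _∷_; map)
  open import Data.Product using (_,_)
  open import Data.Sum using (inj₁; inj₂)
  open import Relation.Binary.PropositionalEquality
  open import Relation.Binary.Bundles using (Setoid)
  open import Relation.Binary.Structures using (IsEquivalence)
  open import Algebra.Bundles using (CommutativeSemiring)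
  open import Level using (0ℓ)
  import Relation.Binary.Reasoning.Setoid as SetoidR


  scale : ℕ → Poly → Poly
  scale c = map (c *_)

  infix 4 _≋_
  -- A record around `_≈ₚ_`, because from a bare family of equations between coefficients the
  -- polynomials `p` and `q` could not be inferred.
  record _≋_ (p q : Poly) : Set where
    constructor mk
    field at : p ≈ₚ q
  open _≋_ public

  ≋-refl : ∀ {p} → p ≋ p
  ≋-refl = mk λ i → refl

  ≋-sym : ∀ {p q} → p ≋ q → q ≋ p
  ≋-sym e = mk λ i → sym (at e i)

  ≋-trans : ∀ {p q r} → p ≋ q → q ≋ r → p ≋ r
  ≋-trans e f = mk λ i → trans (at e i) (at f i)

  ≋-equiv : IsEquivalence _≋_
  ≋-equiv = record { refl = ≋-refl ; sym = ≋-sym ; trans = ≋-trans }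

  ≋-setoid : Setoid 0ℓ 0ℓ
  ≋-setoid = record { isEquivalence = ≋-equiv }

  coeff-+ : ∀ i p q → coeff i (p +ₚ q) ≡ coeff i p + coeff i q
  coeff-+ i [] q = refl
  coeff-+ zero (c ∷ p) [] = sym (+-identityʳ c)
  coeff-+ (suc i) (c ∷ p) [] = sym (+-identityʳ _)
  coeff-+ zero (c ∷ p) (d ∷ q) = refl
  coeff-+ (suc i) (c ∷ p) (d ∷ q) = coeff-+ i p q

  coeff-scale : ∀ i c p → coeff i (scale c p) ≡ c * coeff i p
  coeff-scale i c [] = sym (*-zeroʳ c)
  coeff-scale zero c (d ∷ p) = refl
  coeff-scale (suc i) c (d ∷ p) = coeff-scale i c p

  ∷-cong : ∀ {c d p q} → c ≡ d → p ≋ q → (c ∷ p) ≋ (d ∷ q)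
  ∷-cong e f = mk λ { zero → e ; (suc i) → at f i }

  0∷[] : (0 ∷ []) ≋ []
  0∷[] = mk λ { zero → refl ; (suc i) → refl }

  +ₚ-cong : ∀ {p p' q q'} → p ≋ p' → q ≋ q' → (p +ₚ q) ≋ (p' +ₚ q')
  +ₚ-cong {p} {p'} {q} {q'} e f = mk λ i →
    trans (coeff-+ i p q) (trans (cong₂ _+_ (at e i) (at f i)) (sym (coeff-+ i p' q')))

  +ₚ-assoc : ∀ p q r → ((p +ₚ q) +ₚ r) ≋ (p +ₚ (q +ₚ r))
  +ₚ-assoc p q r = mk λ i → begin
    coeff i ((p +ₚ q) +ₚ r)               ≡⟨ coeff-+ i (p +ₚ q) r ⟩
    coeff i (p +ₚ q) + coeff i r          ≡⟨ cong (_+ coeff i r) (coeff-+ i p q) ⟩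
    coeff i p + coeff i q + coeff i r     ≡⟨ +-assoc (coeff i p) _ _ ⟩
    coeff i p + (coeff i q + coeff i r)   ≡⟨ cong (coeff i p +_) (coeff-+ i q r) ⟨
    coeff i p + coeff i (q +ₚ r)          ≡⟨ coeff-+ i p (q +ₚ r) ⟨
    coeff i (p +ₚ (q +ₚ r))               ∎
    where open ≡-Reasoning

  +ₚ-comm : ∀ p q → (p +ₚ q) ≋ (q +ₚ p)
  +ₚ-comm p q = mk λ i → trans (coeff-+ i p q) (trans (+-comm (coeff i p) _) (sym (coeff-+ i q p)))

  +ₚ-identityʳ : ∀ p → (p +ₚ []) ≋ p
  +ₚ-identityʳ p = +ₚ-comm p []

  scale-cong : ∀ c {p q} → p ≋ q → scale c p ≋ scale c q
  scale-cong c {p} {q} e = mk λ i →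
    trans (coeff-scale i c p) (trans (cong (c *_) (at e i)) (sym (coeff-scale i c q)))

  scale-+ : ∀ c p q → scale c (p +ₚ q) ≋ (scale c p +ₚ scale c q)
  scale-+ c p q = mk λ i → begin
    coeff i (scale c (p +ₚ q))                    ≡⟨ coeff-scale i c (p +ₚ q) ⟩
    c * coeff i (p +ₚ q)                          ≡⟨ cong (c *_) (coeff-+ i p q) ⟩
    c * (coeff i p + coeff i q)                   ≡⟨ *-distribˡ-+ c (coeff i p) _ ⟩
    c * coeff i p + c * coeff i q                 ≡⟨ cong₂ _+_ (coeff-scale i c p) (coeff-scale i c q) ⟨
    coeff i (scale c p) + coeff i (scale c q)     ≡⟨ coeff-+ i (scale c p) (scale c q) ⟨
    coeff i (scale c p +ₚ scale c q)              ∎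
    where open ≡-Reasoning

  scale-scale : ∀ c d p → scale (c * d) p ≋ scale c (scale d p)
  scale-scale c d p = mk λ i → begin
    coeff i (scale (c * d) p)   ≡⟨ coeff-scale i (c * d) p ⟩
    c * d * coeff i p           ≡⟨ *-assoc c d _ ⟩
    c * (d * coeff i p)         ≡⟨ cong (c *_) (coeff-scale i d p) ⟨
    c * coeff i (scale d p)     ≡⟨ coeff-scale i c (scale d p) ⟨
    coeff i (scale c (scale d p)) ∎
    where open ≡-Reasoning

  scale-0 : ∀ p → scale 0 p ≋ []
  scale-0 p = mk λ i → coeff-scale i 0 p

  scale-1 : ∀ p → scale 1 p ≋ p
  scale-1 p = mk λ i → trans (coeff-scale i 1 p) (*-identityˡ _)

  interchange : ∀ p q r s → ((p +ₚ q) +ₚ (r +ₚ s)) ≋ ((p +ₚ r) +ₚ (q +ₚ s))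
  interchange p q r s = mk λ i → begin
    coeff i ((p +ₚ q) +ₚ (r +ₚ s))  ≡⟨ coeff4 i p q r s ⟩
    (coeff i p + coeff i q) + (coeff i r + coeff i s) ≡⟨ +-interchange (coeff i p) (coeff i q) (coeff i r) (coeff i s) ⟩
    (coeff i p + coeff i r) + (coeff i q + coeff i s) ≡⟨ coeff4 i p r q s ⟨
    coeff i ((p +ₚ r) +ₚ (q +ₚ s)) ∎
    where
    open ≡-Reasoning
    coeff4 : ∀ i p q r s → coeff i ((p +ₚ q) +ₚ (r +ₚ s)) ≡ (coeff i p + coeff i q) + (coeff i r + coeff i s)
    coeff4 i p q r s = trans (coeff-+ i (p +ₚ q) (r +ₚ s)) (cong₂ _+_ (coeff-+ i p q) (coeff-+ i r s))
    +-interchange : ∀ p q r s → (p + q) + (r + s) ≡ (p + r) + (q + s)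
    +-interchange = solve-∀

  *ₚ-congʳ : ∀ p {q q'} → q ≋ q' → (p *ₚ q) ≋ (p *ₚ q')
  *ₚ-congʳ [] e = ≋-refl
  *ₚ-congʳ (c ∷ p) e = +ₚ-cong (scale-cong c e) (∷-cong refl (*ₚ-congʳ p e))

  *ₚ-zeroʳ : ∀ p → (p *ₚ []) ≋ []
  *ₚ-zeroʳ [] = ≋-refl
  *ₚ-zeroʳ (c ∷ p) = ≋-trans (∷-cong refl (*ₚ-zeroʳ p)) 0∷[]

  module PR = SetoidR ≋-setoid

  -- The recursion of `_*ₚ_` in its second argument; commutativity compares it with the defining
  -- recursion in the first.
  *ₚ-∷ʳ : ∀ p d q → (p *ₚ (d ∷ q)) ≋ (scale d p +ₚ (0 ∷ (p *ₚ q)))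
  *ₚ-∷ʳ [] d q = ≋-sym 0∷[]
  *ₚ-∷ʳ (c ∷ p) d q = ∷-cong (cong (_+ 0) (*-comm c d)) (begin
    scale c q +ₚ (p *ₚ (d ∷ q))                       ≈⟨ +ₚ-cong (≋-refl {scale c q}) (*ₚ-∷ʳ p d q) ⟩
    scale c q +ₚ (scale d p +ₚ (0 ∷ (p *ₚ q)))        ≈⟨ +ₚ-assoc (scale c q) (scale d p) _ ⟨
    (scale c q +ₚ scale d p) +ₚ (0 ∷ (p *ₚ q))        ≈⟨ +ₚ-cong (+ₚ-comm (scale c q) (scale d p)) ≋-refl ⟩
    (scale d p +ₚ scale c q) +ₚ (0 ∷ (p *ₚ q))        ≈⟨ +ₚ-assoc (scale d p) (scale c q) _ ⟩
    scale d p +ₚ (scale c q +ₚ (0 ∷ (p *ₚ q)))        ∎)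
    where open PR

  *ₚ-comm : ∀ p q → (p *ₚ q) ≋ (q *ₚ p)
  *ₚ-comm [] q = ≋-sym (*ₚ-zeroʳ q)
  *ₚ-comm (c ∷ p) q = ≋-trans (+ₚ-cong (≋-refl {scale c q}) (∷-cong refl (*ₚ-comm p q))) (≋-sym (*ₚ-∷ʳ q c p))

  *ₚ-cong : ∀ {p p' q q'} → p ≋ p' → q ≋ q' → (p *ₚ q) ≋ (p' *ₚ q')
  *ₚ-cong {p} {p'} {q} {q'} e f = begin
    p *ₚ q   ≈⟨ *ₚ-congʳ p f ⟩
    p *ₚ q'  ≈⟨ *ₚ-comm p q' ⟩
    q' *ₚ p  ≈⟨ *ₚ-congʳ q' e ⟩
    q' *ₚ p' ≈⟨ *ₚ-comm q' p' ⟩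
    p' *ₚ q' ∎
    where open PR

  *ₚ-distribˡ : ∀ p q r → (p *ₚ (q +ₚ r)) ≋ ((p *ₚ q) +ₚ (p *ₚ r))
  *ₚ-distribˡ [] q r = ≋-refl
  *ₚ-distribˡ (c ∷ p) q r = begin
    scale c (q +ₚ r) +ₚ (0 ∷ (p *ₚ (q +ₚ r)))
      ≈⟨ +ₚ-cong (scale-+ c q r) (∷-cong refl (*ₚ-distribˡ p q r)) ⟩
    (scale c q +ₚ scale c r) +ₚ ((0 ∷ (p *ₚ q)) +ₚ (0 ∷ (p *ₚ r)))
      ≈⟨ interchange (scale c q) (scale c r) _ _ ⟩
    (scale c q +ₚ (0 ∷ (p *ₚ q))) +ₚ (scale c r +ₚ (0 ∷ (p *ₚ r))) ∎
    where open PR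

  *ₚ-distribʳ : ∀ r p q → ((p +ₚ q) *ₚ r) ≋ ((p *ₚ r) +ₚ (q *ₚ r))
  *ₚ-distribʳ r p q = begin
    (p +ₚ q) *ₚ r         ≈⟨ *ₚ-comm (p +ₚ q) r ⟩
    r *ₚ (p +ₚ q)         ≈⟨ *ₚ-distribˡ r p q ⟩
    (r *ₚ p) +ₚ (r *ₚ q)  ≈⟨ +ₚ-cong (*ₚ-comm r p) (*ₚ-comm r q) ⟩
    (p *ₚ r) +ₚ (q *ₚ r)  ∎
    where open PR

  scale-* : ∀ c p q → (scale c p *ₚ q) ≋ scale c (p *ₚ q)
  scale-* c [] q = ≋-refl
  scale-* c (d ∷ p) q = begin
    scale (c * d) q +ₚ (0 ∷ (scale c p *ₚ q))
      ≈⟨ +ₚ-cong (scale-scale c d q) (∷-cong (sym (*-zeroʳ c)) (scale-* c p q)) ⟩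
    scale c (scale d q) +ₚ scale c (0 ∷ (p *ₚ q))
      ≈⟨ scale-+ c (scale d q) _ ⟨
    scale c (scale d q +ₚ (0 ∷ (p *ₚ q))) ∎
    where open PR

  0∷-* : ∀ p q → ((0 ∷ p) *ₚ q) ≋ (0 ∷ (p *ₚ q))
  0∷-* p q = +ₚ-cong (scale-0 q) ≋-refl

  *ₚ-assoc : ∀ p q r → ((p *ₚ q) *ₚ r) ≋ (p *ₚ (q *ₚ r))
  *ₚ-assoc [] q r = ≋-refl
  *ₚ-assoc (c ∷ p) q r = begin
    (scale c q +ₚ (0 ∷ (p *ₚ q))) *ₚ r           ≈⟨ *ₚ-distribʳ r (scale c q) _ ⟩
    (scale c q *ₚ r) +ₚ ((0 ∷ (p *ₚ q)) *ₚ r)    ≈⟨ +ₚ-cong (scale-* c q r) (0∷-* (p *ₚ q) r) ⟩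
    scale c (q *ₚ r) +ₚ (0 ∷ ((p *ₚ q) *ₚ r))    ≈⟨ +ₚ-cong (≋-refl {scale c (q *ₚ r)}) (∷-cong refl (*ₚ-assoc p q r)) ⟩
    scale c (q *ₚ r) +ₚ (0 ∷ (p *ₚ (q *ₚ r)))    ∎
    where open PR

  1ₚ : Poly
  1ₚ = 1 ∷ []

  *ₚ-identityˡ : ∀ p → (1ₚ *ₚ p) ≋ p
  *ₚ-identityˡ p = begin
    scale 1 p +ₚ (0 ∷ []) ≈⟨ +ₚ-cong (scale-1 p) 0∷[] ⟩
    p +ₚ []               ≈⟨ +ₚ-identityʳ p ⟩
    p ∎
    where open PR

  *ₚ-identityʳ : ∀ p → (p *ₚ 1ₚ) ≋ p
  *ₚ-identityʳ p = ≋-trans (*ₚ-comm p 1ₚ) (*ₚ-identityˡ p)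

  polySemiring : CommutativeSemiring 0ℓ 0ℓ
  polySemiring = record
    { Carrier = Poly ; _≈_ = _≋_ ; _+_ = _+ₚ_ ; _*_ = _*ₚ_ ; 0# = [] ; 1# = 1ₚ
    ; isCommutativeSemiring = record
      { isSemiring = record
        { isSemiringWithoutAnnihilatingZero = record
          { +-isCommutativeMonoid = record
            { isMonoid = record
              { isSemigroup = record
                { isMagma = record { isEquivalence = ≋-equiv ; ∙-cong = +ₚ-cong }
                ; assoc = +ₚ-assoc }
              ; identity = (λ p → ≋-refl) , +ₚ-identityʳ }
            ; comm = +ₚ-comm }
          ; *-cong = *ₚ-cong
          ; *-assoc = *ₚ-assoc
          ; *-identity = *ₚ-identityˡ , *ₚ-identityʳ
          ; distrib = *ₚ-distribˡ , *ₚ-distribʳ }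
        ; zero = (λ p → ≋-refl) , *ₚ-zeroʳ }
      ; *-comm = *ₚ-comm } }

  agree : ℕ → Poly → Poly → Set
  agree k x y = ∀ j → j < k → coeff j x ≡ coeff j y

  agree-+ : ∀ k {x x' y y'} → agree k x x' → agree k y y' → agree k (x +ₚ y) (x' +ₚ y')
  agree-+ k {x} {x'} {y} {y'} e f j l =
    trans (coeff-+ j x y) (trans (cong₂ _+_ (e j l) (f j l)) (sym (coeff-+ j x' y')))

  agree-∷ : ∀ k c {x y} → agree k x y → agree (suc k) (c ∷ x) (c ∷ y)
  agree-∷ k c e zero l = refl
  agree-∷ k c e (suc j) (s≤s l) = e j l

  agree-* : ∀ p k {x y} → agree k x y → agree k (p *ₚ x) (p *ₚ y)
  agree-* [] k e j l = refl
  agree-* (c ∷ p) k {x} {y} e = agree-+ k {scale c x} {scale c y}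
    (λ j l → trans (coeff-scale j c x) (trans (cong (c *_) (e j l)) (sym (coeff-scale j c y))))
    (λ j l → agree-∷ k 0 {p *ₚ x} {p *ₚ y} (agree-* p k e) j (m<n⇒m<1+n l))

  -- The coefficient of x of degree k is determined by that of p * x and the lower ones.
  *ₚ-cancelˡ : ∀ p {x y} → coeff 0 p ≡ 1 → (p *ₚ x) ≋ (p *ₚ y) → x ≋ y
  *ₚ-cancelˡ (.1 ∷ p) {x} {y} refl e = mk λ i → go (suc i) i ≤-refl
    where
    step : ∀ k → agree k x y → coeff k x ≡ coeff k y
    step k h = trans (sym (at (scale-1 x) k)) (trans (+-cancelʳ-≡ (coeff k (0 ∷ (p *ₚ y))) _ _ (begin
      coeff k (scale 1 x) + coeff k (0 ∷ (p *ₚ y)) ≡⟨ cong (coeff k (scale 1 x) +_) (agree-∷ k 0 {p *ₚ x} {p *ₚ y} (agree-* p k h) k ≤-refl) ⟨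
      coeff k (scale 1 x) + coeff k (0 ∷ (p *ₚ x)) ≡⟨ coeff-+ k (scale 1 x) _ ⟨
      coeff k ((1 ∷ p) *ₚ x)                       ≡⟨ at e k ⟩
      coeff k ((1 ∷ p) *ₚ y)                       ≡⟨ coeff-+ k (scale 1 y) _ ⟩
      coeff k (scale 1 y) + coeff k (0 ∷ (p *ₚ y)) ∎)) (at (scale-1 y) k))
      where open ≡-Reasoning
    go : ∀ k → agree k x y
    go (suc k) j (s≤s l) with m≤n⇒m<n∨m≡n l
    ... | inj₁ j<k = go k j j<k
    ... | inj₂ refl = step j (go j)

  coeff0-* : ∀ p q → coeff 0 (p *ₚ q) ≡ coeff 0 p * coeff 0 q
  coeff0-* [] q = refl
  coeff0-* (c ∷ p) q = trans (coeff-+ 0 (scale c q) _) (trans (+-identityʳ _) (coeff-scale 0 c q))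

-- Linear algebra over the integers and the sl₂ argument for unimodality.

module GradedSets where

  open import Data.Nat as ℕ using (ℕ; zero; suc; s≤s)
  import Data.Nat.Properties as ℕ
  open import Data.Integer using (ℤ; +_; -_; _+_; _*_; _-_; 0ℤ; 1ℤ)
  import Data.Integer as ℤ
  import Data.Integer.Properties as ℤ
  open import Data.Integer.Tactic.RingSolver using (solve-∀)
  open import Data.Fin as Fin using (Fin; zero; suc; punchIn)
  import Data.Fin.Properties as Fin
  open import Data.Vec.Functional using (insertAt)
  open import Data.Vec.Functional.Properties using (insertAt-lookup; insertAt-punchIn)
  open import Data.List as List using (List; []; _∷_; _++_; map; length; lookup; filter)
  open import Data.List.Membership.Propositional using (_∈_)
  open import Data.List.Membership.Propositional.Properties using (∈-lookup; ∈-filter⁺; ∈-filter⁻)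
  import Data.List.Relation.Unary.Any as Any
  open import Data.List.Relation.Unary.Any.Properties using (lookup-index)
  open import Data.List.Relation.Unary.All as All using (All; []; _∷_)
  open import Data.List.Relation.Unary.AllPairs using ([]; _∷_)
  open import Data.List.Relation.Unary.Unique.Propositional using (Unique)
  import Data.List.Relation.Unary.Unique.Propositional.Properties as Unique
  open import Data.Product using (Σ; ∃; _×_; _,_; proj₁; proj₂)
  open import Data.Sum using (inj₁; inj₂; [_,_]′)
  open import Data.Empty using (⊥-elim)
  open import Function using (_∘_; case_of_)
  open import Relation.Nullary using (¬_; yes; no)
  open import Relation.Nullary.Decidable using (¬?; decidable-stable)
  open import Relation.Binary.Definitions using (DecidableEquality)
  open import Relation.Binary.PropositionalEquality
  open import Algebra.Properties.Semiring.Sum ℤ.+-*-semiring using (sum; sum-cong-≗; sum-remove; ∑-distrib-+; *-distribˡ-sum; sum-replicate-zero)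

  -- Elimination without fractions. The pivot `α` in row zero clears its column from the other rows
  -- after these are multiplied by `α`. A solution of the smaller system is scaled by `α`, and the
  -- coordinate `- β` at the pivot balances row zero.
  kernel-vector : ∀ q p (A : Fin q → Fin p → ℤ) → q ℕ.< p →
    Σ (Fin p → ℤ) λ v → (∃ λ j → ¬ v j ≡ 0ℤ) × (∀ i → sum (λ j → A i j * v j) ≡ 0ℤ)
  kernel-vector zero (suc p) A _ = (λ _ → 1ℤ) , (zero , λ ()) , λ ()
  kernel-vector (suc q) (suc p) A (s≤s q<p) with Fin.any? (λ j → ¬? (A zero j ℤ.≟ 0ℤ))
  ... | no none =
    let v , nz , eq = kernel-vector q (suc p) (A ∘ suc) (ℕ.m<n⇒m<1+n q<p)
        row₀ : ∀ j → A zero j * v j ≡ 0ℤ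
        row₀ j = cong (_* v j) (decidable-stable (A zero j ℤ.≟ 0ℤ) (λ ne → none (j , ne)))
    in v , nz , λ { zero → trans (sum-cong-≗ row₀) (sum-replicate-zero (suc p)) ; (suc i) → eq i }
  ... | yes (j , α≢0) = v , (punchIn j k , v≢0) , rows
    where
    α = A zero j
    A′ : Fin q → Fin p → ℤ
    A′ i k = α * A (suc i) (punchIn j k) - A (suc i) j * A zero (punchIn j k)
    rec = kernel-vector q p A′ q<p
    v′ = proj₁ rec
    k = proj₁ (proj₁ (proj₂ rec))
    w : Fin p → ℤ
    w k = α * v′ k
    β = sum (λ k → A zero (punchIn j k) * v′ k)
    v : Fin (suc p) → ℤ
    v = insertAt w j (- β)
    v≢0 : ¬ v (punchIn j k) ≡ 0ℤ
    v≢0 e with ℤ.i*j≡0⇒i≡0∨j≡0 α (trans (sym (insertAt-punchIn w j (- β) k)) e)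
    ... | inj₁ α≡0 = α≢0 α≡0
    ... | inj₂ v′≡0 = proj₂ (proj₁ (proj₂ rec)) v′≡0
    split : ∀ i → sum (λ l → A i l * v l) ≡ A i j * - β + sum (λ l → A i (punchIn j l) * (α * v′ l))
    split i = trans (sum-remove {i = j} (λ l → A i l * v l))
      (cong₂ _+_ (cong (A i j *_) (insertAt-lookup w j (- β)))
                 (sum-cong-≗ (λ l → cong (A i (punchIn j l) *_) (insertAt-punchIn w j (- β) l))))
    rows : ∀ i → sum (λ l → A i l * v l) ≡ 0ℤ
    rows zero = begin
      sum (λ l → A zero l * v l)                                    ≡⟨ split zero ⟩
      α * - β + sum (λ l → A zero (punchIn j l) * (α * v′ l))       ≡⟨ cong (λ x → α * - β + x) (sum-cong-≗ (λ l → swap (A zero (punchIn j l)) α (v′ l))) ⟩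
      α * - β + sum (λ l → α * (A zero (punchIn j l) * v′ l))       ≡⟨ cong (λ x → α * - β + x) (*-distribˡ-sum α (λ l → A zero (punchIn j l) * v′ l)) ⟨
      α * - β + α * β                                               ≡⟨ cancel α β ⟩
      0ℤ                                                            ∎
      where
      open ≡-Reasoning
      swap : ∀ x y z → x * (y * z) ≡ y * (x * z)
      swap = solve-∀
      cancel : ∀ x y → x * - y + x * y ≡ 0ℤ
      cancel = solve-∀
    rows (suc i) = begin
      sum (λ l → A (suc i) l * v l)
        ≡⟨ split (suc i) ⟩
      c * - β + sum (λ l → A (suc i) (punchIn j l) * (α * v′ l))
        ≡⟨ cong (_+ S) (neg c β) ⟩
      - c * β + S
        ≡⟨ cong (_+ S) (*-distribˡ-sum (- c) (λ l → A zero (punchIn j l) * v′ l)) ⟩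
      sum (λ l → - c * (A zero (punchIn j l) * v′ l)) + S
        ≡⟨ ∑-distrib-+ (λ l → - c * (A zero (punchIn j l) * v′ l)) _ ⟨
      sum (λ l → - c * (A zero (punchIn j l) * v′ l) + A (suc i) (punchIn j l) * (α * v′ l))
        ≡⟨ sum-cong-≗ (λ l → collect c (A zero (punchIn j l)) (v′ l) (A (suc i) (punchIn j l)) α) ⟩
      sum (λ l → A′ i l * v′ l)
        ≡⟨ proj₂ (proj₂ rec) i ⟩
      0ℤ ∎
      where
      open ≡-Reasoning
      c = A (suc i) j
      S = sum (λ l → A (suc i) (punchIn j l) * (α * v′ l))
      neg : ∀ x y → x * - y ≡ - x * y
      neg = solve-∀
      collect : ∀ c x v y α → - c * (x * v) + y * (α * v) ≡ (α * y - c * x) * v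
      collect = solve-∀

  sum-one : ∀ {n} (j : Fin n) (t : Fin n → ℤ) → (∀ k → ¬ k ≡ j → t k ≡ 0ℤ) → sum t ≡ t j
  sum-one {suc n} j t z = trans (sum-remove {i = j} t)
    (trans (cong (λ x → t j + x) (trans (sum-cong-≗ (λ k → z (punchIn j k) (Fin.punchInᵢ≢i j k))) (sum-replicate-zero n)))
           (ℤ.+-identityʳ (t j)))

  private variable
    S T : Set

  -- Sparse linear functionals on S → ℤ.
  Moves : Set → Set
  Moves S = List (ℤ × S)

  app : Moves S → (S → ℤ) → ℤ
  app [] f = 0ℤ
  app ((c , s) ∷ ms) f = c * f s + app ms f

  act : (S → Moves T) → (T → ℤ) → S → ℤ
  act ms f s = app (ms s) f

  push : (S → T) → Moves S → Moves T
  push g = map (λ { (c , s) → c , g s })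

  app-push : (g : S → T) (ms : Moves S) (f : T → ℤ) → app (push g ms) f ≡ app ms (f ∘ g)
  app-push g [] f = refl
  app-push g ((c , s) ∷ ms) f = cong (λ x → c * f (g s) + x) (app-push g ms f)

  app-++ : (ms ns : Moves S) (f : S → ℤ) → app (ms ++ ns) f ≡ app ms f + app ns f
  app-++ [] ns f = sym (ℤ.+-identityˡ _)
  app-++ ((c , s) ∷ ms) ns f = trans (cong (λ x → c * f s + x) (app-++ ms ns f)) (sym (ℤ.+-assoc (c * f s) _ _))

  app-cong : (ms : Moves S) {f g : S → ℤ} → (∀ s → f s ≡ g s) → app ms f ≡ app ms g
  app-cong [] e = refl
  app-cong ((c , s) ∷ ms) e = cong₂ _+_ (cong (c *_) (e s)) (app-cong ms e)

  app-zero : (ms : Moves S) {f : S → ℤ} → All (λ m → f (proj₂ m) ≡ 0ℤ) ms → app ms f ≡ 0ℤ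
  app-zero [] [] = refl
  app-zero ((c , s) ∷ ms) (e ∷ es) = trans (cong₂ _+_ (trans (cong (c *_) e) (ℤ.*-zeroʳ c)) (app-zero ms es)) (ℤ.+-identityˡ 0ℤ)

  app-+ : (ms : Moves S) (f g : S → ℤ) → app ms (λ s → f s + g s) ≡ app ms f + app ms g
  app-+ [] f g = refl
  app-+ ((c , s) ∷ ms) f g = trans (cong (λ x → c * (f s + g s) + x) (app-+ ms f g)) (lem c (f s) (g s) _ _)
    where
    lem : ∀ c x y z w → c * (x + y) + (z + w) ≡ c * x + z + (c * y + w)
    lem = solve-∀

  app-* : (ms : Moves S) (k : ℤ) (f : S → ℤ) → app ms (λ s → k * f s) ≡ k * app ms f
  app-* [] k f = sym (ℤ.*-zeroʳ k)
  app-* ((c , s) ∷ ms) k f = trans (cong (λ x → c * (k * f s) + x) (app-* ms k f)) (lem c k (f s) (app ms f))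
    where
    lem : ∀ c k x y → c * (k * x) + k * y ≡ k * (c * x + y)
    lem = solve-∀

  app-sum : (ms : Moves S) {n : ℕ} (F : Fin n → S → ℤ) → app ms (λ s → sum (λ j → F j s)) ≡ sum (λ j → app ms (F j))
  app-sum ms {zero} F = app-zero ms (All.universal (λ _ → refl) ms)
  app-sum ms {suc n} F = trans (app-+ ms (F zero) _) (cong (λ z → app ms (F zero) + z) (app-sum ms (F ∘ suc)))

  -- Exchange of two finite sums; it makes operators on different tensor factors commute.
  app-swap : (ms : Moves S) (ns : Moves T) (f : S → T → ℤ) →
    app ms (λ s → app ns (f s)) ≡ app ns (λ t → app ms (λ s → f s t))
  app-swap [] ns f = sym (app-zero ns (All.universal (λ _ → refl) ns))
  app-swap ((c , s) ∷ ms) ns f = begin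
    c * app ns (f s) + app ms (λ s → app ns (f s))              ≡⟨ cong₂ _+_ (sym (app-* ns c (f s))) (app-swap ms ns f) ⟩
    app ns (λ t → c * f s t) + app ns (λ t → app ms (λ s → f s t)) ≡⟨ app-+ ns _ _ ⟨
    app ns (λ t → c * f s t + app ms (λ s → f s t)) ∎
    where open ≡-Reasoning

  -- The field comm is the sl₂ relation [down , up] = top - 2 rk; operators act on functions by pull-back.
  record Graded : Set₁ where
    field
      St       : Set
      _≟_      : DecidableEquality St
      states   : List St
      complete : ∀ s → s ∈ states
      unique   : Unique states
      rk       : St → ℕ
      top      : ℕ
      rk≤top   : ∀ s → rk s ℕ.≤ top
      up down  : St → Moves St
      up-rk    : ∀ s → All (λ m → rk s ≡ suc (rk (proj₂ m))) (up s)
      down-rk  : ∀ s → All (λ m → rk (proj₂ m) ≡ suc (rk s)) (down s)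
      comm     : ∀ f s → act down (act up f) s ≡ act up (act down f) s + (+ top - + 2 * + rk s) * f s

    U D : (St → ℤ) → St → ℤ
    U = act up
    D = act down

    level : ℕ → List St
    level i = filter (λ s → rk s ℕ.≟ i) states

  -- Reversing ranks exchanges raising and lowering and changes the sign of `top - 2 rk`, just as
  -- exchanging the operators changes the sign of the commutator. Statements below the middle rank
  -- thereby become statements above it.
  dual : Graded → Graded
  dual G = record
    { St = St ; _≟_ = _≟_ ; states = states ; complete = complete ; unique = unique
    ; rk = λ s → top ℕ.∸ rk s ; top = top ; rk≤top = λ s → ℕ.m∸n≤m top (rk s)
    ; up = down ; down = up
    ; up-rk = λ s → All.map (λ {m} e → flip-rk (rk s) (rk (proj₂ m)) e (rk≤top (proj₂ m))) (down-rk s)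
    ; down-rk = λ s → All.map (λ {m} e → flip-rk (rk (proj₂ m)) (rk s) e (rk≤top s)) (up-rk s)
    ; comm = λ f s → trans (lem (U (D f) s) (D (U f) s) (+ top - + 2 * + rk s) (f s) (comm f s))
        (cong (λ z → D (U f) s + z * f s) (flip-top (rk s) (rk≤top s))) }
    where
    open Graded G
    flip-rk : ∀ x y → y ≡ suc x → y ℕ.≤ top → top ℕ.∸ x ≡ suc (top ℕ.∸ y)
    flip-rk x .(suc x) refl le = ℕ.+-cancelʳ-≡ x _ _ (trans (ℕ.m∸n+n≡m (ℕ.≤-trans (ℕ.n≤1+n x) le))
      (trans (sym (ℕ.m∸n+n≡m le)) (ℕ.+-suc (top ℕ.∸ suc x) x)))
    lem : ∀ x y z w → y ≡ x + z * w → x ≡ y + (- z) * w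
    lem x .(x + z * w) z w refl = lem′ x z w
      where
      lem′ : ∀ x z w → x ≡ x + z * w + (- z) * w
      lem′ = solve-∀
    flip-top : ∀ r → r ℕ.≤ top → - (+ top - + 2 * + r) ≡ + top - + 2 * + (top ℕ.∸ r)
    flip-top r le = trans (lem′ (+ top) (+ r)) (cong (λ z → + top - + 2 * z) (trans (ℤ.m-n≡m⊖n top r) (ℤ.⊖-≥ le)))
      where
      lem′ : ∀ t r → - (t - + 2 * r) ≡ t - + 2 * (t - r)
      lem′ = solve-∀

  module _ (G : Graded) where
    open Graded G

    supported : ℕ → (St → ℤ) → Set
    supported i f = ∀ s → ¬ rk s ≡ i → f s ≡ 0ℤ

    -- On rank `i` the commutation relation subtracts `top - 2 i` from the eigenvalue `- c`; on
    -- other ranks both sides vanish, because `U D` preserves the support. Below the middle the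
    -- amount subtracted is positive, so the eigenvalue stays negative during the descent.
    UD-negative : ∀ i (f : St → ℤ) (c : ℕ) → 2 ℕ.* i ℕ.< top → supported i f →
      (∀ s → D (U f) s ≡ - (+ c) * f s) → ∀ s → U (D f) s ≡ - (+ (c ℕ.+ (top ℕ.∸ 2 ℕ.* i))) * f s
    UD-negative i f c 2i<top supp DU s with rk s ℕ.≟ i
    ... | yes e = begin
      U (D f) s
        ≡⟨ solve₁ (U (D f) s) _ ⟩
      U (D f) s + (+ top - + 2 * + rk s) * f s - (+ top - + 2 * + rk s) * f s
        ≡⟨ cong (_- (+ top - + 2 * + rk s) * f s) (comm f s) ⟨
      D (U f) s - (+ top - + 2 * + rk s) * f s
        ≡⟨ cong₂ (λ x y → x - y * f s) (DU s) (trans (cong (λ r → + top - + 2 * + r) e) hℤ) ⟩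
      - (+ c) * f s - + h * f s
        ≡⟨ solve₂ (+ c) (+ h) (f s) ⟩
      - (+ c + + h) * f s ∎
      where
      open ≡-Reasoning
      h = top ℕ.∸ 2 ℕ.* i
      hℤ : + top - + 2 * + i ≡ + h
      hℤ = trans (cong (λ z → + top - z) (sym (ℤ.pos-* 2 i))) (trans (ℤ.m-n≡m⊖n top (2 ℕ.* i)) (ℤ.⊖-≥ (ℕ.<⇒≤ 2i<top)))
      solve₁ : ∀ x y → x ≡ x + y - y
      solve₁ = solve-∀
      solve₂ : ∀ x y z → - x * z - y * z ≡ - (x + y) * z
      solve₂ = solve-∀
    ... | no ne = trans (app-zero (up s) (All.map (λ {m} e → app-zero (down (proj₂ m))
            (All.map (λ {m′} e′ → supp (proj₂ m′) (λ e″ → ne (trans e (trans (sym e′) e″)))) (down-rk (proj₂ m)))) (up-rk s)))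
         (sym (trans (cong (- (+ (c ℕ.+ (top ℕ.∸ 2 ℕ.* i))) *_) (supp s ne)) (ℤ.*-zeroʳ (- (+ (c ℕ.+ (top ℕ.∸ 2 ℕ.* i)))))))

    -- If D U f = - c f with c ≥ 0, then D f satisfies the same relation one level lower with a larger
    -- constant, so by induction D f = 0, and then (c + top - 2 i) f = - U D f = 0.
    DU-negative⇒0 : ∀ i (f : St → ℤ) (c : ℕ) → 2 ℕ.* i ℕ.< top → supported i f →
      (∀ s → D (U f) s ≡ - (+ c) * f s) → ∀ s → f s ≡ 0ℤ
    D≡0 : ∀ i (f : St → ℤ) (c : ℕ) → 2 ℕ.* i ℕ.< top → supported i f →
      (∀ s → D (U f) s ≡ - (+ c) * f s) → ∀ s → D f s ≡ 0ℤ
    D≡0 zero f c lt supp DU s =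
      app-zero (down s) (All.map (λ {m} e → supp (proj₂ m) (λ e′ → case trans (sym e) e′ of λ ())) (down-rk s))
    D≡0 (suc j) f c lt supp DU = DU-negative⇒0 j (D f) d
        (ℕ.≤-<-trans (ℕ.*-monoʳ-≤ 2 (ℕ.n≤1+n j)) lt)
        (λ s ne → app-zero (down s) (All.map (λ {m} e → supp (proj₂ m) (λ e′ → ne (ℕ.suc-injective (trans (sym e) e′)))) (down-rk s)))
        (λ s → trans (app-cong (down s) (UD-negative (suc j) f c lt supp DU)) (app-* (down s) (- (+ d)) f))
      where d = c ℕ.+ (top ℕ.∸ 2 ℕ.* suc j)

    DU-negative⇒0 i f c lt supp DU s =
      [ (λ e → ⊥-elim (d≢0 e)) , (λ e → e) ]′ (ℤ.i*j≡0⇒i≡0∨j≡0 (- (+ d))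
        (trans (sym (UD-negative i f c lt supp DU s))
               (app-zero (up s) (All.universal (λ m → D≡0 i f c lt supp DU (proj₂ m)) (up s)))))
      where
      d = c ℕ.+ (top ℕ.∸ 2 ℕ.* i)
      d≢0 : ¬ - (+ d) ≡ 0ℤ
      d≢0 e = ℕ.<⇒≢ (ℕ.m<n⇒0<n∸m lt) (sym (ℕ.m+n≡0⇒n≡0 c (ℤ.+-injective (ℤ.neg-injective {+ d} {+ 0} e))))

    up-injective : ∀ i (f : St → ℤ) → 2 ℕ.* i ℕ.< top → supported i f → (∀ s → U f s ≡ 0ℤ) → ∀ s → f s ≡ 0ℤ
    up-injective i f lt supp Uf = DU-negative⇒0 i f 0 lt supp
      (λ s → trans (app-zero (down s) (All.universal (λ m → Uf (proj₂ m)) (down s))) (sym (ℤ.*-zeroˡ (f s))))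

    private
      δ : St → St → ℤ
      δ s t with s ≟ t
      ... | yes _ = 1ℤ
      ... | no _ = 0ℤ

      δ-refl : ∀ s → δ s s ≡ 1ℤ
      δ-refl s with s ≟ s
      ... | yes _ = refl
      ... | no ne = ⊥-elim (ne refl)

      δ-≢ : ∀ {s t} → ¬ s ≡ t → δ s t ≡ 0ℤ
      δ-≢ {s} {t} ne with s ≟ t
      ... | yes e = ⊥-elim (ne e)
      ... | no _ = refl

    lookup-unique : ∀ {xs : List St} → Unique xs → ∀ i j → lookup xs i ≡ lookup xs j → i ≡ j
    lookup-unique (px ∷ u) zero zero e = refl
    lookup-unique (px ∷ u) zero (suc j) e = ⊥-elim (All.lookup px (∈-lookup j) e)
    lookup-unique (px ∷ u) (suc i) zero e = ⊥-elim (All.lookup px (∈-lookup i) (sym e))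
    lookup-unique (px ∷ u) (suc i) (suc j) e = cong suc (lookup-unique u i j e)

    -- If rank `i` had more states than rank `suc i`, the matrix `A` of `U` between the two would
    -- have more columns than rows. A kernel vector would then combine the indicator functions of
    -- rank `i` into a nonzero `f` with `U f = 0`.
    level-mono : ∀ i → 2 ℕ.* i ℕ.< top → length (level i) ℕ.≤ length (level (suc i))
    level-mono i lt = ℕ.≮⇒≥ λ more → absurd (kernel-vector q p A more)
      where
      p = length (level i)
      q = length (level (suc i))
      ss = lookup (level i)
      ts = lookup (level (suc i))
      A : Fin q → Fin p → ℤ
      A k j = U (δ (ss j)) (ts k)
      rk-ss : ∀ j → rk (ss j) ≡ i
      rk-ss j = proj₂ (∈-filter⁻ (λ s → rk s ℕ.≟ i) {xs = states} (∈-lookup j))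
      absurd : (Σ (Fin p → ℤ) λ v → (∃ λ j → ¬ v j ≡ 0ℤ) × (∀ k → sum (λ j → A k j * v j) ≡ 0ℤ)) → _
      absurd (v , (j₀ , v≢0) , eq) = v≢0 (trans (sym (f-ss j₀)) (up-injective i f lt supp Uf≡0 (ss j₀)))
        where
        f : St → ℤ
        f s = sum (λ j → v j * δ (ss j) s)
        f-ss : ∀ j → f (ss j) ≡ v j
        f-ss j = begin
          f (ss j)
            ≡⟨ sum-one j (λ k → v k * δ (ss k) (ss j)) (λ k k≢j →
                 trans (cong (v k *_) (δ-≢ (λ e → k≢j (lookup-unique (Unique.filter⁺ (λ s → rk s ℕ.≟ i) unique) k j e)))) (ℤ.*-zeroʳ (v k))) ⟩
          v j * δ (ss j) (ss j) ≡⟨ cong (v j *_) (δ-refl (ss j)) ⟩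
          v j * 1ℤ              ≡⟨ ℤ.*-identityʳ (v j) ⟩
          v j                   ∎
          where open ≡-Reasoning
        supp : supported i f
        supp s ne = trans (sum-cong-≗ (λ j → trans (cong (v j *_) (δ-≢ (λ e → ne (trans (cong rk (sym e)) (rk-ss j))))) (ℤ.*-zeroʳ (v j)))) (sum-replicate-zero p)
        Uf : ∀ s → U f s ≡ sum (λ j → U (δ (ss j)) s * v j)
        Uf s = trans (app-sum (up s) (λ j s → v j * δ (ss j) s)) (sum-cong-≗ (λ j → trans (app-* (up s) (v j) (δ (ss j))) (ℤ.*-comm (v j) _)))
        Uf≡0 : ∀ s → U f s ≡ 0ℤ
        Uf≡0 s with rk s ℕ.≟ suc i
        ... | no ne = app-zero (up s) (All.map (λ {m} e → supp (proj₂ m) (λ e′ → ne (trans e (cong suc e′)))) (up-rk s))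
        ... | yes e = trans (Uf s) (subst (λ t → sum (λ j → U (δ (ss j)) t * v j) ≡ 0ℤ) (sym (lookup-index s∈)) (eq (Any.index s∈)))
          where
          s∈ : s ∈ level (suc i)
          s∈ = ∈-filter⁺ (λ s → rk s ℕ.≟ suc i) (complete s) e

-- Gaussian multinomial coefficients as rank generating functions of sl₂-modules.

module QMultinomial where

  open import Defs
  open Polynomial
  open GradedSets
  open import Data.Nat as ℕ using (ℕ; zero; suc; z≤n)
  import Data.Nat.Properties as ℕ
  import Data.Nat.ListAction as ℕ
  open import Data.Integer using (ℤ; +_; -_; _+_; _*_; _-_; 0ℤ; 1ℤ)
  import Data.Integer.Properties as ℤ
  open import Data.Integer.Tactic.RingSolver using (solve-∀)
  open import Data.List as List using (List; []; _∷_; _++_; map; length; filter; cartesianProduct)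
  open import Data.List.Properties using (filter-≐; filter-accept; filter-reject; filter-none)
  open import Data.List.Membership.Propositional using (_∈_)
  open import Data.List.Membership.Propositional.Properties using (∈-++⁺ˡ; ∈-++⁺ʳ; ∈-map⁺; ∈-map⁻; ∈-cartesianProduct⁺)
  open import Data.List.Relation.Unary.Any using (here)
  open import Data.List.Relation.Unary.All as All using (All; []; _∷_)
  import Data.List.Relation.Unary.All.Properties as All
  open import Data.List.Relation.Unary.AllPairs using ([]; _∷_)
  open import Data.List.Relation.Unary.Unique.Propositional using (Unique)
  import Data.List.Relation.Unary.Unique.Propositional.Properties as Unique
  open import Data.Product using (_×_; _,_; proj₁; proj₂)
  open import Data.Product.Properties using (≡-dec)
  open import Data.Unit using (⊤; tt)
  import Data.Unit.Properties as ⊤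
  open import Data.Empty using (⊥-elim)
  open import Function using (_∘_)
  open import Relation.Nullary using (¬_; yes; no)
  open import Relation.Binary.Definitions using (DecidableEquality)
  open import Relation.Binary.PropositionalEquality
  open import Algebra.Solver.Ring.NaturalCoefficients.Default polySemiring as PS using (_:+_; _:*_; _:=_)

  data Ch : ℕ → ℕ → Set where
    nil : Ch 0 0
    zer   : ∀ {z k} → Ch z k → Ch (suc z) k
    one   : ∀ {z k} → Ch z k → Ch z (suc k)

  private variable
    z k : ℕ

  -- The number of pairs of a zero and a later one.
  rkC : Ch z k → ℕ
  rkC nil = 0
  rkC (zer {k = k} s) = k ℕ.+ rkC s
  rkC (one s) = rkC s

  rkC≤ : (s : Ch z k) → rkC s ℕ.≤ z ℕ.* k
  rkC≤ nil = z≤n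
  rkC≤ (zer {k = k} s) = ℕ.+-monoʳ-≤ k (rkC≤ s)
  rkC≤ (one {z} {k} s) = ℕ.≤-trans (rkC≤ s) (ℕ.*-monoʳ-≤ z (ℕ.n≤1+n k))

  headU : Ch z k → Moves (Ch (suc z) k)
  headU nil = []
  headU (zer t) = []
  headU (one t) = (1ℤ , one (zer t)) ∷ []

  headD : ℤ → Ch z k → Moves (Ch z (suc k))
  headD w nil = []
  headD w (zer t) = (w , zer (one t)) ∷ []
  headD w (one t) = []

  upC : Ch z k → Moves (Ch z k)
  upC nil = []
  upC (zer s) = headU s ++ push zer (upC s)
  upC (one s) = push one (upC s)

  -- Here `l` is a position counted from 1 and `z + k` the number of symbols after it, so this is
  -- `l (N - l)` for words of length `N`. These are the coefficients of one operator on the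
  -- irreducible sl₂-module of dimension `N` when the opposite one has coefficients 1; 0/1-words
  -- with `k` ones index a basis of its `k`-th exterior power.
  wt : ℕ → ℕ → ℕ → ℤ
  wt l z k = + l * (+ z + + k)

  downC : ℕ → Ch z k → Moves (Ch z k)
  downC l nil = []
  downC l (zer s) = push zer (downC (suc l) s)
  downC l (one {z} {k} s) = headD (wt l z k) s ++ push one (downC (suc l) s)

  upC-rk : (s : Ch z k) → All (λ m → rkC s ≡ suc (rkC (proj₂ m))) (upC s)
  upC-rk nil = []
  upC-rk (zer {k = k} s) = All.++⁺ (head s) (All.map⁺ (All.map (λ {m} e → trans (cong (k ℕ.+_) e) (ℕ.+-suc k _)) (upC-rk s)))
    where
    head : (s : Ch z k) → All (λ m → rkC (zer s) ≡ suc (rkC (proj₂ m))) (headU s)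
    head nil = []
    head (zer t) = []
    head (one t) = refl ∷ []
  upC-rk (one s) = All.map⁺ (upC-rk s)

  downC-rk : ∀ l (s : Ch z k) → All (λ m → rkC (proj₂ m) ≡ suc (rkC s)) (downC l s)
  downC-rk l nil = []
  downC-rk l (zer {k = k} s) = All.map⁺ (All.map (λ {m} e → trans (cong (k ℕ.+_) e) (ℕ.+-suc k _)) (downC-rk (suc l) s))
  downC-rk l (one {z} {k} s) = All.++⁺ (head (wt l z k) s) (All.map⁺ (downC-rk (suc l) s))
    where
    head : ∀ w (s : Ch z k) → All (λ m → rkC (proj₂ m) ≡ suc (rkC (one s))) (headD w s)
    head w nil = []
    head w (zer t) = refl ∷ []
    head w (one t) = []

  diag₀ : ∀ (s : Ch z k) → ℤ → ℤ → ℤ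
  diag₀ nil x y = 0ℤ
  diag₀ (zer s) x y = x
  diag₀ (one s) x y = y

  -- The commutator is diagonal, since only a swap followed by its reverse survives: each adjacent
  -- pair "one, zero" contributes its weight and each pair "zero, one" minus its weight.
  diag : ℕ → Ch z k → ℤ
  diag l nil = 0ℤ
  diag l (zer {z} {k} s) = diag₀ s 0ℤ (- wt l z k) + diag (suc l) s
  diag l (one {z} {k} s) = diag₀ s (wt l z k) 0ℤ + diag (suc l) s

  actU-o : (f : Ch (suc z) k → ℤ) (s : Ch z k) → act upC f (zer s) ≡ act headU f s + act upC (f ∘ zer) s
  actU-o f s = trans (app-++ (headU s) _ f) (cong (λ x → app (headU s) f + x) (app-push zer (upC s) f))

  actU-i : (f : Ch z (suc k) → ℤ) (s : Ch z k) → act upC f (one s) ≡ act upC (f ∘ one) s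
  actU-i f s = app-push one (upC s) f

  actD-o : ∀ l (f : Ch (suc z) k → ℤ) (s : Ch z k) → act (downC l) f (zer s) ≡ act (downC (suc l)) (f ∘ zer) s
  actD-o l f s = app-push zer (downC (suc l) s) f

  actD-i : ∀ l (f : Ch z (suc k) → ℤ) (s : Ch z k) →
    act (downC l) f (one s) ≡ act (headD (wt l z k)) f s + act (downC (suc l)) (f ∘ one) s
  actD-i {z} {k} l f s = trans (app-++ (headD (wt l z k) s) _ f)
    (cong (λ x → app (headD (wt l z k) s) f + x) (app-push one (downC (suc l) s) f))

  act-0 : ∀ {S T : Set} (ms : S → Moves T) (f : T → ℤ) s → (∀ t → f t ≡ 0ℤ) → act ms f s ≡ 0ℤ
  act-0 ms f s e = app-zero (ms s) (All.universal (λ m → e (proj₂ m)) (ms s))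

  -- Moves in disjoint positions commute and moves in overlapping positions compose to 0.
  headU-down : ∀ l (f : Ch (suc z) k → ℤ) (s : Ch z k) →
    act (downC (suc l)) (act headU f) s ≡ act headU (act (downC l) f) s + diag₀ s 0ℤ (- wt l z k) * f (zer s)
  headU-down l f nil = refl
  headU-down l f (zer t) = trans (actD-o (suc l) (act headU f) t) (act-0 (downC (2 ℕ.+ l)) _ t (λ _ → refl))
  headU-down {z} {suc k} l f (one t) = begin
    act (downC (suc l)) (act headU f) (one t)
      ≡⟨ actD-i (suc l) (act headU f) t ⟩
    act (headD (wt (suc l) z k)) (act headU f) t + act (downC (2 ℕ.+ l)) (act headU f ∘ one) t
      ≡⟨ cong₂ _+_ (zero-head (wt (suc l) z k) t) (app-cong (downC (2 ℕ.+ l) t) (λ t′ → simp₁ (f (one (zer t′))))) ⟩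
    0ℤ + X
      ≡⟨ simp₂ X (+ l) (+ z) (+ k) (f (zer (one t))) ⟩
    1ℤ * (wt l (suc z) k * f (zer (one t)) + 0ℤ + X) + 0ℤ + (- wt l z (suc k)) * f (zer (one t))
      ≡⟨ cong (λ x → 1ℤ * (wt l (suc z) k * f (zer (one t)) + 0ℤ + x) + 0ℤ + (- wt l z (suc k)) * f (zer (one t))) (actD-o (suc l) (f ∘ one) t) ⟨
    1ℤ * (wt l (suc z) k * f (zer (one t)) + 0ℤ + act (downC (suc l)) (f ∘ one) (zer t)) + 0ℤ + (- wt l z (suc k)) * f (zer (one t))
      ≡⟨ cong (λ x → 1ℤ * x + 0ℤ + (- wt l z (suc k)) * f (zer (one t))) (actD-i l f (zer t)) ⟨
    1ℤ * act (downC l) f (one (zer t)) + 0ℤ + (- wt l z (suc k)) * f (zer (one t)) ∎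
    where
    open ≡-Reasoning
    X = act (downC (2 ℕ.+ l)) (λ t′ → f (one (zer t′))) t
    zero-head : ∀ w (t : Ch z k) → act (headD w) (act headU f) t ≡ 0ℤ
    zero-head w nil = refl
    zero-head w (zer u) = trans (ℤ.+-identityʳ _) (ℤ.*-zeroʳ w)
    zero-head w (one u) = refl
    simp₁ : ∀ x → 1ℤ * x + 0ℤ ≡ x
    simp₁ = solve-∀
    simp₂ : ∀ X l z k x → 0ℤ + X ≡ 1ℤ * (l * (1ℤ + z + k) * x + 0ℤ + X) + 0ℤ + (- (l * (z + (1ℤ + k)))) * x
    simp₂ = solve-∀

  -- Mirror image of `headU-down`; the surviving diagonal term is now positive and comes from a one
  -- followed by a zero.
  headD-up : ∀ l (f : Ch z (suc k) → ℤ) (s : Ch z k) →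
    act (headD (wt l z k)) (act upC f) s ≡ act upC (act (headD (wt l z k)) f) s + diag₀ s (wt l z k) 0ℤ * f (one s)
  headD-up l f nil = refl
  headD-up {z} {k} l f (one t) = sym (trans (cong (_+ 0ℤ) (trans (actU-i (act (headD (wt l z k)) f) t) (act-0 upC _ t (λ _ → refl)))) refl)
  headD-up {suc z} {k} l f (zer t) = begin
    w * act upC f (zer (one t)) + 0ℤ
      ≡⟨ cong (λ x → w * x + 0ℤ) (trans (actU-o f (one t)) (cong (λ x → 1ℤ * f (one (zer t)) + 0ℤ + x) (actU-i (f ∘ zer) t))) ⟩
    w * (1ℤ * f (one (zer t)) + 0ℤ + Y) + 0ℤ
      ≡⟨ simp w (f (one (zer t))) Y ⟩
    0ℤ + w * Y + w * f (one (zer t))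
      ≡⟨ cong (λ x → 0ℤ + x + w * f (one (zer t))) (sym (app-* (upC t) w (λ t′ → f (zer (one t′))))) ⟩
    0ℤ + act upC (λ t′ → w * f (zer (one t′))) t + w * f (one (zer t))
      ≡⟨ cong₂ (λ x y → x + y + w * f (one (zer t))) (sym (zero-head t)) (app-cong (upC t) (λ t′ → sym (ℤ.+-identityʳ (w * f (zer (one t′)))))) ⟩
    act headU (act (headD w) f) t + act upC (act (headD w) f ∘ zer) t + w * f (one (zer t))
      ≡⟨ cong (_+ w * f (one (zer t))) (actU-o (act (headD w) f) t) ⟨
    act upC (act (headD w) f) (zer t) + w * f (one (zer t)) ∎
    where
    open ≡-Reasoning
    w = wt l (suc z) k
    Y = act upC (λ t′ → f (zer (one t′))) t
    zero-head : (t : Ch z k) → act headU (act (headD w) f) t ≡ 0ℤ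
    zero-head nil = refl
    zero-head (zer u) = refl
    zero-head (one u) = refl
    simp : ∀ w x y → w * (1ℤ * x + 0ℤ + y) + 0ℤ ≡ 0ℤ + w * y + w * x
    simp = solve-∀

  commC : ∀ l (f : Ch z k → ℤ) s → act (downC l) (act upC f) s ≡ act upC (act (downC l) f) s + diag l s * f s
  commC l f nil = refl
  commC l f (zer {z} {k} s) = begin
    act (downC l) (act upC f) (zer s)
      ≡⟨ trans (actD-o l (act upC f) s) (app-cong (downC (suc l) s) (actU-o f)) ⟩
    act (downC (suc l)) (λ s′ → act headU f s′ + act upC (f ∘ zer) s′) s
      ≡⟨ app-+ (downC (suc l) s) (act headU f) (act upC (f ∘ zer)) ⟩
    act (downC (suc l)) (act headU f) s + act (downC (suc l)) (act upC (f ∘ zer)) s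
      ≡⟨ cong₂ _+_ (headU-down l f s) (commC (suc l) (f ∘ zer) s) ⟩
    (act headU (act (downC l) f) s + d₀ * f (zer s)) + (act upC (act (downC (suc l)) (f ∘ zer)) s + diag (suc l) s * f (zer s))
      ≡⟨ regroup (act headU (act (downC l) f) s) d₀ (f (zer s)) (act upC (act (downC (suc l)) (f ∘ zer)) s) (diag (suc l) s) ⟩
    (act headU (act (downC l) f) s + act upC (act (downC (suc l)) (f ∘ zer)) s) + (d₀ + diag (suc l) s) * f (zer s)
      ≡⟨ cong (λ x → act headU (act (downC l) f) s + x + (d₀ + diag (suc l) s) * f (zer s)) (app-cong (upC s) (λ s′ → sym (actD-o l f s′))) ⟩
    (act headU (act (downC l) f) s + act upC (act (downC l) f ∘ zer) s) + (d₀ + diag (suc l) s) * f (zer s)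
      ≡⟨ cong (_+ (d₀ + diag (suc l) s) * f (zer s)) (actU-o (act (downC l) f) s) ⟨
    act upC (act (downC l) f) (zer s) + diag l (zer s) * f (zer s) ∎
    where
    open ≡-Reasoning
    d₀ = diag₀ s 0ℤ (- wt l z k)
    regroup : ∀ a d x b e → (a + d * x) + (b + e * x) ≡ (a + b) + (d + e) * x
    regroup = solve-∀
  commC l f (one {z} {k} s) = begin
    act (downC l) (act upC f) (one s)
      ≡⟨ actD-i l (act upC f) s ⟩
    act (headD w) (act upC f) s + act (downC (suc l)) (act upC f ∘ one) s
      ≡⟨ cong₂ _+_ (headD-up l f s) (trans (app-cong (downC (suc l) s) (actU-i f)) (commC (suc l) (f ∘ one) s)) ⟩
    (act upC (act (headD w) f) s + d₀ * f (one s)) + (act upC (act (downC (suc l)) (f ∘ one)) s + diag (suc l) s * f (one s))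
      ≡⟨ regroup (act upC (act (headD w) f) s) d₀ (f (one s)) (act upC (act (downC (suc l)) (f ∘ one)) s) (diag (suc l) s) ⟩
    (act upC (act (headD w) f) s + act upC (act (downC (suc l)) (f ∘ one)) s) + (d₀ + diag (suc l) s) * f (one s)
      ≡⟨ cong (_+ (d₀ + diag (suc l) s) * f (one s)) (app-+ (upC s) (act (headD w) f) (act (downC (suc l)) (f ∘ one))) ⟨
    act upC (λ s′ → act (headD w) f s′ + act (downC (suc l)) (f ∘ one) s′) s + (d₀ + diag (suc l) s) * f (one s)
      ≡⟨ cong (_+ (d₀ + diag (suc l) s) * f (one s)) (trans (actU-i (act (downC l) f) s) (app-cong (upC s) (actD-i l f))) ⟨
    act upC (act (downC l) f) (one s) + diag l (one s) * f (one s) ∎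
    where
    open ≡-Reasoning
    w = wt l z k
    d₀ = diag₀ s w 0ℤ
    regroup : ∀ a d x b e → (a + d * x) + (b + e * x) ≡ (a + b) + (d + e) * x
    regroup = solve-∀

  -- Abel summation of the weights l (z + k), with the first symbol treated separately.
  diag-value : ∀ l (s : Ch z k) →
    diag l s ≡ diag₀ s 0ℤ ((+ l - 1ℤ) * (+ z + + k)) + (+ k * + z + + k * (1ℤ - + l) - + 2 * + rkC s)
  diag-value l nil = lem (+ l)
    where
    lem : ∀ l → 0ℤ ≡ 0ℤ + (0ℤ * 0ℤ + 0ℤ * (1ℤ - l) - + 2 * 0ℤ)
    lem = solve-∀
  diag-value l (zer nil) = lem (+ l)
    where
    lem : ∀ l → 0ℤ + 0ℤ ≡ 0ℤ + (0ℤ * 1ℤ + 0ℤ * (1ℤ - l) - + 2 * 0ℤ)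
    lem = solve-∀
  diag-value l (zer (zer {z} {k} t)) = trans (cong (λ x → 0ℤ + x) (diag-value (suc l) (zer t))) (lem (+ l) (+ z) (+ k) (+ rkC t))
    where
    lem : ∀ l z k r → 0ℤ + (0ℤ + (k * (1ℤ + z) + k * (1ℤ - (1ℤ + l)) - + 2 * (k + r)))
      ≡ 0ℤ + (k * (+ 2 + z) + k * (1ℤ - l) - + 2 * (k + (k + r)))
    lem = solve-∀
  diag-value l (zer (one {z} {k} t)) = trans (cong (λ x → (- wt l z (suc k)) + x) (diag-value (suc l) (one t))) (lem (+ l) (+ z) (+ k) (+ rkC t))
    where
    lem : ∀ l z k r → - (l * (z + (1ℤ + k))) + ((1ℤ + l - 1ℤ) * (z + (1ℤ + k)) + ((1ℤ + k) * z + (1ℤ + k) * (1ℤ - (1ℤ + l)) - + 2 * r))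
      ≡ 0ℤ + ((1ℤ + k) * (1ℤ + z) + (1ℤ + k) * (1ℤ - l) - + 2 * (1ℤ + k + r))
    lem = solve-∀
  diag-value l (one nil) = lem (+ l)
    where
    lem : ∀ l → 0ℤ + 0ℤ ≡ (l - 1ℤ) * 1ℤ + (1ℤ * 0ℤ + 1ℤ * (1ℤ - l) - + 2 * 0ℤ)
    lem = solve-∀
  diag-value l (one (zer {z} {k} t)) = trans (cong (λ x → wt l (suc z) k + x) (diag-value (suc l) (zer t))) (lem (+ l) (+ z) (+ k) (+ rkC t))
    where
    lem : ∀ l z k r → l * (1ℤ + z + k) + (0ℤ + (k * (1ℤ + z) + k * (1ℤ - (1ℤ + l)) - + 2 * (k + r)))
      ≡ (l - 1ℤ) * (1ℤ + z + (1ℤ + k)) + ((1ℤ + k) * (1ℤ + z) + (1ℤ + k) * (1ℤ - l) - + 2 * (k + r))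
    lem = solve-∀
  diag-value l (one (one {z} {k} t)) = trans (cong (λ x → 0ℤ + x) (diag-value (suc l) (one t))) (lem (+ l) (+ z) (+ k) (+ rkC t))
    where
    lem : ∀ l z k r → 0ℤ + ((1ℤ + l - 1ℤ) * (z + (1ℤ + k)) + ((1ℤ + k) * z + (1ℤ + k) * (1ℤ - (1ℤ + l)) - + 2 * r))
      ≡ (l - 1ℤ) * (z + (+ 2 + k)) + ((+ 2 + k) * z + (+ 2 + k) * (1ℤ - l) - + 2 * r)
    lem = solve-∀

  statesC : ∀ z k → List (Ch z k)
  statesC zero zero = nil ∷ []
  statesC (suc z) zero = map zer (statesC z zero)
  statesC zero (suc k) = map one (statesC zero k)
  statesC (suc z) (suc k) = map zer (statesC z (suc k)) ++ map one (statesC (suc z) k)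

  completeC : (s : Ch z k) → s ∈ statesC z k
  completeC nil = here refl
  completeC (zer {k = zero} s) = ∈-map⁺ zer (completeC s)
  completeC (zer {k = suc k} s) = ∈-++⁺ˡ (∈-map⁺ zer (completeC s))
  completeC (one {z = zero} s) = ∈-map⁺ one (completeC s)
  completeC (one {z = suc z} {k} s) = ∈-++⁺ʳ (map zer (statesC z (suc k))) (∈-map⁺ one (completeC s))

  o-injective : {s t : Ch z k} → zer s ≡ zer t → s ≡ t
  o-injective refl = refl

  i-injective : {s t : Ch z k} → one s ≡ one t → s ≡ t
  i-injective refl = refl

  o≢i : {s : Ch z (suc k)} {t : Ch (suc z) k} → ¬ zer s ≡ one t
  o≢i ()

  uniqueC : ∀ z k → Unique (statesC z k)
  uniqueC zero zero = [] ∷ []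
  uniqueC (suc z) zero = Unique.map⁺ o-injective (uniqueC z zero)
  uniqueC zero (suc k) = Unique.map⁺ i-injective (uniqueC zero k)
  uniqueC (suc z) (suc k) = Unique.++⁺ (Unique.map⁺ o-injective (uniqueC z (suc k))) (Unique.map⁺ i-injective (uniqueC (suc z) k))
    (λ { (p , q) → o≢i (trans (sym (proj₂ (proj₂ (∈-map⁻ zer p)))) (proj₂ (proj₂ (∈-map⁻ one q)))) })

  _≟C_ : DecidableEquality (Ch z k)
  nil ≟C nil = yes refl
  zer s ≟C zer t with s ≟C t
  ... | yes refl = yes refl
  ... | no ne = no (ne ∘ o-injective)
  zer s ≟C one t = no λ ()
  one s ≟C zer t = no λ ()
  one s ≟C one t with s ≟C t
  ... | yes refl = yes refl
  ... | no ne = no (ne ∘ i-injective)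

  chain : ℕ → ℕ → Graded
  chain z k = record
    { St = Ch z k ; _≟_ = _≟C_ ; states = statesC z k ; complete = completeC ; unique = uniqueC z k
    ; rk = rkC ; top = z ℕ.* k ; rk≤top = rkC≤
    ; up = upC ; down = downC 1 ; up-rk = upC-rk ; down-rk = downC-rk 1
    ; comm = λ f s → trans (commC 1 f s) (cong (λ x → act upC (act (downC 1) f) s + x * f s) (diag-1 s)) }
    where
    -- At `l = 1` every term of `diag-value` with a factor `l - 1` vanishes, leaving `z k - 2 rk`.
    diag-1 : (s : Ch z k) → diag 1 s ≡ + (z ℕ.* k) - + 2 * + rkC s
    diag-1 s = trans (diag-value 1 s) (trans (cong₂ _+_ (d₀ s) refl)
      (trans (lem (+ z) (+ k) (+ rkC s)) (cong (λ x → x - + 2 * + rkC s) (sym (ℤ.pos-* z k)))))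
      where
      d₀ : (s : Ch z k) → diag₀ s 0ℤ (0ℤ * (+ z + + k)) ≡ 0ℤ
      d₀ nil = refl
      d₀ (zer s) = refl
      d₀ (one s) = refl
      lem : ∀ z k r → 0ℤ + (k * z + k * 0ℤ - + 2 * r) ≡ z * k - + 2 * r
      lem = solve-∀

  point : Graded
  point = record
    { St = ⊤ ; _≟_ = ⊤._≟_ ; states = tt ∷ [] ; complete = λ _ → here refl ; unique = [] ∷ []
    ; rk = λ _ → 0 ; top = 0 ; rk≤top = λ _ → z≤n ; up = λ _ → [] ; down = λ _ → []
    ; up-rk = λ _ → [] ; down-rk = λ _ → [] ; comm = λ f s → lem (f s) }
    where
    lem : ∀ x → 0ℤ ≡ 0ℤ + (0ℤ - + 2 * 0ℤ) * x
    lem = solve-∀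

  infixr 6 _⊗_
  -- The tensor product of sl₂-modules. In the commutator the cross terms cancel and the two
  -- diagonal terms add. Products are formed at this level because a product of unimodal polynomials
  -- need not be unimodal.
  _⊗_ : Graded → Graded → Graded
  G ⊗ H = record
    { St = G.St × H.St ; _≟_ = ≡-dec G._≟_ H._≟_
    ; states = cartesianProduct G.states H.states
    ; complete = λ { (s , t) → ∈-cartesianProduct⁺ (G.complete s) (H.complete t) }
    ; unique = Unique.cartesianProduct⁺ G.unique H.unique
    ; rk = λ { (s , t) → G.rk s ℕ.+ H.rk t } ; top = G.top ℕ.+ H.top
    ; rk≤top = λ { (s , t) → ℕ.+-mono-≤ (G.rk≤top s) (H.rk≤top t) }
    ; up = both G.up H.up ; down = both G.down H.down
    ; up-rk = λ { (s , t) → All.++⁺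
        (All.map⁺ (All.map (λ e → cong (ℕ._+ H.rk t) e) (G.up-rk s)))
        (All.map⁺ (All.map (λ e → trans (cong (G.rk s ℕ.+_) e) (ℕ.+-suc (G.rk s) _)) (H.up-rk t))) }
    ; down-rk = λ { (s , t) → All.++⁺
        (All.map⁺ (All.map (λ e → cong (ℕ._+ H.rk t) e) (G.down-rk s)))
        (All.map⁺ (All.map (λ e → trans (cong (G.rk s ℕ.+_) e) (ℕ.+-suc (G.rk s) _)) (H.down-rk t))) }
    ; comm = comm }
    where
    module G = Graded G
    module H = Graded H
    both : (G.St → Moves G.St) → (H.St → Moves H.St) → G.St × H.St → Moves (G.St × H.St)
    both x y (s , t) = push (_, t) (x s) ++ push (s ,_) (y t)
    act-both : ∀ x y f s t → act (both x y) f (s , t) ≡ app (x s) (λ s′ → f (s′ , t)) + app (y t) (λ t′ → f (s , t′))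
    act-both x y f s t = trans (app-++ (push (_, t) (x s)) _ f)
      (cong₂ _+_ (app-push (_, t) (x s) f) (app-push (s ,_) (y t) f))
    act-both² : ∀ x y x′ y′ f s t → act (both x y) (act (both x′ y′) f) (s , t) ≡
      (act x (act x′ (λ s → f (s , t))) s + app (x s) (λ s′ → app (y′ t) (λ t′ → f (s′ , t′)))) +
      (app (y t) (λ t′ → app (x′ s) (λ s′ → f (s′ , t′))) + act y (act y′ (λ t → f (s , t))) t)
    act-both² x y x′ y′ f s t = trans (act-both x y _ s t) (cong₂ _+_
      (trans (app-cong (x s) (λ s′ → act-both x′ y′ f s′ t)) (app-+ (x s) _ _))
      (trans (app-cong (y t) (λ t′ → act-both x′ y′ f s t′)) (app-+ (y t) _ _)))
    comm : ∀ f st → act (both G.down H.down) (act (both G.up H.up) f) st ≡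
      act (both G.up H.up) (act (both G.down H.down) f) st +
      (+ (G.top ℕ.+ H.top) - + 2 * + (G.rk (proj₁ st) ℕ.+ H.rk (proj₂ st))) * f st
    comm f (s , t) = begin
      act (both G.down H.down) (act (both G.up H.up) f) (s , t)
        ≡⟨ act-both² G.down H.down G.up H.up f s t ⟩
      (G.D (G.U (λ s → f (s , t))) s + app (G.down s) (λ s′ → app (H.up t) (λ t′ → f (s′ , t′)))) +
      (app (H.down t) (λ t′ → app (G.up s) (λ s′ → f (s′ , t′))) + H.D (H.U (λ t → f (s , t))) t)
        ≡⟨ cong₂ _+_
             (cong₂ _+_ (G.comm (λ s → f (s , t)) s) (app-swap (G.down s) (H.up t) (λ s t → f (s , t))))
             (cong₂ _+_ (sym (app-swap (G.up s) (H.down t) (λ s t → f (s , t)))) (H.comm (λ t → f (s , t)) t)) ⟩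
      (a + (+ G.top - + 2 * + G.rk s) * f (s , t) + b) + (c + (d + (+ H.top - + 2 * + H.rk t) * f (s , t)))
        ≡⟨ regroup a b c d (+ G.top) (+ G.rk s) (+ H.top) (+ H.rk t) (f (s , t)) ⟩
      ((a + c) + (b + d)) + (+ G.top + + H.top - + 2 * (+ G.rk s + + H.rk t)) * f (s , t)
        ≡⟨ cong (_+ (+ G.top + + H.top - + 2 * (+ G.rk s + + H.rk t)) * f (s , t)) (act-both² G.up H.up G.down H.down f s t) ⟨
      act (both G.up H.up) (act (both G.down H.down) f) (s , t) + (+ (G.top ℕ.+ H.top) - + 2 * + (G.rk s ℕ.+ H.rk t)) * f (s , t) ∎
      where
      open ≡-Reasoning
      a = G.U (G.D (λ s → f (s , t))) s
      b = app (H.up t) (λ t′ → app (G.down s) (λ s′ → f (s′ , t′)))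
      c = app (G.up s) (λ s′ → app (H.down t) (λ t′ → f (s′ , t′)))
      d = H.U (H.D (λ t → f (s , t))) t
      regroup : ∀ a b c d p r p′ r′ x → (a + (p - + 2 * r) * x + b) + (c + (d + (p′ - + 2 * r′) * x))
        ≡ ((a + c) + (b + d)) + (p + p′ - + 2 * (r + r′)) * x
      regroup = solve-∀

  mono : ℕ → Poly
  mono zero = 1 ∷ []
  mono (suc n) = 0 ∷ mono n

  mono-+ : ∀ m n → mono (m ℕ.+ n) ≋ mono m *ₚ mono n
  mono-+ zero n = ≋-sym (*ₚ-identityˡ (mono n))
  mono-+ (suc m) n = ≋-trans (∷-cong refl (mono-+ m n)) (≋-sym (0∷-* (mono m) (mono n)))

  gen : ∀ {S : Set} → (S → ℕ) → List S → Poly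
  gen rk [] = []
  gen rk (s ∷ ss) = mono (rk s) +ₚ gen rk ss

  coeff-mono-≡ : ∀ n → coeff n (mono n) ≡ 1
  coeff-mono-≡ zero = refl
  coeff-mono-≡ (suc n) = coeff-mono-≡ n

  coeff-mono-≢ : ∀ n j → ¬ n ≡ j → coeff j (mono n) ≡ 0
  coeff-mono-≢ zero zero ne = ⊥-elim (ne refl)
  coeff-mono-≢ zero (suc j) ne = refl
  coeff-mono-≢ (suc n) zero ne = refl
  coeff-mono-≢ (suc n) (suc j) ne = coeff-mono-≢ n j (ne ∘ cong suc)

  coeff-gen : ∀ {S : Set} (rk : S → ℕ) j ss → coeff j (gen rk ss) ≡ length (filter (λ s → rk s ℕ.≟ j) ss)
  coeff-gen rk j [] = refl
  coeff-gen rk j (s ∷ ss) with rk s ℕ.≟ j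
  ... | yes e = trans (coeff-+ j (mono (rk s)) _) (trans
    (cong₂ ℕ._+_ (trans (cong (λ n → coeff j (mono n)) e) (coeff-mono-≡ j)) (coeff-gen rk j ss))
    (sym (cong length (filter-accept (λ s → rk s ℕ.≟ j) {s} {ss} e))))
  ... | no ne = trans (coeff-+ j (mono (rk s)) _) (trans
    (cong₂ ℕ._+_ (coeff-mono-≢ (rk s) j ne) (coeff-gen rk j ss))
    (sym (cong length (filter-reject (λ s → rk s ℕ.≟ j) {s} {ss} ne))))

  gen-++ : ∀ {S : Set} (rk : S → ℕ) ss ts → gen rk (ss ++ ts) ≋ gen rk ss +ₚ gen rk ts
  gen-++ rk [] ts = ≋-refl
  gen-++ rk (s ∷ ss) ts = ≋-trans (+ₚ-cong (≋-refl {mono (rk s)}) (gen-++ rk ss ts)) (≋-sym (+ₚ-assoc (mono (rk s)) _ _))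

  gen-map : ∀ {S T : Set} (rk : T → ℕ) (rk′ : S → ℕ) (g : S → T) c → (∀ s → rk (g s) ≡ c ℕ.+ rk′ s) →
    ∀ ss → gen rk (map g ss) ≋ mono c *ₚ gen rk′ ss
  gen-map rk rk′ g c e [] = ≋-sym (*ₚ-zeroʳ (mono c))
  gen-map rk rk′ g c e (s ∷ ss) = ≋-trans
    (+ₚ-cong (subst (λ r → mono r ≋ mono c *ₚ mono (rk′ s)) (sym (e s)) (mono-+ c (rk′ s))) (gen-map rk rk′ g c e ss))
    (≋-sym (*ₚ-distribˡ (mono c) (mono (rk′ s)) _))

  gen-× : ∀ {S T : Set} (rk : S → ℕ) (rk′ : T → ℕ) ss ts →
    gen (λ { (s , t) → rk s ℕ.+ rk′ t }) (cartesianProduct ss ts) ≋ gen rk ss *ₚ gen rk′ ts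
  gen-× rk rk′ [] ts = ≋-refl
  gen-× rk rk′ (s ∷ ss) ts = ≋-trans (gen-++ _ (map (s ,_) ts) _) (≋-trans
    (+ₚ-cong (gen-map _ rk′ (s ,_) (rk s) (λ _ → refl) ts) (gen-× rk rk′ ss ts))
    (≋-sym (*ₚ-distribʳ (gen rk′ ts) (mono (rk s)) _)))

  genG : Graded → Poly
  genG G = gen (Graded.rk G) (Graded.states G)

  genG-rises : ∀ G j → 2 ℕ.* j ℕ.< Graded.top G → coeff j (genG G) ℕ.≤ coeff (suc j) (genG G)
  genG-rises G j lt = subst₂ ℕ._≤_ (sym (coeff-gen rk j states)) (sym (coeff-gen rk (suc j) states)) (level-mono G j lt)
    where open Graded G

  -- `level-mono` for the dual module, at rank `top - suc j`. Degrees beyond `top` carry no states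
  -- and make the remaining case.
  genG-falls : ∀ G j → Graded.top G ℕ.< 2 ℕ.* suc j → coeff (suc j) (genG G) ℕ.≤ coeff j (genG G)
  genG-falls G j lt with suc j ℕ.≤? Graded.top G
  ... | yes le = subst₂ ℕ._≤_ (count (suc j) le) (trans (cong (λ x → length (Graded.level (dual G) x)) (sym top-j)) (count j (ℕ.≤-trans (ℕ.n≤1+n j) le)))
        (level-mono (dual G) (top ℕ.∸ suc j) (ℕ.+-cancelʳ-< (2 ℕ.* suc j) _ _ (begin-strict
          2 ℕ.* (top ℕ.∸ suc j) ℕ.+ 2 ℕ.* suc j  ≡⟨ ℕ.*-distribˡ-+ 2 (top ℕ.∸ suc j) (suc j) ⟨
          2 ℕ.* (top ℕ.∸ suc j ℕ.+ suc j)        ≡⟨ cong (2 ℕ.*_) (ℕ.m∸n+n≡m le) ⟩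
          2 ℕ.* top                              ≡⟨ cong (top ℕ.+_) (ℕ.+-identityʳ top) ⟩
          top ℕ.+ top                            <⟨ ℕ.+-monoʳ-< top lt ⟩
          top ℕ.+ 2 ℕ.* suc j ∎)))
    where
    open Graded G
    open ℕ.≤-Reasoning
    top-j : top ℕ.∸ j ≡ suc (top ℕ.∸ suc j)
    top-j = ℕ.+-∸-assoc 1 le
    count : ∀ j → j ℕ.≤ top → length (Graded.level (dual G) (top ℕ.∸ j)) ≡ coeff j (genG G)
    count j le = trans (cong length (filter-≐ (λ s → (top ℕ.∸ rk s) ℕ.≟ (top ℕ.∸ j)) (λ s → rk s ℕ.≟ j)
      ((λ {s} e → ℕ.∸-cancelˡ-≡ (rk≤top s) le e) , cong (top ℕ.∸_)) states)) (sym (coeff-gen rk j states))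
  ... | no nle = subst (ℕ._≤ coeff j (genG G)) (sym (trans (coeff-gen rk (suc j) states) (cong length (filter-none (λ s → rk s ℕ.≟ suc j) {states} (All.universal (λ s e → nle (subst (ℕ._≤ top) e (rk≤top s))) states))))) z≤n
    where open Graded G

  qint-+ : ∀ m n → qint (m ℕ.+ n) ≋ qint m +ₚ (mono m *ₚ qint n)
  qint-+ zero n = ≋-sym (*ₚ-identityˡ (qint n))
  qint-+ (suc m) n = ≋-trans (∷-cong refl (qint-+ m n)) (+ₚ-cong (≋-refl {qint (suc m)}) (≋-sym (0∷-* (mono m) (qint n))))

  qbinomial : ℕ → ℕ → Poly
  qbinomial z k = genG (chain z k)

  -- Split by the first symbol: a leading zero stands before all `suc k` ones and so adds `suc k` to
  -- the rank, a leading one adds nothing.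
  qbinomial-pascal : ∀ z k → qbinomial (suc z) (suc k) ≋ (mono (suc k) *ₚ qbinomial z (suc k)) +ₚ qbinomial (suc z) k
  qbinomial-pascal z k = ≋-trans (gen-++ rkC (map zer (statesC z (suc k))) _) (+ₚ-cong
    (gen-map rkC rkC zer (suc k) (λ _ → refl) (statesC z (suc k)))
    (≋-trans (gen-map rkC rkC one 0 (λ _ → refl) (statesC (suc z) k)) (*ₚ-identityˡ _)))

  -- Pascal's rule together with `[k+1] + q^(k+1) [z+1] = [k+z+2]`.
  qbinomial-fact : ∀ z k → qbinomial z k *ₚ (qfact k *ₚ qfact z) ≋ qfact (k ℕ.+ z)
  qbinomial-fact zero zero = mk λ { zero → refl ; (suc zero) → refl ; (suc (suc zero)) → refl ; (suc (suc (suc _))) → refl }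
  qbinomial-fact (suc z) zero = begin
    qbinomial (suc z) 0 *ₚ (1ₚ *ₚ (qint (suc z) *ₚ qfact z))
      ≈⟨ *ₚ-cong (≋-trans (gen-map rkC rkC zer 0 (λ _ → refl) (statesC z 0)) (*ₚ-identityˡ _)) ≋-refl ⟩
    qbinomial z 0 *ₚ (1ₚ *ₚ (qint (suc z) *ₚ qfact z))
      ≈⟨ PS.solve 4 (λ x y w e → x :* (e :* (y :* w)) := y :* (x :* (e :* w))) ≋-refl (qbinomial z 0) (qint (suc z)) (qfact z) 1ₚ ⟩
    qint (suc z) *ₚ (qbinomial z 0 *ₚ (1ₚ *ₚ qfact z))
      ≈⟨ *ₚ-congʳ (qint (suc z)) (qbinomial-fact z 0) ⟩
    qfact (suc z) ∎
    where open PR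
  qbinomial-fact zero (suc k) = begin
    qbinomial 0 (suc k) *ₚ ((qint (suc k) *ₚ qfact k) *ₚ 1ₚ)
      ≈⟨ *ₚ-cong (≋-trans (gen-map rkC rkC one 0 (λ _ → refl) (statesC 0 k)) (*ₚ-identityˡ _)) ≋-refl ⟩
    qbinomial 0 k *ₚ ((qint (suc k) *ₚ qfact k) *ₚ 1ₚ)
      ≈⟨ PS.solve 4 (λ x y w e → x :* ((y :* w) :* e) := y :* (x :* (w :* e))) ≋-refl (qbinomial 0 k) (qint (suc k)) (qfact k) 1ₚ ⟩
    qint (suc k) *ₚ (qbinomial 0 k *ₚ (qfact k *ₚ 1ₚ))
      ≈⟨ *ₚ-congʳ (qint (suc k)) (qbinomial-fact 0 k) ⟩
    qint (suc k) *ₚ qfact (k ℕ.+ 0)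
      ≡⟨ cong (λ n → qint (suc n) *ₚ qfact (k ℕ.+ 0)) (ℕ.+-identityʳ k) ⟨
    qfact (suc k ℕ.+ 0) ∎
    where open PR
  qbinomial-fact (suc z) (suc k) = begin
    qbinomial (suc z) (suc k) *ₚ ((qint (suc k) *ₚ qfact k) *ₚ (qint (suc z) *ₚ qfact z))
      ≈⟨ *ₚ-cong (qbinomial-pascal z k) ≋-refl ⟩
    ((mono (suc k) *ₚ qbinomial z (suc k)) +ₚ qbinomial (suc z) k) *ₚ ((qint (suc k) *ₚ qfact k) *ₚ (qint (suc z) *ₚ qfact z))
      ≈⟨ PS.solve 7 (λ m x y a f c g → (m :* x :+ y) :* ((a :* f) :* (c :* g)) := (m :* c) :* (x :* ((a :* f) :* g)) :+ a :* (y :* (f :* (c :* g))))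
           ≋-refl (mono (suc k)) (qbinomial z (suc k)) (qbinomial (suc z) k) (qint (suc k)) (qfact k) (qint (suc z)) (qfact z) ⟩
    ((mono (suc k) *ₚ qint (suc z)) *ₚ (qbinomial z (suc k) *ₚ ((qint (suc k) *ₚ qfact k) *ₚ qfact z))) +ₚ
    (qint (suc k) *ₚ (qbinomial (suc z) k *ₚ (qfact k *ₚ (qint (suc z) *ₚ qfact z))))
      ≈⟨ +ₚ-cong (*ₚ-congʳ (mono (suc k) *ₚ qint (suc z)) (qbinomial-fact z (suc k)))
                 (*ₚ-congʳ (qint (suc k)) (subst (λ n → qbinomial (suc z) k *ₚ (qfact k *ₚ (qint (suc z) *ₚ qfact z)) ≋ qfact n) (ℕ.+-suc k z) (qbinomial-fact (suc z) k))) ⟩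
    ((mono (suc k) *ₚ qint (suc z)) *ₚ F) +ₚ (qint (suc k) *ₚ F)
      ≈⟨ PS.solve 3 (λ x y f → x :* f :+ y :* f := (y :+ x) :* f) ≋-refl (mono (suc k) *ₚ qint (suc z)) (qint (suc k)) F ⟩
    (qint (suc k) +ₚ (mono (suc k) *ₚ qint (suc z))) *ₚ F
      ≈⟨ *ₚ-cong (qint-+ (suc k) (suc z)) ≋-refl ⟨
    qint (suc k ℕ.+ suc z) *ₚ F
      ≡⟨ cong (λ n → qint (suc k ℕ.+ suc z) *ₚ qfact n) (ℕ.+-suc k z) ⟨
    qfact (suc k ℕ.+ suc z) ∎
    where
    open PR
    F = qfact (suc k ℕ.+ z)

  -- Choose the places of the first letter (the ones of a 0/1-word), then distribute the other
  -- letters over the zeros.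
  multi : List ℕ → Graded
  multi [] = point
  multi (c ∷ cs) = chain (ℕ.sum cs) c ⊗ multi cs

  qmultinomial : List ℕ → Poly
  qmultinomial cs = genG (multi cs)

  qfacts : List ℕ → Poly
  qfacts cs = prodₚ (map qfact cs)

  qmultinomial-fact : ∀ cs → qmultinomial cs *ₚ qfacts cs ≋ qfact (ℕ.sum cs)
  qmultinomial-fact [] = mk λ { zero → refl ; (suc zero) → refl ; (suc (suc _)) → refl }
  qmultinomial-fact (c ∷ cs) = begin
    qmultinomial (c ∷ cs) *ₚ (qfact c *ₚ qfacts cs)
      ≈⟨ *ₚ-cong (gen-× rkC (Graded.rk (multi cs)) (statesC (ℕ.sum cs) c) (Graded.states (multi cs))) ≋-refl ⟩
    (qbinomial (ℕ.sum cs) c *ₚ qmultinomial cs) *ₚ (qfact c *ₚ qfacts cs)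
      ≈⟨ PS.solve 4 (λ x y f g → (x :* y) :* (f :* g) := x :* (f :* (y :* g))) ≋-refl (qbinomial (ℕ.sum cs) c) (qmultinomial cs) (qfact c) (qfacts cs) ⟩
    qbinomial (ℕ.sum cs) c *ₚ (qfact c *ₚ (qmultinomial cs *ₚ qfacts cs))
      ≈⟨ *ₚ-congʳ (qbinomial (ℕ.sum cs) c) (*ₚ-congʳ (qfact c) (qmultinomial-fact cs)) ⟩
    qbinomial (ℕ.sum cs) c *ₚ (qfact c *ₚ qfact (ℕ.sum cs))
      ≈⟨ qbinomial-fact (ℕ.sum cs) c ⟩
    qfact (c ℕ.+ ℕ.sum cs) ∎
    where open PR

-- Divisibility by `[b]` and nonnegativity of the quotient.

module Kreweras where

  open import Defs hiding (N; E)
  open Polynomial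
  open GradedSets using (Graded)
  open QMultinomial
  open import Data.Nat using (ℕ; zero; suc; _+_; _*_; _∸_; _≤_; _<_; z≤n; s≤s; z<s; _≤?_; _<?_)
  open import Data.Nat.Properties
  open import Data.Nat.ListAction using (sum)
  open import Data.Nat.ListAction.Properties using (sum-++)
  open import Data.Nat.Coprimality using (Coprime; coprime-Bézout)
  open import Data.Nat.GCD using (module Bézout)
  open Bézout.Identity using (+-; -+)
  open import Data.Nat.Tactic.RingSolver using (solve-∀)
  open import Data.Fin using (Fin; zero; suc; toℕ)
  open import Data.List using ([]; _∷_; _++_; length)
  open import Data.List.Membership.Propositional using (_∈_)
  open import Data.List.Membership.Propositional.Properties using (∈-∃++)
  open import Data.List.Relation.Unary.Any using (here; there)
  open import Data.Vec as Vec using (Vec; []; _∷_; tabulate; lookup)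
  import Data.Vec.Properties as Vec
  import Data.Vec.Membership.Propositional.Properties as Vec
  open import Data.Product using (∃; _,_; proj₁; proj₂)
  open import Data.Empty using (⊥-elim)
  open import Function using (_∘_)
  open import Relation.Nullary using (yes; no)
  open import Relation.Binary.PropositionalEquality
  open import Algebra.Solver.Ring.NaturalCoefficients.Default polySemiring as PS using (_:+_; _:*_; _:=_)

  +ₚ-cancelʳ : ∀ r {p q} → p +ₚ r ≋ q +ₚ r → p ≋ q
  +ₚ-cancelʳ r {p} {q} e = mk λ i → +-cancelʳ-≡ (coeff i r) _ _ (trans (sym (coeff-+ i p r)) (trans (at e i) (coeff-+ i q r)))

  coeff0-qfact : ∀ n → coeff 0 (qfact n) ≡ 1
  coeff0-qfact zero = refl
  coeff0-qfact (suc n) = trans (coeff0-* (qint (suc n)) (qfact n)) (trans (+-identityʳ _) (coeff0-qfact n))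

  coeff0-qfacts : ∀ cs → coeff 0 (qfacts cs) ≡ 1
  coeff0-qfacts [] = refl
  coeff0-qfacts (c ∷ cs) = trans (coeff0-* (qfact c) (qfacts cs)) (cong₂ _*_ (coeff0-qfact c) (coeff0-qfacts cs))

  qfacts-suc : ∀ xs c ys → qfacts (xs ++ suc c ∷ ys) ≋ qint (suc c) *ₚ qfacts (xs ++ c ∷ ys)
  qfacts-suc [] c ys = *ₚ-assoc (qint (suc c)) (qfact c) (qfacts ys)
  qfacts-suc (x ∷ xs) c ys = ≋-trans (*ₚ-congʳ (qfact x) (qfacts-suc xs c ys))
    (PS.solve 3 (λ f q g → f :* (q :* g) := q :* (f :* g)) ≋-refl (qfact x) (qint (suc c)) (qfacts (xs ++ c ∷ ys)))

  sum-suc : ∀ xs c ys → sum (xs ++ suc c ∷ ys) ≡ suc (sum (xs ++ c ∷ ys))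
  sum-suc xs c ys = trans (sum-++ xs (suc c ∷ ys)) (trans (+-suc (sum xs) _) (cong suc (sym (sum-++ xs (c ∷ ys)))))

  coeff-beyond : ∀ p i → length p ≤ i → coeff i p ≡ 0
  coeff-beyond [] i le = refl
  coeff-beyond (c ∷ p) (suc i) (s≤s le) = coeff-beyond p i le

  coeff-mono*-+ : ∀ n p j → coeff (n + j) (mono n *ₚ p) ≡ coeff j p
  coeff-mono*-+ zero p j = at (*ₚ-identityˡ p) j
  coeff-mono*-+ (suc n) p j = trans (at (0∷-* (mono n) p) (suc n + j)) (coeff-mono*-+ n p j)

  coeff-mono*-< : ∀ n p j → j < n → coeff j (mono n *ₚ p) ≡ 0
  coeff-mono*-< (suc n) p zero lt = at (0∷-* (mono n) p) 0
  coeff-mono*-< (suc n) p (suc j) (s≤s lt) = trans (at (0∷-* (mono n) p) (suc j)) (coeff-mono*-< n p j lt)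

  _−ₚ_ : Poly → Poly → Poly
  [] −ₚ q = []
  (c ∷ p) −ₚ [] = c ∷ p
  (c ∷ p) −ₚ (d ∷ q) = (c ∸ d) ∷ (p −ₚ q)

  coeff-−ₚ : ∀ i p q → coeff i (p −ₚ q) ≡ coeff i p ∸ coeff i q
  coeff-−ₚ i [] q = sym (0∸n≡0 (coeff i q))
  coeff-−ₚ i (c ∷ p) [] = refl
  coeff-−ₚ zero (c ∷ p) (d ∷ q) = refl
  coeff-−ₚ (suc i) (c ∷ p) (d ∷ q) = coeff-−ₚ i p q

  qint-1 : ∀ p → qint 1 *ₚ p ≋ p
  qint-1 = *ₚ-identityˡ

  -- The numbers t for which [b] divides [t] M in ℤ[q]; the quotient is P - N.
  record Divides (b : ℕ) (M : Poly) (t : ℕ) : Set where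
    constructor divides
    field
      P N : Poly
      eq  : P *ₚ qint b ≋ (N *ₚ qint b) +ₚ (qint t *ₚ M)

  module _ {b : ℕ} {M : Poly} where

    divides-0 : Divides b M 0
    divides-0 = divides [] [] ≋-refl

    divides-b : Divides b M b
    divides-b = divides M [] (*ₚ-comm M (qint b))

    divides-+ : ∀ {s t} → Divides b M s → Divides b M t → Divides b M (s + t)
    divides-+ {s} {t} (divides P N e) (divides P′ N′ e′) = divides (P +ₚ (mono s *ₚ P′)) (N +ₚ (mono s *ₚ N′)) (begin
      (P +ₚ (mono s *ₚ P′)) *ₚ qint b
        ≈⟨ PS.solve 4 (λ p m p′ b → (p :+ m :* p′) :* b := p :* b :+ m :* (p′ :* b)) ≋-refl P (mono s) P′ (qint b) ⟩
      (P *ₚ qint b) +ₚ (mono s *ₚ (P′ *ₚ qint b))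
        ≈⟨ +ₚ-cong e (*ₚ-congʳ (mono s) e′) ⟩
      ((N *ₚ qint b) +ₚ (qint s *ₚ M)) +ₚ (mono s *ₚ ((N′ *ₚ qint b) +ₚ (qint t *ₚ M)))
        ≈⟨ PS.solve 7 (λ n b s M m n′ t → (n :* b :+ s :* M) :+ m :* (n′ :* b :+ t :* M) := (n :+ m :* n′) :* b :+ (s :+ m :* t) :* M)
             ≋-refl N (qint b) (qint s) M (mono s) N′ (qint t) ⟩
      ((N +ₚ (mono s *ₚ N′)) *ₚ qint b) +ₚ ((qint s +ₚ (mono s *ₚ qint t)) *ₚ M)
        ≈⟨ +ₚ-cong ≋-refl (*ₚ-cong (qint-+ s t) ≋-refl) ⟨
      ((N +ₚ (mono s *ₚ N′)) *ₚ qint b) +ₚ (qint (s + t) *ₚ M) ∎)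
      where open PR

    -- From `[s + t] = [s] + q^s [t]`; subtracting the second quotient exchanges the roles of `P′`
    -- and `N′`.
    divides-− : ∀ {s t} → Divides b M (s + t) → Divides b M t → Divides b M s
    divides-− {s} {t} (divides P N e) (divides P′ N′ e′) = divides (P +ₚ (mono s *ₚ N′)) (N +ₚ (mono s *ₚ P′)) (begin
      (P +ₚ (mono s *ₚ N′)) *ₚ qint b
        ≈⟨ PS.solve 4 (λ p m p′ b → (p :+ m :* p′) :* b := p :* b :+ m :* (p′ :* b)) ≋-refl P (mono s) N′ (qint b) ⟩
      (P *ₚ qint b) +ₚ (mono s *ₚ (N′ *ₚ qint b))
        ≈⟨ +ₚ-cong (≋-trans e (+ₚ-cong ≋-refl (*ₚ-cong (qint-+ s t) ≋-refl))) ≋-refl ⟩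
      ((N *ₚ qint b) +ₚ ((qint s +ₚ (mono s *ₚ qint t)) *ₚ M)) +ₚ (mono s *ₚ (N′ *ₚ qint b))
        ≈⟨ PS.solve 7 (λ n b s M m n′ t → (n :* b :+ (s :+ m :* t) :* M) :+ m :* (n′ :* b) := n :* b :+ m :* (n′ :* b :+ t :* M) :+ s :* M)
             ≋-refl N (qint b) (qint s) M (mono s) N′ (qint t) ⟩
      ((N *ₚ qint b) +ₚ (mono s *ₚ ((N′ *ₚ qint b) +ₚ (qint t *ₚ M)))) +ₚ (qint s *ₚ M)
        ≈⟨ +ₚ-cong (+ₚ-cong (≋-refl {N *ₚ qint b}) (*ₚ-congʳ (mono s) (≋-sym e′))) ≋-refl ⟩
      ((N *ₚ qint b) +ₚ (mono s *ₚ (P′ *ₚ qint b))) +ₚ (qint s *ₚ M)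
        ≈⟨ +ₚ-cong (PS.solve 4 (λ p m p′ b → p :* b :+ m :* (p′ :* b) := (p :+ m :* p′) :* b) ≋-refl N (mono s) P′ (qint b)) ≋-refl ⟩
      ((N +ₚ (mono s *ₚ P′)) *ₚ qint b) +ₚ (qint s *ₚ M) ∎)
      where open PR

    divides-* : ∀ n {t} → Divides b M t → Divides b M (n * t)
    divides-* zero d = divides-0
    divides-* (suc n) d = divides-+ d (divides-* n d)

    divides-sum : ∀ {n} (f : Fin n → ℕ) → (∀ t → Divides b M (f t)) → Divides b M (Vec.sum (tabulate f))
    divides-sum {zero} f d = divides-0
    divides-sum {suc n} f d = divides-+ (d zero) (divides-sum (f ∘ suc) (d ∘ suc))

    -- The numbers `t` in question are closed under sums and differences, so a Bézout identity for
    -- `a` and `b` leads down to 1.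
    divides-1 : ∀ {a} → Coprime a b → Divides b M a → Divides b M 1
    divides-1 {a} c d with coprime-Bézout c
    ... | +- x y e = divides-− (subst (Divides b M) (sym e) (divides-* x d)) (divides-* y divides-b)
    ... | -+ x y e = divides-− (subst (Divides b M) (sym e) (divides-* y divides-b)) (divides-* x d)

  -- Lowering one part from `suc c` to `c` gives a multinomial coefficient `M′` with
  -- `[c+1] M = [b] M′`: multiplied by the q-factorials of the lowered parts, both sides become
  -- `[b]!`.
  divides-part : ∀ {b cs c} → sum cs ≡ b → c ∈ cs → Divides b (qmultinomial cs) c
  divides-part {c = zero} _ _ = divides-0
  divides-part {b} {cs} {suc c} e c∈ with ∈-∃++ c∈
  ... | xs , ys , refl = divides M′ [] (*ₚ-cancelˡ F′ (coeff0-qfacts (xs ++ c ∷ ys)) (begin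
      F′ *ₚ (M′ *ₚ qint b)              ≈⟨ PS.solve 3 (λ f m b → f :* (m :* b) := b :* (m :* f)) ≋-refl F′ M′ (qint b) ⟩
      qint b *ₚ (M′ *ₚ F′)              ≈⟨ *ₚ-congʳ (qint b) (qmultinomial-fact (xs ++ c ∷ ys)) ⟩
      qint b *ₚ qfact (sum (xs ++ c ∷ ys)) ≡⟨ cong (λ n → qint n *ₚ qfact (sum (xs ++ c ∷ ys))) (trans (sym e) (sum-suc xs c ys)) ⟩
      qfact (suc (sum (xs ++ c ∷ ys)))  ≡⟨ cong qfact (sum-suc xs c ys) ⟨
      qfact (sum (xs ++ suc c ∷ ys))    ≈⟨ qmultinomial-fact (xs ++ suc c ∷ ys) ⟨
      M *ₚ qfacts (xs ++ suc c ∷ ys)    ≈⟨ *ₚ-congʳ M (qfacts-suc xs c ys) ⟩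
      M *ₚ (qint (suc c) *ₚ F′)         ≈⟨ PS.solve 3 (λ m q f → m :* (q :* f) := f :* (q :* m)) ≋-refl M (qint (suc c)) F′ ⟩
      F′ *ₚ (qint (suc c) *ₚ M)         ∎))
      where
      open PR
      F′ = qfacts (xs ++ c ∷ ys)
      M′ = qmultinomial (xs ++ c ∷ ys)
      M = qmultinomial (xs ++ suc c ∷ ys)

  -- P - N = (1 - q) M / (1 - q^b).  Up to the middle degree of M its coefficients are sums of coefficients
  -- of (1 - q) M, hence nonnegative; from the middle on the same holds reading from the top degree down.
  module _ (G : Graded) {b : ℕ} (0<b : 0 < b) (P N : Poly)
           (e : P *ₚ qint b ≋ (N *ₚ qint b) +ₚ (qint 1 *ₚ genG G)) where
    private
      M = genG G
      top = Graded.top G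
      Q = mono 1

      qint-two-ways : (Q *ₚ qint b) +ₚ qint 1 ≋ qint b +ₚ mono b
      qint-two-ways = ≋-trans (+ₚ-comm (Q *ₚ qint b) (qint 1)) (≋-trans (≋-sym (qint-+ 1 b))
        (subst (λ n → qint n ≋ qint b +ₚ mono b) (+-comm b 1) (≋-trans (qint-+ b 1) (+ₚ-cong (≋-refl {qint b}) (*ₚ-identityʳ (mono b))))))

      -- This is `(P - N)(1 - q^b) = (1 - q) M` with all negative terms moved across: `e` multiplied
      -- by `1 - q`, where `qint-two-ways` stands for `(1 - q)[b] = 1 - q^b`.
      balance : (P +ₚ (Q *ₚ M)) +ₚ (mono b *ₚ N) ≋ (M +ₚ (mono b *ₚ P)) +ₚ N
      balance = +ₚ-cancelʳ R (begin
        ((P +ₚ (Q *ₚ M)) +ₚ (mono b *ₚ N)) +ₚ R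
          ≈⟨ PS.solve 7 (λ p q M m n b u → ((p :+ q :* M) :+ m :* n) :+ (q :* (n :* b) :+ n :* b)
               := p :+ q :* (n :* b :+ M) :+ n :* (b :+ m)) ≋-refl P Q M (mono b) N (qint b) (qint 1) ⟩
        (P +ₚ (Q *ₚ ((N *ₚ qint b) +ₚ M))) +ₚ (N *ₚ (qint b +ₚ mono b))
          ≈⟨ +ₚ-cong (+ₚ-cong (≋-refl {P}) (*ₚ-congʳ Q e′)) (*ₚ-congʳ N (≋-sym qint-two-ways)) ⟩
        (P +ₚ (Q *ₚ (P *ₚ qint b))) +ₚ (N *ₚ ((Q *ₚ qint b) +ₚ qint 1))
          ≈⟨ +ₚ-cong (+ₚ-cong (≋-sym (*ₚ-identityʳ P)) ≋-refl) ≋-refl ⟩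
        ((P *ₚ qint 1) +ₚ (Q *ₚ (P *ₚ qint b))) +ₚ (N *ₚ ((Q *ₚ qint b) +ₚ qint 1))
          ≈⟨ PS.solve 5 (λ p u q b n → (p :* u :+ q :* (p :* b)) :+ n :* (q :* b :+ u) := p :* (q :* b :+ u) :+ n :* (q :* b) :+ n :* u)
               ≋-refl P (qint 1) Q (qint b) N ⟩
        ((P *ₚ ((Q *ₚ qint b) +ₚ qint 1)) +ₚ (N *ₚ (Q *ₚ qint b))) +ₚ (N *ₚ qint 1)
          ≈⟨ +ₚ-cong (+ₚ-cong (*ₚ-congʳ P qint-two-ways) ≋-refl) (*ₚ-identityʳ N) ⟩
        ((P *ₚ (qint b +ₚ mono b)) +ₚ (N *ₚ (Q *ₚ qint b))) +ₚ N
          ≈⟨ PS.solve 5 (λ p b m n q → p :* (b :+ m) :+ n :* (q :* b) :+ n := p :* b :+ m :* p :+ n :* (q :* b) :+ n) ≋-refl P (qint b) (mono b) N Q ⟩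
        (((P *ₚ qint b) +ₚ (mono b *ₚ P)) +ₚ (N *ₚ (Q *ₚ qint b))) +ₚ N
          ≈⟨ +ₚ-cong (+ₚ-cong (+ₚ-cong (≋-sym e′) ≋-refl) ≋-refl) ≋-refl ⟩
        ((((N *ₚ qint b) +ₚ M) +ₚ (mono b *ₚ P)) +ₚ (N *ₚ (Q *ₚ qint b))) +ₚ N
          ≈⟨ PS.solve 6 (λ n b M m p q → n :* b :+ M :+ m :* p :+ n :* (q :* b) :+ n := (M :+ m :* p) :+ n :+ (q :* (n :* b) :+ n :* b))
               ≋-refl N (qint b) M (mono b) P Q ⟩
        ((M +ₚ (mono b *ₚ P)) +ₚ N) +ₚ R ∎)
        where
        open PR
        R = (Q *ₚ (N *ₚ qint b)) +ₚ (N *ₚ qint b)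
        e′ : (N *ₚ qint b) +ₚ M ≋ P *ₚ qint b
        e′ = ≋-trans (+ₚ-cong (≋-refl {N *ₚ qint b}) (≋-sym (qint-1 M))) (≋-sym e)

      balance-at : ∀ i → (coeff i P + coeff i (Q *ₚ M)) + coeff i (mono b *ₚ N) ≡ (coeff i M + coeff i (mono b *ₚ P)) + coeff i N
      balance-at i = trans (sym (trans (coeff-+ i (P +ₚ (Q *ₚ M)) _) (cong (_+ coeff i (mono b *ₚ N)) (coeff-+ i P _))))
        (trans (at balance i) (trans (coeff-+ i (M +ₚ (mono b *ₚ P)) N) (cong (_+ coeff i N) (coeff-+ i M _))))

      combine : ∀ {p q n m p′ n′} → (p + q) + n′ ≡ (m + p′) + n → q ≤ m → n′ ≤ p′ → n ≤ p
      combine {p} {q} {n} {m} {p′} {n′} eq q≤m n′≤p′ = +-cancelˡ-≤ (q + n′) n p (begin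
        (q + n′) + n ≤⟨ +-monoˡ-≤ n (+-mono-≤ q≤m n′≤p′) ⟩
        (m + p′) + n ≡⟨ eq ⟨
        (p + q) + n′ ≡⟨ lem p q n′ ⟩
        (q + n′) + p ∎)
        where
        open ≤-Reasoning
        lem : ∀ p q n → (p + q) + n ≡ (q + n) + p
        lem = solve-∀

      combine′ : ∀ {p q n m p′ n′} → (p + q) + n′ ≡ (m + p′) + n → m ≤ q → n ≤ p → n′ ≤ p′
      combine′ {p} {q} {n} {m} {p′} {n′} eq m≤q n≤p = +-cancelˡ-≤ (m + n) n′ p′ (begin
        (m + n) + n′ ≤⟨ +-monoˡ-≤ n′ (+-mono-≤ m≤q n≤p) ⟩
        (q + p) + n′ ≡⟨ cong (_+ n′) (+-comm q p) ⟩
        (p + q) + n′ ≡⟨ eq ⟩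
        (m + p′) + n ≡⟨ lem m p′ n ⟩
        (m + n) + p′ ∎)
        where
        open ≤-Reasoning
        lem : ∀ p q n → (p + q) + n ≡ (p + n) + q
        lem = solve-∀

      QM : ∀ i → coeff (suc i) (Q *ₚ M) ≡ coeff i M
      QM = coeff-mono*-+ 1 M

      lower : ∀ n i → i < n → 2 * i < suc (suc top) → coeff i N ≤ coeff i P
      lower (suc n) i (s≤s i≤n) lt = combine (balance-at i) (rise i lt) shifted
        where
        rise : ∀ i → 2 * i < suc (suc top) → coeff i (Q *ₚ M) ≤ coeff i M
        rise zero lt = ≤-trans (≤-reflexive (coeff-mono*-< 1 M 0 z<s)) z≤n
        rise (suc i) lt = subst (_≤ coeff (suc i) M) (sym (QM i))
          (genG-rises G i (+-cancelˡ-< 2 _ _ (subst (_< 2 + top) (*-suc 2 i) lt)))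
        shifted : coeff i (mono b *ₚ N) ≤ coeff i (mono b *ₚ P)
        shifted with b ≤? i
        ... | no b≰i = ≤-trans (≤-reflexive (coeff-mono*-< b N i (≰⇒> b≰i))) z≤n
        ... | yes b≤i = subst₂ _≤_ (trans (sym (coeff-mono*-+ b N j)) (cong (λ k → coeff k (mono b *ₚ N)) b+j))
                                   (trans (sym (coeff-mono*-+ b P j)) (cong (λ k → coeff k (mono b *ₚ P)) b+j))
            (lower n j (<-≤-trans j<i i≤n) (≤-<-trans (*-monoʳ-≤ 2 (<⇒≤ j<i)) lt))
          where
          j = i ∸ b
          b+j : b + j ≡ i
          b+j = m+[n∸m]≡n b≤i
          j<i : j < i
          j<i = subst (j <_) b+j (m<n+m j 0<b)

      -- The recursion solved for the lower index: the coefficient of `P - N` at `t` is the one at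
      -- `b + t` plus a fall of `M`. Beyond the length of `N` the claim is trivial, and the fuel
      -- bounds the way there.
      upper : ∀ fuel t → length N ≤ t + fuel → suc top < 2 * suc t → coeff t N ≤ coeff t P
      upper zero t le lt = ≤-trans (≤-reflexive (coeff-beyond N t (subst (length N ≤_) (+-identityʳ t) le))) z≤n
      upper (suc fuel) t le lt = subst₂ _≤_ (coeff-mono*-+ b N t) (coeff-mono*-+ b P t)
        (combine′ (balance-at (b + t)) fall (upper fuel (b + t) fuel-ok (≤-trans lt (*-monoʳ-≤ 2 (s≤s (m≤n+m t b))))))
        where
        fuel-ok : length N ≤ b + t + fuel
        fuel-ok = ≤-trans le (≤-trans (≤-reflexive (+-suc t fuel)) (+-monoˡ-≤ fuel (m<n+m t 0<b)))
        fall : coeff (b + t) M ≤ coeff (b + t) (Q *ₚ M)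
        fall with b + t in eq
        ... | zero = ⊥-elim (<⇒≢ (≤-trans 0<b (m≤m+n b t)) (sym eq))
        ... | suc j = subst (coeff (suc j) M ≤_) (sym (QM j)) (genG-falls G j
                (≤-trans (≤-trans (n≤1+n _) lt) (*-monoʳ-≤ 2 (subst (suc t ≤_) eq (m<n+m t 0<b)))))

    quotient-nonneg : ∀ i → coeff i N ≤ coeff i P
    quotient-nonneg i with suc top <? 2 * suc i
    ... | yes lt = upper (length N) i (m≤n+m (length N) i) lt
    ... | no ≮ = lower (suc i) i ≤-refl (≤-<-trans (+-cancelˡ-≤ 2 _ _ (subst (_≤ 2 + top) (*-suc 2 i) (≤-trans (≮⇒≥ ≮) (n≤1+n _)))) (≤-trans ≤-refl (n≤1+n _)))

    quotient : ∃ λ X → X *ₚ qint b ≋ M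
    quotient = X , +ₚ-cancelʳ (N *ₚ qint b) (begin
      (X *ₚ qint b) +ₚ (N *ₚ qint b)   ≈⟨ *ₚ-distribʳ (qint b) X N ⟨
      (X +ₚ N) *ₚ qint b               ≈⟨ *ₚ-cong X+N ≋-refl ⟩
      P *ₚ qint b                      ≈⟨ e ⟩
      (N *ₚ qint b) +ₚ (qint 1 *ₚ M)   ≈⟨ +ₚ-cong (≋-refl {N *ₚ qint b}) (qint-1 M) ⟩
      (N *ₚ qint b) +ₚ M               ≈⟨ +ₚ-comm (N *ₚ qint b) M ⟩
      M +ₚ (N *ₚ qint b)               ∎)
      where
      open PR
      X = P −ₚ N
      X+N : X +ₚ N ≋ P
      X+N = mk λ i → trans (coeff-+ i X N) (trans (cong (_+ coeff i N) (coeff-−ₚ i P N)) (m∸n+n≡m (quotient-nonneg i)))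

  sum-tabulate-mono : ∀ {n} (f g : Fin n → ℕ) → (∀ t → f t ≤ g t) → Vec.sum (tabulate f) ≤ Vec.sum (tabulate g)
  sum-tabulate-mono {zero} f g le = z≤n
  sum-tabulate-mono {suc n} f g le = +-mono-≤ (le zero) (sum-tabulate-mono (f ∘ suc) (g ∘ suc) (le ∘ suc))

  sum≤weighted : ∀ {a} (r : Vec ℕ a) → Vec.sum r ≤ Vec.sum (tabulate (λ (t : Fin a) → suc (toℕ t) * lookup r t))
  sum≤weighted r = subst (_≤ Vec.sum (tabulate (λ t → suc (toℕ t) * lookup r t))) (cong Vec.sum (Vec.tabulate∘lookup r))
    (sum-tabulate-mono (lookup r) _ (λ t → m≤m+n (lookup r t) (toℕ t * lookup r t)))

  sum-toList : ∀ {n} (r : Vec ℕ n) → sum (Vec.toList r) ≡ Vec.sum r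
  sum-toList [] = refl
  sum-toList (x ∷ r) = cong (x +_) (sum-toList r)

  lookup∈toList : ∀ {n} (r : Vec ℕ n) t → lookup r t ∈ Vec.toList r
  lookup∈toList (x ∷ r) zero = here refl
  lookup∈toList (x ∷ r) (suc t) = there (lookup∈toList r t)

  krewDen-qfacts : ∀ {a} b (r : Vec ℕ a) → krewDen b r ≋ qfacts ((b ∸ Vec.sum r) ∷ Vec.toList r)
  krewDen-qfacts b r = ≋-trans (*ₚ-comm (prodₚ (Vec.toList (Vec.map qfact r))) (qfact (b ∸ Vec.sum r)))
    (*ₚ-congʳ (qfact (b ∸ Vec.sum r)) (subst (λ l → prodₚ l ≋ qfacts (Vec.toList r)) (sym (Vec.toList-map qfact r)) ≋-refl))

  -- With the extra part `b - k` the parts add up to `b`. Each `[r_i] M` is divisible by `[b]`,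
  -- hence so is `[a] M` as `a` is the sum of the `i r_i`, and by coprimality so is `M`. Dividing
  -- `M` by `[b]` turns `[b]!` into `[b-1]!`.
  krew : ∀ a m → a ≤ m → Coprime a (suc m) → (r : Vec ℕ a) →
    Vec.sum (tabulate (λ (t : Fin a) → suc (toℕ t) * lookup r t)) ≡ a →
    ∃ λ X → X *ₚ krewDen (suc m) r ≋ krewNum (suc m)
  krew a m a≤m cop r weighted = X , *ₚ-cancelˡ (qint b) refl (begin
      qint b *ₚ (X *ₚ krewDen b r)     ≈⟨ *ₚ-congʳ (qint b) (*ₚ-congʳ X (krewDen-qfacts b r)) ⟩
      qint b *ₚ (X *ₚ qfacts cs)       ≈⟨ PS.solve 3 (λ b x f → b :* (x :* f) := (x :* b) :* f) ≋-refl (qint b) X (qfacts cs) ⟩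
      (X *ₚ qint b) *ₚ qfacts cs       ≈⟨ *ₚ-cong (proj₂ quot) ≋-refl ⟩
      qmultinomial cs *ₚ qfacts cs     ≈⟨ qmultinomial-fact cs ⟩
      qfact (sum cs)                   ≡⟨ cong qfact sum-cs ⟩
      qint b *ₚ krewNum b              ∎)
    where
    open PR
    b = suc m
    cs = (b ∸ Vec.sum r) ∷ Vec.toList r
    k≤b : Vec.sum r ≤ b
    k≤b = ≤-trans (sum≤weighted r) (≤-trans (≤-reflexive weighted) (≤-trans a≤m (n≤1+n m)))
    sum-cs : sum cs ≡ b
    sum-cs = trans (cong (b ∸ Vec.sum r +_) (sum-toList r)) (m∸n+n≡m k≤b)
    div : Divides b (qmultinomial cs) 1
    div = divides-1 cop (subst (Divides b (qmultinomial cs)) weighted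
      (divides-sum _ (λ t → divides-* (suc (toℕ t)) (divides-part sum-cs (there (lookup∈toList r t))))))
    quot = quotient (multi cs) z<s (Divides.P div) (Divides.N div) (Divides.eq div)
    X = proj₁ quot

-- Values at roots of unity.

module Evaluation where

  open import Defs hiding (N; E)
  open Polynomial
  open QMultinomial using (mono; qint-+; qfacts)
  open import Level using (0ℓ)
  open import Data.Nat as ℕ using (ℕ; zero; suc; _≤_; _<_; z≤n; s≤s; z<s; NonZero; _!)
  import Data.Nat.Properties as ℕ
  open import Data.Nat.DivMod using (_/_; _%_; m%n<n; m≡m%n+[m/n]*n)
  open import Data.Nat.ListAction using (sum; product)
  open import Data.List using (List; []; _∷_; map)
  open import Data.Product using (proj₁; proj₂)
  open import Data.Sum using (inj₁; inj₂)
  open import Data.Empty using (⊥-elim)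
  open import Function using (_∘_)
  open import Relation.Nullary using (¬_)
  import Relation.Binary.PropositionalEquality as ≡
  open ≡ using (_≡_)
  open import Algebra.Bundles using (CommutativeRing)
  import Relation.Binary.Reasoning.Setoid as SetoidReasoning
  import Algebra.Solver.Ring.NaturalCoefficients.Default as NatSolver
  import Algebra.Properties.Ring as RingProps
  import Algebra.Solver.Ring.NaturalCoefficients.Default polySemiring as PS

  powₚ : Poly → ℕ → Poly
  powₚ p zero = 1ₚ
  powₚ p (suc t) = p *ₚ powₚ p t

  powₚ-+ : ∀ p s t → powₚ p (s ℕ.+ t) ≋ powₚ p s *ₚ powₚ p t
  powₚ-+ p zero t = ≋-sym (*ₚ-identityˡ (powₚ p t))
  powₚ-+ p (suc s) t = ≋-trans (*ₚ-congʳ p (powₚ-+ p s t)) (≋-sym (*ₚ-assoc p (powₚ p s) (powₚ p t)))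

  coeff0-powₚ : ∀ p t → coeff 0 p ≡ 1 → coeff 0 (powₚ p t) ≡ 1
  coeff0-powₚ p zero e = ≡.refl
  coeff0-powₚ p (suc t) e = ≡.trans (coeff0-* p (powₚ p t)) (≡.cong₂ ℕ._*_ e (coeff0-powₚ p t e))

  -- The q-integer `[t]` in the variable `q^n`.
  qintAt : ℕ → ℕ → Poly
  qintAt n zero = []
  qintAt n (suc t) = 1ₚ +ₚ (mono n *ₚ qintAt n t)

  qint-* : ∀ n t → qint (t ℕ.* n) ≋ qint n *ₚ qintAt n t
  qint-* n zero = ≋-sym (*ₚ-zeroʳ (qint n))
  qint-* n (suc t) = begin
    qint (n ℕ.+ t ℕ.* n)                           ≈⟨ qint-+ n (t ℕ.* n) ⟩
    qint n +ₚ (mono n *ₚ qint (t ℕ.* n))           ≈⟨ +ₚ-cong (≋-sym (*ₚ-identityʳ (qint n))) (*ₚ-congʳ (mono n) (qint-* n t)) ⟩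
    (qint n *ₚ 1ₚ) +ₚ (mono n *ₚ (qint n *ₚ qintAt n t))
      ≈⟨ PS.solve 4 (λ q u m s → q PS.:* u PS.:+ m PS.:* (q PS.:* s) PS.:= q PS.:* (u PS.:+ m PS.:* s)) ≋-refl (qint n) 1ₚ (mono n) (qintAt n t) ⟩
    qint n *ₚ (1ₚ +ₚ (mono n *ₚ qintAt n t)) ∎
    where open PR

  facts : List ℕ → ℕ
  facts cs = product (map _! cs)

  module Eval (R : CommutativeRing 0ℓ 0ℓ) where
    open CommutativeRing R
    open RingEval R public
    open SetoidReasoning setoid
    open NatSolver commutativeSemiring using (solve; _:+_; _:*_; _:=_; con)

    ι-+ : ∀ m n → ιℕ (m ℕ.+ n) ≈ ιℕ m + ιℕ n
    ι-+ zero n = sym (+-identityˡ (ιℕ n))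
    ι-+ (suc m) n = trans (+-congˡ (ι-+ m n)) (sym (+-assoc 1# (ιℕ m) (ιℕ n)))

    ι-* : ∀ m n → ιℕ (m ℕ.* n) ≈ ιℕ m * ιℕ n
    ι-* zero n = sym (zeroˡ (ιℕ n))
    ι-* (suc m) n = trans (ι-+ n (m ℕ.* n)) (trans (+-cong (sym (*-identityˡ (ιℕ n))) (ι-* m n)) (sym (distribʳ (ιℕ n) 1# (ιℕ m))))

    eval-0 : ∀ p x → (∀ i → coeff i p ≡ 0) → eval p x ≈ 0#
    eval-0 [] x e = refl
    eval-0 (c ∷ p) x e = trans (+-cong (reflexive (≡.cong ιℕ (e 0))) (trans (*-congˡ (eval-0 p x (e ∘ suc))) (zeroʳ x))) (+-identityˡ 0#)

    eval-cong : ∀ {p q} x → p ≋ q → eval p x ≈ eval q x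
    eval-cong {[]} {q} x e = sym (eval-0 q x (λ i → ≡.sym (at e i)))
    eval-cong {c ∷ p} {[]} x e = eval-0 (c ∷ p) x (at e)
    eval-cong {c ∷ p} {d ∷ q} x e = +-cong (reflexive (≡.cong ιℕ (at e 0))) (*-congˡ (eval-cong {p} {q} x (mk λ i → at e (suc i))))

    eval-+ : ∀ p q x → eval (p +ₚ q) x ≈ eval p x + eval q x
    eval-+ [] q x = sym (+-identityˡ _)
    eval-+ (c ∷ p) [] x = sym (+-identityʳ _)
    eval-+ (c ∷ p) (d ∷ q) x = begin
      ιℕ (c ℕ.+ d) + x * eval (p +ₚ q) x            ≈⟨ +-cong (ι-+ c d) (*-congˡ (eval-+ p q x)) ⟩
      ιℕ c + ιℕ d + x * (eval p x + eval q x)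
        ≈⟨ solve 5 (λ c d x p q → (c :+ d) :+ x :* (p :+ q) := (c :+ x :* p) :+ (d :+ x :* q)) refl (ιℕ c) (ιℕ d) x (eval p x) (eval q x) ⟩
      (ιℕ c + x * eval p x) + (ιℕ d + x * eval q x) ∎

    eval-scale : ∀ c p x → eval (scale c p) x ≈ ιℕ c * eval p x
    eval-scale c [] x = sym (zeroʳ (ιℕ c))
    eval-scale c (d ∷ p) x = begin
      ιℕ (c ℕ.* d) + x * eval (scale c p) x    ≈⟨ +-cong (ι-* c d) (*-congˡ (eval-scale c p x)) ⟩
      ιℕ c * ιℕ d + x * (ιℕ c * eval p x)
        ≈⟨ solve 4 (λ c d x p → c :* d :+ x :* (c :* p) := c :* (d :+ x :* p)) refl (ιℕ c) (ιℕ d) x (eval p x) ⟩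
      ιℕ c * (ιℕ d + x * eval p x) ∎

    eval-* : ∀ p q x → eval (p *ₚ q) x ≈ eval p x * eval q x
    eval-* [] q x = sym (zeroˡ _)
    eval-* (c ∷ p) q x = begin
      eval (scale c q +ₚ (0 ∷ (p *ₚ q))) x             ≈⟨ eval-+ (scale c q) (0 ∷ (p *ₚ q)) x ⟩
      eval (scale c q) x + (0# + x * eval (p *ₚ q) x)  ≈⟨ +-cong (eval-scale c q x) (trans (+-identityˡ _) (*-congˡ (eval-* p q x))) ⟩
      ιℕ c * eval q x + x * (eval p x * eval q x)
        ≈⟨ solve 4 (λ c q x p → c :* q :+ x :* (p :* q) := (c :+ x :* p) :* q) refl (ιℕ c) (eval q x) x (eval p x) ⟩
      (ιℕ c + x * eval p x) * eval q x ∎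

    eval-1ₚ : ∀ x → eval 1ₚ x ≈ 1#
    eval-1ₚ x = trans (+-cong (+-identityʳ 1#) (zeroʳ x)) (+-identityʳ 1#)

    eval-mono : ∀ n x → eval (mono n) x ≈ pow x n
    eval-mono zero x = eval-1ₚ x
    eval-mono (suc n) x = trans (+-identityˡ _) (*-congˡ (eval-mono n x))

    eval-powₚ : ∀ p t x → eval (powₚ p t) x ≈ pow (eval p x) t
    eval-powₚ p zero x = eval-1ₚ x
    eval-powₚ p (suc t) x = trans (eval-* p (powₚ p t) x) (*-congˡ (eval-powₚ p t x))

    pow-+ : ∀ x s t → pow x (s ℕ.+ t) ≈ pow x s * pow x t
    pow-+ x zero t = sym (*-identityˡ _)
    pow-+ x (suc s) t = trans (*-congˡ (pow-+ x s t)) (sym (*-assoc x _ _))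

    pow-1# : ∀ t → pow 1# t ≈ 1#
    pow-1# zero = refl
    pow-1# (suc t) = trans (*-identityˡ _) (pow-1# t)

    pow-cong : ∀ {x y} t → x ≈ y → pow x t ≈ pow y t
    pow-cong zero e = refl
    pow-cong (suc t) e = *-cong e (pow-cong t e)

    pow-* : ∀ x s t → pow x (t ℕ.* s) ≈ pow (pow x s) t
    pow-* x s zero = refl
    pow-* x s (suc t) = trans (pow-+ x s (t ℕ.* s)) (*-congˡ (pow-* x s t))

    module _ {x : Carrier} (x≈1 : x ≈ 1#) where
      eval-qint-1 : ∀ n → eval (qint n) x ≈ ιℕ n
      eval-qint-1 zero = refl
      eval-qint-1 (suc n) = +-cong (+-identityʳ 1#) (trans (*-cong x≈1 (eval-qint-1 n)) (*-identityˡ _))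

      eval-qfact-1 : ∀ n → eval (qfact n) x ≈ ιℕ (n !)
      eval-qfact-1 zero = trans (eval-1ₚ x) (sym (+-identityʳ 1#))
      eval-qfact-1 (suc n) = trans (eval-* (qint (suc n)) (qfact n) x)
        (trans (*-cong (eval-qint-1 (suc n)) (eval-qfact-1 n)) (sym (ι-* (suc n) (n !))))

      eval-qfacts-1 : ∀ cs → eval (qfacts cs) x ≈ ιℕ (facts cs)
      eval-qfacts-1 [] = trans (eval-1ₚ x) (sym (+-identityʳ 1#))
      eval-qfacts-1 (c ∷ cs) = trans (eval-* (qfact c) (qfacts cs) x)
        (trans (*-cong (eval-qfact-1 c) (eval-qfacts-1 cs)) (sym (ι-* (c !) (facts cs))))

    module Domain (dom : IsChar0Domain) where
      open RingProps ring using (-‿distribˡ-*)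

      1≉0 : ¬ 1# ≈ 0#
      1≉0 = proj₁ dom

      *-nonzero : ∀ {x y} → ¬ x ≈ 0# → ¬ y ≈ 0# → ¬ x * y ≈ 0#
      *-nonzero {x} {y} x≉0 y≉0 e with proj₁ (proj₂ dom) x y e
      ... | inj₁ x≈0 = x≉0 x≈0
      ... | inj₂ y≈0 = y≉0 y≈0

      pow-nonzero : ∀ {x} t → ¬ x ≈ 0# → ¬ pow x t ≈ 0#
      pow-nonzero zero x≉0 = 1≉0
      pow-nonzero (suc t) x≉0 = *-nonzero x≉0 (pow-nonzero t x≉0)

      ι-nonzero : ∀ n → 0 < n → ¬ ιℕ n ≈ 0#
      ι-nonzero (suc n) _ = proj₂ (proj₂ dom) n

      *-cancelʳ : ∀ {x y z} → ¬ z ≈ 0# → x * z ≈ y * z → x ≈ y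
      *-cancelʳ {x} {y} {z} z≉0 e with proj₁ (proj₂ dom) (x + - y) z (begin
          (x + - y) * z      ≈⟨ distribʳ z x (- y) ⟩
          x * z + - y * z    ≈⟨ +-cong e (sym (-‿distribˡ-* y z)) ⟩
          y * z + - (y * z)  ≈⟨ -‿inverseʳ (y * z) ⟩
          0# ∎)
      ... | inj₂ z≈0 = ⊥-elim (z≉0 z≈0)
      ... | inj₁ d≈0 = begin
          x              ≈⟨ +-identityʳ x ⟨
          x + 0#         ≈⟨ +-congˡ (-‿inverseˡ y) ⟨
          x + (- y + y)  ≈⟨ +-assoc x (- y) y ⟨
          (x + - y) + y  ≈⟨ +-congʳ d≈0 ⟩
          0# + y         ≈⟨ +-identityˡ y ⟩
          y ∎

      facts-pos : ∀ cs → 0 < facts cs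
      facts-pos [] = z<s
      facts-pos (c ∷ cs) = ℕ.*-mono-< (ℕ.1≤n! c) (facts-pos cs)

      module Root (n : ℕ) .{{_ : NonZero n}} (1<n : 1 < n) (ω : Carrier) (ωⁿ : pow ω n ≈ 1#)
                  (ωʲ : ∀ j → 0 < j → j < n → ¬ pow ω j ≈ 1#) where

        ev : Poly → Carrier
        ev p = eval p ω

        -- The identity `(1 - ω)[s] = 1 - ω^s` without subtraction. It shows both that `[s]` is
        -- nonzero for `0 < s < n` and that `[n]` vanishes.
        two-ways : ∀ s → 1# + ω * ev (qint s) ≈ ev (qint s) + pow ω s
        two-ways s = begin
          1# + ω * ev (qint s)                  ≈⟨ +-congʳ (+-identityʳ 1#) ⟨
          ev (qint (suc s))                     ≡⟨ ≡.cong (ev ∘ qint) (ℕ.+-comm 1 s) ⟩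
          ev (qint (s ℕ.+ 1))                   ≈⟨ eval-cong ω (qint-+ s 1) ⟩
          ev (qint s +ₚ (mono s *ₚ qint 1))     ≈⟨ eval-+ (qint s) _ ω ⟩
          ev (qint s) + ev (mono s *ₚ qint 1)   ≈⟨ +-congˡ (eval-cong ω (*ₚ-identityʳ (mono s))) ⟩
          ev (qint s) + ev (mono s)             ≈⟨ +-congˡ (eval-mono s ω) ⟩
          ev (qint s) + pow ω s                 ∎

        qint-nonzero : ∀ s → 0 < s → s < n → ¬ ev (qint s) ≈ 0#
        qint-nonzero s 0<s s<n e = ωʲ s 0<s s<n (begin
          pow ω s                  ≈⟨ +-identityˡ _ ⟨
          0# + pow ω s             ≈⟨ +-congʳ e ⟨
          ev (qint s) + pow ω s    ≈⟨ two-ways s ⟨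
          1# + ω * ev (qint s)     ≈⟨ +-congˡ (trans (*-congˡ e) (zeroʳ ω)) ⟩
          1# + 0#                  ≈⟨ +-identityʳ 1# ⟩
          1# ∎)

        qfact-nonzero : ∀ s → s < n → ¬ ev (qfact s) ≈ 0#
        qfact-nonzero zero _ e = 1≉0 (trans (sym (eval-1ₚ ω)) e)
        qfact-nonzero (suc s) lt e = *-nonzero (qint-nonzero (suc s) z<s lt) (qfact-nonzero s (ℕ.<-trans ℕ.≤-refl lt))
          (trans (sym (eval-* (qint (suc s)) (qfact s) ω)) e)

        qint-n : ev (qint n) ≈ 0#
        qint-n = *-cancelʳ′ (begin
          ω * q + 1#   ≈⟨ +-comm _ _ ⟩
          1# + ω * q   ≈⟨ two-ways n ⟩
          q + pow ω n  ≈⟨ +-congˡ ωⁿ ⟩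
          q + 1# ∎)
          where
          q = ev (qint n)
          ω≉1 : ¬ ω ≈ 1#
          ω≉1 e = ωʲ 1 z<s 1<n (trans (*-identityʳ ω) e)
          *-cancelʳ′ : ω * q + 1# ≈ q + 1# → q ≈ 0#
          *-cancelʳ′ e with proj₁ (proj₂ dom) (ω + - 1#) q (begin
              (ω + - 1#) * q                     ≈⟨ distribʳ q ω (- 1#) ⟩
              ω * q + - 1# * q                   ≈⟨ +-congʳ (trans (sym (+-identityʳ _)) (trans (+-congˡ (sym (-‿inverseʳ 1#))) (sym (+-assoc _ _ _)))) ⟩
              ((ω * q + 1#) + - 1#) + - 1# * q   ≈⟨ +-congʳ (+-congʳ e) ⟩
              ((q + 1#) + - 1#) + - 1# * q       ≈⟨ +-congʳ (trans (+-assoc _ _ _) (trans (+-congˡ (-‿inverseʳ 1#)) (+-identityʳ q))) ⟩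
              q + - 1# * q                       ≈⟨ +-cong (*-identityˡ q) (-‿distribˡ-* 1# q) ⟨
              1# * q + - (1# * q)                ≈⟨ -‿inverseʳ _ ⟩
              0# ∎)
          ... | inj₂ q≈0 = q≈0
          ... | inj₁ d≈0 = ⊥-elim (ω≉1 (begin
              ω                  ≈⟨ +-identityʳ ω ⟨
              ω + 0#             ≈⟨ +-congˡ (-‿inverseˡ 1#) ⟨
              ω + (- 1# + 1#)    ≈⟨ +-assoc ω (- 1#) 1# ⟨
              (ω + - 1#) + 1#    ≈⟨ +-congʳ d≈0 ⟩
              0# + 1#            ≈⟨ +-identityˡ 1# ⟩
              1# ∎))

        qint-mod : ∀ s t → ev (qint (s ℕ.+ t ℕ.* n)) ≈ ev (qint s)
        qint-mod s t = begin
          ev (qint (s ℕ.+ t ℕ.* n))                       ≈⟨ eval-cong ω (qint-+ s (t ℕ.* n)) ⟩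
          ev (qint s +ₚ (mono s *ₚ qint (t ℕ.* n)))       ≈⟨ eval-+ (qint s) _ ω ⟩
          ev (qint s) + ev (mono s *ₚ qint (t ℕ.* n))     ≈⟨ +-congˡ (eval-* (mono s) (qint (t ℕ.* n)) ω) ⟩
          ev (qint s) + ev (mono s) * ev (qint (t ℕ.* n)) ≈⟨ +-congˡ (*-congˡ (trans (eval-cong ω (qint-* n t)) (eval-* (qint n) _ ω))) ⟩
          ev (qint s) + ev (mono s) * (ev (qint n) * ev (qintAt n t))
            ≈⟨ +-congˡ (trans (*-congˡ (trans (*-congʳ qint-n) (zeroˡ _))) (zeroʳ _)) ⟩
          ev (qint s) + 0#                                ≈⟨ +-identityʳ _ ⟩
          ev (qint s) ∎

        ev-qintAt : ∀ t → ev (qintAt n t) ≈ ιℕ t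
        ev-qintAt zero = refl
        ev-qintAt (suc t) = begin
          ev (1ₚ +ₚ (mono n *ₚ qintAt n t))        ≈⟨ eval-+ 1ₚ (mono n *ₚ qintAt n t) ω ⟩
          ev 1ₚ + ev (mono n *ₚ qintAt n t)        ≈⟨ +-cong (eval-1ₚ ω) (eval-* (mono n) (qintAt n t) ω) ⟩
          1# + ev (mono n) * ev (qintAt n t)       ≈⟨ +-congˡ (*-cong (trans (eval-mono n ω) ωⁿ) (ev-qintAt t)) ⟩
          1# + 1# * ιℕ t                           ≈⟨ +-congˡ (*-identityˡ _) ⟩
          1# + ιℕ t ∎

        -- The value of a full run of factors strictly between two consecutive multiples of `n`. It
        -- is nonzero and later cancels, occurring to the same power on both sides.
        U : Carrier
        U = ev (qfact (n ℕ.∸ 1))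

        -- The factors `[n]` vanish at `ω`, so they are split off as polynomials before the
        -- evaluation. In the value of the cofactor, `T` collects the multiples of `n`, `U` the full
        -- runs between them, and `S` the incomplete run at the end.
        record Factored (P : Poly) (t T : ℕ) (S : Poly) : Set where
          constructor factored
          field
            F     : Poly
            split : P ≋ powₚ (qint n) t *ₚ F
            value : ev F ≈ (ιℕ T * pow U t) * ev S

        -- The factor `[i n]` is `[n]` times a polynomial of value `i`, and `[s + t n]` has the
        -- value of `[s]`. The induction runs through the factors of the q-factorial, with a
        -- multiple of `n` wherever `s` is zero and `t` is not.
        factor-qfact : ∀ t s → s < n → Factored (qfact (s ℕ.+ t ℕ.* n)) t (t !) (qfact s)
        factor-qfact zero zero lt = factored 1ₚ (≋-sym (*ₚ-identityˡ 1ₚ))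
          (trans (sym (*-identityˡ _)) (*-congʳ (sym (trans (*-identityʳ _) (+-identityʳ 1#)))))
        factor-qfact t (suc s) lt with factor-qfact t s (ℕ.<-trans ℕ.≤-refl lt)
        ... | factored F e v = factored (q *ₚ F)
          (≋-trans (*ₚ-congʳ q e) (PS.solve 3 (λ q p f → q PS.:* (p PS.:* f) PS.:= p PS.:* (q PS.:* f)) ≋-refl q (powₚ (qint n) t) F))
          (begin
            ev (q *ₚ F)                                    ≈⟨ eval-* q F ω ⟩
            ev q * ev F                                    ≈⟨ *-cong (qint-mod (suc s) t) v ⟩
            ev (qint (suc s)) * (c * ev (qfact s))         ≈⟨ solve 3 (λ x y z → x :* (y :* z) := y :* (x :* z)) refl _ _ _ ⟩
            c * (ev (qint (suc s)) * ev (qfact s))         ≈⟨ *-congˡ (eval-* (qint (suc s)) (qfact s) ω) ⟨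
            c * ev (qfact (suc s)) ∎)
          where
          q = qint (suc s ℕ.+ t ℕ.* n)
          c = ιℕ (t !) * pow U t
        factor-qfact (suc t) zero lt with factor-qfact t (n ℕ.∸ 1) (ℕ.≤-reflexive n-1)
          where
          n-1 : suc (n ℕ.∸ 1) ≡ n
          n-1 = ℕ.m+[n∸m]≡n (ℕ.<⇒≤ 1<n)
        ... | factored F e v = factored (qintAt n (suc t) *ₚ F)
          (≋-trans top
            (≋-trans (*ₚ-cong (qint-* n (suc t)) e)
            (PS.solve 4 (λ q a p f → (q PS.:* a) PS.:* (p PS.:* f) PS.:= (q PS.:* p) PS.:* (a PS.:* f)) ≋-refl (qint n) (qintAt n (suc t)) (powₚ (qint n) t) F)))
          (begin
            ev (qintAt n (suc t) *ₚ F)                         ≈⟨ eval-* (qintAt n (suc t)) F ω ⟩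
            ev (qintAt n (suc t)) * ev F                       ≈⟨ *-cong (ev-qintAt (suc t)) v ⟩
            ιℕ (suc t) * ((ιℕ (t !) * pow U t) * U)            ≈⟨ solve 4 (λ a b c d → a :* ((b :* c) :* d) := (a :* b) :* (d :* c)) refl _ _ _ _ ⟩
            (ιℕ (suc t) * ιℕ (t !)) * (U * pow U t)            ≈⟨ *-congʳ (ι-* (suc t) (t !)) ⟨
            ιℕ (suc t !) * (U * pow U t)                       ≈⟨ trans (*-congˡ (eval-1ₚ ω)) (*-identityʳ _) ⟨
            (ιℕ (suc t !) * pow U (suc t)) * ev (qfact 0) ∎)
          where
          N = n ℕ.∸ 1 ℕ.+ t ℕ.* n
          sN : suc t ℕ.* n ≡ suc N
          sN = ≡.cong (ℕ._+ t ℕ.* n) (≡.sym (ℕ.m+[n∸m]≡n (ℕ.<⇒≤ 1<n)))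
          top : qfact (suc t ℕ.* n) ≋ qint (suc t ℕ.* n) *ₚ qfact N
          top = ≡.subst (λ M → qfact M ≋ qint M *ₚ qfact N) (≡.sym sN) ≋-refl

        quots rems : List ℕ → List ℕ
        quots = map (_/ n)
        rems = map (_% n)

        factor-qfacts : ∀ cs → Factored (qfacts cs) (sum (quots cs)) (facts (quots cs)) (qfacts (rems cs))
        factor-qfacts [] = factored 1ₚ (≋-sym (*ₚ-identityˡ 1ₚ))
          (trans (sym (*-identityˡ _)) (*-congʳ (sym (trans (*-identityʳ _) (+-identityʳ 1#)))))
        factor-qfacts (c ∷ cs) with factor-qfact (c / n) (c % n) (m%n<n c n) | factor-qfacts cs
        ... | factored F e v | factored F′ e′ v′ = factored (F *ₚ F′)
          (≋-trans (*ₚ-cong (≡.subst (λ x → qfact x ≋ powₚ (qint n) (c / n) *ₚ F) (≡.sym (m≡m%n+[m/n]*n c n)) e) e′)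
            (≋-trans (PS.solve 4 (λ p f p′ f′ → (p PS.:* f) PS.:* (p′ PS.:* f′) PS.:= (p PS.:* p′) PS.:* (f PS.:* f′))
                       ≋-refl (powₚ (qint n) (c / n)) F (powₚ (qint n) (sum (quots cs))) F′)
                     (*ₚ-cong (≋-sym (powₚ-+ (qint n) (c / n) (sum (quots cs)))) ≋-refl)))
          (begin
            ev (F *ₚ F′)              ≈⟨ eval-* F F′ ω ⟩
            ev F * ev F′              ≈⟨ *-cong v v′ ⟩
            ((ιℕ ((c / n) !) * pow U (c / n)) * ev (qfact (c % n))) * ((ιℕ (facts (quots cs)) * pow U (sum (quots cs))) * ev (qfacts (rems cs)))
              ≈⟨ solve 6 (λ a b c a′ b′ c′ → ((a :* b) :* c) :* ((a′ :* b′) :* c′) := ((a :* a′) :* (b :* b′)) :* (c :* c′)) refl _ _ _ _ _ _ ⟩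
            ((ιℕ ((c / n) !) * ιℕ (facts (quots cs))) * (pow U (c / n) * pow U (sum (quots cs)))) * (ev (qfact (c % n)) * ev (qfacts (rems cs)))
              ≈⟨ *-cong (*-cong (ι-* ((c / n) !) (facts (quots cs))) (pow-+ U (c / n) (sum (quots cs)))) (eval-* (qfact (c % n)) (qfacts (rems cs)) ω) ⟨
            (ιℕ (facts (quots (c ∷ cs))) * pow U (sum (quots (c ∷ cs)))) * ev (qfacts (rems (c ∷ cs))) ∎)

        rems-nonzero : ∀ cs → ¬ ev (qfacts (rems cs)) ≈ 0#
        rems-nonzero [] e = 1≉0 (trans (sym (eval-1ₚ ω)) e)
        rems-nonzero (c ∷ cs) e = *-nonzero (qfact-nonzero (c % n) (m%n<n c n)) (rems-nonzero cs)
          (trans (sym (eval-* (qfact (c % n)) (qfacts (rems cs)) ω)) e)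

        rems-sum : ∀ cs → sum cs ≡ sum (rems cs) ℕ.+ sum (quots cs) ℕ.* n
        rems-sum [] = ≡.refl
        rems-sum (c ∷ cs) = ≡.trans (≡.cong₂ ℕ._+_ (m≡m%n+[m/n]*n c n) (rems-sum cs))
          (lem (c % n) (c / n) n (sum (rems cs)) (sum (quots cs)))
          where
          open import Data.Nat.Tactic.RingSolver using (solve-∀)
          lem : ∀ a b n c d → a ℕ.+ b ℕ.* n ℕ.+ (c ℕ.+ d ℕ.* n) ≡ a ℕ.+ c ℕ.+ (b ℕ.+ d) ℕ.* n
          lem = solve-∀

        small-qfacts : ∀ cs → sum cs ≤ 1 → ev (qfacts cs) ≈ 1#
        small-qfacts [] le = eval-1ₚ ω
        small-qfacts (zero ∷ cs) le = trans (eval-* 1ₚ (qfacts cs) ω) (trans (*-cong (eval-1ₚ ω) (small-qfacts cs le)) (*-identityˡ 1#))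
        small-qfacts (suc zero ∷ cs) (s≤s le) = trans (eval-* (qint 1 *ₚ 1ₚ) (qfacts cs) ω)
          (trans (*-cong (trans (eval-* (qint 1) 1ₚ ω) (*-cong (eval-1ₚ ω) (eval-1ₚ ω))) (small-qfacts cs (ℕ.≤-trans le z≤n)))
                 (trans (*-congʳ (*-identityˡ 1#)) (*-identityˡ 1#)))
        small-qfacts (suc (suc c) ∷ cs) (s≤s ())

        module _ (g : ℕ) (cs : List ℕ) (sum-cs : sum cs ≡ suc (g ℕ.* n)) (X : Poly)
                 (quot : X *ₚ qfacts cs ≋ qfact (g ℕ.* n)) where
          private
            E = sum (quots cs)
            fc = factor-qfacts cs
            fm = factor-qfact g 0 (ℕ.<-trans z<s 1<n)
            F = Factored.F fc
            Fm = Factored.F fm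

            sums : suc (g ℕ.* n) ≡ sum (rems cs) ℕ.+ E ℕ.* n
            sums = ≡.trans (≡.sym sum-cs) (rems-sum cs)

            -- From `E n ≤ g n + 1 < (g + 1) n`, using `1 < n`.
            E≤g : E ≤ g
            E≤g = ℕ.s≤s⁻¹ (ℕ.*-cancelʳ-< n E (suc g) (ℕ.≤-<-trans
              (ℕ.≤-trans (ℕ.m≤n+m (E ℕ.* n) (sum (rems cs))) (ℕ.≤-reflexive (≡.sym sums)))
              (ℕ.+-monoˡ-< (g ℕ.* n) 1<n)))

            reduced : X *ₚ F ≋ powₚ (qint n) (g ℕ.∸ E) *ₚ Fm
            reduced = *ₚ-cancelˡ (powₚ (qint n) E) (coeff0-powₚ (qint n) E (c0 n 1<n)) (PR.begin
              powₚ (qint n) E *ₚ (X *ₚ F)      PR.≈⟨ PS.solve 3 (λ p x f → p PS.:* (x PS.:* f) PS.:= x PS.:* (p PS.:* f)) ≋-refl (powₚ (qint n) E) X F ⟩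
              X *ₚ (powₚ (qint n) E *ₚ F)      PR.≈⟨ *ₚ-congʳ X (Factored.split fc) ⟨
              X *ₚ qfacts cs                   PR.≈⟨ quot ⟩
              qfact (g ℕ.* n)                  PR.≈⟨ Factored.split fm ⟩
              powₚ (qint n) g *ₚ Fm            PR.≡⟨ ≡.cong (λ x → powₚ (qint n) x *ₚ Fm) (ℕ.m+[n∸m]≡n E≤g) ⟨
              powₚ (qint n) (E ℕ.+ (g ℕ.∸ E)) *ₚ Fm PR.≈⟨ *ₚ-cong (powₚ-+ (qint n) E (g ℕ.∸ E)) ≋-refl ⟩
              (powₚ (qint n) E *ₚ powₚ (qint n) (g ℕ.∸ E)) *ₚ Fm PR.≈⟨ *ₚ-assoc (powₚ (qint n) E) _ Fm ⟩
              powₚ (qint n) E *ₚ (powₚ (qint n) (g ℕ.∸ E) *ₚ Fm) PR.∎)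
              where
              c0 : ∀ n → 1 < n → coeff 0 (qint n) ≡ 1
              c0 (suc n) _ = ≡.refl

            U≉0 : ¬ U ≈ 0#
            U≉0 = qfact-nonzero (n ℕ.∸ 1) (ℕ.≤-reflexive (ℕ.m+[n∸m]≡n (ℕ.<⇒≤ 1<n)))

          -- The numerator has more factors `[n]` than the denominator, and one that survives makes
          -- the value 0.
          value-vanishes : ¬ E ≡ g → ev X ≈ 0#
          value-vanishes E≢g = *-cancelʳ F≉0 (begin
            ev X * ev F                                    ≈⟨ eval-* X F ω ⟨
            ev (X *ₚ F)                                    ≈⟨ eval-cong ω reduced ⟩
            ev (powₚ (qint n) (g ℕ.∸ E) *ₚ Fm)             ≈⟨ eval-* (powₚ (qint n) (g ℕ.∸ E)) Fm ω ⟩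
            ev (powₚ (qint n) (g ℕ.∸ E)) * ev Fm           ≈⟨ *-congʳ (eval-powₚ (qint n) (g ℕ.∸ E) ω) ⟩
            pow (ev (qint n)) (g ℕ.∸ E) * ev Fm            ≈⟨ *-congʳ (vanish (g ℕ.∸ E) (ℕ.m<n⇒0<n∸m (ℕ.≤∧≢⇒< E≤g E≢g))) ⟩
            0# * ev Fm                                     ≈⟨ zeroˡ _ ⟩
            0#                                             ≈⟨ zeroˡ _ ⟨
            0# * ev F ∎)
            where
            vanish : ∀ t → 0 < t → pow (ev (qint n)) t ≈ 0#
            vanish (suc t) _ = trans (*-congʳ qint-n) (zeroˡ _)
            F≉0 : ¬ ev F ≈ 0#
            F≉0 e = *-nonzero (*-nonzero (ι-nonzero _ (facts-pos (quots cs))) (pow-nonzero E U≉0)) (rems-nonzero cs)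
              (trans (sym (Factored.value fc)) e)

          -- All factors `[n]` cancel. The remainders then sum to 1, so their q-factorials are
          -- `[0]!` or `[1]!` and have the value 1.
          value-multinomial : E ≡ g → ev X * ιℕ (facts (quots cs)) ≈ ιℕ (g !)
          value-multinomial E≡g = *-cancelʳ (pow-nonzero g U≉0) (begin
            (ev X * ιℕ (facts (quots cs))) * pow U g
              ≈⟨ *-assoc _ _ _ ⟩
            ev X * (ιℕ (facts (quots cs)) * pow U g)
              ≡⟨ ≡.cong (λ e → ev X * (ιℕ (facts (quots cs)) * pow U e)) (≡.sym E≡g) ⟩
            ev X * (ιℕ (facts (quots cs)) * pow U E)
              ≈⟨ *-congˡ (trans (*-congˡ (small-qfacts (rems cs) rems≤1)) (*-identityʳ _)) ⟨
            ev X * ((ιℕ (facts (quots cs)) * pow U E) * ev (qfacts (rems cs)))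
              ≈⟨ *-congˡ (Factored.value fc) ⟨
            ev X * ev F
              ≈⟨ eval-* X F ω ⟨
            ev (X *ₚ F)
              ≈⟨ eval-cong ω reduced ⟩
            ev (powₚ (qint n) (g ℕ.∸ E) *ₚ Fm)
              ≡⟨ ≡.cong (λ e → ev (powₚ (qint n) e *ₚ Fm)) (≡.trans (≡.cong (g ℕ.∸_) E≡g) (ℕ.n∸n≡0 g)) ⟩
            ev (1ₚ *ₚ Fm)
              ≈⟨ eval-cong ω (*ₚ-identityˡ Fm) ⟩
            ev Fm
              ≈⟨ Factored.value fm ⟩
            (ιℕ (g !) * pow U g) * ev (qfact 0)
              ≈⟨ trans (*-congˡ (eval-1ₚ ω)) (*-identityʳ _) ⟩
            ιℕ (g !) * pow U g ∎)
            where
            rems≤1 : sum (rems cs) ≤ 1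
            rems≤1 = ℕ.≤-reflexive (ℕ.+-cancelʳ-≡ (g ℕ.* n) _ _ (≡.trans (≡.cong (λ e → sum (rems cs) ℕ.+ e ℕ.* n) (≡.sym E≡g)) (≡.sym sums)))

-- Blocks as sets of labels with a common parent, and how parents move under a change of base.

module Parents where

  open import Data.Nat
  open import Data.Nat.Properties
  open import Data.Product using (∃; _×_; _,_)
  open import Data.Sum using (inj₁; inj₂)
  open import Data.Empty using (⊥; ⊥-elim)
  open import Relation.Nullary using (yes; no)
  open import Relation.Binary.PropositionalEquality
  open import Relation.Binary.Definitions using (tri<; tri≈; tri>)

  -- With h the levels b y - a x of the lattice points after the east steps, the laser fired from x is the highest
  -- one passing below label i, so blocks are the sets of labels with the same x.
  record Par (h : ℕ → ℕ) (x i : ℕ) : Set where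
    constructor par
    field
      before  : x < i
      smaller : h x < h i
      between : ∀ k → x < k → k < i → h i ≤ h k
  open Par public

  par-unique : ∀ {h x y i} → Par h x i → Par h y i → x ≡ y
  par-unique {h} {x} {y} {i} p q with <-cmp x y
  ... | tri≈ _ e _ = e
  ... | tri< x<y _ _ = ⊥-elim (<⇒≱ (smaller q) (between p y x<y (before q)))
  ... | tri> _ _ y<x = ⊥-elim (<⇒≱ (smaller p) (between q x y<x (before p)))

  -- Search backwards from the position before `i`; the base vertex 0, being lower than `i`, stops
  -- the search at the latest.
  par-exists : ∀ h i → h 0 < h i → ∃ λ x → Par h x i
  par-exists h zero lt = ⊥-elim (<-irrefl refl lt)
  par-exists h (suc i) lt = search i ≤-refl (λ k i<k k<i → ⊥-elim (<⇒≱ k<i i<k))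
    where
    search : ∀ y → y < suc i → (∀ k → y < k → k < suc i → h (suc i) ≤ h k) → ∃ λ x → Par h x (suc i)
    search y y<i btw with h y <? h (suc i)
    ... | yes hy< = y , par y<i hy< btw
    search zero y<i btw | no ≮ = ⊥-elim (≮ lt)
    search (suc y) y<i btw | no ≮ = search y (<-trans ≤-refl y<i) btw′
      where
      btw′ : ∀ k → y < k → k < suc i → h (suc i) ≤ h k
      btw′ k y<k k<i with m≤n⇒m<n∨m≡n y<k
      ... | inj₁ y+1<k = btw k y+1<k k<i
      ... | inj₂ refl = ≮⇒≥ ≮

  par-child : ∀ {h x i} → Par h x i → Par h x (suc x)
  par-child {h} {x} {i} p with m≤n⇒m<n∨m≡n (before p)
  ... | inj₂ refl = p
  ... | inj₁ x+1<i = par ≤-refl (<-≤-trans (smaller p) (between p (suc x) ≤-refl x+1<i)) (λ k x<k k<x+1 → ⊥-elim (<⇒≱ k<x+1 x<k))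

  par-above : ∀ {h x i} → Par h x i → ∀ k → x < k → k ≤ i → h i ≤ h k
  par-above {h} {x} {i} p k x<k k≤i with m≤n⇒m<n∨m≡n k≤i
  ... | inj₁ k<i = between p k x<k k<i
  ... | inj₂ refl = ≤-refl

  SameBlock : (ℕ → ℕ) → ℕ → ℕ → Set
  SameBlock h i j = ∃ λ x → Par h x i × Par h x j

  -- The levels would satisfy `h y < h j ≤ h i ≤ h y`.
  noncrossing : ∀ {h x y i j} → x < y → y < i → i < j → Par h x i → Par h y j → ⊥
  noncrossing {h} {x} {y} {i} {j} x<y y<i i<j p q =
    <⇒≱ (<-≤-trans (smaller q) (between q i y<i i<j)) (between p y x<y y<i)

  -- Labels of a rotated word, and the positions they come from: the word of length x + p is rotated by x.
  data Moved (x p : ℕ) : ℕ → ℕ → Set where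
    near : ∀ {i} → 0 < i → i ≤ p → Moved x p i (x + i)
    far  : ∀ {j} → 0 < j → j ≤ x → Moved x p (p + j) j

  +-cancel-mono : ∀ {u v u′ v′} c d → u + c ≡ v + d → u′ + c ≡ v′ + d → v ≤ v′ → u ≤ u′
  +-cancel-mono {u} {v} {u′} {v′} c d e e′ le = +-cancelʳ-≤ c u u′ (subst₂ _≤_ (sym e) (sym e′) (+-monoˡ-≤ d le))

  +-cancel-mono-< : ∀ {u v u′ v′} c d → u + c ≡ v + d → u′ + c ≡ v′ + d → v < v′ → u < u′
  +-cancel-mono-< {u} {v} {u′} {v′} c d e e′ le = +-cancelʳ-< c u u′ (subst₂ _<_ (sym e) (sym e′) (+-monoˡ-< d le))

  -- The relation `T` matches old parents with new ones. Asking for `parents` in one direction is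
  -- enough: since `T` is one-to-one and old parents exist, equality of new parents carries back.
  record Transport (h h′ : ℕ → ℕ) (x p : ℕ) : Set₁ where
    field
      T       : ℕ → ℕ → Set
      T-fun   : ∀ {y z z′} → T y z → T y z′ → z ≡ z′
      T-inj   : ∀ {y y′ z} → T y z → T y′ z → y ≡ y′
      parents : ∀ {i j y} → Moved x p i j → Par h y j → ∃ λ z → T y z × Par h′ z i
      child   : ∀ {i j} → Moved x p i j → ∃ λ y → Par h y j

    forward : ∀ {i j i′ j′} → Moved x p i j → Moved x p i′ j′ → SameBlock h j j′ → SameBlock h′ i i′
    forward {i′ = i′} s s′ (y , q , q′) with parents s q | parents s′ q′
    ... | z , t , r | z′ , t′ , r′ = z , r , subst (λ z → Par h′ z i′) (T-fun t′ t) r′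

    backward : ∀ {i j i′ j′} → Moved x p i j → Moved x p i′ j′ → SameBlock h′ i i′ → SameBlock h j j′
    backward {j′ = j′} s s′ (z , r , r′) with child s | child s′
    ... | y , q | y′ , q′ with parents s q | parents s′ q′
    ... | z₁ , t , r₁ | z₂ , t′ , r₂ =
      y , q , subst (λ y → Par h y j′) (T-inj (subst (T y′) (trans (par-unique r₂ r′) (par-unique r r₁)) t′) t) q′

  data T₀ (x p : ℕ) : ℕ → ℕ → Set where
    near : ∀ {z} → z < p → T₀ x p (x + z) z
    far  : ∀ {y} → y < x → T₀ x p y (p + y)

  -- For the move around the base block: the root stays the root. The old vertex `x` and the new
  -- vertex `p` are left out; they carry the letter 0 and are parents of nothing.
  data T₁ (x p : ℕ) : ℕ → ℕ → Set where
    root : T₁ x p 0 0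
    near : ∀ {z} → 0 < z → z < p → T₁ x p (x + z) z
    far  : ∀ {y} → 0 < y → y < x → T₁ x p y (p + y)

  private
    ≥-split : ∀ {x y} → x ≤ y → ∃ λ z → y ≡ x + z
    ≥-split {x} {y} le = y ∸ x , sym (m+[n∸m]≡n le)

    T₀-fun : ∀ {x p y z z′} → T₀ x p y z → T₀ x p y z′ → z ≡ z′
    T₀-fun {x} {p} {y} s t = go s t refl
      where
      go : ∀ {y y′ z z′} → T₀ x p y z → T₀ x p y′ z′ → y ≡ y′ → z ≡ z′
      go (near _) (near _) e = +-cancelˡ-≡ x _ _ e
      go (near _) (far l) refl = ⊥-elim (<⇒≱ l (m≤m+n x _))
      go (far l) (near _) refl = ⊥-elim (<⇒≱ l (m≤m+n x _))
      go (far _) (far _) refl = refl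

    T₀-inj : ∀ {x p y y′ z} → T₀ x p y z → T₀ x p y′ z → y ≡ y′
    T₀-inj {x} {p} s t = go s t refl
      where
      go : ∀ {y y′ z z′} → T₀ x p y z → T₀ x p y′ z′ → z ≡ z′ → y ≡ y′
      go (near _) (near _) refl = refl
      go (near l) (far _) refl = ⊥-elim (<⇒≱ l (m≤m+n p _))
      go (far _) (near l) refl = ⊥-elim (<⇒≱ l (m≤m+n p _))
      go (far _) (far _) e = +-cancelˡ-≡ p _ _ e

    T₁-fun : ∀ {x p y z z′} → T₁ x p y z → T₁ x p y z′ → z ≡ z′
    T₁-fun {x} {p} {y} s t = go s t refl
      where
      go : ∀ {y y′ z z′} → T₁ x p y z → T₁ x p y′ z′ → y ≡ y′ → z ≡ z′
      go root root e = refl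
      go root (near {suc z} _ _) e = ⊥-elim (0≢1+n (trans e (+-suc x z)))
      go root (far () _) refl
      go (near {suc z} _ _) root e = ⊥-elim (0≢1+n (trans (sym e) (+-suc x z)))
      go (near _ _) (near _ _) e = +-cancelˡ-≡ x _ _ e
      go (near _ _) (far _ l) refl = ⊥-elim (<⇒≱ l (m≤m+n x _))
      go (far () _) root refl
      go (far _ l) (near _ _) refl = ⊥-elim (<⇒≱ l (m≤m+n x _))
      go (far _ _) (far _ _) refl = refl

    T₁-inj : ∀ {x p y y′ z} → T₁ x p y z → T₁ x p y′ z → y ≡ y′
    T₁-inj {x} {p} s t = go s t refl
      where
      go : ∀ {y y′ z z′} → T₁ x p y z → T₁ x p y′ z′ → z ≡ z′ → y ≡ y′
      go root root e = refl
      go root (near () _) refl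
      go root (far {suc y} _ _) e = ⊥-elim (0≢1+n (trans e (+-suc p y)))
      go (near () _) root refl
      go (near _ _) (near _ _) refl = refl
      go (near _ l) (far _ _) refl = ⊥-elim (<⇒≱ l (m≤m+n p _))
      go (far {suc y} _ _) root e = ⊥-elim (0≢1+n (trans (sym e) (+-suc p y)))
      go (far _ _) (near _ l) refl = ⊥-elim (<⇒≱ l (m≤m+n p _))
      go (far _ _) (far _ _) e = +-cancelˡ-≡ p _ _ e

  module _ {h h′ : ℕ → ℕ} {x p a : ℕ} (h0 : h 0 ≡ 0) (pos : ∀ i → 0 < i → i ≤ x + p → 0 < h i) where

    private
      child′ : ∀ {i j} → Moved x p i j → ∃ λ y → Par h y j
      child′ (near {i} 0<i i≤p) = par-exists h (x + i) (subst (_< h (x + i)) (sym h0) (pos _ (<-≤-trans 0<i (m≤n+m i x)) (+-monoʳ-≤ x i≤p)))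
      child′ (far {j} 0<j j≤x) = par-exists h j (subst (_< h j) (sym h0) (pos _ 0<j (≤-trans j≤x (m≤m+n x p))))

    -- The levels `h′` are `h` seen from `x`, where the part before `x` is read after a full turn,
    -- which adds `a`. By `spine` no label after `x` has its parent before `x`, so parents stay
    -- inside each of the two parts.
    transport-region : (∀ i → i ≤ p → h′ i + h x ≡ h (x + i)) → (∀ j → j ≤ x → h′ (p + j) + h x ≡ h j + a) →
      (∀ i → 0 < i → i ≤ p → h x < h (x + i)) → Transport h h′ x p
    transport-region nearE farE spine = record { T = T₀ x p ; T-fun = T₀-fun ; T-inj = T₀-inj ; parents = parents′ ; child = child′ }
      where
      nearE′ : ∀ i → i ≤ p → h′ i + h x ≡ h (x + i) + 0
      nearE′ i le = trans (nearE i le) (sym (+-identityʳ _))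
      parents′ : ∀ {i j y} → Moved x p i j → Par h y j → ∃ λ z → T₀ x p y z × Par h′ z i
      parents′ {y = y} (near {i} 0<i i≤p) q with x ≤? y
      ... | no x≰y = ⊥-elim (<⇒≱ (spine i 0<i i≤p) (between q x (≰⇒> x≰y) (m<m+n x 0<i)))
      ... | yes x≤y with ≥-split x≤y
      ...   | z , refl = z , near (<-≤-trans z<i i≤p) , par z<i
                (+-cancel-mono-< (h x) 0 (nearE′ z (≤-trans (<⇒≤ z<i) i≤p)) (nearE′ i i≤p) (smaller q))
                (λ k z<k k<i → +-cancel-mono (h x) 0 (nearE′ i i≤p) (nearE′ k (≤-trans (<⇒≤ k<i) i≤p))
                  (between q (x + k) (+-monoʳ-< x z<k) (+-monoʳ-< x k<i)))
        where
        z<i : z < i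
        z<i = +-cancelˡ-< x z i (before q)
      parents′ {y = y} (far {j} 0<j j≤x) q = p + y , far (<-≤-trans (before q) j≤x) , par (+-monoʳ-< p (before q))
        (+-cancel-mono-< (h x) a (farE y (≤-trans (<⇒≤ (before q)) j≤x)) (farE j j≤x) (smaller q)) btw
        where
        btw : ∀ k → p + y < k → k < p + j → h′ (p + j) ≤ h′ k
        btw k l u with ≥-split (≤-trans (m≤m+n p y) (<⇒≤ l))
        ... | k′ , refl = +-cancel-mono (h x) a (farE j j≤x) (farE k′ (≤-trans (<⇒≤ (+-cancelˡ-< p k′ j u)) j≤x))
                (between q k′ (+-cancelˡ-< p y k′ l) (+-cancelˡ-< p k′ j u))

    -- The constant `e` is `b` times the rank of the base block, by which the new levels are lifted.
    -- Positivity of the new word makes label `suc x` lower than all earlier labels (`central`).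
    -- Hence a parent strictly between 0 and `suc x` has no child past `x`, and only the children of
    -- the root lie on both sides of the cut.
    transport-block : ∀ {e} → (∀ i → 0 < i → i ≤ p → h′ i + h x ≡ h (x + i) + e) → (∀ j → 0 < j → j ≤ x → h′ (p + j) + h x ≡ h j + a) →
      h 1 + a ≡ e → h′ 0 ≡ 0 → (∀ i → 0 < i → i ≤ x + p → 0 < h′ i) → 0 < p → h x ≡ h (suc x) + a → Transport h h′ x p
    transport-block {e} nearE farE h1 h′0 pos′ 0<p drop =
      record { T = T₁ x p ; T-fun = T₁-fun ; T-inj = T₁-inj ; parents = parents′ ; child = child′ }
      where
      central : ∀ t → 0 < t → t ≤ x → h (suc x) < h t
      central t 0<t t≤x = +-cancelʳ-< a _ _ (subst₂ _<_ drop (farE t 0<t t≤x)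
        (m<n+m (h x) (pos′ (p + t) (<-≤-trans 0<t (m≤n+m t p)) (subst (p + t ≤_) (+-comm p x) (+-monoʳ-≤ p t≤x)))))
      parents′ : ∀ {i j y} → Moved x p i j → Par h y j → ∃ λ z → T₁ x p y z × Par h′ z i
      parents′ {y = zero} (near {i} 0<i i≤p) q = 0 , root , par 0<i (subst (_< h′ i) (sym h′0) (pos′ i 0<i (≤-trans i≤p (m≤n+m p x))))
        (λ k 0<k k<i → +-cancel-mono (h x) e (nearE i 0<i i≤p) (nearE k 0<k (≤-trans (<⇒≤ k<i) i≤p))
          (between q (x + k) (<-≤-trans 0<k (m≤n+m k x)) (+-monoʳ-< x k<i)))
      parents′ {y = zero} (far {j} 0<j j≤x) q = 0 , root , par (<-≤-trans 0<j (m≤n+m j p))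
        (subst (_< h′ (p + j)) (sym h′0) (pos′ (p + j) (<-≤-trans 0<j (m≤n+m j p)) (subst (p + j ≤_) (+-comm p x) (+-monoʳ-≤ p j≤x)))) btw
        where
        btw : ∀ k → 0 < k → k < p + j → h′ (p + j) ≤ h′ k
        btw k 0<k k<p+j with k ≤? p
        -- A child of the root is at most as high as label 1, and `h 1 + a = e`; so in the new order
        -- it lies at or below every label of the part now read first.
        ... | yes k≤p = +-cancelʳ-≤ (h x) _ _ (subst₂ _≤_ (sym (farE j 0<j j≤x)) (sym (nearE k 0<k k≤p))
                  (≤-trans (+-monoˡ-≤ a (par-above q 1 z<s 0<j)) (≤-trans (≤-reflexive h1) (m≤n+m e _))))
        ... | no k≰p with ≥-split (<⇒≤ (≰⇒> k≰p))
        ...   | zero , refl = ⊥-elim (k≰p (≤-reflexive (+-identityʳ p)))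
        ...   | suc k′ , refl = +-cancel-mono (h x) a (farE j 0<j j≤x) (farE (suc k′) z<s (≤-trans (<⇒≤ k′<j) j≤x)) (between q (suc k′) z<s k′<j)
          where
          k′<j : suc k′ < j
          k′<j = +-cancelˡ-< p _ _ k<p+j
      parents′ {y = suc y} (near {i} 0<i i≤p) q with suc x ≤? suc y
      ... | no x≰y with i
      ...   | suc zero = ⊥-elim (<-asym (smaller q) (subst (_< h (suc y)) (cong h (sym (+-comm x 1))) (central (suc y) z<s (s≤s⁻¹ (≰⇒> x≰y)))))
      ...   | suc (suc i′) = ⊥-elim (<⇒≱ (<-trans (central (suc y) z<s (s≤s⁻¹ (≰⇒> x≰y))) (smaller q))
                (between q (suc x) (≰⇒> x≰y) (subst (suc x <_) (sym (trans (+-suc x (suc i′)) (cong suc (+-suc x i′)))) (s≤s (s≤s (m≤m+n x i′))))))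
      parents′ {y = suc y} (near {i} 0<i i≤p) q | yes x≤y with ≥-split (≤-trans (n≤1+n x) x≤y)
      ...   | zero , e′ = ⊥-elim (<⇒≱ x≤y (≤-reflexive (trans e′ (+-identityʳ x))))
      ...   | suc z , e′ = suc z , subst (λ y → T₁ x p y (suc z)) (sym e′) (near z<s (<-≤-trans z<i i≤p)) , par z<i
                (+-cancel-mono-< (h x) e (nearE (suc z) z<s (≤-trans (<⇒≤ z<i) i≤p)) (nearE i 0<i i≤p) (subst (λ y → h y < h (x + i)) e′ (smaller q)))
                (λ k z<k k<i → +-cancel-mono (h x) e (nearE i 0<i i≤p) (nearE k (≤-<-trans z≤n z<k) (≤-trans (<⇒≤ k<i) i≤p))
                  (between q (x + k) (subst (_< x + k) (sym e′) (+-monoʳ-< x z<k)) (+-monoʳ-< x k<i)))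
        where
        z<i : suc z < i
        z<i = +-cancelˡ-< x (suc z) i (subst (_< x + i) e′ (before q))
      parents′ {y = suc y} (far {j} 0<j j≤x) q = p + suc y , far z<s (<-≤-trans (before q) j≤x) , par (+-monoʳ-< p (before q))
        (+-cancel-mono-< (h x) a (farE (suc y) z<s (≤-trans (<⇒≤ (before q)) j≤x)) (farE j 0<j j≤x) (smaller q)) btw
        where
        btw : ∀ k → p + suc y < k → k < p + j → h′ (p + j) ≤ h′ k
        btw k l u with ≥-split (≤-trans (m≤m+n p (suc y)) (<⇒≤ l))
        ... | k′ , refl = +-cancel-mono (h x) a (farE j 0<j j≤x) (farE k′ (≤-<-trans z≤n (+-cancelˡ-< p (suc y) k′ l)) (≤-trans (<⇒≤ (+-cancelˡ-< p k′ j u)) j≤x))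
                (between q k′ (+-cancelˡ-< p (suc y) k′ l) (+-cancelˡ-< p k′ j u))

-- Words, windows of periodic words, and the enumeration of words of given content.

module Words where

  open Evaluation using (facts)
  open import Data.Nat
  open import Data.Nat.Properties
  open import Data.Nat.DivMod using (m<n⇒m%n≡m; [m+n]%n≡m%n; m≡m%n+[m/n]*n)
  open import Data.Nat.ListAction using (sum)
  open import Data.Nat.ListAction.Properties using (sum-++)
  open import Data.Nat.Tactic.RingSolver using (solve-∀)
  open import Data.Bool using (if_then_else_)
  open import Data.Fin as Fin using (Fin; zero; suc; toℕ; fromℕ<)
  import Data.Fin.Properties as Fin
  open import Data.List as List using (List; []; _∷_; _++_; map; length; concatMap; allFin)
  open import Data.List.Properties using (∷-injectiveˡ; map-tabulate; length-++; length-map; map-cong)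
  open import Data.List.Membership.Propositional using (_∈_)
  open import Data.List.Membership.Propositional.Properties using (∈-∃++; ∈-++⁺ˡ; ∈-++⁺ʳ; ∈-++⁻; ∈-map⁺; ∈-map⁻; ∈-concat⁺′; ∈-concat⁻′; ∈-allFin)
  open import Data.List.Relation.Unary.Any using (here; there)
  open import Data.List.Relation.Unary.All as All using (All; []; _∷_)
  import Data.List.Relation.Unary.All.Properties as All
  open import Data.List.Relation.Unary.AllPairs as AllPairs using ([]; _∷_)
  import Data.List.Relation.Unary.AllPairs.Properties as AllPairs
  open import Data.List.Relation.Unary.Unique.Propositional using (Unique)
  import Data.List.Relation.Unary.Unique.Propositional.Properties as Unique
  open import Data.List.Relation.Binary.Disjoint.Propositional using (Disjoint)
  open import Data.Vec as Vec using (Vec; []; _∷_; lookup; _[_]≔_)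
  import Data.Vec.Properties as Vec
  open import Data.Product using (∃; _×_; _,_)
  open import Data.Sum using (inj₁; inj₂)
  open import Data.Empty using (⊥-elim)
  open import Function using (_∘_; id)
  open import Relation.Nullary using (¬_; yes; no; does)
  open import Relation.Nullary.Decidable using (dec-true; dec-false)
  open import Relation.Binary.PropositionalEquality

  -- The default 0 past the end agrees with the run 0 that precedes the last east step.
  nth : List ℕ → ℕ → ℕ
  nth [] t = 0
  nth (n ∷ ns) zero = n
  nth (n ∷ ns) (suc t) = nth ns t

  S : List ℕ → ℕ → ℕ
  S ns zero = 0
  S [] (suc i) = 0
  S (n ∷ ns) (suc i) = n + S ns i

  S-suc : ∀ ns i → S ns (suc i) ≡ S ns i + nth ns i
  S-suc [] zero = refl
  S-suc [] (suc i) = refl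
  S-suc (n ∷ ns) zero = +-comm n 0
  S-suc (n ∷ ns) (suc i) = trans (cong (n +_) (S-suc ns i)) (sym (+-assoc n _ _))

  S-length : ∀ ns → S ns (length ns) ≡ sum ns
  S-length [] = refl
  S-length (n ∷ ns) = cong (n +_) (S-length ns)

  S-++ˡ : ∀ us vs i → i ≤ length us → S (us ++ vs) i ≡ S us i
  S-++ˡ us vs zero le = refl
  S-++ˡ (u ∷ us) vs (suc i) (s≤s le) = cong (u +_) (S-++ˡ us vs i le)

  S-++ʳ : ∀ us vs i → S (us ++ vs) (length us + i) ≡ sum us + S vs i
  S-++ʳ [] vs i = refl
  S-++ʳ (u ∷ us) vs i = trans (cong (u +_) (S-++ʳ us vs i)) (sym (+-assoc u _ _))

  nth-++ˡ : ∀ us vs i → i < length us → nth (us ++ vs) i ≡ nth us i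
  nth-++ˡ (u ∷ us) vs zero lt = refl
  nth-++ˡ (u ∷ us) vs (suc i) (s≤s lt) = nth-++ˡ us vs i lt

  nth-++ʳ : ∀ us vs i → nth (us ++ vs) (length us + i) ≡ nth vs i
  nth-++ʳ [] vs i = refl
  nth-++ʳ (u ∷ us) vs i = nth-++ʳ us vs i

  nth-ext : ∀ us vs → length us ≡ length vs → (∀ i → i < length us → nth us i ≡ nth vs i) → us ≡ vs
  nth-ext [] [] e f = refl
  nth-ext (u ∷ us) (v ∷ vs) e f = cong₂ _∷_ (f 0 z<s) (nth-ext us vs (suc-injective e) (λ i lt → f (suc i) (s≤s lt)))

  seg : (ℕ → ℕ) → ℕ → ℕ → List ℕ
  seg f v zero = []
  seg f v (suc k) = f v ∷ seg f (suc v) k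

  length-seg : ∀ f v k → length (seg f v k) ≡ k
  length-seg f v zero = refl
  length-seg f v (suc k) = cong suc (length-seg f (suc v) k)

  seg-++ : ∀ f v x p → seg f v (x + p) ≡ seg f v x ++ seg f (v + x) p
  seg-++ f v zero p = cong (λ w → seg f w p) (sym (+-identityʳ v))
  seg-++ f v (suc x) p = cong (f v ∷_) (trans (seg-++ f (suc v) x p) (cong (λ w → seg f (suc v) x ++ seg f w p) (sym (+-suc v x))))

  nth-seg : ∀ f v k i → i < k → nth (seg f v k) i ≡ f (v + i)
  nth-seg f v (suc k) zero lt = cong f (sym (+-identityʳ v))
  nth-seg f v (suc k) (suc i) (s≤s lt) = trans (nth-seg f (suc v) k i lt) (cong f (sym (+-suc v i)))

  seg-cong : ∀ f g v w k → (∀ t → t < k → f (v + t) ≡ g (w + t)) → seg f v k ≡ seg g w k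
  seg-cong f g v w k e = nth-ext _ _ (trans (length-seg f v k) (sym (length-seg g w k)))
    (λ i lt → let i<k = subst (i <_) (length-seg f v k) lt in
      trans (nth-seg f v k i i<k) (trans (e i i<k) (sym (nth-seg g w k i i<k))))

  module _ (g : ℕ) .{{_ : NonZero g}} where
    ext : List ℕ → ℕ → ℕ
    ext ns t = nth ns (t % g)

    ext-periodic : ∀ ns t → ext ns (t + g) ≡ ext ns t
    ext-periodic ns t = cong (nth ns) ([m+n]%n≡m%n t g)

    ext-< : ∀ ns t → t < g → ext ns t ≡ nth ns t
    ext-< ns t lt = cong (nth ns) (m<n⇒m%n≡m lt)

    seg-ext : ∀ ns → length ns ≡ g → seg (ext ns) 0 g ≡ ns
    seg-ext ns e = nth-ext _ _ (trans (length-seg (ext ns) 0 g) (sym e))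
      (λ i lt → let i<g = subst (i <_) (length-seg (ext ns) 0 g) lt in trans (nth-seg (ext ns) 0 g i i<g) (ext-< ns i i<g))

  Periodic : ℕ → (ℕ → ℕ) → Set
  Periodic g f = ∀ t → f (t + g) ≡ f t

  periodic-* : ∀ {g f} → Periodic g f → ∀ k t → f (t + k * g) ≡ f t
  periodic-* {g} {f} P zero t = cong f (+-identityʳ t)
  periodic-* {g} {f} P (suc k) t = trans (cong f (trans (cong (t +_) (+-comm g (k * g))) (sym (+-assoc t (k * g) g)))) (trans (P (t + k * g)) (periodic-* P k t))

  δ : ℕ → ℕ → ℕ
  δ x y = if does (x ≟ y) then 1 else 0

  δ-refl : ∀ x → δ x x ≡ 1
  δ-refl x = cong (if_then 1 else 0) (dec-true (x ≟ x) refl)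

  δ-≢ : ∀ {x y} → ¬ x ≡ y → δ x y ≡ 0
  δ-≢ {x} {y} ne = cong (if_then 1 else 0) (dec-false (x ≟ y) ne)

  cnt : ℕ → List ℕ → ℕ
  cnt x [] = 0
  cnt x (y ∷ ys) = δ x y + cnt x ys

  cnt-++ : ∀ x us vs → cnt x (us ++ vs) ≡ cnt x us + cnt x vs
  cnt-++ x [] vs = refl
  cnt-++ x (u ∷ us) vs = trans (cong (δ x u +_) (cnt-++ x us vs)) (sym (+-assoc (δ x u) _ _))

  cnt-seg-rotate : ∀ {g f} → Periodic g f → ∀ x v → cnt x (seg f v g) ≡ cnt x (seg f 0 g)
  cnt-seg-rotate P x zero = refl
  cnt-seg-rotate {zero} P x (suc v) = refl
  cnt-seg-rotate {suc g} {f} P x (suc v) = trans (step v) (cnt-seg-rotate P x v)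
    where
    step : ∀ v → cnt x (seg f (suc v) (suc g)) ≡ cnt x (seg f v (suc g))
    step v = begin
      cnt x (seg f (suc v) (suc g))                    ≡⟨ cong (λ k → cnt x (seg f (suc v) k)) (+-comm 1 g) ⟩
      cnt x (seg f (suc v) (g + 1))                    ≡⟨ cong (cnt x) (seg-++ f (suc v) g 1) ⟩
      cnt x (seg f (suc v) g ++ f (suc v + g) ∷ [])    ≡⟨ cnt-++ x (seg f (suc v) g) _ ⟩
      cnt x (seg f (suc v) g) + (δ x (f (suc v + g)) + 0) ≡⟨ cong (cnt x (seg f (suc v) g) +_) (trans (+-identityʳ _) (cong (δ x) (trans (cong f (sym (+-suc v g))) (P v)))) ⟩
      cnt x (seg f (suc v) g) + δ x (f v)              ≡⟨ +-comm _ (δ x (f v)) ⟩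
      δ x (f v) + cnt x (seg f (suc v) g)              ∎
      where open ≡-Reasoning

  cnt-seg-* : ∀ {g f} → Periodic g f → ∀ x n v → cnt x (seg f v (n * g)) ≡ n * cnt x (seg f 0 g)
  cnt-seg-* P x zero v = refl
  cnt-seg-* {g} {f} P x (suc n) v = trans (cong (cnt x) (seg-++ f v g (n * g))) (trans (cnt-++ x (seg f v g) _)
    (cong₂ _+_ (cnt-seg-rotate P x v) (cnt-seg-* P x n (v + g))))

  sum-seg-rotate : ∀ {g f} → Periodic g f → ∀ v → sum (seg f v g) ≡ sum (seg f 0 g)
  sum-seg-rotate P zero = refl
  sum-seg-rotate {zero} P (suc v) = refl
  sum-seg-rotate {suc g} {f} P (suc v) = trans (step v) (sum-seg-rotate P v)
    where
    step : ∀ v → sum (seg f (suc v) (suc g)) ≡ sum (seg f v (suc g))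
    step v = begin
      sum (seg f (suc v) (suc g))                    ≡⟨ cong (λ k → sum (seg f (suc v) k)) (+-comm 1 g) ⟩
      sum (seg f (suc v) (g + 1))                    ≡⟨ cong sum (seg-++ f (suc v) g 1) ⟩
      sum (seg f (suc v) g ++ f (suc v + g) ∷ [])    ≡⟨ sum-++ (seg f (suc v) g) _ ⟩
      sum (seg f (suc v) g) + (f (suc v + g) + 0)    ≡⟨ cong (sum (seg f (suc v) g) +_) (trans (+-identityʳ _) (trans (cong f (sym (+-suc v g))) (P v))) ⟩
      sum (seg f (suc v) g) + f v                    ≡⟨ +-comm _ (f v) ⟩
      f v + sum (seg f (suc v) g)                    ∎
      where open ≡-Reasoning

  sum-seg-* : ∀ {g f} → Periodic g f → ∀ n v → sum (seg f v (n * g)) ≡ n * sum (seg f 0 g)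
  sum-seg-* P zero v = refl
  sum-seg-* {g} {f} P (suc n) v = trans (cong sum (seg-++ f v g (n * g))) (trans (sum-++ (seg f v g) _)
    (cong₂ _+_ (sum-seg-rotate P v) (sum-seg-* P n (v + g))))

  -- Arrangements of a multiset, listed by their first letter. The multiplicity of that letter is a
  -- separate argument of `starting` so that it can be matched on while `c` stays intact.
  words : ∀ {A} → ℕ → Vec ℕ A → List (List ℕ)
  starting : ∀ {A} → ℕ → Vec ℕ A → Fin A → ℕ → List (List ℕ)
  words zero c = [] ∷ []
  words {A} (suc N) c = concatMap (λ t → starting N c t (lookup c t)) (allFin A)
  starting N c t zero = []
  starting N c t (suc k) = map (toℕ t ∷_) (words N (c [ t ]≔ k))

  HasContent : ∀ {A} → Vec ℕ A → List ℕ → Set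
  HasContent {A} c ns = All (_< A) ns × (∀ (t : Fin A) → cnt (toℕ t) ns ≡ lookup c t)

  sum-update : ∀ {A} (c : Vec ℕ A) t {k} → lookup c t ≡ suc k → suc (Vec.sum (c [ t ]≔ k)) ≡ Vec.sum c
  sum-update (x ∷ c) zero refl = refl
  sum-update (x ∷ c) (suc t) e = trans (sym (+-suc x _)) (cong (x +_) (sum-update c t e))

  facts-update : ∀ {A} (c : Vec ℕ A) t {k} → lookup c t ≡ suc k → facts (Vec.toList c) ≡ suc k * facts (Vec.toList (c [ t ]≔ k))
  facts-update (x ∷ c) zero {k} refl = *-assoc (suc k) (k !) _
  facts-update (x ∷ c) (suc t) {k} e = trans (cong (x ! *_) (facts-update c t e)) (lem (x !) (suc k) _)
    where
    lem : ∀ x y z → x * (y * z) ≡ y * (x * z)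
    lem = solve-∀

  sum-0 : ∀ {A} (c : Vec ℕ A) → Vec.sum c ≡ 0 → ∀ t → lookup c t ≡ 0
  sum-0 (x ∷ c) e zero = m+n≡0⇒m≡0 x e
  sum-0 (x ∷ c) e (suc t) = sum-0 c (m+n≡0⇒n≡0 x e) t

  content-∷⁺ : ∀ {A} (c : Vec ℕ A) t {k ns} → lookup c t ≡ suc k → HasContent (c [ t ]≔ k) ns → HasContent c (toℕ t ∷ ns)
  content-∷⁺ c t {k} {ns} e (all , co) = Fin.toℕ<n t ∷ all , go
    where
    go : ∀ s → cnt (toℕ s) (toℕ t ∷ ns) ≡ lookup c s
    go s with s Fin.≟ t
    ... | yes refl = trans (cong₂ _+_ (δ-refl (toℕ s)) (trans (co s) (Vec.lookup∘update s c k))) (sym e)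
    ... | no ne = trans (cong₂ _+_ (δ-≢ (ne ∘ Fin.toℕ-injective)) (co s)) (Vec.lookup∘update′ ne c k)

  content-∷⁻ : ∀ {A} (c : Vec ℕ A) t {ns} → HasContent c (toℕ t ∷ ns) → ∃ λ k → lookup c t ≡ suc k × HasContent (c [ t ]≔ k) ns
  content-∷⁻ c t {ns} (_ ∷ all , co) = cnt (toℕ t) ns , sym e , all , go
    where
    e : suc (cnt (toℕ t) ns) ≡ lookup c t
    e = trans (cong (_+ cnt (toℕ t) ns) (sym (δ-refl (toℕ t)))) (co t)
    go : ∀ s → cnt (toℕ s) ns ≡ lookup (c [ t ]≔ cnt (toℕ t) ns) s
    go s with s Fin.≟ t
    ... | yes refl = sym (Vec.lookup∘update s c (cnt (toℕ s) ns))
    ... | no ne = trans (cong (_+ cnt (toℕ s) ns) (sym (δ-≢ (ne ∘ Fin.toℕ-injective)))) (trans (co s) (sym (Vec.lookup∘update′ ne c (cnt (toℕ t) ns))))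

  words-sound : ∀ {A} N (c : Vec ℕ A) → Vec.sum c ≡ N → ∀ {ns} → ns ∈ words N c → length ns ≡ N × HasContent c ns
  words-sound zero c e (here refl) = refl , [] , λ t → sym (sum-0 c e t)
  words-sound {A} (suc N) c e {ns} ns∈ with ∈-concat⁻′ (map (λ t → starting N c t (lookup c t)) (allFin A)) ns∈
  ... | xs , ns∈xs , xs∈ with ∈-map⁻ (λ t → starting N c t (lookup c t)) xs∈
  ...   | t , _ , refl = go (lookup c t) refl ns∈xs
    where
    go : ∀ k → lookup c t ≡ k → ns ∈ starting N c t k → length ns ≡ suc N × HasContent c ns
    go (suc k) et p with ∈-map⁻ (toℕ t ∷_) p
    ... | ns′ , p′ , refl with words-sound N (c [ t ]≔ k) (suc-injective (trans (sum-update c t et) e)) p′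
    ...   | len , co = cong suc len , content-∷⁺ c t et co

  words-complete : ∀ {A} N (c : Vec ℕ A) → ∀ ns → length ns ≡ N → HasContent c ns → ns ∈ words N c
  words-complete zero c [] e co = here refl
  words-complete {A} (suc N) c (x ∷ ns) e co@(x<A ∷ _ , _) = subst (λ y → (y ∷ ns) ∈ words (suc N) c) (Fin.toℕ-fromℕ< x<A) (go (fromℕ< x<A) (subst (λ y → HasContent c (y ∷ ns)) (sym (Fin.toℕ-fromℕ< x<A)) co))
    where
    go : ∀ t → HasContent c (toℕ t ∷ ns) → (toℕ t ∷ ns) ∈ words (suc N) c
    go t co with content-∷⁻ c t co
    ... | k , et , co′ = ∈-concat⁺′ {xss = map (λ t → starting N c t (lookup c t)) (allFin A)}
      (subst (λ z → (toℕ t ∷ ns) ∈ starting N c t z) (sym et) (∈-map⁺ (toℕ t ∷_) (words-complete N (c [ t ]≔ k) ns (suc-injective e) co′)))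
      (∈-map⁺ (λ t → starting N c t (lookup c t)) (∈-allFin t))

  words-unique : ∀ {A} N (c : Vec ℕ A) → Unique (words N c)
  words-unique zero c = [] ∷ []
  words-unique {A} (suc N) c = Unique.concat⁺
    (All.map⁺ (All.universal (λ t → uniq t (lookup c t)) (allFin A)))
    (AllPairs.map⁺ (AllPairs.map (λ {s} {t} s≢t {v} → disj s≢t (lookup c s) (lookup c t) {v}) (Unique.allFin⁺ A)))
    where
    uniq : ∀ t k → Unique (starting N c t k)
    uniq t zero = []
    uniq t (suc k) = Unique.map⁺ (λ { refl → refl }) (words-unique N (c [ t ]≔ k))
    disj : ∀ {s t} → ¬ s ≡ t → ∀ k l → Disjoint (starting N c s k) (starting N c t l)
    disj s≢t (suc k) (suc l) (p , q) with ∈-map⁻ _ p | ∈-map⁻ _ q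
    ... | _ , _ , refl | _ , _ , e = s≢t (Fin.toℕ-injective (∷-injectiveˡ e))

  length-concatMap : ∀ {A B : Set} (f : A → List B) xs → length (concatMap f xs) ≡ sum (map (length ∘ f) xs)
  length-concatMap f [] = refl
  length-concatMap f (x ∷ xs) = trans (length-++ (f x)) (cong (length (f x) +_) (length-concatMap f xs))

  sum-map-*ʳ : ∀ {A : Set} (f : A → ℕ) k xs → sum (map f xs) * k ≡ sum (map (λ x → f x * k) xs)
  sum-map-*ʳ f k [] = refl
  sum-map-*ʳ f k (x ∷ xs) = trans (*-distribʳ-+ k (f x) _) (cong (f x * k +_) (sum-map-*ʳ f k xs))

  sum-lookup : ∀ {A} (c : Vec ℕ A) → sum (map (lookup c) (allFin A)) ≡ Vec.sum c
  sum-lookup {A} c = trans (cong sum (map-tabulate id (lookup c))) (go c)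
    where
    go : ∀ {A} (c : Vec ℕ A) → sum (List.tabulate (lookup c)) ≡ Vec.sum c
    go [] = refl
    go (x ∷ c) = cong (x +_) (go c)

  -- The words with first letter `t`, times the product of the factorials, number
  -- `lookup c t * N !`; summing over `t` gives the factor `suc N`.
  words-count : ∀ {A} N (c : Vec ℕ A) → Vec.sum c ≡ N → length (words N c) * facts (Vec.toList c) ≡ N !
  words-count zero c e = trans (+-identityʳ _) (go c e)
    where
    go : ∀ {A} (c : Vec ℕ A) → Vec.sum c ≡ 0 → facts (Vec.toList c) ≡ 1
    go [] e = refl
    go (zero ∷ c) e = trans (+-identityʳ _) (go c e)
  words-count {A} (suc N) c e = begin
    length (words (suc N) c) * F
      ≡⟨ cong (_* F) (length-concatMap (λ t → starting N c t (lookup c t)) (allFin A)) ⟩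
    sum (map (λ t → length (starting N c t (lookup c t))) (allFin A)) * F
      ≡⟨ sum-map-*ʳ (λ t → length (starting N c t (lookup c t))) F (allFin A) ⟩
    sum (map (λ t → length (starting N c t (lookup c t)) * F) (allFin A))
      ≡⟨ cong sum (map-cong (λ t → term t (lookup c t) refl) (allFin A)) ⟩
    sum (map (λ t → lookup c t * N !) (allFin A))
      ≡⟨ sum-map-*ʳ (lookup c) (N !) (allFin A) ⟨
    sum (map (lookup c) (allFin A)) * N !
      ≡⟨ cong (_* N !) (trans (sum-lookup c) e) ⟩
    suc N * N ! ∎
    where
    open ≡-Reasoning
    F = facts (Vec.toList c)
    lem : ∀ x y z → x * (y * z) ≡ y * (x * z)
    lem = solve-∀
    term : ∀ t k → lookup c t ≡ k → length (starting N c t k) * F ≡ k * N !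
    term t zero et = refl
    term t (suc k) et = begin
      length (map (toℕ t ∷_) W) * F               ≡⟨ cong₂ _*_ (length-map (toℕ t ∷_) W) (facts-update c t et) ⟩
      length W * (suc k * facts (Vec.toList c′))  ≡⟨ lem (length W) (suc k) (facts (Vec.toList c′)) ⟩
      suc k * (length W * facts (Vec.toList c′))  ≡⟨ cong (suc k *_) (words-count N c′ (suc-injective (trans (sum-update c t et) e))) ⟩
      suc k * N ! ∎
      where
      c′ = c [ t ]≔ k
      W = words N c′

  injection-≤ : ∀ {A B : Set} (R : A → B → Set) xs ys → Unique xs →
    (∀ {x} → x ∈ xs → ∃ λ y → y ∈ ys × R x y) → (∀ {x x′ y} → R x y → R x′ y → x ≡ x′) → length xs ≤ length ys
  injection-≤ R [] ys u tot inj = z≤n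
  injection-≤ R (x ∷ xs) ys (x∉ ∷ u) tot inj with tot (here refl)
  ... | y , y∈ , r with ∈-∃++ y∈
  ...   | l , l′ , refl = subst (suc (length xs) ≤_) len (s≤s (injection-≤ R xs (l ++ l′) u tot′ inj))
    where
    len : suc (length (l ++ l′)) ≡ length (l ++ y ∷ l′)
    len = trans (cong suc (length-++ l)) (trans (sym (+-suc (length l) (length l′))) (sym (length-++ l)))
    tot′ : ∀ {x′} → x′ ∈ xs → ∃ λ y′ → y′ ∈ l ++ l′ × R x′ y′
    tot′ {x′} x′∈ with tot (there x′∈)
    ... | y′ , y′∈ , r′ with ∈-++⁻ l y′∈
    ...   | inj₁ p = y′ , ∈-++⁺ˡ p , r′
    ...   | inj₂ (there p) = y′ , ∈-++⁺ʳ l p , r′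
    ...   | inj₂ (here refl) = ⊥-elim (All.lookup x∉ x′∈ (inj r r′))

  -- The bijection is a relation, since the codes used later come from searches and are
  -- characterised by properties rather than computed by a formula.
  bijection-≡ : ∀ {A B : Set} (R : A → B → Set) xs ys → Unique xs → Unique ys →
    (∀ {x} → x ∈ xs → ∃ λ y → y ∈ ys × R x y) → (∀ {y} → y ∈ ys → ∃ λ x → x ∈ xs × R x y) →
    (∀ {x x′ y} → R x y → R x′ y → x ≡ x′) → (∀ {x y y′} → R x y → R x y′ → y ≡ y′) → length xs ≡ length ys
  bijection-≡ R xs ys u u′ tot tot′ inj fun =
    ≤-antisym (injection-≤ R xs ys u tot inj) (injection-≤ (λ y x → R x y) ys xs u′ tot′ fun)

-- Run-length words of Dyck paths and the two moves of the base.

module DyckWords where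

  open Parents
  open Words
  open import Data.Nat
  open import Data.Nat.Properties
  open import Data.Nat.Divisibility using (divides; ∣⇒≤)
  open import Data.Nat.Coprimality as Coprime using (Coprime; coprime-divisor)
  open import Data.Nat.ListAction using (sum)
  open import Data.Nat.ListAction.Properties using (sum-++)
  open import Data.Nat.Tactic.RingSolver using (solve-∀)
  open import Data.List as List using (List; []; _∷_; _++_; length; drop)
  open import Data.List.Properties using (length-++)
  open import Data.Product using (∃)
  open import Data.Sum using (inj₁; inj₂)
  open import Data.Empty using (⊥-elim)
  open import Relation.Nullary using (¬_; yes; no)
  open import Relation.Binary.PropositionalEquality

  S-+ : ∀ ns i d → S ns (i + d) ≡ S ns i + S (drop i ns) d
  S-+ ns zero d = refl
  S-+ [] (suc i) zero = refl
  S-+ [] (suc i) (suc d) = refl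
  S-+ (n ∷ ns) (suc i) d = trans (cong (n +_) (S-+ ns i d)) (sym (+-assoc n _ _))

  module Base (a m : ℕ) (0<a : 0 < a) (a≤m : a ≤ m) (cop : Coprime a (suc m)) where

    b : ℕ
    b = suc m

    h : List ℕ → ℕ → ℕ
    h ns i = b * S ns i ∸ a * i

    -- Words n₁ … n_m of run lengths of a,b-Dyck paths; the last east step is preceded by no north step.
    record DW (ns : List ℕ) : Set where
      field
        len : length ns ≡ m
        tot : sum ns ≡ a
        pos : ∀ i → 0 < i → i ≤ m → a * i < b * S ns i

    -- Otherwise `b` would divide `a d`, hence `d`, which is smaller than `b`. This is how
    -- coprimality turns weak inequalities of levels into strict ones.
    no-tie : ∀ s d → 0 < d → d ≤ m → ¬ b * s ≡ a * d
    no-tie s (suc d) _ d≤m e = <⇒≱ (s≤s d≤m) (∣⇒≤ (coprime-divisor (Coprime.sym cop) (divides s (trans (sym e) (*-comm b s)))))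

    module _ {ns : List ℕ} (D : DW ns) where
      open DW D

      h-eq : ∀ i → i ≤ m → h ns i + a * i ≡ b * S ns i
      h-eq zero _ = trans (cong (λ z → b * 0 ∸ z + z) (*-zeroʳ a)) (+-identityʳ _)
      h-eq (suc i) le = m∸n+n≡m (<⇒≤ (pos (suc i) z<s le))

      h-0 : h ns 0 ≡ 0
      h-0 = trans (cong (_∸ a * 0) (*-zeroʳ b)) (0∸n≡0 (a * 0))

      h-pos : ∀ i → 0 < i → i ≤ m → 0 < h ns i
      h-pos i 0<i le = m<n⇒0<n∸m (pos i 0<i le)

      -- The gain of a full turn through all `m` labels, and the source of the constant `a` wherever
      -- a part of the word is read after a turn.
      h-m : h ns m ≡ a
      h-m = +-cancelʳ-≡ (a * m) _ _ (begin
        h ns m + a * m  ≡⟨ h-eq m ≤-refl ⟩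
        b * S ns m      ≡⟨ cong (b *_) (trans (cong (S ns) (sym len)) (trans (S-length ns) tot)) ⟩
        a + m * a       ≡⟨ cong (a +_) (*-comm m a) ⟩
        a + a * m ∎)
        where open ≡-Reasoning

      h-step : ∀ i → i < m → h ns (suc i) + a ≡ h ns i + b * nth ns i
      h-step i i<m = +-cancelʳ-≡ (a * i) _ _ (begin
        h ns (suc i) + a + a * i        ≡⟨ lem (h ns (suc i)) a i ⟩
        h ns (suc i) + a * suc i        ≡⟨ h-eq (suc i) i<m ⟩
        b * S ns (suc i)                ≡⟨ cong (b *_) (S-suc ns i) ⟩
        b * (S ns i + nth ns i)         ≡⟨ *-distribˡ-+ b (S ns i) _ ⟩
        b * S ns i + b * nth ns i       ≡⟨ cong (_+ b * nth ns i) (h-eq i (<⇒≤ i<m)) ⟨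
        h ns i + a * i + b * nth ns i   ≡⟨ lem′ (h ns i) (a * i) (b * nth ns i) ⟩
        h ns i + b * nth ns i + a * i ∎)
        where
        open ≡-Reasoning
        lem : ∀ h a i → h + a + a * i ≡ h + a * suc i
        lem = solve-∀
        lem′ : ∀ x y z → x + y + z ≡ x + z + y
        lem′ = solve-∀

      h-distinct : ∀ {i j} → i < j → j ≤ m → ¬ h ns i ≡ h ns j
      h-distinct {i} {j} i<j j≤m e = no-tie (S (drop i ns) d) d (m<n⇒0<n∸m i<j) (≤-trans (m∸n≤m j i) j≤m)
        (+-cancelˡ-≡ (h ns i + a * i) _ _ (begin
          h ns i + a * i + b * S (drop i ns) d      ≡⟨ cong (_+ b * S (drop i ns) d) (h-eq i (≤-trans (<⇒≤ i<j) j≤m)) ⟩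
          b * S ns i + b * S (drop i ns) d          ≡⟨ *-distribˡ-+ b (S ns i) _ ⟨
          b * (S ns i + S (drop i ns) d)            ≡⟨ cong (b *_) (S-+ ns i d) ⟨
          b * S ns (i + d)                          ≡⟨ cong (λ k → b * S ns k) i+d ⟩
          b * S ns j                                ≡⟨ h-eq j j≤m ⟨
          h ns j + a * j                            ≡⟨ cong₂ (λ x k → x + a * k) (sym e) (sym i+d) ⟩
          h ns i + a * (i + d)                      ≡⟨ lem (h ns i) a i d ⟩
          h ns i + a * i + a * d ∎))
        where
        open ≡-Reasoning
        d = j ∸ i
        i+d : i + d ≡ j
        i+d = m+[n∸m]≡n (<⇒≤ i<j)
        lem : ∀ h a i d → h + a * (i + d) ≡ h + a * i + a * d
        lem = solve-∀

      -- A positive letter raises the level by at least `b - a`, which is positive.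
      h-rise : ∀ {i} → i < m → 0 < nth ns i → Par (h ns) i (suc i)
      h-rise {i} i<m n>0 = par ≤-refl (+-cancelʳ-< a _ _ (subst (h ns i + a <_) (sym (h-step i i<m))
          (+-monoʳ-< (h ns i) (≤-trans (s≤s a≤m) (≤-trans (≤-reflexive (sym (*-identityʳ b))) (*-monoʳ-≤ b n>0))))))
        (λ k l u → ⊥-elim (<⇒≱ u l))

      h-fall : ∀ {i} → i < m → nth ns i ≡ 0 → h ns (suc i) + a ≡ h ns i
      h-fall {i} i<m e = trans (h-step i i<m) (trans (cong (λ n → h ns i + b * n) e) (trans (cong (h ns i +_) (*-zeroʳ b)) (+-identityʳ _)))

      h-fall-< : ∀ {i} → i < m → nth ns i ≡ 0 → h ns (suc i) < h ns i
      h-fall-< {i} i<m e = subst (h ns (suc i) <_) (h-fall i<m e) (m<m+n _ 0<a)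

      parent : ∀ {i} → 0 < i → i ≤ m → ∃ λ x → Par (h ns) x i
      parent {i} 0<i i≤m = par-exists (h ns) i (subst (_< h ns i) (sym h-0) (h-pos i 0<i i≤m))

      -- The label after a parent is itself a child of it and thus higher, while a letter 0 would
      -- make the level fall.
      par-nth : ∀ {x i} → i ≤ m → Par (h ns) x i → 0 < nth ns x
      par-nth {x} i≤m p with nth ns x in e
      ... | suc _ = z<s
      ... | zero = ⊥-elim (<-asym (smaller (par-child p)) (h-fall-< (<-≤-trans (before p) i≤m) e))

    DW-length : ∀ us vs → DW (us ++ vs) → length us + length vs ≡ m
    DW-length us vs D = trans (sym (length-++ us)) (DW.len D)

    sum-swap : ∀ us vs → sum (vs ++ us) ≡ sum (us ++ vs)
    sum-swap us vs = trans (sum-++ vs us) (trans (+-comm (sum vs) (sum us)) (sym (sum-++ us vs)))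

    length-swap : ∀ (us vs : List ℕ) → length (vs ++ us) ≡ length (us ++ vs)
    length-swap us vs = trans (length-++ vs) (trans (+-comm (length vs) (length us)) (sym (length-++ us)))

    module Region (us vs : List ℕ) (D : DW (us ++ vs)) where
      private
        x = length us
        p = length vs
        H = h (us ++ vs)
        x+p : x + p ≡ m
        x+p = DW-length us vs D
        total : sum us + sum vs ≡ a
        total = trans (sym (sum-++ us vs)) (DW.tot D)
        x≤m : x ≤ m
        x≤m = subst (x ≤_) x+p (m≤m+n x p)
        x+i≤m : ∀ {i} → i ≤ p → x + i ≤ m
        x+i≤m {i} le = subst (x + i ≤_) x+p (+-monoʳ-≤ x le)
        p+j≤m : ∀ {j} → j ≤ x → p + j ≤ m
        p+j≤m {j} le = subst (p + j ≤_) (trans (+-comm p x) x+p) (+-monoʳ-≤ p le)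
        Hx : H x + a * x ≡ b * sum us
        Hx = trans (h-eq D x x≤m) (cong (b *_) (trans (S-++ˡ us vs x ≤-refl) (S-length us)))
        Hx+i : ∀ i → i ≤ p → H (x + i) + a * (x + i) ≡ b * (sum us + S vs i)
        Hx+i i le = trans (h-eq D (x + i) (x+i≤m le)) (cong (b *_) (S-++ʳ us vs i))
        Hj : ∀ j → j ≤ x → H j + a * j ≡ b * S us j
        Hj j le = trans (h-eq D j (≤-trans le x≤m)) (cong (b *_) (S-++ˡ us vs j le))

        near-eq : ∀ i → i ≤ p → ∀ u → u + a * i ≡ b * S vs i → u + H x ≡ H (x + i)
        near-eq i le u e = +-cancelʳ-≡ (a * (x + i)) _ _ (begin
          u + H x + a * (x + i)                    ≡⟨ lem u (H x) a x i ⟩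
          (H x + a * x) + (u + a * i)              ≡⟨ cong₂ _+_ Hx e ⟩
          b * sum us + b * S vs i                  ≡⟨ *-distribˡ-+ b (sum us) _ ⟨
          b * (sum us + S vs i)                    ≡⟨ Hx+i i le ⟨
          H (x + i) + a * (x + i) ∎)
          where
          open ≡-Reasoning
          lem : ∀ u v a x i → u + v + a * (x + i) ≡ (v + a * x) + (u + a * i)
          lem = solve-∀

        far-eq : ∀ j → j ≤ x → ∀ u → u + a * (p + j) ≡ b * (sum vs + S us j) → u + H x ≡ H j + a
        far-eq j le u e = +-cancelʳ-≡ (a * (p + j) + a * x) _ _ (begin
          u + H x + (a * (p + j) + a * x)          ≡⟨ lem u (H x) (a * (p + j)) (a * x) ⟩
          (H x + a * x) + (u + a * (p + j))        ≡⟨ cong₂ _+_ Hx e ⟩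
          b * sum us + b * (sum vs + S us j)       ≡⟨ lem₂ b (sum us) (sum vs) (S us j) ⟩
          b * (sum us + sum vs) + b * S us j       ≡⟨ cong₂ (λ t s → b * t + s) total (sym (Hj j le)) ⟩
          b * a + (H j + a * j)                    ≡⟨ cong (λ k → (a + k * a) + (H j + a * j)) (sym x+p) ⟩
          (a + (x + p) * a) + (H j + a * j)        ≡⟨ lem₃ a x p (H j) j ⟩
          H j + a + (a * (p + j) + a * x) ∎)
          where
          open ≡-Reasoning
          lem : ∀ u v y z → u + v + (y + z) ≡ (v + z) + (u + y)
          lem = solve-∀
          lem₂ : ∀ b s t r → b * s + b * (t + r) ≡ b * (s + t) + b * r
          lem₂ = solve-∀
          lem₃ : ∀ a x p u j → (a + (x + p) * a) + (u + a * j) ≡ u + a + (a * (p + j) + a * x)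
          lem₃ = solve-∀

      -- The labels after `x` are positive by `spine`. The others gain `a` from the full turn, and
      -- `H x` is at most `H m = a`; strictness comes from `spine` if something follows `x`, and
      -- otherwise from the positivity of `H j` or of `a`.
      rotated : (∀ i → 0 < i → i ≤ p → H x < H (x + i)) → DW (vs ++ us)
      rotated spine = record { len = trans (length-swap us vs) (DW.len D) ; tot = trans (sum-swap us vs) (DW.tot D) ; pos = pos′ }
        where
        near-pos : ∀ i → 0 < i → i ≤ p → a * i < b * S vs i
        near-pos i 0<i le = +-cancelˡ-< (H x + a * x) _ _ (begin-strict
          H x + a * x + a * i                 ≡⟨ lem (H x) a x i ⟩
          H x + a * (x + i)                   <⟨ +-monoˡ-< (a * (x + i)) (spine i 0<i le) ⟩
          H (x + i) + a * (x + i)             ≡⟨ Hx+i i le ⟩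
          b * (sum us + S vs i)               ≡⟨ *-distribˡ-+ b (sum us) _ ⟩
          b * sum us + b * S vs i             ≡⟨ cong (_+ b * S vs i) Hx ⟨
          H x + a * x + b * S vs i ∎)
          where
          open ≤-Reasoning
          lem : ∀ u a x i → u + a * x + a * i ≡ u + a * (x + i)
          lem = solve-∀
        far-pos : ∀ j → 0 < j → j ≤ x → a * (p + j) < b * (sum vs + S us j)
        far-pos j 0<j le = +-cancelʳ-< (H x + a * x) _ _ (begin-strict
          a * (p + j) + (H x + a * x)            <⟨ +-monoʳ-< (a * (p + j)) (+-monoˡ-< (a * x) (Hx< p refl)) ⟩
          a * (p + j) + (H j + a + a * x)        ≡⟨ lem₃ a x p (H j) j ⟩
          (a + (x + p) * a) + (H j + a * j)      ≡⟨ cong (λ k → (a + k * a) + (H j + a * j)) x+p ⟩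
          b * a + (H j + a * j)                  ≡⟨ cong₂ (λ t s → b * t + s) (sym total) (Hj j le) ⟩
          b * (sum us + sum vs) + b * S us j     ≡⟨ lem₂ b (sum us) (sum vs) (S us j) ⟩
          b * (sum vs + S us j) + b * sum us     ≡⟨ cong (b * (sum vs + S us j) +_) Hx ⟨
          b * (sum vs + S us j) + (H x + a * x) ∎)
          where
          open ≤-Reasoning
          Hx< : ∀ q → q ≡ p → H x < H j + a
          Hx< zero e with m≤n⇒m<n∨m≡n le
          ... | inj₂ refl = m<m+n (H x) 0<a
          ... | inj₁ _ = subst (_< H j + a) (sym (trans (cong H (trans (sym (+-identityʳ x)) (trans (cong (x +_) e) x+p))) (h-m D))) (m<n+m a (h-pos D j 0<j (≤-trans le x≤m)))
          Hx< (suc q) e = <-≤-trans (subst (H x <_) (trans (cong H x+p) (h-m D)) (spine p (subst (0 <_) e z<s) ≤-refl)) (m≤n+m a (H j))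
          lem₂ : ∀ b s t r → b * (s + t) + b * r ≡ b * (t + r) + b * s
          lem₂ = solve-∀
          lem₃ : ∀ a x p u j → a * (p + j) + (u + a + a * x) ≡ (a + (x + p) * a) + (u + a * j)
          lem₃ = solve-∀
        pos′ : ∀ i → 0 < i → i ≤ m → a * i < b * S (vs ++ us) i
        pos′ i 0<i i≤m with i ≤? p
        ... | yes le = subst (λ s → a * i < b * s) (sym (S-++ˡ vs us i le)) (near-pos i 0<i le)
        ... | no i≰p = subst (λ k → a * k < b * S (vs ++ us) k) (m+[n∸m]≡n (<⇒≤ (≰⇒> i≰p)))
            (subst (λ s → a * (p + j) < b * s) (sym (S-++ʳ vs us j)) (far-pos j (m<n⇒0<n∸m (≰⇒> i≰p))
              (+-cancelˡ-≤ p j x (subst₂ _≤_ (sym (m+[n∸m]≡n (<⇒≤ (≰⇒> i≰p)))) (trans (sym x+p) (+-comm x p)) i≤m))))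
          where j = i ∸ p

      transport : DW (vs ++ us) → Transport H (h (vs ++ us)) x p
      transport D′ = transport-region {a = a} (h-0 D) (λ i 0<i le → h-pos D i 0<i (subst (i ≤_) x+p le)) nearE
        (λ j le → far-eq j le _ (trans (h-eq D′ (p + j) (p+j≤m le)) (cong (b *_) (S-++ʳ vs us j))))
        -- Positivity of the rotated word is the spine condition read from `x`.
        (λ i 0<i le → subst (H x <_) (nearE i le) (m<n+m (H x) (h-pos D′ i 0<i (≤-trans (m≤n+m i x) (x+i≤m le)))))
        where
        nearE : ∀ i → i ≤ p → h (vs ++ us) i + H x ≡ H (x + i)
        nearE i le = near-eq i le _ (trans (h-eq D′ i (≤-trans (m≤n+m i x) (x+i≤m le))) (cong (b *_) (S-++ˡ vs us i le)))

    module Block (k : ℕ) (us vs : List ℕ) (D : DW ((k ∷ us) ++ (0 ∷ vs))) where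
      private
        x = suc (length us)
        p = suc (length vs)
        ns = (k ∷ us) ++ (0 ∷ vs)
        ns′ = (k ∷ vs) ++ (0 ∷ us)
        H = h ns
        x+p : x + p ≡ m
        x+p = DW-length (k ∷ us) (0 ∷ vs) D
        total : k + sum us + sum vs ≡ a
        total = trans (sym (sum-++ (k ∷ us) (0 ∷ vs))) (DW.tot D)
        x≤m : x ≤ m
        x≤m = subst (x ≤_) x+p (m≤m+n x p)
        x+i≤m : ∀ {i} → i ≤ p → x + i ≤ m
        x+i≤m {i} le = subst (x + i ≤_) x+p (+-monoʳ-≤ x le)
        p+j≤m : ∀ {j} → j ≤ x → p + j ≤ m
        p+j≤m {j} le = subst (p + j ≤_) (trans (+-comm p x) x+p) (+-monoʳ-≤ p le)
        Hx : H x + a * x ≡ b * (k + sum us)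
        Hx = trans (h-eq D x x≤m) (cong (b *_) (trans (S-++ˡ (k ∷ us) (0 ∷ vs) x ≤-refl) (S-length (k ∷ us))))
        Hx+i : ∀ i → suc i ≤ p → H (x + suc i) + a * (x + suc i) ≡ b * (k + sum us + S vs i)
        Hx+i i le = trans (h-eq D (x + suc i) (x+i≤m le)) (cong (b *_) (S-++ʳ (k ∷ us) (0 ∷ vs) (suc i)))
        Hj : ∀ j → suc j ≤ x → H (suc j) + a * suc j ≡ b * (k + S us j)
        Hj j le = trans (h-eq D (suc j) (≤-trans le x≤m)) (cong (b *_) (S-++ˡ (k ∷ us) (0 ∷ vs) (suc j) le))
        H1 : H 1 + a ≡ b * k
        H1 = trans (cong (H 1 +_) (sym (*-identityʳ a))) (trans (Hj 0 (s≤s z≤n)) (cong (b *_) (+-identityʳ k)))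
        x<m : x < m
        x<m = subst (x <_) x+p (m<m+n x z<s)
        fall : H (suc x) + a ≡ H x
        fall = h-fall D x<m (trans (cong (nth ns) (sym (+-identityʳ x))) (nth-++ʳ (k ∷ us) (0 ∷ vs) 0))

        near-eq : ∀ i → suc i ≤ p → ∀ u → u + a * suc i ≡ b * (k + S vs i) → u + H x ≡ H (x + suc i) + b * k
        near-eq i le u e = +-cancelʳ-≡ (a * (x + suc i)) _ _ (begin
          u + H x + a * (x + suc i)                 ≡⟨ lem u (H x) a x (suc i) ⟩
          (H x + a * x) + (u + a * suc i)           ≡⟨ cong₂ _+_ Hx e ⟩
          b * (k + sum us) + b * (k + S vs i)       ≡⟨ lem₂ b (k + sum us) k (S vs i) ⟩
          b * (k + sum us + S vs i) + b * k         ≡⟨ cong (_+ b * k) (Hx+i i le) ⟨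
          H (x + suc i) + a * (x + suc i) + b * k   ≡⟨ lem₃ (H (x + suc i)) (a * (x + suc i)) (b * k) ⟩
          H (x + suc i) + b * k + a * (x + suc i) ∎)
          where
          open ≡-Reasoning
          lem : ∀ u v a x i → u + v + a * (x + i) ≡ (v + a * x) + (u + a * i)
          lem = solve-∀
          lem₂ : ∀ b y k z → b * y + b * (k + z) ≡ b * (y + z) + b * k
          lem₂ = solve-∀
          lem₃ : ∀ x y z → x + y + z ≡ x + z + y
          lem₃ = solve-∀

        far-eq : ∀ j → suc j ≤ x → ∀ u → u + a * (p + suc j) ≡ b * (k + sum vs + S us j) → u + H x ≡ H (suc j) + a
        far-eq j le u e = +-cancelʳ-≡ (a * (p + suc j) + a * x) _ _ (begin
          u + H x + (a * (p + suc j) + a * x)               ≡⟨ lem u (H x) (a * (p + suc j)) (a * x) ⟩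
          (H x + a * x) + (u + a * (p + suc j))             ≡⟨ cong₂ _+_ Hx e ⟩
          b * (k + sum us) + b * (k + sum vs + S us j)      ≡⟨ lem₂ b k (sum us) (sum vs) (S us j) ⟩
          b * (k + sum us + sum vs) + b * (k + S us j)      ≡⟨ cong₂ (λ t s → b * t + s) total (sym (Hj j le)) ⟩
          b * a + (H (suc j) + a * suc j)                   ≡⟨ cong (λ k → (a + k * a) + (H (suc j) + a * suc j)) (sym x+p) ⟩
          (a + (x + p) * a) + (H (suc j) + a * suc j)       ≡⟨ lem₃ a x p (H (suc j)) (suc j) ⟩
          H (suc j) + a + (a * (p + suc j) + a * x) ∎)
          where
          open ≡-Reasoning
          lem : ∀ u v y z → u + v + (y + z) ≡ (v + z) + (u + y)
          lem = solve-∀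
          lem₂ : ∀ b k s t r → b * (k + s) + b * (k + t + r) ≡ b * (k + s + t) + b * (k + r)
          lem₂ = solve-∀
          lem₃ : ∀ a x p u j → (a + (x + p) * a) + (u + a * j) ≡ u + a + (a * (p + j) + a * x)
          lem₃ = solve-∀

      -- Label `suc x` lies in the base block, so it is at or below the labels before it, strictly
      -- below by `h-distinct`. As the letter at `x` is 0, `H x = H (suc x) + a`. This is at most
      -- `H 1 + a = b k`, which settles the part read first, and less than `H j + a` for
      -- `0 < j ≤ x`, which settles the rest.
      rotated : Par H 0 (suc x) → DW ns′
      rotated central = record
        { len = trans (cong suc (trans (length-++ vs) (trans (+-suc _ _) (cong suc (+-comm (length vs) (length us))))))
                      (trans (cong suc (sym (+-suc (length us) (length vs)))) x+p)
        ; tot = trans (cong (k +_) (trans (sum-++ vs (0 ∷ us)) (+-comm (sum vs) (sum us)))) (trans (sym (+-assoc k (sum us) (sum vs))) total)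
        ; pos = pos′ }
        where
        near-pos : ∀ i → suc i ≤ p → a * suc i < b * (k + S vs i)
        near-pos i le = +-cancelˡ-< (H x + a * x) _ _ (begin-strict
          H x + a * x + a * suc i                     ≡⟨ lem (H x) a x (suc i) ⟩
          H x + a * (x + suc i)                       <⟨ +-monoˡ-< (a * (x + suc i)) Hx< ⟩
          H (x + suc i) + b * k + a * (x + suc i)     ≡⟨ lem₃ (H (x + suc i)) (b * k) (a * (x + suc i)) ⟩
          H (x + suc i) + a * (x + suc i) + b * k     ≡⟨ cong (_+ b * k) (Hx+i i le) ⟩
          b * (k + sum us + S vs i) + b * k           ≡⟨ lem₂ b (k + sum us) k (S vs i) ⟩
          b * (k + sum us) + b * (k + S vs i)         ≡⟨ cong (_+ b * (k + S vs i)) Hx ⟨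
          H x + a * x + b * (k + S vs i) ∎)
          where
          open ≤-Reasoning
          Hx< : H x < H (x + suc i) + b * k
          Hx< = begin-strict
            H x                     ≡⟨ fall ⟨
            H (suc x) + a           ≤⟨ +-monoˡ-≤ a (par-above central 1 z<s (s≤s z≤n)) ⟩
            H 1 + a                 ≡⟨ H1 ⟩
            b * k                   <⟨ m<n+m (b * k) (h-pos D (x + suc i) (<-≤-trans z<s (m≤n+m (suc i) x)) (x+i≤m le)) ⟩
            H (x + suc i) + b * k ∎
          lem : ∀ u a x i → u + a * x + a * i ≡ u + a * (x + i)
          lem = solve-∀
          lem₂ : ∀ b y k z → b * (y + z) + b * k ≡ b * y + b * (k + z)
          lem₂ = solve-∀
          lem₃ : ∀ x y z → x + y + z ≡ x + z + y
          lem₃ = solve-∀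
        far-pos : ∀ j → suc j ≤ x → a * (p + suc j) < b * (k + sum vs + S us j)
        far-pos j le = +-cancelʳ-< (H x + a * x) _ _ (begin-strict
          a * (p + suc j) + (H x + a * x)                   <⟨ +-monoʳ-< (a * (p + suc j)) (+-monoˡ-< (a * x) Hx<) ⟩
          a * (p + suc j) + (H (suc j) + a + a * x)         ≡⟨ lem₃ a x p (H (suc j)) (suc j) ⟩
          (a + (x + p) * a) + (H (suc j) + a * suc j)       ≡⟨ cong (λ k → (a + k * a) + (H (suc j) + a * suc j)) x+p ⟩
          b * a + (H (suc j) + a * suc j)                   ≡⟨ cong₂ (λ t s → b * t + s) (sym total) (Hj j le) ⟩
          b * (k + sum us + sum vs) + b * (k + S us j)      ≡⟨ lem₂ b k (sum us) (sum vs) (S us j) ⟩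
          b * (k + sum vs + S us j) + b * (k + sum us)      ≡⟨ cong (b * (k + sum vs + S us j) +_) Hx ⟨
          b * (k + sum vs + S us j) + (H x + a * x) ∎)
          where
          open ≤-Reasoning
          Hx< : H x < H (suc j) + a
          Hx< = subst (_< H (suc j) + a) fall (+-monoˡ-< a (≤∧≢⇒< (between central (suc j) z<s (s≤s le))
            (λ e → h-distinct D (s≤s le) x<m (sym e))))
          lem₂ : ∀ b k s t r → b * (k + s + t) + b * (k + r) ≡ b * (k + t + r) + b * (k + s)
          lem₂ = solve-∀
          lem₃ : ∀ a x p u j → a * (p + j) + (u + a + a * x) ≡ (a + (x + p) * a) + (u + a * j)
          lem₃ = solve-∀
        pos′ : ∀ i → 0 < i → i ≤ m → a * i < b * S ns′ i
        pos′ (suc i) _ i≤m with suc i ≤? p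
        ... | yes le = subst (λ s → a * suc i < b * s) (sym (S-++ˡ (k ∷ vs) (0 ∷ us) (suc i) le)) (near-pos i le)
        ... | no i≰p = go (suc i ∸ p) (m+[n∸m]≡n (<⇒≤ (≰⇒> i≰p)))
          where
          go : ∀ j → p + j ≡ suc i → a * suc i < b * S ns′ (suc i)
          go zero e = ⊥-elim (i≰p (≤-reflexive (trans (sym e) (+-identityʳ p))))
          go (suc j) e = subst (λ k → a * k < b * S ns′ k) e (subst (λ s → a * (p + suc j) < b * s) (sym (S-++ʳ (k ∷ vs) (0 ∷ us) (suc j)))
            (far-pos j (+-cancelˡ-≤ p (suc j) x (subst₂ _≤_ (sym e) (trans (sym x+p) (+-comm x p)) i≤m))))

      transport : DW ns′ → Transport H (h ns′) x p
      transport D′ = transport-block {a = a} (h-0 D) (λ i 0<i le → h-pos D i 0<i (subst (i ≤_) x+p le))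
        nearE farE H1 (h-0 D′) (λ i 0<i le → h-pos D′ i 0<i (subst (i ≤_) x+p le)) z<s (sym fall)
        where
        nearE : ∀ i → 0 < i → i ≤ p → h ns′ i + H x ≡ H (x + i) + b * k
        nearE (suc i) _ le = near-eq i le _ (trans (h-eq D′ (suc i) (≤-trans (m≤n+m (suc i) x) (x+i≤m le))) (cong (b *_) (S-++ˡ (k ∷ vs) (0 ∷ us) (suc i) le)))
        farE : ∀ j → 0 < j → j ≤ x → h ns′ (p + j) + H x ≡ H j + a
        farE (suc j) _ le = far-eq j le _ (trans (h-eq D′ (p + suc j) (p+j≤m le)) (cong (b *_) (S-++ʳ (k ∷ vs) (0 ∷ us) (suc j))))

-- Lattice paths, valleys and lasers in terms of words.

module DyckPaths where

  open import Defs
  open Parents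
  open Words
  open DyckWords
  open import Data.Nat
  open import Data.Nat.Properties
  open import Data.Nat.Coprimality using (Coprime)
  open import Data.Nat.ListAction using (sum)
  open import Data.Nat.ListAction.Properties using (sum-++)
  open import Data.Nat.Tactic.RingSolver using (solve-∀)
  open import Data.Bool using (Bool; true; false; not; _∧_; _xor_; T)
  import Data.Bool.Properties as Bool
  open import Data.Bool.ListAction using (all; any)
  open import Data.Fin as Fin using (toℕ)
  import Data.Fin.Properties as Fin
  open import Data.List as List using (List; []; _∷_; _++_; map; length; replicate; upTo; take; drop)
  open import Data.List.Properties using (length-++; ++-assoc; ++-identityʳ; take++drop≡id; length-take)
  open import Data.List.Membership.Propositional using (_∈_)
  open import Data.List.Membership.Propositional.Properties using (∈-map⁺; ∈-map⁻; ∈-upTo⁺; ∈-upTo⁻)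
  open import Data.List.Relation.Unary.Any using (here; there)
  open import Data.Vec as Vec using (lookup)
  import Data.Vec.Properties as Vec
  open import Data.Product using (∃; _×_; _,_; proj₁; proj₂)
  open import Data.Sum using (_⊎_; inj₁; inj₂)
  open import Data.Empty using (⊥-elim)
  open import Data.Unit using (tt)
  open import Function using (_∘_; _⇔_; mk⇔; Equivalence)
  open import Relation.Nullary using (¬_; yes; no)
  open import Relation.Binary.PropositionalEquality
  open import Relation.Binary.Definitions using (tri<; tri≈; tri>)

  -- The local functions behind eastHeight and valleys are recovered by unification.
  mutual
    eastFrom : Path → ℕ → ℕ → Path → ℕ → ℕ
    eastFrom = _
    eastFrom-def : ∀ s j → eastHeight (E ∷ s) (suc (suc j)) ≡ eastFrom (E ∷ s) (suc (suc j)) 0 s (suc j)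
    eastFrom-def s j with suc (suc j)
    ... | j₀ with suc j | E ∷ s | 0
    ... | j′ | D₀ | y = refl

  mutual
    valleysFrom : Path → ℕ → ℕ → Path → List (ℕ × ℕ)
    valleysFrom = _
    valleysFrom-def : ∀ s → valleys (N ∷ s) ≡ valleysFrom (N ∷ s) 0 1 s
    valleysFrom-def s with N ∷ s | 1
    ... | D₀ | y with 0
    ... | x = refl

  runs : List ℕ → Path
  runs [] = []
  runs (n ∷ ns) = replicate n N ++ E ∷ runs ns

  path : List ℕ → Path
  path ns = runs (ns ++ 0 ∷ [])

  runs-++ : ∀ us vs → runs (us ++ vs) ≡ runs us ++ runs vs
  runs-++ [] vs = refl
  runs-++ (u ∷ us) vs = trans (cong (λ s → replicate u N ++ E ∷ s) (runs-++ us vs)) (sym (++-assoc (replicate u N) (E ∷ runs us) (runs vs)))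

  countE-N : ∀ n s → countE (replicate n N ++ s) ≡ countE s
  countE-N zero s = refl
  countE-N (suc n) s = countE-N n s

  countN-N : ∀ n s → countN (replicate n N ++ s) ≡ n + countN s
  countN-N zero s = refl
  countN-N (suc n) s = cong suc (countN-N n s)

  countE-runs : ∀ ns s → countE (runs ns ++ s) ≡ length ns + countE s
  countE-runs [] s = refl
  countE-runs (n ∷ ns) s = trans (cong countE (++-assoc (replicate n N) (E ∷ runs ns) s)) (trans (countE-N n _) (cong suc (countE-runs ns s)))

  countN-runs : ∀ ns s → countN (runs ns ++ s) ≡ sum ns + countN s
  countN-runs [] s = refl
  countN-runs (n ∷ ns) s = trans (cong countN (++-assoc (replicate n N) (E ∷ runs ns) s))
    (trans (countN-N n _) (trans (cong (n +_) (countN-runs ns s)) (sym (+-assoc n _ _))))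

  decompose : ∀ D → ∃ λ ns → ∃ λ t → D ≡ runs ns ++ replicate t N
  decompose [] = [] , 0 , refl
  decompose (E ∷ D) with decompose D
  ... | ns , t , e = 0 ∷ ns , t , cong (E ∷_) e
  decompose (N ∷ D) with decompose D
  ... | [] , t , e = [] , suc t , cong (N ∷_) e
  ... | n ∷ ns , t , e = suc n ∷ ns , t , cong (N ∷_) e

  eastFrom-N : ∀ D₀ j₀ y n s j → eastFrom D₀ j₀ y (replicate n N ++ s) j ≡ eastFrom D₀ j₀ (y + n) s j
  eastFrom-N D₀ j₀ y zero s j = cong (λ y → eastFrom D₀ j₀ y s j) (sym (+-identityʳ y))
  eastFrom-N D₀ j₀ y (suc n) s j = trans (eastFrom-N D₀ j₀ (suc y) n s j) (cong (λ y → eastFrom D₀ j₀ y s j) (sym (+-suc y n)))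

  eastFrom-runs : ∀ D₀ j₀ y ns j → suc j ≤ length ns → eastFrom D₀ j₀ y (runs ns) (suc j) ≡ y + S ns (suc j)
  eastFrom-runs D₀ j₀ y (n ∷ ns) zero le = trans (eastFrom-N D₀ j₀ y n (E ∷ runs ns) 1) (cong (y +_) (sym (+-identityʳ n)))
  eastFrom-runs D₀ j₀ y (n ∷ ns) (suc j) (s≤s le) = trans (eastFrom-N D₀ j₀ y n (E ∷ runs ns) (suc (suc j)))
    (trans (eastFrom-runs D₀ j₀ (y + n) ns j le) (+-assoc y n _))

  valleysFrom-N : ∀ D₀ x y n s → valleysFrom D₀ x y (replicate n N ++ s) ≡ valleysFrom D₀ x (y + n) s
  valleysFrom-N D₀ x y zero s = cong (λ y → valleysFrom D₀ x y s) (sym (+-identityʳ y))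
  valleysFrom-N D₀ x y (suc n) s = trans (valleysFrom-N D₀ x (suc y) n s) (cong (λ y → valleysFrom D₀ x y s) (sym (+-suc y n)))

  valleysFrom-E : ∀ D₀ x y ns → (ns ≡ [] × valleysFrom D₀ x y (E ∷ runs ns) ≡ []) ⊎
    (nth ns 0 ≡ 0 × valleysFrom D₀ x y (E ∷ runs ns) ≡ valleysFrom D₀ (suc x) y (runs ns)) ⊎
    (0 < nth ns 0 × valleysFrom D₀ x y (E ∷ runs ns) ≡ (suc x , y) ∷ valleysFrom D₀ (suc x) y (runs ns))
  valleysFrom-E D₀ x y [] = inj₁ (refl , refl)
  valleysFrom-E D₀ x y (zero ∷ ns) = inj₂ (inj₁ (refl , refl))
  valleysFrom-E D₀ x y (suc n ∷ ns) = inj₂ (inj₂ (z<s , refl))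

  -- A valley follows `t ≥ 1` east steps and precedes a nonempty run. The base vertex 0 fires no
  -- laser: its children are the labels that lie under none.
  valleys⁺ : ∀ D₀ x y ns t → 0 < t → 0 < nth ns t → (x + t , y + S ns t) ∈ valleysFrom D₀ x y (runs ns)
  valleys⁺ D₀ x y (n ∷ ns) (suc t) _ pos = subst (_ ∈_) (sym (valleysFrom-N D₀ x y n (E ∷ runs ns)))
    (subst₂ (λ u v → (u , v) ∈ valleysFrom D₀ x (y + n) (E ∷ runs ns)) (sym (+-suc x t)) (+-assoc y n (S ns t)) (go t pos))
    where
    go : ∀ t → 0 < nth ns t → (suc x + t , y + n + S ns t) ∈ valleysFrom D₀ x (y + n) (E ∷ runs ns)
    go t pos with valleysFrom-E D₀ x (y + n) ns
    ... | inj₁ (refl , _) = ⊥-elim (<-irrefl refl pos)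
    go zero pos | inj₂ (inj₁ (e , _)) = ⊥-elim (<⇒≢ pos (sym e))
    go (suc t) pos | inj₂ (inj₁ (_ , e)) = subst (_ ∈_) (sym e) (valleys⁺ D₀ (suc x) (y + n) ns (suc t) z<s pos)
    go zero pos | inj₂ (inj₂ (_ , e)) = subst (_ ∈_) (sym e) (here (cong₂ _,_ (+-identityʳ (suc x)) (+-identityʳ (y + n))))
    go (suc t) pos | inj₂ (inj₂ (_ , e)) = subst (_ ∈_) (sym e) (there (valleys⁺ D₀ (suc x) (y + n) ns (suc t) z<s pos))

  valleys⁻ : ∀ D₀ x y ns {X Y} → (X , Y) ∈ valleysFrom D₀ x y (runs ns) →
    ∃ λ t → 0 < t × 0 < nth ns t × X ≡ x + t × Y ≡ y + S ns t
  valleys⁻ D₀ x y (n ∷ ns) {X} {Y} p = go (subst (_ ∈_) (valleysFrom-N D₀ x y n (E ∷ runs ns)) p)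
    where
    rec : (X , Y) ∈ valleysFrom D₀ (suc x) (y + n) (runs ns) →
      ∃ λ t → 0 < t × 0 < nth (n ∷ ns) t × X ≡ x + t × Y ≡ y + S (n ∷ ns) t
    rec p with valleys⁻ D₀ (suc x) (y + n) ns p
    ... | t , _ , pos , eX , eY = suc t , z<s , pos , trans eX (sym (+-suc x t)) , trans eY (+-assoc y n _)
    go : (X , Y) ∈ valleysFrom D₀ x (y + n) (E ∷ runs ns) →
      ∃ λ t → 0 < t × 0 < nth (n ∷ ns) t × X ≡ x + t × Y ≡ y + S (n ∷ ns) t
    go p with valleysFrom-E D₀ x (y + n) ns
    ... | inj₁ (_ , e) with () ← subst (_ ∈_) e p
    ... | inj₂ (inj₁ (_ , e)) = rec (subst (_ ∈_) e p)
    ... | inj₂ (inj₂ (pos , e)) with subst (_ ∈_) e p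
    ...   | here refl = 1 , z<s , pos , sym (+-comm x 1) , cong (y +_) (sym (+-identityʳ n))
    ...   | there p′ = rec p′

  all-true : ∀ {A : Set} (f : A → Bool) xs → all f xs ≡ true → ∀ {x} → x ∈ xs → f x ≡ true
  all-true f (x ∷ xs) e p with f x in eq
  all-true f (x ∷ xs) e (here refl) | true = eq
  all-true f (x ∷ xs) e (there p) | true = all-true f xs e p

  all-intro : ∀ {A : Set} (f : A → Bool) xs → (∀ {x} → x ∈ xs → f x ≡ true) → all f xs ≡ true
  all-intro f [] g = refl
  all-intro f (x ∷ xs) g rewrite g {x} (here refl) = all-intro f xs (g ∘ there)

  any-false : ∀ {A : Set} (f : A → Bool) xs → any f xs ≡ false → ∀ {x} → x ∈ xs → f x ≡ false
  any-false f (x ∷ xs) e p with f x in eq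
  any-false f (x ∷ xs) e (here refl) | false = eq
  any-false f (x ∷ xs) e (there p) | false = any-false f xs e p

  any-intro : ∀ {A : Set} (f : A → Bool) xs → (∀ {x} → x ∈ xs → f x ≡ false) → any f xs ≡ false
  any-intro f [] g = refl
  any-intro f (x ∷ xs) g rewrite g {x} (here refl) = any-intro f xs (g ∘ there)

  ∧-true : ∀ {x y} → x ∧ y ≡ true → x ≡ true × y ≡ true
  ∧-true {true} {true} _ = refl , refl

  xor-false : ∀ x y → x xor y ≡ false → x ≡ y
  xor-false true true _ = refl
  xor-false false false _ = refl

  xor-refl : ∀ x → x xor x ≡ false
  xor-refl true = refl
  xor-refl false = refl

  <ᵇ-true : ∀ {m n} → (m <ᵇ n) ≡ true → m < n
  <ᵇ-true {m} {n} e = <ᵇ⇒< m n (subst T (sym e) tt)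

  <-true : ∀ {m n} → m < n → (m <ᵇ n) ≡ true
  <-true {m} {n} lt with m <ᵇ n | <⇒<ᵇ lt
  ... | true | _ = refl

  bool-ext : ∀ {x y : Bool} → (x ≡ true → y ≡ true) → (y ≡ true → x ≡ true) → x ≡ y
  bool-ext {true} {true} f g = refl
  bool-ext {false} {false} f g = refl
  bool-ext {true} {false} f g = sym (f refl)
  bool-ext {false} {true} f g = g refl

  -- The laser from `x` is still below the path at label `i`. The parent of `i` is the last such
  -- `x`.
  record Anc (h : ℕ → ℕ) (x i : ℕ) : Set where
    constructor anc
    field
      above-start : x < i
      above       : ∀ k → x < k → k ≤ i → h x < h k
  open Anc

  module PathBase (a m : ℕ) (0<a : 0 < a) (a≤m : a ≤ m) (cop : Coprime a (suc m)) where
    open Base a m 0<a a≤m cop public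

    module _ {ns : List ℕ} (D : DW ns) where
      open DW D
      private
        H = h ns
        ns₀ = ns ++ 0 ∷ []

        S₀ : ∀ {i} → i ≤ m → S ns₀ i ≡ S ns i
        S₀ {i} le = S-++ˡ ns (0 ∷ []) i (subst (i ≤_) (sym len) le)

        nth₀ : ∀ t → nth ns₀ t ≡ nth ns t
        nth₀ t = go ns t
          where
          go : ∀ ns t → nth (ns ++ 0 ∷ []) t ≡ nth ns t
          go [] zero = refl
          go [] (suc t) = refl
          go (n ∷ ns) zero = refl
          go (n ∷ ns) (suc t) = go ns t

        nth-bound : ∀ t → 0 < nth ns t → t < m
        nth-bound t pos = subst (t <_) len (go ns t pos)
          where
          go : ∀ ns t → 0 < nth ns t → t < length ns
          go (n ∷ ns) zero pos = z<s
          go (n ∷ ns) (suc t) pos = s≤s (go ns t pos)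

        east : ∀ j → 0 < j → j ≤ m → eastHeight (path ns) j ≡ S ns j
        east (suc j) _ le = trans (eastFrom-runs (path ns) (suc j) 0 ns₀ j
          (≤-trans le (≤-trans (≤-reflexive (sym len)) (≤-trans (m≤m+n (length ns) 1) (≤-reflexive (sym (length-++ ns))))))) (S₀ le)

        -- Adding `a k` to both levels turns their comparison into the inequality of the line of
        -- slope `a/b`.
        laser : ∀ {x k} → x < k → k ≤ m → (a * (k ∸ x) + b * S ns x < b * S ns k) ⇔ (H x < H k)
        laser {x} {k} x<k k≤m = mk⇔
          (λ lt → +-cancelʳ-< (a * k) _ _ (subst₂ _<_ lhs (sym (h-eq D k k≤m)) lt))
          (λ lt → subst₂ _<_ (sym lhs) (h-eq D k k≤m) (+-monoˡ-< (a * k) lt))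
          where
          lhs : a * (k ∸ x) + b * S ns x ≡ H x + a * k
          lhs = begin
            a * (k ∸ x) + b * S ns x         ≡⟨ cong (a * (k ∸ x) +_) (h-eq D x (≤-trans (<⇒≤ x<k) k≤m)) ⟨
            a * (k ∸ x) + (H x + a * x)      ≡⟨ lem a (k ∸ x) (H x) x ⟩
            H x + a * (k ∸ x + x)            ≡⟨ cong (λ t → H x + a * t) (m∸n+n≡m (<⇒≤ x<k)) ⟩
            H x + a * k ∎
            where
            open ≡-Reasoning
            lem : ∀ a d u x → a * d + (u + a * x) ≡ u + a * (d + x)
            lem = solve-∀

        test : ℕ → ℕ → Bool
        test x j = (a * (j ∸ x) + b * S ns x) <ᵇ (b * eastHeight (path ns) j)

        under⁻ : ∀ {x i} → i ≤ m → underPath a b (path ns) (x , S ns x) i ≡ true → Anc H x i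
        under⁻ {x} {i} i≤m e = anc x<i λ k x<k k≤i → Equivalence.to (laser x<k (≤-trans k≤i i≤m))
            (subst (λ s → a * (k ∸ x) + b * S ns x < b * s) (east k (≤-<-trans z≤n x<k) (≤-trans k≤i i≤m))
              (<ᵇ-true (all-true (test x) _ (proj₂ (∧-true {x <ᵇ i} e)) (k∈ k x<k k≤i))))
          where
          x<i : x < i
          x<i = <ᵇ-true (proj₁ (∧-true {x <ᵇ i} e))
          k∈ : ∀ k → x < k → k ≤ i → k ∈ map (λ t → x + suc t) (upTo (i ∸ x))
          k∈ k x<k k≤i = subst (_∈ map (λ t → x + suc t) (upTo (i ∸ x))) (trans (+-suc x _) (m+[n∸m]≡n x<k))
            (∈-map⁺ (λ t → x + suc t) (∈-upTo⁺ (∸-mono-<′ k x<k k≤i)))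
            where
            ∸-mono-<′ : ∀ k → x < k → k ≤ i → k ∸ suc x < i ∸ x
            ∸-mono-<′ k x<k k≤i = ≤-trans (≤-reflexive (sym (+-∸-assoc 1 x<k))) (∸-monoˡ-≤ x k≤i)

        under⁺ : ∀ {x i} → i ≤ m → Anc H x i → underPath a b (path ns) (x , S ns x) i ≡ true
        under⁺ {x} {i} i≤m (anc x<i ab) = cong₂ _∧_ (<-true x<i) (all-intro (test x) _ go)
          where
          go : ∀ {k} → k ∈ map (λ t → x + suc t) (upTo (i ∸ x)) → test x k ≡ true
          go p with ∈-map⁻ (λ t → x + suc t) p
          ... | t , t∈ , refl = <-true (subst (λ s → a * (x + suc t ∸ x) + b * S ns x < b * s) (sym (east (x + suc t) (≤-<-trans z≤n x<k) k≤m))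
                (Equivalence.from (laser x<k k≤m) (ab (x + suc t) x<k k≤i)))
            where
            x<k : x < x + suc t
            x<k = m<m+n x z<s
            k≤i : x + suc t ≤ i
            k≤i = ≤-trans (+-monoʳ-≤ x (∈-upTo⁻ t∈)) (≤-reflexive (m+[n∸m]≡n (<⇒≤ x<i)))
            k≤m = ≤-trans k≤i i≤m

        par⇒anc : ∀ {x i} → Par H x i → Anc H x i
        par⇒anc p = anc (before p) λ k x<k k≤i → <-≤-trans (smaller p) (par-above p k x<k k≤i)

        -- The laser starts at some `t ≤ x`, because no vertex between the parent `x` and `i` is
        -- below `i`. It passes at or below `x`, and the path stays above `x` all the way to `j`.
        anc⇒anc : ∀ {x i j} → Par H x i → Par H x j → ∀ t → Anc H t i → Anc H t j
        anc⇒anc {x} {i} {j} p q t (anc t<i ab) = anc (≤-<-trans t≤x (before q)) go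
          where
          t≤x : t ≤ x
          t≤x = ≮⇒≥ λ x<t → <⇒≱ (ab i t<i ≤-refl) (between p t x<t t<i)
          ht≤hx : H t ≤ H x
          ht≤hx with m≤n⇒m<n∨m≡n t≤x
          ... | inj₁ t<x = <⇒≤ (ab x t<x (<⇒≤ (before p)))
          ... | inj₂ refl = ≤-refl
          go : ∀ k → t < k → k ≤ j → H t < H k
          go k t<k k≤j with k ≤? x
          ... | yes k≤x = ab k t<k (≤-trans k≤x (<⇒≤ (before p)))
          ... | no k≰x = ≤-<-trans ht≤hx (<-≤-trans (smaller q) (par-above q k (≰⇒> k≰x) k≤j))

        valley∈ : ∀ {t} → 0 < t → 0 < nth ns t → (t , S ns t) ∈ valleys (path ns)
        valley∈ {t} 0<t pos = subst (λ s → (t , s) ∈ valleys (path ns)) (S₀ (<⇒≤ (nth-bound t pos)))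
          (valleys⁺ (path ns) 0 0 ns₀ t 0<t (subst (0 <_) (sym (nth₀ t)) pos))

        -- The later parent `y` is positive and hence a valley. Its laser runs below `j` but not
        -- below `i`, since between `x` and `i` no vertex is lower than `i`.
        ¬smaller-parent : ∀ {i j x y} → i ≤ m → j ≤ m → separated a b (path ns) i j ≡ false → Par H x i → Par H y j → ¬ x < y
        ¬smaller-parent {i} {j} {x} {y} i≤m j≤m e p q x<y = <⇒≱ (above y-anc i (above-start y-anc) ≤-refl) (between p y x<y (above-start y-anc))
          where
          y-anc : Anc H y i
          y-anc = under⁻ i≤m (trans (xor-false _ _ (any-false (λ P → underPath a b (path ns) P i xor underPath a b (path ns) P j) _ e
            (valley∈ (≤-<-trans z≤n x<y) (par-nth D j≤m q)))) (under⁺ j≤m (par⇒anc q)))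

        separated-sym : ∀ i j → separated a b (path ns) i j ≡ false → separated a b (path ns) j i ≡ false
        separated-sym i j e = any-intro _ (valleys (path ns)) λ {P} p →
          trans (Bool.xor-comm (underPath a b (path ns) P j) _) (any-false (λ P → underPath a b (path ns) P i xor underPath a b (path ns) P j) _ e p)

      unseparated⁻ : ∀ {i j} → 0 < i → i ≤ m → 0 < j → j ≤ m → separated a b (path ns) i j ≡ false → SameBlock H i j
      unseparated⁻ {i} {j} 0<i i≤m 0<j j≤m e with parent D 0<i i≤m | parent D 0<j j≤m
      ... | x , p | y , q with <-cmp x y
      ...   | tri≈ _ refl _ = x , p , q
      ...   | tri< x<y _ _ = ⊥-elim (¬smaller-parent i≤m j≤m e p q x<y)
      ...   | tri> _ _ y<x = ⊥-elim (¬smaller-parent j≤m i≤m (separated-sym i j e) q p y<x)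

      unseparated⁺ : ∀ {i j} → i ≤ m → j ≤ m → SameBlock H i j → separated a b (path ns) i j ≡ false
      unseparated⁺ {i} {j} i≤m j≤m (x , p , q) = any-intro _ (valleys (path ns)) λ { {X , Y} v → go v }
        where
        go : ∀ {X Y} → (X , Y) ∈ valleys (path ns) → underPath a b (path ns) (X , Y) i xor underPath a b (path ns) (X , Y) j ≡ false
        go v with valleys⁻ (path ns) 0 0 ns₀ v
        ... | t , 0<t , pos , refl , refl = trans (cong (_xor under j) (bool-ext
                (λ e → back j≤m (anc⇒anc p q t (forth i≤m e))) (λ e → back i≤m (anc⇒anc q p t (forth j≤m e))))) (xor-refl (under j))
          where
          under : ℕ → Bool
          under = underPath a b (path ns) (t , S ns₀ t)
          St : S ns₀ t ≡ S ns t
          St = S₀ (<⇒≤ (nth-bound t (subst (0 <_) (nth₀ t) pos)))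
          forth : ∀ {i} → i ≤ m → under i ≡ true → Anc H t i
          forth {i} le e = under⁻ le (subst (λ s → underPath a b (path ns) (t , s) i ≡ true) St e)
          back : ∀ {i} → i ≤ m → Anc H t i → under i ≡ true
          back {i} le e = subst (λ s → underPath a b (path ns) (t , s) i ≡ true) (sym St) (under⁺ le e)

    opaque
      πW : List ℕ → Rel m
      πW ns = πD a b (path ns)

      πW-def : ∀ ns → πW ns ≡ πD a b (path ns)
      πW-def ns = refl

      rel-πW : ∀ ns i j → rel (πW ns) i j ≡ not (separated a b (path ns) (suc (toℕ i)) (suc (toℕ j)))
      rel-πW ns i j = trans (cong (λ v → lookup v j) (Vec.lookup∘tabulate _ i)) (Vec.lookup∘tabulate _ j)

    not-true : ∀ {x} → not x ≡ true → x ≡ false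
    not-true {false} _ = refl

    related⁻ : ∀ {ns} → DW ns → ∀ i j → rel (πW ns) i j ≡ true → SameBlock (h ns) (suc (toℕ i)) (suc (toℕ j))
    related⁻ {ns} D i j e = unseparated⁻ D z<s (Fin.toℕ<n i) z<s (Fin.toℕ<n j) (not-true (trans (sym (rel-πW ns i j)) e))

    related⁺ : ∀ {ns} → DW ns → ∀ i j → SameBlock (h ns) (suc (toℕ i)) (suc (toℕ j)) → rel (πW ns) i j ≡ true
    related⁺ {ns} D i j sb = trans (rel-πW ns i j) (cong not (unseparated⁺ D (Fin.toℕ<n i) (Fin.toℕ<n j) sb))

    private
      take-++ : ∀ (us vs : Path) → take (length us) (us ++ vs) ≡ us
      take-++ [] vs = refl
      take-++ (u ∷ us) vs = cong (u ∷_) (take-++ us vs)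

      S-take : ∀ ns i → sum (take i ns) ≡ S ns i
      S-take ns zero = refl
      S-take [] (suc i) = refl
      S-take (n ∷ ns) (suc i) = cong (n +_) (S-take ns i)

      prefix-bound : ∀ {D} → IsDyck a b D → ∀ ns s → D ≡ runs ns ++ s → a * length ns ≤ b * sum ns
      prefix-bound (_ , _ , bound) ns s refl = subst₂ (λ x y → a * x ≤ b * y) (trans (cong countE eq) (trans (cong countE (sym (++-identityʳ (runs ns)))) (trans (countE-runs ns []) (+-identityʳ _))))
          (trans (cong countN eq) (trans (cong countN (sym (++-identityʳ (runs ns)))) (trans (countN-runs ns []) (+-identityʳ _)))) (bound (length (runs ns)))
        where
        eq : take (length (runs ns)) (runs ns ++ s) ≡ runs ns
        eq = take-++ (runs ns) s

      prefix-S : ∀ {D} → IsDyck a b D → ∀ ns s → D ≡ runs ns ++ s → ∀ i → i ≤ length ns → a * i ≤ b * S ns i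
      prefix-S dy ns s e i le = subst₂ (λ x y → a * x ≤ b * y) (trans (length-take i ns) (m≤n⇒m⊓n≡m le)) (S-take ns i)
        (prefix-bound dy (take i ns) (runs (drop i ns) ++ s) (trans e (trans (cong (λ l → runs l ++ s) (sym (take++drop≡id i ns)))
          (trans (cong (_++ s) (runs-++ (take i ns) (drop i ns))) (++-assoc (runs (take i ns)) _ s)))))

      unsnoc : ∀ (ns : List ℕ) k → length ns ≡ suc k → ∃ λ us → ∃ λ n → ns ≡ us ++ n ∷ [] × length us ≡ k
      unsnoc (n ∷ []) zero e = [] , n , refl , refl
      unsnoc (n ∷ n′ ∷ ns) (suc k) e with unsnoc (n′ ∷ ns) k (suc-injective e)
      ... | us , l , eq , len = n ∷ us , l , cong (n ∷_) eq , cong suc len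

      countE-N′ : ∀ t → countE (replicate t N) ≡ 0
      countE-N′ zero = refl
      countE-N′ (suc t) = countE-N′ t

      countN-N′ : ∀ t → countN (replicate t N) ≡ t
      countN-N′ zero = refl
      countN-N′ (suc t) = cong suc (countN-N′ t)

    -- Weak inequalities become strict by `no-tie`. At label `m` the bound `a m < b (sum us)` forces
    -- `a ≤ sum us`, so no north step is left for the last run or after the last east step.
    word-of : ∀ {D} → IsDyck a b D → ∃ λ ns → DW ns × D ≡ path ns
    word-of {D} dy@(nN , nE , bound) with decompose D
    ... | ns , t , e with unsnoc ns m (trans (trans (sym (trans (countE-runs ns (replicate t N)) (trans (cong (length ns +_) (countE-N′ t)) (+-identityʳ _)))) (cong countE (sym e))) nE)
    ...   | us , n , refl , len = us , record { len = len ; tot = tot-us ; pos = pos′ } , trans e (trans (cong (λ t → runs (us ++ n ∷ []) ++ replicate t N) t≡0) (trans (++-identityʳ _) (cong (λ n → runs (us ++ n ∷ [])) n≡0)))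
      where
      S-us : ∀ {i} → i ≤ m → S (us ++ n ∷ []) i ≡ S us i
      S-us {i} le = S-++ˡ us (n ∷ []) i (subst (i ≤_) (sym len) le)
      pos′ : ∀ i → 0 < i → i ≤ m → a * i < b * S us i
      pos′ i 0<i le = ≤∧≢⇒< (subst (λ s → a * i ≤ b * s) (S-us le) (prefix-S dy (us ++ n ∷ []) (replicate t N) e i
        (≤-trans le (≤-trans (≤-reflexive (sym len)) (≤-trans (m≤m+n (length us) 1) (≤-reflexive (sym (length-++ us)))))))) (λ e → no-tie (S us i) i 0<i le (sym e))
      total : sum us + (n + t) ≡ a
      total = trans (lem (sum us) n t) (trans (cong (λ s → s + t) (sym (sum-++ us (n ∷ [])))) (trans (sym (trans (countN-runs (us ++ n ∷ []) (replicate t N)) (cong (sum (us ++ n ∷ []) +_) (countN-N′ t)))) (trans (cong countN (sym e)) nN)))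
        where
        lem : ∀ s n t → s + (n + t) ≡ s + (n + 0) + t
        lem = solve-∀
      a≤us : a ≤ sum us
      a≤us = s≤s⁻¹ (*-cancelˡ-< b a (suc (sum us)) (begin-strict
        b * a               ≡⟨ cong (a +_) (*-comm m a) ⟩
        a + a * m           <⟨ +-mono-≤-< (≤-trans a≤m (n≤1+n m)) (subst (λ s → a * m < b * s) (trans (cong (S us) (sym len)) (S-length us)) (pos′ m (<-≤-trans 0<a a≤m) ≤-refl)) ⟩
        b + b * sum us      ≡⟨ *-suc b (sum us) ⟨
        b * suc (sum us) ∎))
        where open ≤-Reasoning
      n+t≡0 : n + t ≡ 0
      n+t≡0 = n≤0⇒n≡0 (+-cancelˡ-≤ (sum us) _ _ (≤-trans (≤-reflexive total) (≤-trans a≤us (≤-reflexive (sym (+-identityʳ _))))))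
      n≡0 : n ≡ 0
      n≡0 = m+n≡0⇒m≡0 n n+t≡0
      t≡0 : t ≡ 0
      t≡0 = m+n≡0⇒n≡0 n n+t≡0
      tot-us : sum us ≡ a
      tot-us = trans (sym (+-identityʳ _)) (trans (cong (sum us +_) (sym n+t≡0)) total)

    private
      -- The bound is recorded at the ends of east steps only; north steps in between raise just the
      -- right-hand side.
      Above : ℕ → ℕ → List ℕ → Set
      Above x y ns = ∀ i → i ≤ length ns → a * (x + i) ≤ b * (y + S ns i)

      start : ∀ {x y ns} → Above x y ns → a * (x + 0) ≤ b * (y + 0)
      start ab = ab 0 z≤n

      prefixes : ∀ x y ns → Above x y ns → ∀ n → a * (x + countE (take n (runs ns))) ≤ b * (y + countN (take n (runs ns)))
      prefixes-∷ : ∀ x y k ns → Above x y (k ∷ ns) → ∀ n → a * (x + countE (take n (runs (k ∷ ns)))) ≤ b * (y + countN (take n (runs (k ∷ ns))))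
      prefixes x y [] ab zero = start {x} {y} {[]} ab
      prefixes x y [] ab (suc n) = start {x} {y} {[]} ab
      prefixes x y (k ∷ ns) ab n = prefixes-∷ x y k ns ab n
      prefixes-∷ x y k ns ab zero = start {x} {y} {k ∷ ns} ab
      prefixes-∷ x y zero ns ab (suc n) = subst (λ u → a * u ≤ b * (y + countN (take n (runs ns)))) (sym (+-suc x (countE (take n (runs ns)))))
        (prefixes (suc x) y ns (λ i le → subst (λ u → a * u ≤ b * (y + S ns i)) (+-suc x i) (ab (suc i) (s≤s le))) n)
      prefixes-∷ x y (suc k) ns ab (suc n) = subst (λ v → a * (x + countE (take n (runs (k ∷ ns)))) ≤ b * v) (sym (+-suc y _))
        (prefixes-∷ x (suc y) k ns ab′ n)
        where
        ab′ : Above x (suc y) (k ∷ ns)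
        ab′ zero le = ≤-trans (ab 0 z≤n) (*-monoʳ-≤ b (n≤1+n (y + 0)))
        ab′ (suc i) le = subst (λ v → a * (x + suc i) ≤ b * v) (+-suc y (k + S ns i)) (ab (suc i) le)

    path-Dyck : ∀ {ns} → DW ns → IsDyck a b (path ns)
    path-Dyck {ns} D = trans (cong countN (sym (++-identityʳ (path ns)))) (trans (countN-runs ns₀ []) (trans (+-identityʳ _) sum₀))
      , trans (cong countE (sym (++-identityʳ (path ns)))) (trans (countE-runs ns₀ []) (trans (+-identityʳ _) len₀))
      , prefixes 0 0 ns₀ ab
      where
      open DW D
      ns₀ = ns ++ 0 ∷ []
      sum₀ : sum ns₀ ≡ a
      sum₀ = trans (sum-++ ns (0 ∷ [])) (trans (+-identityʳ _) tot)
      len₀ : length ns₀ ≡ b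
      len₀ = trans (length-++ ns) (trans (cong (_+ 1) len) (+-comm m 1))
      ab : Above 0 0 ns₀
      ab zero le = ≤-trans (≤-reflexive (*-zeroʳ a)) z≤n
      ab (suc i) le with m≤n⇒m<n∨m≡n (subst (suc i ≤_) len₀ le)
      ... | inj₁ (s≤s i<m) = ≤-trans (<⇒≤ (pos (suc i) z<s i<m)) (≤-reflexive (cong (b *_) (sym (S-++ˡ ns (0 ∷ []) (suc i) (subst (suc i ≤_) (sym len) i<m)))))
      ... | inj₂ e = ≤-reflexive (trans (cong (a *_) e) (trans (*-comm a b) (cong (b *_) (sym (trans (cong (S ns₀) (trans e (sym len₀))) (trans (S-length ns₀) sum₀))))))

-- Ranks are the letters of the word, and the partition determines the word.

module Ranks where

  open import Defs
  open Parents
  open Words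
  open DyckWords
  open DyckPaths
  open import Data.Nat
  open import Data.Nat.Properties
  open import Data.Nat.DivMod using (+-distrib-/-∣ʳ; m<n⇒m/n≡0; m*n/n≡m)
  open import Data.Nat.Divisibility using (divides-refl)
  open import Data.Nat.Coprimality using (Coprime)
  open import Data.Nat.ListAction using (sum)
  open import Data.Nat.Tactic.RingSolver using (solve-∀)
  open import Data.Integer as ℤ using (ℤ) renaming (+_ to ℤ+_)
  import Data.Integer.Properties as ℤ
  import Algebra.Properties.AbelianGroup ℤ.+-0-abelianGroup as ℤGroup
  open import Data.Bool using (Bool; true; false; not; _∧_; if_then_else_; T)
  open import Data.Bool.Properties using (T?)
  open import Data.Fin as Fin using (Fin; toℕ; fromℕ<)
  import Data.Fin.Properties as Fin
  open import Data.List as List using (List; []; _∷_; map; length; filterᵇ; allFin; foldr; tabulate)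
  open import Data.List.Properties using (map-tabulate; map-cong)
  open import Data.List.Membership.Propositional using (_∈_)
  open import Data.List.Membership.Propositional.Properties using (∈-allFin; ∈-filter⁺; ∈-filter⁻)
  open import Data.List.Relation.Unary.Any using (here; there)
  open import Data.List.Relation.Unary.All as All using ([]; _∷_)
  open import Data.List.Relation.Unary.AllPairs using ([]; _∷_)
  open import Data.List.Relation.Unary.Unique.Propositional using (Unique)
  import Data.List.Relation.Unary.Unique.Propositional.Properties as Unique
  open import Data.Vec as Vec using (Vec; lookup)
  open import Data.Product using (∃; _×_; _,_; proj₁; proj₂)
  open import Data.Sum using (inj₁; inj₂)
  open import Data.Empty using (⊥; ⊥-elim)
  open import Data.Unit using (tt)
  open import Function using (_∘_; id)
  open import Relation.Nullary using (¬_; Dec; yes; no; ⌊_⌋)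
  open import Relation.Nullary.Decidable using (dec-true; dec-false; isYes≗does)
  open import Relation.Binary.PropositionalEquality

  T⇒true : ∀ {x} → T x → x ≡ true
  T⇒true {true} _ = refl

  true⇒T : ∀ {x} → x ≡ true → T x
  true⇒T refl = tt

  ∈-filterᵇ⁺ : ∀ {A : Set} (p : A → Bool) {x xs} → x ∈ xs → p x ≡ true → x ∈ filterᵇ p xs
  ∈-filterᵇ⁺ p x∈ e = ∈-filter⁺ (T? ∘ p) x∈ (true⇒T e)

  ∈-filterᵇ⁻ : ∀ {A : Set} (p : A → Bool) {x} xs → x ∈ filterᵇ p xs → x ∈ xs × p x ≡ true
  ∈-filterᵇ⁻ p xs x∈ with ∈-filter⁻ (T? ∘ p) {xs = xs} x∈
  ... | x∈xs , t = x∈xs , T⇒true t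

  sumTo : (ℕ → ℕ) → ℕ → ℕ
  sumTo f zero = 0
  sumTo f (suc k) = f 0 + sumTo (f ∘ suc) k

  sumTo-cong : ∀ {f g} k → (∀ t → t < k → f t ≡ g t) → sumTo f k ≡ sumTo g k
  sumTo-cong zero e = refl
  sumTo-cong (suc k) e = cong₂ _+_ (e 0 z<s) (sumTo-cong k (λ t lt → e (suc t) (s≤s lt)))

  sumTo-0 : ∀ k → sumTo (λ _ → 0) k ≡ 0
  sumTo-0 zero = refl
  sumTo-0 (suc k) = sumTo-0 k

  sumTo-S : ∀ ns k → sumTo (nth ns) k ≡ S ns k
  sumTo-S ns zero = refl
  sumTo-S [] (suc k) = sumTo-0 k
  sumTo-S (n ∷ ns) (suc k) = cong (n +_) (sumTo-S ns k)

  sum-allFin : ∀ (f : ℕ → ℕ) k → sum (map (f ∘ toℕ) (allFin k)) ≡ sumTo f k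
  sum-allFin f k = trans (cong sum (map-tabulate {n = k} id (f ∘ toℕ))) (go f k)
    where
    go : ∀ (f : ℕ → ℕ) k → sum (tabulate {n = k} (f ∘ toℕ)) ≡ sumTo f k
    go f zero = refl
    go f (suc k) = cong (_ +_) (go (f ∘ suc) k)

  within : ℕ → ℕ → ℕ → Bool
  within x M t = not (t <ᵇ x) ∧ (t <ᵇ M)

  sumTo-within : ∀ f x M k → x ≤ M → M ≤ k → sumTo (λ t → if within x M t then f t else 0) k + sumTo f x ≡ sumTo f M
  sumTo-within f zero zero k _ _ = trans (+-identityʳ _) (sumTo-0 k)
  sumTo-within f zero (suc M) (suc k) _ (s≤s le) = trans (+-identityʳ _) (cong (f 0 +_) (trans (sym (+-identityʳ _)) (sumTo-within (f ∘ suc) zero M k z≤n le)))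
  sumTo-within f (suc x) (suc M) (suc k) (s≤s l) (s≤s le) = trans (lem _ (f 0) (sumTo (f ∘ suc) x)) (cong (f 0 +_) (sumTo-within (f ∘ suc) x M k l le))
    where
    lem : ∀ u v w → u + (v + w) ≡ v + (u + w)
    lem = solve-∀

  sum-filterᵇ : ∀ {A : Set} (p : A → Bool) (f : A → ℕ) xs → sum (map f (filterᵇ p xs)) ≡ sum (map (λ x → if p x then f x else 0) xs)
  sum-filterᵇ p f [] = refl
  sum-filterᵇ p f (x ∷ xs) with p x
  ... | true = cong (f x +_) (sum-filterᵇ p f xs)
  ... | false = sum-filterᵇ p f xs

  length-filterᵇ : ∀ {A : Set} (p : A → Bool) xs → length (filterᵇ p xs) ≡ sum (map (λ x → if p x then 1 else 0) xs)
  length-filterᵇ p [] = refl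
  length-filterᵇ p (x ∷ xs) with p x
  ... | true = cong suc (length-filterᵇ p xs)
  ... | false = length-filterᵇ p xs

  sumℤ-pos : ∀ {A : Set} (f : A → ℕ) xs → sumℤ (map (λ x → ℤ+ f x) xs) ≡ ℤ+ sum (map f xs)
  sumℤ-pos f [] = refl
  sumℤ-pos f (x ∷ xs) = cong (λ z → ℤ+ f x ℤ.+ z) (sumℤ-pos f xs)

  sumℤ-determined : ∀ {A : Set} (f g : A → ℤ) {i} xs → Unique xs → i ∈ xs → (∀ {j} → j ∈ xs → ¬ j ≡ i → f j ≡ g j) →
    sumℤ (map f xs) ≡ sumℤ (map g xs) → f i ≡ g i
  sumℤ-determined f g {i} (x ∷ xs) (x∉ ∷ u) (here refl) agree e =
    ℤGroup.∙-cancelʳ (sumℤ (map g xs)) (f i) (g i) (trans (cong (λ z → f i ℤ.+ z) (sym (tails xs (λ j∈ → agree (there j∈) (λ { refl → All.lookup x∉ j∈ refl }))))) e)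
    where
    tails : ∀ xs → (∀ {j} → j ∈ xs → f j ≡ g j) → sumℤ (map f xs) ≡ sumℤ (map g xs)
    tails [] h = refl
    tails (x ∷ xs) h = cong₂ ℤ._+_ (h (here refl)) (tails xs (h ∘ there))
  sumℤ-determined f g {i} (x ∷ xs) (x∉ ∷ u) (there i∈) agree e =
    sumℤ-determined f g xs u i∈ (agree ∘ there) (ℤGroup.∙-cancelˡ (g x) _ _ (trans (cong (ℤ._+ sumℤ (map f xs)) (sym (agree (here refl) (λ { refl → All.lookup x∉ i∈ refl })))) e))

  module _ {m : ℕ} (R : Rel m) (i : Fin m) where
    private
      step : Fin m → ℕ → ℕ
      step j acc = if rel R i j then toℕ j ⊔ acc else acc

    blockMax-≥ : ∀ j → rel R i j ≡ true → toℕ j ≤ blockMax R i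
    blockMax-≥ j e = go (allFin m) (∈-allFin j)
      where
      go : ∀ xs → j ∈ xs → toℕ j ≤ foldr step (toℕ i) xs
      go (x ∷ xs) (here refl) rewrite e = m≤m⊔n (toℕ j) _
      go (x ∷ xs) (there j∈) with rel R i x
      ... | true = ≤-trans (go xs j∈) (m≤n⊔m (toℕ x) _)
      ... | false = go xs j∈

    blockMax-attained : rel R i i ≡ true → ∃ λ j → rel R i j ≡ true × toℕ j ≡ blockMax R i
    blockMax-attained e = go (allFin m)
      where
      go : ∀ xs → ∃ λ j → rel R i j ≡ true × toℕ j ≡ foldr step (toℕ i) xs
      go [] = i , e , refl
      go (x ∷ xs) with rel R i x in eq
      ... | false = go xs
      ... | true with ⊔-sel (toℕ x) (foldr step (toℕ i) xs)
      ...   | inj₁ e₁ = x , eq , sym e₁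
      ...   | inj₂ e₂ = let j , ej , ej′ = go xs in j , ej , trans ej′ (sym e₂)

    isMin⁻ : isMin R i ≡ true → ∀ j → rel R i j ≡ true → toℕ i ≤ toℕ j
    isMin⁻ e j r = ≮⇒≥ λ j<i → contra (all-true (λ j → not ((toℕ j <ᵇ toℕ i) ∧ rel R i j)) (allFin m) e (∈-allFin j)) (<-true j<i)
      where
      contra : not ((toℕ j <ᵇ toℕ i) ∧ rel R i j) ≡ true → (toℕ j <ᵇ toℕ i) ≡ true → ⊥
      contra n l rewrite l | r with () ← n

    isMin⁺ : (∀ j → rel R i j ≡ true → toℕ i ≤ toℕ j) → isMin R i ≡ true
    isMin⁺ f = all-intro (λ j → not ((toℕ j <ᵇ toℕ i) ∧ rel R i j)) (allFin m) λ {j} _ → go j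
      where
      go : ∀ j → not ((toℕ j <ᵇ toℕ i) ∧ rel R i j) ≡ true
      go j with toℕ j <ᵇ toℕ i in l | rel R i j in r
      ... | false | _ = refl
      ... | true | false = refl
      ... | true | true = ⊥-elim (<⇒≱ (<ᵇ-true l) (f j r))

  not-<ᵇ : ∀ {m n} → n ≤ m → not (m <ᵇ n) ≡ true
  not-<ᵇ {m} {n} le with m <ᵇ n in e
  ... | false = refl
  ... | true = ⊥-elim (<⇒≱ (<ᵇ-true e) le)

  not-<ᵇ⁻ : ∀ {m n} → not (m <ᵇ n) ≡ true → n ≤ m
  not-<ᵇ⁻ {m} {n} e = ≮⇒≥ λ lt → contra (<-true lt) e
    where
    contra : (m <ᵇ n) ≡ true → not (m <ᵇ n) ≡ true → ⊥
    contra p q rewrite p with () ← q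

  -- Blocks strictly nested in B have smaller spread, so the defining equations determine the ranks one by one.
  rank-unique : ∀ {m} a b (R : Rel m) (rk rk′ : Fin m → ℤ) → (∀ i → rel R i i ≡ true) → IsRankFn a b R rk → IsRankFn a b R rk′ →
    ∀ i → isMin R i ≡ true → rk i ≡ rk′ i
  rank-unique {m} a b R rk rk′ rfl isr isr′ i min = go (suc (blockMax R i ∸ toℕ i)) i ≤-refl min
    where
    nest : Fin m → Fin m → Bool
    nest i i′ = isMin R i′ ∧ nestedIn R i′ i
    go : ∀ n i → blockMax R i ∸ toℕ i < n → isMin R i ≡ true → rk i ≡ rk′ i
    go (suc n) i (s≤s lt) min = sumℤ-determined rk rk′ (filterᵇ (nest i) (allFin m)) (Unique.filter⁺ (T? ∘ nest i) (Unique.allFin⁺ m))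
      (∈-filterᵇ⁺ (nest i) (∈-allFin i) (cong₂ _∧_ min (cong₂ _∧_ (not-<ᵇ {toℕ i} ≤-refl) (not-<ᵇ {blockMax R i} ≤-refl))))
      smaller-rank (trans (isr i min) (sym (isr′ i min)))
      where
      smaller-rank : ∀ {j} → j ∈ filterᵇ (nest i) (allFin m) → ¬ j ≡ i → rk j ≡ rk′ j
      smaller-rank {j} j∈ j≢i with ∧-true {isMin R j} (proj₂ (∈-filterᵇ⁻ (nest i) (allFin m) j∈))
      ... | minj , nested with ∧-true {not (toℕ j <ᵇ toℕ i)} nested
      ...   | l , u = go n j (<-≤-trans (≤-<-trans (∸-monoˡ-≤ (toℕ j) bm≤) (∸-monoʳ-< i<j (≤-trans (blockMax-≥ R j j (rfl j)) bm≤))) lt) minj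
        where
        bm≤ : blockMax R j ≤ blockMax R i
        bm≤ = not-<ᵇ⁻ {blockMax R i} u
        i<j : toℕ i < toℕ j
        i<j = ≤∧≢⇒< (not-<ᵇ⁻ {toℕ j} l) (λ e → j≢i (Fin.toℕ-injective (sym e)))

  true≢false : ¬ true ≡ false
  true≢false ()

  rank-test : ∀ (min : Bool) (rk : ℤ) n t → (min ≡ true → rk ≡ ℤ+ n) → (min ≡ false → n ≡ 0) →
    (if min ∧ ⌊ rk ℤ.≟ ℤ+ suc t ⌋ then 1 else 0) ≡ δ (suc t) n
  rank-test false rk n t _ z rewrite z refl = refl
  rank-test true rk n t f _ = trans (cong (λ z → if ⌊ z ℤ.≟ ℤ+ suc t ⌋ then 1 else 0) (f refl)) (go (n ≟ suc t))
    where
    go : Dec (n ≡ suc t) → (if ⌊ ℤ+ n ℤ.≟ ℤ+ suc t ⌋ then 1 else 0) ≡ δ (suc t) n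
    go (yes refl) = trans (cong (if_then 1 else 0) (trans (isYes≗does (ℤ+ suc t ℤ.≟ ℤ+ suc t)) (dec-true (ℤ+ suc t ℤ.≟ ℤ+ suc t) refl))) (sym (δ-refl (suc t)))
    go (no ne) = trans (cong (if_then 1 else 0) (trans (isYes≗does (ℤ+ n ℤ.≟ ℤ+ suc t)) (dec-false (ℤ+ n ℤ.≟ ℤ+ suc t) (ne ∘ ℤ.+-injective)))) (sym (δ-≢ (ne ∘ sym)))

  module RankBase (a m : ℕ) (0<a : 0 < a) (a≤m : a ≤ m) (cop : Coprime a (suc m)) where
    open PathBase a m 0<a a≤m cop public

    related-refl : ∀ {ns} → DW ns → ∀ i → rel (πW ns) i i ≡ true
    related-refl D i = related⁺ D i i (let x , p = parent D z<s (Fin.toℕ<n i) in x , p , p)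

    module _ {ns : List ℕ} (D : DW ns) where
      private
        R = πW ns
        H = h ns

      -- A positive letter at `t` makes `t` the parent of label `t + 1`, so all labels of that block
      -- lie beyond `t`.
      minimal⁺ : ∀ i → 0 < nth ns (toℕ i) → isMin R i ≡ true
      minimal⁺ i pos = isMin⁺ R i λ j e → go j (related⁻ D i j e)
        where
        go : ∀ j → SameBlock H (suc (toℕ i)) (suc (toℕ j)) → toℕ i ≤ toℕ j
        go j (x , p , q) = s≤s⁻¹ (subst (_< suc (toℕ j)) (par-unique p (h-rise D (Fin.toℕ<n i) pos)) (before q))

      minimal⁻ : ∀ i → isMin R i ≡ true → 0 < nth ns (toℕ i)
      minimal⁻ i min with parent D z<s (Fin.toℕ<n i)
      ... | x , p = subst (λ t → 0 < nth ns t) x≡i (par-nth D (Fin.toℕ<n i) p)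
        where
        x<m : x < m
        x<m = <-≤-trans (before p) (Fin.toℕ<n i)
        x≡i : x ≡ toℕ i
        x≡i = ≤-antisym (s≤s⁻¹ (before p)) (subst (toℕ i ≤_) (Fin.toℕ-fromℕ< x<m)
          (isMin⁻ R i min (fromℕ< x<m) (related⁺ D i (fromℕ< x<m) (x , p , subst (λ t → Par H x (suc t)) (sym (Fin.toℕ-fromℕ< x<m)) (par-child p)))))

      private
        module MinBlock (i : Fin m) (pos : 0 < nth ns (toℕ i)) where
          x = toℕ i
          M = suc (blockMax R i)

          rise : Par H x (suc x)
          rise = h-rise D (Fin.toℕ<n i) pos

          child-of : ∀ j → rel R i j ≡ true → Par H x (suc (toℕ j))
          child-of j e with related⁻ D i j e
          ... | y , p , q = subst (λ y → Par H y (suc (toℕ j))) (par-unique p rise) q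

          last : Par H x M
          last with blockMax-attained R i (related-refl D i)
          ... | j , e , eq = subst (λ t → Par H x (suc t)) eq (child-of j e)

          M≤m : M ≤ m
          M≤m with blockMax-attained R i (related-refl D i)
          ... | j , e , eq = subst (_< m) eq (Fin.toℕ<n j)

          x<M : x < M
          x<M = before last

          is-last : ∀ y → y ≤ m → Par H x y → y ≤ M
          is-last (suc y) y≤m p = s≤s (subst (_≤ blockMax R i) (Fin.toℕ-fromℕ< y≤m)
            (blockMax-≥ R i (fromℕ< y≤m) (related⁺ D i (fromℕ< y≤m) (x , rise , subst (λ t → Par H x (suc t)) (sym (Fin.toℕ-fromℕ< y≤m)) p))))

          -- Otherwise the first position after M with level below h M would be a further child of x.
          last-low : H M ≤ H x + a
          last-low = ≮⇒≥ λ big → search big (m ∸ M) M (m+[n∸m]≡n M≤m) ≤-refl (λ k x<k k≤M → par-above last k x<k k≤M)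
            where
            search : H x + a < H M → ∀ d y → y + d ≡ m → M ≤ y → (∀ k → x < k → k ≤ y → H M ≤ H k) → ⊥
            search big zero y e M≤y above = <⇒≱ big (≤-trans (above m (<-≤-trans x<M M≤m) (≤-reflexive (trans (sym e) (+-identityʳ y))))
              (≤-trans (≤-reflexive (h-m D)) (m≤n+m a (H x))))
            search big (suc d) y e M≤y above with H M ≤? H (suc y)
            ... | yes le = search big d (suc y) (trans (sym (+-suc y d)) e) (≤-trans M≤y (n≤1+n y)) above′
              where
              above′ : ∀ k → x < k → k ≤ suc y → H M ≤ H k
              above′ k x<k k≤ with m≤n⇒m<n∨m≡n k≤
              ... | inj₁ (s≤s k≤y) = above k x<k k≤y
              ... | inj₂ refl = le
            ... | no ≰ = <⇒≱ (s≤s M≤y) (is-last (suc y) y<m (par (≤-trans x<M (≤-trans M≤y (n≤1+n y)))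
                  (+-cancelʳ-< a _ _ (<-≤-trans big (≤-trans (above y (<-≤-trans x<M M≤y) ≤-refl) (≤-trans (m≤m+n (H y) _) (≤-reflexive (sym (h-step D y y<m)))))))
                  (λ k x<k k<y → ≤-trans (<⇒≤ (≰⇒> ≰)) (above k x<k (s≤s⁻¹ k<y)))))
              where
              y<m : y < m
              y<m = subst (y <_) e (m<m+n y z<s)

          -- Here `M ∸ x` is the spread of the block, maximum minus minimum plus 1. The difference
          -- `b W - a (M - x)` equals `H M - H x`, which is between 0 and `a ≤ m` by `last-low`;
          -- therefore `W` is the ceiling.
          weight : ∃ λ W → S ns M ≡ W + S ns x × ceilDiv ((M ∸ x) * a) b ≡ W
          weight = W , SM , (begin
            ((M ∸ x) * a + m) / b      ≡⟨ cong (_/ b) num ⟩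
            (q + W * b) / b            ≡⟨ +-distrib-/-∣ʳ q {d = b} (divides-refl W) ⟩
            q / b + W * b / b          ≡⟨ cong₂ _+_ (m<n⇒m/n≡0 (s≤s (m∸n≤m m e))) (m*n/n≡m W b) ⟩
            W ∎)
            where
            open ≡-Reasoning
            W = S (List.drop x ns) (M ∸ x)
            e = H M ∸ H x
            q = m ∸ e
            e-eq : e + H x ≡ H M
            e-eq = m∸n+n≡m (<⇒≤ (smaller last))
            e≤m : e ≤ m
            e≤m = ≤-trans (+-cancelʳ-≤ (H x) _ _ (≤-trans (≤-reflexive e-eq) (≤-trans last-low (≤-reflexive (+-comm (H x) a))))) a≤m
            SM : S ns M ≡ W + S ns x
            SM = trans (cong (S ns) (sym (m+[n∸m]≡n (<⇒≤ x<M)))) (trans (S-+ ns x (M ∸ x)) (+-comm (S ns x) W))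
            bW : b * W ≡ e + a * (M ∸ x)
            bW = +-cancelʳ-≡ (H x + a * x) _ _ (begin
              b * W + (H x + a * x)           ≡⟨ cong (b * W +_) (h-eq D x (≤-trans (<⇒≤ x<M) M≤m)) ⟩
              b * W + b * S ns x              ≡⟨ *-distribˡ-+ b W (S ns x) ⟨
              b * (W + S ns x)                ≡⟨ cong (b *_) SM ⟨
              b * S ns M                      ≡⟨ h-eq D M M≤m ⟨
              H M + a * M                     ≡⟨ cong₂ (λ u v → u + a * v) (sym e-eq) (sym (m∸n+n≡m (<⇒≤ x<M))) ⟩
              e + H x + a * (M ∸ x + x)       ≡⟨ lem e (H x) a (M ∸ x) x ⟩
              e + a * (M ∸ x) + (H x + a * x) ∎)
              where
              lem : ∀ e u a d x → e + u + a * (d + x) ≡ e + a * d + (u + a * x)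
              lem = solve-∀
            num : (M ∸ x) * a + m ≡ q + W * b
            num = +-cancelʳ-≡ e _ _ (begin
              (M ∸ x) * a + m + e       ≡⟨ lem (M ∸ x) a m e ⟩
              m + (e + a * (M ∸ x))     ≡⟨ cong₂ _+_ (sym (m∸n+n≡m e≤m)) (trans (sym bW) (*-comm b W)) ⟩
              q + e + W * b             ≡⟨ lem′ q e (W * b) ⟩
              q + W * b + e ∎)
              where
              lem : ∀ d a m e → d * a + m + e ≡ m + (e + a * d)
              lem = solve-∀
              lem′ : ∀ x y z → x + y + z ≡ x + z + y
              lem′ = solve-∀

          -- A block that starts inside the given one also ends inside it, by `noncrossing`. So
          -- being nested only constrains the minimum, and the other positions carry the letter 0.
          nested-term : ∀ i′ → (if isMin R i′ ∧ nestedIn R i′ i then nth ns (toℕ i′) else 0) ≡ (if within x M (toℕ i′) then nth ns (toℕ i′) else 0)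
          nested-term i′ with nth ns (toℕ i′) in eq
          ... | zero = trans (if-same (isMin R i′ ∧ nestedIn R i′ i)) (sym (if-same (within x M (toℕ i′))))
            where
            if-same : ∀ c → (if c then 0 else 0) ≡ 0
            if-same true = refl
            if-same false = refl
          ... | suc n = cong (if_then suc n else 0) (trans (cong (_∧ nestedIn R i′ i) (minimal⁺ i′ pos′)) nested)
            where
            pos′ : 0 < nth ns (toℕ i′)
            pos′ = subst (0 <_) (sym eq) z<s
            bm≥ : toℕ i′ ≤ blockMax R i′
            bm≥ = blockMax-≥ R i′ i′ (related-refl D i′)
            last′ : Par H (toℕ i′) (suc (blockMax R i′))
            last′ with blockMax-attained R i′ (related-refl D i′)
            ... | j , e , eqj with related⁻ D i′ j e
            ...   | y , p , q = subst (λ t → Par H (toℕ i′) (suc t)) eqj (subst (λ y → Par H y (suc (toℕ j))) (par-unique p (h-rise D (Fin.toℕ<n i′) pos′)) q)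
            nested : nestedIn R i′ i ≡ within x M (toℕ i′)
            nested with toℕ i′ <ᵇ x in l
            ... | true = refl
            ... | false = bool-ext
                (λ e → <-true (s≤s (≤-trans bm≥ (not-<ᵇ⁻ {blockMax R i} e))))
                (λ e → not-<ᵇ {blockMax R i} (inside (s≤s⁻¹ (<ᵇ-true e))))
              where
              x≤ : x ≤ toℕ i′
              x≤ = not-<ᵇ⁻ {toℕ i′} (cong not l)
              inside : toℕ i′ ≤ blockMax R i → blockMax R i′ ≤ blockMax R i
              inside t≤ with m≤n⇒m<n∨m≡n x≤
              ... | inj₂ e = ≤-reflexive (cong (blockMax R) (Fin.toℕ-injective (sym e)))
              ... | inj₁ x<t = ≮⇒≥ λ lt → noncrossing x<t (s≤s t≤) (s≤s lt) last last′

      rank-of-word : IsRankFn a b R (λ i → ℤ+ nth ns (toℕ i))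
      rank-of-word i min = trans (sumℤ-pos (nth ns ∘ toℕ) (filterᵇ nest (allFin m))) (cong ℤ+_ (trans (+-cancelʳ-≡ (S ns x) _ _ (begin
          sum (map (nth ns ∘ toℕ) (filterᵇ nest (allFin m))) + S ns x
            ≡⟨ cong (_+ S ns x) (sum-filterᵇ nest (nth ns ∘ toℕ) (allFin m)) ⟩
          sum (map (λ i′ → if nest i′ then nth ns (toℕ i′) else 0) (allFin m)) + S ns x
            ≡⟨ cong (λ l → sum l + S ns x) (map-cong nested-term (allFin m)) ⟩
          sum (map (λ i′ → if within x M (toℕ i′) then nth ns (toℕ i′) else 0) (allFin m)) + S ns x
            ≡⟨ cong₂ _+_ (sum-allFin (λ t → if within x M t then nth ns t else 0) m) (sym (sumTo-S ns x)) ⟩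
          sumTo (λ t → if within x M t then nth ns t else 0) m + sumTo (nth ns) x
            ≡⟨ sumTo-within (nth ns) x M m (<⇒≤ x<M) M≤m ⟩
          sumTo (nth ns) M
            ≡⟨ sumTo-S ns M ⟩
          S ns M
            ≡⟨ proj₁ (proj₂ weight) ⟩
          proj₁ weight + S ns x ∎)) (sym (proj₂ (proj₂ weight)))))
        where
        open ≡-Reasoning
        open MinBlock i (minimal⁻ i min)
        nest : Fin m → Bool
        nest i′ = isMin R i′ ∧ nestedIn R i′ i

      cnt-as-sum : ∀ v → sumTo (λ t → δ v (nth ns t)) m ≡ cnt v ns
      cnt-as-sum v = trans (cong (sumTo _) (sym (DW.len D))) (go ns)
        where
        go : ∀ ns → sumTo (λ t → δ v (nth ns t)) (length ns) ≡ cnt v ns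
        go [] = refl
        go (n ∷ ns) = cong (δ v n +_) (go ns)

      blocks-count : ∀ rk → IsRankFn a b R rk → ∀ t → blocksOfRank R rk (suc t) ≡ cnt (suc t) ns
      blocks-count rk isr t = trans (length-filterᵇ q (allFin m)) (trans (cong sum (map-cong term (allFin m)))
        (trans (sum-allFin (λ u → δ (suc t) (nth ns u)) m) (cnt-as-sum (suc t))))
        where
        q : Fin m → Bool
        q i = isMin R i ∧ ⌊ rk i ℤ.≟ ℤ+ suc t ⌋
        zero-weight : ∀ i → isMin R i ≡ false → nth ns (toℕ i) ≡ 0
        zero-weight i min = n≤0⇒n≡0 (≮⇒≥ λ pos → true≢false (trans (sym (minimal⁺ i pos)) min))
        term : ∀ i → (if q i then 1 else 0) ≡ δ (suc t) (nth ns (toℕ i))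
        term i = rank-test (isMin R i) (rk i) (nth ns (toℕ i)) t
          (rank-unique a b R rk (λ i → ℤ+ nth ns (toℕ i)) (related-refl D) isr rank-of-word i) (zero-weight i)

    -- At a block minimum the letter is the rank, which the partition determines; at all other
    -- positions it is 0.
    π-injective : ∀ {ns ns′} → DW ns → DW ns′ → πW ns ≡ πW ns′ → ns ≡ ns′
    π-injective {ns} {ns′} D D′ e = nth-ext ns ns′ (trans (DW.len D) (sym (DW.len D′))) λ t lt →
      subst (λ u → nth ns u ≡ nth ns′ u) (Fin.toℕ-fromℕ< (subst (t <_) (DW.len D) lt)) (go (fromℕ< (subst (t <_) (DW.len D) lt)))
      where
      go : ∀ i → nth ns (toℕ i) ≡ nth ns′ (toℕ i)
      go i = same-weight (isMin (πW ns) i)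
        (λ min → ℤ.+-injective (rank-unique a b (πW ns) (λ i → ℤ+ nth ns (toℕ i)) (λ i → ℤ+ nth ns′ (toℕ i)) (related-refl D)
              (rank-of-word D) (subst (λ R → IsRankFn a b R (λ i → ℤ+ nth ns′ (toℕ i))) (sym e) (rank-of-word D′)) i min))
        (minimal⁺ D i) (λ pos → trans (cong (λ R → isMin R i) e) (minimal⁺ D′ i pos))
        where
        same-weight : ∀ c {n n′} → (c ≡ true → n ≡ n′) → (0 < n → c ≡ true) → (0 < n′ → c ≡ true) → n ≡ n′
        same-weight true f _ _ = f refl
        same-weight false {zero} {zero} _ _ _ = refl
        same-weight false {suc n} _ g _ with () ← g z<s
        same-weight false {zero} {suc n} _ _ g with () ← g z<s

    Content : Vec ℕ a → List ℕ → Set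
    Content r ns = ∀ (t : Fin a) → cnt (suc (toℕ t)) ns ≡ lookup r t

    InX⇒word : ∀ {r π} → InX a b r π → ∃ λ ns → DW ns × Content r ns × πW ns ≡ π
    InX⇒word {r} {π} ((P , dy , e) , rk , isr , prof) with word-of dy
    ... | ns , D , refl = ns , D , (λ t → trans (sym (blocks-count D rk (subst (λ R → IsRankFn a b R rk) (sym e′) isr) (toℕ t)))
          (trans (cong (λ R → blocksOfRank R rk (suc (toℕ t))) e′) (prof t))) , e′
      where
      e′ : πW ns ≡ π
      e′ = trans (πW-def ns) e

    word⇒InX : ∀ {r ns} → DW ns → Content r ns → InX a b r (πW ns)
    word⇒InX {r} {ns} D co = (path ns , path-Dyck D , sym (πW-def ns)) , (λ i → ℤ+ nth ns (toℕ i)) , rank-of-word D ,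
      λ t → trans (blocks-count D _ (rank-of-word D) (toℕ t)) (co t)

-- Rotation of partitions realised by changes of base.

module Rotation where

  open import Defs
  open Parents
  open Words
  open DyckWords
  open DyckPaths
  open Ranks
  open import Data.Nat
  open import Data.Nat.Properties
  open import Data.Nat.DivMod using (m%n<n; m<n⇒m%n≡m; [m+n]%n≡m%n; [m+kn]%n≡m%n; m≡m%n+[m/n]*n; n%n≡0)
  open import Data.Nat.Coprimality using (Coprime)
  open import Data.Nat.Tactic.RingSolver using (solve-∀)
  open import Data.Bool using (Bool; true)
  open import Data.Fin as Fin using (Fin; toℕ; fromℕ<)
  import Data.Fin.Properties as Fin
  open import Data.List as List using (List; []; _∷_; _++_; length; take; drop)
  open import Data.List.Properties using (++-assoc; length-++; take++drop≡id; length-take)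
  open import Data.Vec as Vec using (Vec; lookup)
  import Data.Vec.Properties as Vec
  open import Data.Product using (∃; _×_; _,_)
  open import Data.Sum using (inj₁; inj₂)
  open import Data.Empty using (⊥-elim)
  open import Function using (_∘_)
  open import Relation.Nullary using (yes; no)
  open import Relation.Binary.PropositionalEquality

  suc-% : ∀ t m .{{_ : NonZero m}} → suc t % m ≡ suc (t % m) % m
  suc-% t m = trans (cong (λ u → suc u % m) (m≡m%n+[m/n]*n t m)) ([m+kn]%n≡m%n (suc (t % m)) (t / m) m)

  +-% : ∀ x t m .{{_ : NonZero m}} → (x + t) % m ≡ (x + t % m) % m
  +-% x t m = trans (cong (λ u → (x + u) % m) (m≡m%n+[m/n]*n t m)) (trans (cong (_% m) (sym (+-assoc x (t % m) _))) ([m+kn]%n≡m%n (x + t % m) (t / m) m))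

  module _ {m : ℕ} .{{_ : NonZero m}} where

    idx : ℕ → Fin m
    idx t = fromℕ< (m%n<n t m)

    toℕ-idx : ∀ t → toℕ (idx t) ≡ t % m
    toℕ-idx t = Fin.toℕ-fromℕ< (m%n<n t m)

    -- The relation on all natural numbers, read modulo `m`, which makes rotations into
    -- translations.
    β : Rel m → ℕ → ℕ → Bool
    β R t t′ = rel R (idx t) (idx t′)

    idx-cong : ∀ {t t′} → t % m ≡ t′ % m → idx t ≡ idx t′
    idx-cong {t} {t′} e = Fin.toℕ-injective (trans (toℕ-idx t) (trans e (sym (toℕ-idx t′))))

    idx-toℕ : ∀ i → idx (toℕ i) ≡ i
    idx-toℕ i = Fin.toℕ-injective (trans (toℕ-idx (toℕ i)) (m<n⇒m%n≡m (Fin.toℕ<n i)))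

    β-ext : ∀ R R′ → (∀ t t′ → β R t t′ ≡ β R′ t t′) → R ≡ R′
    β-ext R R′ e = vec-ext R R′ λ i → vec-ext _ _ λ j → subst₂ (λ i j → rel R i j ≡ rel R′ i j) (idx-toℕ i) (idx-toℕ j) (e (toℕ i) (toℕ j))
      where
      vec-ext : ∀ {A : Set} {n} (u v : Vec A n) → (∀ i → lookup u i ≡ lookup v i) → u ≡ v
      vec-ext u v e = trans (sym (Vec.tabulate∘lookup u)) (trans (Vec.tabulate-cong e) (Vec.tabulate∘lookup v))

    β-+* : ∀ R k t t′ → β R (t + k * m) (t′ + k * m) ≡ β R t t′
    β-+* R k t t′ = cong₂ (rel R) (idx-cong ([m+kn]%n≡m%n t k m)) (idx-cong ([m+kn]%n≡m%n t′ k m))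

  rotInv-suc : ∀ {n} (i j : Fin (suc n)) → suc (toℕ j) % suc n ≡ toℕ i → rotInv i ≡ j
  rotInv-suc {n} Fin.zero j e with m≤n⇒m<n∨m≡n (Fin.toℕ<n j)
  ... | inj₁ lt = ⊥-elim (0≢1+n (trans (sym e) (m<n⇒m%n≡m lt)))
  ... | inj₂ eq = Fin.toℕ-injective (trans (Fin.toℕ-fromℕ n) (sym (suc-injective eq)))
  rotInv-suc {n} (Fin.suc i) j e with m≤n⇒m<n∨m≡n (Fin.toℕ<n j)
  ... | inj₁ lt = Fin.toℕ-injective (trans (Fin.toℕ-inject₁ i) (suc-injective (trans (sym e) (m<n⇒m%n≡m lt))))
  ... | inj₂ eq = ⊥-elim (0≢1+n (trans (sym (trans (cong (_% suc n) eq) (n%n≡0 (suc n)))) e))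

  rel-rot : ∀ {m} (R : Rel m) i j → rel (rot R) i j ≡ rel R (rotInv i) (rotInv j)
  rel-rot R i j = trans (cong (λ v → lookup v j) (Vec.lookup∘tabulate _ i)) (Vec.lookup∘tabulate _ j)

  β-rot : ∀ {n} (R : Rel (suc n)) t t′ → β (rot R) (suc t) (suc t′) ≡ β R t t′
  β-rot {n} R t t′ = trans (rel-rot R (idx (suc t)) (idx (suc t′))) (cong₂ (rel R) (go t) (go t′))
    where
    go : ∀ t → rotInv (idx {suc n} (suc t)) ≡ idx t
    go t = rotInv-suc (idx (suc t)) (idx t) (trans (cong (λ u → suc u % suc n) (toℕ-idx t)) (trans (sym (suc-% t (suc n))) (sym (toℕ-idx (suc t)))))

  β-rotIter : ∀ {n} d (R : Rel (suc n)) t t′ → β (rotIter d R) (d + t) (d + t′) ≡ β R t t′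
  β-rotIter zero R t t′ = refl
  β-rotIter (suc d) R t t′ = trans (β-rot (rotIter d R) (d + t) (d + t′)) (β-rotIter d R t t′)

  Invariant : ∀ {m} .{{_ : NonZero m}} → Rel m → ℕ → Set
  Invariant R d = ∀ t t′ → β R (d + t) (d + t′) ≡ β R t t′

  rot-fixed⇒invariant : ∀ {n} d (R : Rel (suc n)) → rotIter d R ≡ R → Invariant R d
  rot-fixed⇒invariant d R e t t′ = trans (cong (λ R → β R (d + t) (d + t′)) (sym e)) (β-rotIter d R t t′)

  invariant⇒rot-fixed : ∀ {n} d (R : Rel (suc n)) → Invariant R d → rotIter d R ≡ R
  invariant⇒rot-fixed {n} d R inv = β-ext (rotIter d R) R λ t t′ → begin
    -- Adding `d m` to both indices exposes a summand `d` without changing their residues.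
    β (rotIter d R) t t′                                     ≡⟨ β-+* (rotIter d R) d t t′ ⟨
    β (rotIter d R) (t + d * suc n) (t′ + d * suc n)         ≡⟨ cong₂ (β (rotIter d R)) (lem t d n) (lem t′ d n) ⟩
    β (rotIter d R) (d + (t + d * n)) (d + (t′ + d * n))     ≡⟨ β-rotIter d R (t + d * n) (t′ + d * n) ⟩
    β R (t + d * n) (t′ + d * n)                             ≡⟨ inv (t + d * n) (t′ + d * n) ⟨
    β R (d + (t + d * n)) (d + (t′ + d * n))                 ≡⟨ cong₂ (β R) (lem t d n) (lem t′ d n) ⟨
    β R (t + d * suc n) (t′ + d * suc n)                     ≡⟨ β-+* R d t t′ ⟩
    β R t t′ ∎
    where
    open ≡-Reasoning
    lem : ∀ t d n → t + d * suc n ≡ d + (t + d * n)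
    lem = solve-∀

  cnt-swap : ∀ v us vs → cnt v (vs ++ us) ≡ cnt v (us ++ vs)
  cnt-swap v us vs = trans (cnt-++ v vs us) (trans (+-comm (cnt v vs) (cnt v us)) (sym (cnt-++ v us vs)))

  split-at : ∀ (ns : List ℕ) x → x ≤ length ns → ∃ λ us → ∃ λ vs → ns ≡ us ++ vs × length us ≡ x
  split-at ns x le = take x ns , drop x ns , sym (take++drop≡id x ns) , trans (length-take x ns) (m≤n⇒m⊓n≡m le)

  module ShiftBase (a m : ℕ) (0<a : 0 < a) (a≤m : a ≤ m) (cop : Coprime a (suc m)) where
    open RankBase a m 0<a a≤m cop public

    0<m : 0 < m
    0<m = <-≤-trans 0<a a≤m

    instance
      m-nonZero : NonZero m
      m-nonZero = >-nonZero 0<m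

    B : List ℕ → ℕ → ℕ → Bool
    B ns = β (πW ns)

    B⁻ : ∀ {ns} → DW ns → ∀ t t′ → B ns t t′ ≡ true → SameBlock (h ns) (suc (t % m)) (suc (t′ % m))
    B⁻ {ns} D t t′ e = subst₂ (λ u v → SameBlock (h ns) (suc u) (suc v)) (toℕ-idx t) (toℕ-idx t′) (related⁻ D (idx t) (idx t′) e)

    B⁺ : ∀ {ns} → DW ns → ∀ t t′ → SameBlock (h ns) (suc (t % m)) (suc (t′ % m)) → B ns t t′ ≡ true
    B⁺ {ns} D t t′ s = related⁺ D (idx t) (idx t′) (subst₂ (λ u v → SameBlock (h ns) (suc u) (suc v)) (sym (toℕ-idx t)) (sym (toℕ-idx t′)) s)

    -- `w` is the rank of the block of index `t`, indices counted from 0 modulo `m`. It is attached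
    -- to every label of the block and so does not depend on the base.
    record Weight (ns : List ℕ) (t w : ℕ) : Set where
      constructor weight
      field
        {source} : ℕ
        isPar    : Par (h ns) source (suc (t % m))
        value    : nth ns source ≡ w

    weight-unique : ∀ {ns t w w′} → Weight ns t w → Weight ns t w′ → w ≡ w′
    weight-unique {ns} (weight p refl) (weight p′ refl) = cong (nth ns) (par-unique p p′)

    weight-exists : ∀ {ns} → DW ns → ∀ t → ∃ (Weight ns t)
    weight-exists D t = let x , p = parent D z<s (m%n<n t m) in _ , weight p refl

    weight-+* : ∀ {ns t w} k → Weight ns (t + k * m) w → Weight ns t w
    weight-+* {ns} {t} k (weight {x} p e) = weight (subst (λ u → Par (h ns) x (suc u)) ([m+kn]%n≡m%n t k m) p) e

    weight-+*⁻ : ∀ {ns t w} k → Weight ns t w → Weight ns (t + k * m) w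
    weight-+*⁻ {ns} {t} k (weight {x} p e) = weight (subst (λ u → Par (h ns) x (suc u)) (sym ([m+kn]%n≡m%n t k m)) p) e

    -- The partition of ns′, with its weights, is the partition of ns turned back by x.
    record Shifted (x : ℕ) (ns ns′ : List ℕ) : Set where
      constructor shifted
      field
        blocks  : ∀ t t′ → B ns′ t t′ ≡ B ns (x + t) (x + t′)
        weights : ∀ t w → Weight ns (x + t) w → Weight ns′ t w
    open Shifted public

    shifted-refl : ∀ {ns} → Shifted 0 ns ns
    shifted-refl = shifted (λ _ _ → refl) (λ _ _ w → w)

    shifted-trans : ∀ {x y ns ns′ ns″} → Shifted x ns ns′ → Shifted y ns′ ns″ → Shifted (x + y) ns ns″
    shifted-trans {x} {y} {ns} s s′ = shifted
      (λ t t′ → trans (blocks s′ t t′) (trans (blocks s (y + t) (y + t′)) (cong₂ (B ns) (sym (+-assoc x y t)) (sym (+-assoc x y t′)))))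
      (λ t w wt → weights s′ t w (weights s (y + t) w (subst (λ u → Weight ns u w) (+-assoc x y t) wt)))

    private
      move : ∀ x k t → x + k * m + t ≡ x + t + k * m
      move x k t = trans (+-assoc x (k * m) t) (trans (cong (x +_) (+-comm (k * m) t)) (sym (+-assoc x t (k * m))))

    shifted-drop : ∀ {x ns ns′} k → Shifted (x + k * m) ns ns′ → Shifted x ns ns′
    shifted-drop {x} {ns} k s = shifted
      (λ t t′ → trans (blocks s t t′) (trans (cong₂ (B ns) (move x k t) (move x k t′)) (β-+* (πW ns) k (x + t) (x + t′))))
      (λ t w wt → weights s t w (subst (λ u → Weight ns u w) (sym (move x k t)) (weight-+*⁻ k wt)))

    shifted-add : ∀ {x ns ns′} k → Shifted x ns ns′ → Shifted (x + k * m) ns ns′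
    shifted-add {x} {ns} k s = shifted
      (λ t t′ → trans (blocks s t t′) (sym (trans (cong₂ (B ns) (move x k t) (move x k t′)) (β-+* (πW ns) k (x + t) (x + t′)))))
      (λ t w wt → weights s t w (weight-+* k (subst (λ u → Weight ns u w) (move x k t) wt)))

    moved : ∀ x p → x + p ≡ m → ∀ t → Moved x p (suc (t % m)) (suc ((x + t) % m))
    moved x p e t = subst (λ u → Moved x p (suc (t % m)) (suc u)) (sym (+-% x t m)) (go (t % m) (m%n<n t m))
      where
      go : ∀ s → s < m → Moved x p (suc s) (suc ((x + s) % m))
      go s s<m with s <? p
      ... | yes s<p = subst (Moved x p (suc s)) (trans (+-suc x s) (cong suc (sym (m<n⇒m%n≡m (subst (x + s <_) e (+-monoʳ-< x s<p)))))) (near z<s s<p)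
      ... | no s≮p = subst₂ (Moved x p) (trans (+-suc p j) (cong suc p+j)) (cong suc (sym j-eq)) (far z<s j<x)
        where
        j = s ∸ p
        p+j : p + j ≡ s
        p+j = m+[n∸m]≡n (≮⇒≥ s≮p)
        j<x : j < x
        j<x = +-cancelˡ-< p j x (subst₂ _<_ (sym p+j) (trans (sym e) (+-comm x p)) s<m)
        j-eq : (x + s) % m ≡ j
        j-eq = trans (cong (_% m) (trans (cong (x +_) (sym p+j)) (trans (sym (+-assoc x p j)) (trans (cong (_+ j) e) (+-comm m j)))))
          (trans ([m+n]%n≡m%n j m) (m<n⇒m%n≡m (<-≤-trans j<x (subst (x ≤_) e (m≤m+n x p)))))

    transport⇒shifted : ∀ {ns ns′ x p} → DW ns → DW ns′ → x + p ≡ m → (tr : Transport (h ns) (h ns′) x p) →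
      (∀ {y z} → Transport.T tr y z → nth ns′ z ≡ nth ns y) → Shifted x ns ns′
    transport⇒shifted {ns} {ns′} {x} {p} D D′ e tr wts = shifted
      (λ t t′ → bool-ext
        (λ b → B⁺ D (x + t) (x + t′) (backward (moved x p e t) (moved x p e t′) (B⁻ D′ t t′ b)))
        (λ b → B⁺ D′ t t′ (forward (moved x p e t) (moved x p e t′) (B⁻ D (x + t) (x + t′) b))))
      λ { t w (weight q refl) → let z , r , q′ = parents (moved x p e t) q in weight q′ (wts r) }
      where open Transport tr

    region-shift : ∀ us vs → DW (us ++ vs) → DW (vs ++ us) → Shifted (length us) (us ++ vs) (vs ++ us)
    region-shift us vs D D′ = transport⇒shifted D D′ (DW-length us vs D) (Region.transport us vs D D′) wts
      where
      wts : ∀ {y z} → T₀ (length us) (length vs) y z → nth (vs ++ us) z ≡ nth (us ++ vs) y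
      wts (near {z} z<p) = trans (nth-++ˡ vs us z z<p) (sym (nth-++ʳ us vs z))
      wts (far {y} y<x) = trans (nth-++ʳ vs us y) (sym (nth-++ˡ us vs y y<x))

    block-shift : ∀ k us vs → DW ((k ∷ us) ++ (0 ∷ vs)) → DW ((k ∷ vs) ++ (0 ∷ us)) →
      Shifted (suc (length us)) ((k ∷ us) ++ (0 ∷ vs)) ((k ∷ vs) ++ (0 ∷ us))
    block-shift k us vs D D′ = transport⇒shifted D D′ (DW-length (k ∷ us) (0 ∷ vs) D) (Block.transport k us vs D D′) wts
      where
      wts : ∀ {y z} → T₁ (suc (length us)) (suc (length vs)) y z → nth ((k ∷ vs) ++ (0 ∷ us)) z ≡ nth ((k ∷ us) ++ (0 ∷ vs)) y
      wts root = refl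
      wts (near {suc z} _ (s≤s z<p)) = trans (nth-++ˡ vs (0 ∷ us) z z<p) (sym (nth-++ʳ us (0 ∷ vs) (suc z)))
      wts (far {suc y} _ (s≤s y<x)) = trans (nth-++ʳ vs (0 ∷ us) (suc y)) (sym (nth-++ˡ us (0 ∷ vs) y y<x))

    cnt-block : ∀ v k us vs → cnt v ((k ∷ vs) ++ (0 ∷ us)) ≡ cnt v ((k ∷ us) ++ (0 ∷ vs))
    cnt-block v k us vs = cong (δ v k +_) (trans (cnt-++ v vs (0 ∷ us)) (trans (lem (cnt v vs) (δ v 0) (cnt v us)) (sym (cnt-++ v us (0 ∷ vs)))))
      where
      lem : ∀ x d y → x + (d + y) ≡ y + (d + x)
      lem = solve-∀

    -- First make the parent of the last label the base vertex, then move the base around its block to that label.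
    rotate₁ : ∀ {ns} → DW ns → ∃ λ ns′ → DW ns′ × Shifted (m ∸ 1) ns ns′ × (∀ v → cnt v ns′ ≡ cnt v ns)
    rotate₁ {ns} D with parent D 0<m ≤-refl
    ... | x , q with split-at ns x (≤-trans (<⇒≤ (before q)) (≤-reflexive (sym (DW.len D))))
    ...   | us , [] , refl , refl = ⊥-elim (<⇒≱ (before q) (≤-reflexive (trans (sym (DW.len D)) (trans (length-++ us) (+-identityʳ _)))))
    ...   | us , k ∷ vs , refl , refl = finish vs refl
      where
      x+p : length us + suc (length vs) ≡ m
      x+p = DW-length us (k ∷ vs) D
      D₁ : DW (k ∷ vs ++ us)
      D₁ = Region.rotated us (k ∷ vs) D λ i 0<i le →
        <-≤-trans (smaller q) (par-above q _ (m<m+n (length us) 0<i) (subst (length us + i ≤_) x+p (+-monoʳ-≤ (length us) le)))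
      s₁ : Shifted (length us) (us ++ k ∷ vs) (k ∷ vs ++ us)
      s₁ = region-shift us (k ∷ vs) D D₁
      central : Par (h (k ∷ vs ++ us)) 0 (suc (length vs))
      central with Transport.parents (Region.transport us (k ∷ vs) D D₁) (near z<s ≤-refl) (subst (Par (h (us ++ k ∷ vs)) (length us)) (sym x+p) q)
      ... | z , t , r = subst (λ z → Par (h (k ∷ vs ++ us)) z (suc (length vs))) (root-of refl t) r
        where
        root-of : ∀ {y z} → y ≡ length us → T₀ (length us) (suc (length vs)) y z → z ≡ 0
        root-of e (near {z} _) = +-cancelˡ-≡ (length us) z 0 (trans e (sym (+-identityʳ _)))
        root-of refl (far lt) = ⊥-elim (<-irrefl refl lt)
      m-1 : m ∸ 1 ≡ length us + length vs
      m-1 = cong (_∸ 1) (trans (sym x+p) (+-suc (length us) (length vs)))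
      snoc : ∀ (vs : List ℕ) l → length vs ≡ suc l → ∃ λ ws → ∃ λ n → vs ≡ ws ++ n ∷ [] × length ws ≡ l
      snoc (v ∷ []) zero e = [] , v , refl , refl
      snoc (v ∷ v′ ∷ vs) (suc l) e = let ws , n′ , eq , len = snoc (v′ ∷ vs) l (suc-injective e) in v ∷ ws , n′ , cong (v ∷_) eq , cong suc len
      resize : ∀ {x y ns ns′} → x ≡ y → Shifted x ns ns′ → Shifted y ns ns′
      resize refl s = s
      relist : ∀ {x ns₁ ns₂ ns′} → ns₁ ≡ ns₂ → Shifted x ns₂ ns′ → Shifted x ns₁ ns′
      relist refl s = s
      finish : ∀ vs′ → vs′ ≡ vs → ∃ λ ns′ → DW ns′ × Shifted (m ∸ 1) (us ++ k ∷ vs) ns′ × (∀ v → cnt v ns′ ≡ cnt v (us ++ k ∷ vs))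
      -- With `vs` empty the last label directly follows its parent, and the move through the region
      -- already turns by `m - 1`.
      finish [] refl = _ , D₁ , resize (sym (trans m-1 (+-identityʳ _))) s₁ , λ v → cnt-swap v us (k ∷ vs)
      finish (v₀ ∷ vs₀) refl with snoc (v₀ ∷ vs₀) (length vs₀) refl
      ... | ws , n , eq , len = _ , D₂ , resize (sym (trans m-1 (cong (length us +_) (cong suc (sym len)))))
              (shifted-trans s₁ (relist D₁-eq (block-shift k ws us D₁′ D₂))) ,
            λ v → trans (cnt-block v k ws us) (trans (cong (cnt v) (sym D₁-eq)) (cnt-swap v us (k ∷ v₀ ∷ vs₀)))
        where
        list-eq : k ∷ (v₀ ∷ vs₀) ++ us ≡ (k ∷ ws) ++ (n ∷ us)
        list-eq = trans (cong (λ l → k ∷ l ++ us) eq) (cong (k ∷_) (++-assoc ws (n ∷ []) us))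
        last-index : nth (k ∷ (v₀ ∷ vs₀) ++ us) (suc (length vs₀)) ≡ n
        last-index = trans (cong₂ nth list-eq (cong suc (trans (sym len) (sym (+-identityʳ (length ws)))))) (nth-++ʳ (k ∷ ws) (n ∷ us) 0)
        -- A positive letter there would make that position the parent of the next label, whose
        -- parent is 0 by `central`.
        n≡0 : n ≡ 0
        n≡0 = n≤0⇒n≡0 (≮⇒≥ λ pos → 0≢1+n (par-unique central (h-rise D₁ (subst (suc (length vs₀) <_) x+p (m<n⇒m<o+n (length us) ≤-refl)) (subst (0 <_) (sym last-index) pos))))
          where
          m<n⇒m<o+n : ∀ o {m n} → m < n → m < o + n
          m<n⇒m<o+n o lt = <-≤-trans lt (m≤n+m _ o)
        D₁-eq : k ∷ (v₀ ∷ vs₀) ++ us ≡ (k ∷ ws) ++ (0 ∷ us)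
        D₁-eq = trans list-eq (cong (λ n → (k ∷ ws) ++ (n ∷ us)) n≡0)
        D₁′ : DW ((k ∷ ws) ++ (0 ∷ us))
        D₁′ = subst DW D₁-eq D₁
        D₂ : DW ((k ∷ us) ++ (0 ∷ ws))
        D₂ = Block.rotated k ws us D₁′ (subst₂ (λ l c → Par (h l) 0 c) D₁-eq (cong (suc ∘ suc) (sym len)) central)

    -- `rotate₁` turns by -1 modulo `m`; doing so `v (m - 1)` times turns by `v`, as
    -- `(m - 1)(m - 1)` is 1 modulo `m`.
    shift : ∀ v {ns} → DW ns → ∃ λ ns′ → DW ns′ × Shifted v ns ns′ × (∀ x → cnt x ns′ ≡ cnt x ns)
    shift v {ns} D with iterate (v * (m ∸ 1)) D
      where
      iterate : ∀ k {ns} → DW ns → ∃ λ ns′ → DW ns′ × Shifted (k * (m ∸ 1)) ns ns′ × (∀ x → cnt x ns′ ≡ cnt x ns)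
      iterate zero D = _ , D , shifted-refl , λ _ → refl
      iterate (suc k) D with rotate₁ D
      ... | ns₁ , D₁ , s₁ , c₁ with iterate k D₁
      ...   | ns₂ , D₂ , s₂ , c₂ = ns₂ , D₂ , shifted-trans s₁ s₂ , λ x → trans (c₂ x) (c₁ x)
    ... | ns′ , D′ , s , c = ns′ , D′ , shifted-drop k (subst (λ x → Shifted x ns ns′) eq (shifted-add v s)) , c
      where
      k = v * (m ∸ 1)
      eq : k * (m ∸ 1) + v * m ≡ v + k * m
      eq = subst (λ M → v * (m ∸ 1) * (m ∸ 1) + v * M ≡ v + v * (m ∸ 1) * M) (m+[n∸m]≡n 0<m) (lem v (m ∸ 1))
        where
        lem : ∀ v n → v * n * n + v * suc n ≡ v + v * n * suc n
        lem = solve-∀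

-- The centre of a rotation-invariant noncrossing partition of a circle.

module Centre where

  open import Data.Nat
  open import Data.Nat.Properties
  open import Data.Nat.DivMod using (m%n<n; m≡m%n+[m/n]*n)
  open import Data.Nat.Tactic.RingSolver using (solve-∀)
  open import Data.Bool using (Bool; true)
  import Data.Bool.Properties as Bool
  open import Data.Product using (∃; _×_; _,_)
  open import Data.Sum using (_⊎_; inj₁; inj₂)
  open import Data.Empty using (⊥; ⊥-elim)
  open import Relation.Nullary using (¬_; Dec; yes; no)
  open import Relation.Nullary.Decidable using (_→-dec_; _×-dec_)
  open import Relation.Unary using (Decidable)
  open import Relation.Binary.PropositionalEquality

  last-below : ∀ {P : ℕ → Set} → Decidable P → ∀ lo k → P lo → ∃ λ p → lo ≤ p × p ≤ lo + k × P p × (∀ t → p < t → t ≤ lo + k → ¬ P t)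
  last-below P? lo zero Plo = lo , ≤-refl , m≤m+n lo 0 , Plo , λ t l u _ → <⇒≱ l (≤-trans u (≤-reflexive (+-identityʳ lo)))
  last-below {P} P? lo (suc k) Plo with P? (lo + suc k)
  ... | yes p = lo + suc k , m≤m+n lo (suc k) , ≤-refl , p , λ t l u _ → <⇒≱ l u
  ... | no ¬p with last-below P? lo k Plo
  ...   | q , l , u , Pq , last = q , l , ≤-trans u (+-monoʳ-≤ lo (n≤1+n k)) , Pq , go
    where
    go : ∀ t → q < t → t ≤ lo + suc k → ¬ P t
    go t q<t t≤ with m≤n⇒m<n∨m≡n t≤
    ... | inj₂ refl = ¬p
    ... | inj₁ t< = last t q<t (s≤s⁻¹ (≤-trans t< (≤-reflexive (+-suc lo k))))

  first-from : ∀ {P : ℕ → Set} → Decidable P → ∀ lo k → P (lo + k) → ∃ λ c → lo ≤ c × c ≤ lo + k × P c × (∀ t → lo ≤ t → t < c → ¬ P t)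
  first-from {P} P? lo zero Ph = lo , ≤-refl , m≤m+n lo 0 , subst P (+-identityʳ lo) Ph , λ t l u _ → <⇒≱ u l
  first-from {P} P? lo (suc k) Ph with P? lo
  ... | yes p = lo , ≤-refl , m≤m+n lo (suc k) , p , λ t l u _ → <⇒≱ u l
  ... | no ¬p with first-from P? (suc lo) k (subst P (+-suc lo k) Ph)
  ...   | c , l , u , Pc , first = c , <⇒≤ l , ≤-trans u (≤-reflexive (sym (+-suc lo k))) , Pc , go
    where
    go : ∀ t → lo ≤ t → t < c → ¬ P t
    go t lo≤t t<c with m≤n⇒m<n∨m≡n lo≤t
    ... | inj₁ lo<t = first t lo<t t<c
    ... | inj₂ refl = ¬p

  -- Indices run over the universal cover of the circle. The noncrossing law is required for four
  -- indices within any window of length `m`, so no cut is singled out.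
  record CyclicPartition (m : ℕ) : Set where
    field
      ρ        : ℕ → ℕ → Bool
    infix 4 _~_
    _~_ : ℕ → ℕ → Set
    i ~ j = ρ i j ≡ true
    field
      ~-refl   : ∀ i → i ~ i
      ~-sym    : ∀ {i j} → i ~ j → j ~ i
      ~-trans  : ∀ {i j k} → i ~ j → j ~ k → i ~ k
      periodic : ∀ i → i + m ~ i
      crossing : ∀ {i j k l} → i < j → j < k → k < l → l < i + m → i ~ k → j ~ l → i ~ j

  module CenterOf {m : ℕ} (C : CyclicPartition m) (g : ℕ) (0<g : 0 < g) (2g≤m : g + g ≤ m)
    (invariant : ∀ {i j} → CyclicPartition._~_ C i j → CyclicPartition._~_ C (i + g) (j + g)) where
    open CyclicPartition C

    _~?_ : ∀ i j → Dec (i ~ j)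
    i ~? j = ρ i j Bool.≟ true

    0<m : 0 < m
    0<m = <-≤-trans 0<g (≤-trans (m≤m+n g g) 2g≤m)

    -- Going forward from `c`, the whole block of `c` is met within `L` steps.
    Arc : ℕ → ℕ → Set
    Arc L c = ∀ s → s < m → c ~ c + s → s ≤ L

    Arc? : ∀ L c → Dec (Arc L c)
    Arc? L c with allUpTo? (λ s → (c ~? (c + s)) →-dec (s ≤? L)) m
    ... | yes all = yes λ s s<m r → all s<m r
    ... | no ¬all = no λ arc → ¬all λ {s} s<m r → arc s s<m r

    -- If e ≁ e + g, let p be the last element of the block of e before e + g. The block and its rotation by g do not
    -- cross, so there is no element of the block between p and p + m - g.
    gap : ∀ e → ¬ e ~ e + g → ∃ λ c → e ~ c × Arc (g ∸ 1) c
    gap e ≁ with last-below (λ t → e ~? t) e g (~-refl e)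
    ... | p , e≤p , p≤ , e~p , last = finish (first-from (λ t → e ~? t) lo (g ∸ 1) (subst (e ~_) (sym hi) (~-trans e~p (~-sym (periodic p)))))
      where
      p<e+g : p < e + g
      p<e+g = ≤∧≢⇒< p≤ λ { refl → ≁ e~p }
      e+g≁ : ∀ {z} → e ~ z → ¬ e + g ~ z
      e+g≁ e~z r = ≁ (~-trans e~z (~-sym r))
      no-element : ∀ z → p < z → z + g ≤ p + m → ¬ e ~ z
      no-element z p<z z+g≤ e~z with m≤n⇒m<n∨m≡n z+g≤
      ... | inj₂ eq = e+g≁ (~-trans e~p (~-sym (periodic p))) (subst (e + g ~_) eq (invariant e~z))
      ... | inj₁ lt = ≁ (~-trans e~p (crossing p<e+g e+g<z (m<m+n z 0<g) lt (~-trans (~-sym e~p) e~z) (invariant e~z)))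
        where
        e+g<z : e + g < z
        e+g<z with z ≤? e + g
        ... | yes z≤ = ⊥-elim (last z p<z z≤ e~z)
        ... | no z≰ = ≰⇒> z≰
      g≤m : g ≤ m
      g≤m = ≤-trans (m≤m+n g g) 2g≤m
      -- By `no-element`, what the block has in the turn after `p` lies among the `g` positions from
      -- here to `p + m`; the first element found is the start of a short arc.
      lo = suc (p + (m ∸ g))
      hi : lo + (g ∸ 1) ≡ p + m
      hi = begin
        suc (p + (m ∸ g)) + (g ∸ 1)     ≡⟨ lem p (m ∸ g) (g ∸ 1) ⟩
        p + (m ∸ g + suc (g ∸ 1))       ≡⟨ cong (λ x → p + (m ∸ g + x)) (m+[n∸m]≡n 0<g) ⟩
        p + (m ∸ g + g)                 ≡⟨ cong (p +_) (m∸n+n≡m g≤m) ⟩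
        p + m ∎
        where
        open ≡-Reasoning
        lem : ∀ p x y → suc (p + x) + y ≡ p + (x + suc y)
        lem = solve-∀
      lo-g : lo + g ≡ suc (p + m)
      lo-g = trans (cong suc (trans (+-assoc p (m ∸ g) g) (cong (p +_) (m∸n+n≡m g≤m)))) refl
      arc : ∀ c → lo ≤ c → e ~ c → (∀ t → lo ≤ t → t < c → ¬ e ~ t) → Arc (g ∸ 1) c
      arc c lo≤c e~c none-before s s<m r with c + s ≤? p + m
      ... | yes c+s≤ = s≤s⁻¹ (≤-trans (+-cancelˡ-< lo s g (≤-trans (s≤s (≤-trans (+-monoˡ-≤ s lo≤c) c+s≤)) (≤-reflexive (sym lo-g)))) (≤-reflexive (sym (m+[n∸m]≡n 0<g))))
      ... | no c+s≰ = ⊥-elim absurd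
        where
        z = c + s ∸ m
        z+m : z + m ≡ c + s
        z+m = m∸n+n≡m (≤-trans (m≤n+m m p) (<⇒≤ (≰⇒> c+s≰)))
        p<z : p < z
        p<z = +-cancelʳ-< m p z (subst (p + m <_) (sym z+m) (≰⇒> c+s≰))
        z<c : z < c
        z<c = +-cancelʳ-< m z c (subst (_< c + m) (sym z+m) (+-monoʳ-< c s<m))
        e~z : e ~ z
        e~z = ~-trans e~c (~-trans (subst (c ~_) (sym z+m) r) (periodic z))
        absurd : ⊥
        absurd with lo ≤? z
        ... | yes lo≤z = none-before z lo≤z z<c e~z
        ... | no lo≰z = no-element z p<z (≤-trans (+-monoˡ-≤ g (s≤s⁻¹ (≰⇒> lo≰z))) (≤-reflexive (suc-injective lo-g))) e~z
      finish : (∃ λ c → lo ≤ c × c ≤ lo + (g ∸ 1) × e ~ c × (∀ t → lo ≤ t → t < c → ¬ e ~ t)) → ∃ λ c → e ~ c × Arc (g ∸ 1) c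
      finish (c , lo≤c , _ , e~c , none-before) = c , e~c , arc c lo≤c e~c none-before

    periodic* : ∀ k i → i + k * m ~ i
    periodic* zero i = subst (_~ i) (sym (+-identityʳ i)) (~-refl i)
    periodic* (suc k) i = ~-trans (subst (_~ i + k * m) (lem i k m) (periodic (i + k * m))) (periodic* k i)
      where
      lem : ∀ i k m → i + k * m + m ≡ i + suc k * m
      lem = solve-∀

    private
      instance
        m≢0 : NonZero m
        m≢0 = >-nonZero 0<m

    mod~ : ∀ i → i % m ~ i
    mod~ i = ~-sym (subst (_~ i % m) (sym (m≡m%n+[m/n]*n i m)) (periodic* (i / m) (i % m)))

    shift~ : ∀ {i j} k → i ≡ j + k * m → ∀ s → i + s ~ j + s
    shift~ {i} {j} k e s = subst (_~ j + s) (trans (lem j s (k * m)) (cong (_+ s) (sym e))) (periodic* k (j + s))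
      where
      lem : ∀ j s x → j + s + x ≡ j + x + s
      lem = solve-∀

    Arc-mod : ∀ {L c} → Arc L c → Arc L (c % m)
    Arc-mod {L} {c} arc s s<m r = arc s s<m (~-trans (~-sym (mod~ c)) (~-trans r (~-sym (shift~ (c / m) (m≡m%n+[m/n]*n c m) s))))

    -- The centre of the disc lies in a block, or in the complementary region bounded by the widest blocks.
    record Widest : Set where
      field
        v L    : ℕ
        v<m    : v < m
        L<g    : L < g
        v~     : v ~ v + L
        v-arc  : Arc L v
        widest : ∀ e → ∃ λ c → e ~ c × Arc L c

    private
      Attained : ℕ → Set
      Attained s = ∃ λ c → c < m × Arc (g ∸ 1) c × c ~ c + s

      Attained? : Decidable Attained
      Attained? s = anyUpTo? (λ c → Arc? (g ∸ 1) c ×-dec (c ~? (c + s))) m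

      assemble : (∀ e → ∃ λ c → e ~ c × Arc (g ∸ 1) c) →
        (∃ λ L → 0 ≤ L × L ≤ g ∸ 1 × Attained L × (∀ s → L < s → s ≤ g ∸ 1 → ¬ Attained s)) → Widest
      assemble arc-of (L , _ , L≤ , (v , v<m , ar , v~) , best) = record
        { v = v ; L = L ; v<m = v<m ; L<g = ≤-trans (s≤s L≤) (≤-reflexive (m+[n∸m]≡n 0<g)) ; v~ = v~ ; v-arc = wide v v<m ar
        ; widest = λ e → let c , e~c , ar = arc-of e in c % m , ~-trans e~c (~-sym (mod~ c)) , wide (c % m) (m%n<n c m) (Arc-mod ar) }
        where
        wide : ∀ c → c < m → Arc (g ∸ 1) c → Arc L c
        wide c c<m ar s s<m r with s ≤? L
        ... | yes le = le
        ... | no ≰ = ⊥-elim (best s (≰⇒> ≰) (ar s s<m r) (c , c<m , ar , r))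

    -- If some `v` is related to `v + g`, its block is carried to itself by the rotation. Otherwise
    -- `gap` puts every block into an arc of length less than `g`, and a block of greatest span is
    -- selected.
    center : (∃ λ v → v < m × v ~ v + g) ⊎ Widest
    center with anyUpTo? (λ v → v ~? (v + g)) m
    ... | yes p = inj₁ p
    ... | no none = inj₂ (assemble arc-of (last-below Attained? 0 (g ∸ 1) start))
      where
      arc-of : ∀ e → ∃ λ c → e ~ c × Arc (g ∸ 1) c
      arc-of e = gap e λ r → none (e % m , m%n<n e m , ~-trans (mod~ e) (~-trans r (shift~ (e / m) (m≡m%n+[m/n]*n e m) g)))
      start : Attained 0
      start = let c , _ , ar = arc-of 0 in c % m , m%n<n c m , Arc-mod ar , subst (c % m ~_) (sym (+-identityʳ (c % m))) (~-refl (c % m))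

-- Cycle lemmas: periodic words have a good starting point.

module CycleLemma where

  open Words
  open DyckWords
  open import Data.Nat
  open import Data.Nat.Properties
  open import Data.Nat.Coprimality using (Coprime)
  open import Data.Nat.ListAction using (sum)
  open import Data.Nat.ListAction.Properties using (sum-++)
  open import Data.Nat.Tactic.RingSolver using (solve-∀)
  open import Data.List as List using (List; []; _∷_; _++_; length)
  open import Data.Product using (∃; _×_; _,_)
  open import Data.Sum using (inj₁; inj₂)
  open import Data.Empty using (⊥; ⊥-elim)
  open import Relation.Nullary using (yes; no)
  open import Relation.Binary.PropositionalEquality

  argmin : ∀ (K : ℕ → ℕ) lo k → ∃ λ v → lo ≤ v × v ≤ lo + k × (∀ i → lo ≤ i → i ≤ lo + k → K v ≤ K i)
  argmin K lo zero = lo , ≤-refl , m≤m+n lo 0 , λ i l u → ≤-reflexive (cong K (≤-antisym l (≤-trans u (≤-reflexive (+-identityʳ lo)))))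
  argmin K lo (suc k) with argmin K lo k
  ... | v , l , u , min with K v ≤? K (lo + suc k)
  ...   | yes le = v , l , ≤-trans u (+-monoʳ-≤ lo (n≤1+n k)) , go
    where
    go : ∀ i → lo ≤ i → i ≤ lo + suc k → K v ≤ K i
    go i li ui with m≤n⇒m<n∨m≡n ui
    ... | inj₂ refl = le
    ... | inj₁ lt = min i li (s≤s⁻¹ (≤-trans lt (≤-reflexive (+-suc lo k))))
  ...   | no ≰ = lo + suc k , m≤m+n lo (suc k) , ≤-refl , go
    where
    go : ∀ i → lo ≤ i → i ≤ lo + suc k → K (lo + suc k) ≤ K i
    go i li ui with m≤n⇒m<n∨m≡n ui
    ... | inj₂ refl = ≤-refl
    ... | inj₁ lt = ≤-trans (<⇒≤ (≰⇒> ≰)) (min i li (s≤s⁻¹ (≤-trans lt (≤-reflexive (+-suc lo k)))))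

  S-seg : ∀ f v k i → i ≤ k → S (seg f v k) i ≡ sum (seg f v i)
  S-seg f v k zero le = refl
  S-seg f v (suc k) (suc i) (s≤s le) = cong (f v +_) (S-seg f (suc v) k i le)

  -- A word together with the weight removed from its first letter; j is the rank of the block at the centre, or 0
  -- when the centre lies in a region.
  data Based : ℕ → List ℕ → List ℕ → Set where
    region : ∀ {z} → Based 0 z z
    block  : ∀ {j z} → Based (suc j) (0 ∷ z) (suc j ∷ z)

  module SearchBase (a m : ℕ) (0<a : 0 < a) (a≤m : a ≤ m) (cop : Coprime a (suc m)) where
    open Base a m 0<a a≤m cop

    module _ (f : ℕ → ℕ) where

      σ : ℕ → ℕ
      σ u = sum (seg f 0 u)

      σ-+ : ∀ u i → σ (u + i) ≡ σ u + sum (seg f u i)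
      σ-+ u i = trans (cong sum (seg-++ f 0 u i)) (sum-++ (seg f 0 u) (seg f u i))

      -- The level at u is at most the level at w.
      Lower : ℕ → ℕ → Set
      Lower u w = b * σ u + a * w ≤ b * σ w + a * u

      -- The level `b σ u - a u` is minimised after adding the constant `a (lo + k)`, which keeps it
      -- a natural number.
      lowest : ∀ lo k → ∃ λ v → lo ≤ v × v ≤ lo + k × (∀ w → lo ≤ w → w ≤ lo + k → Lower v w)
      lowest lo k with argmin (λ u → b * σ u + a * (lo + k ∸ u)) lo k
      ... | v , l , u , min = v , l , u , λ w lw uw → +-cancelʳ-≤ (a * (lo + k)) _ _ (begin
        b * σ v + a * w + a * M                      ≡⟨ cong (λ t → b * σ v + a * w + a * t) (m∸n+n≡m u) ⟨
        b * σ v + a * w + a * (M ∸ v + v)            ≡⟨ lem (b * σ v) a w (M ∸ v) v ⟩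
        (b * σ v + a * (M ∸ v)) + (a * w + a * v)    ≤⟨ +-monoˡ-≤ (a * w + a * v) (min w lw uw) ⟩
        (b * σ w + a * (M ∸ w)) + (a * w + a * v)    ≡⟨ lem′ (b * σ w) a (M ∸ w) w v ⟩
        b * σ w + a * v + a * (M ∸ w + w)            ≡⟨ cong (λ t → b * σ w + a * v + a * t) (m∸n+n≡m uw) ⟩
        b * σ w + a * v + a * M ∎)
        where
        open ≤-Reasoning
        M = lo + k
        lem : ∀ s a w d v → s + a * w + a * (d + v) ≡ (s + a * d) + (a * w + a * v)
        lem = solve-∀
        lem′ : ∀ s a d w v → (s + a * d) + (a * w + a * v) ≡ s + a * v + a * (d + w)
        lem′ = solve-∀

      ahead : ∀ {v i} → Lower v (v + i) → a * i ≤ b * sum (seg f v i)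
      ahead {v} {i} le = +-cancelˡ-≤ (b * σ v + a * v) _ _ (begin
        b * σ v + a * v + a * i              ≡⟨ lem (b * σ v) a v i ⟩
        b * σ v + a * (v + i)                ≤⟨ le ⟩
        b * σ (v + i) + a * v                ≡⟨ cong (λ s → b * s + a * v) (σ-+ v i) ⟩
        b * (σ v + sum (seg f v i)) + a * v  ≡⟨ lem′ b (σ v) (sum (seg f v i)) (a * v) ⟩
        b * σ v + a * v + b * sum (seg f v i) ∎)
        where
        open ≤-Reasoning
        lem : ∀ s a v i → s + a * v + a * i ≡ s + a * (v + i)
        lem = solve-∀
        lem′ : ∀ b s t x → b * (s + t) + x ≡ b * s + x + b * t
        lem′ = solve-∀

      σ-wrap : ∀ {P} → Periodic P f → ∀ t → σ (P + t) ≡ σ P + σ t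
      σ-wrap {P} per t = trans (σ-+ P t) (cong (λ l → σ P + sum l) (seg-cong f f P 0 t (λ s _ → trans (cong f (+-comm P s)) (per s))))

    module _ {f : ℕ → ℕ} where

      -- Over a period of length `b` the level returns to its value, so reading from a lowest vertex
      -- stays weakly above the diagonal, and strictly by `no-tie`. The first `m` letters then
      -- already sum to `a`, leaving 0 for the last.
      dyck-rotation : Periodic b f → σ f b ≡ a → ∃ λ v → v < b × DW (seg f v m) × f (v + m) ≡ 0
      dyck-rotation per total with lowest f 0 m
      ... | v , _ , v≤m , low = v , s≤s v≤m , D , last-zero
        where
        pos′ : ∀ i → 0 < i → i ≤ m → a * i < b * S (seg f v m) i
        pos′ i 0<i i≤m = ≤∧≢⇒< (subst (λ s → a * i ≤ b * s) (sym (S-seg f v m i i≤m)) (weak i i≤m)) (λ e → no-tie (S (seg f v m) i) i 0<i i≤m (sym e))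
          where
          weak : ∀ i → i ≤ m → a * i ≤ b * sum (seg f v i)
          weak i i≤m with v + i ≤? m
          ... | yes le = ahead f (low (v + i) z≤n le)
          ... | no ≰ = +-cancelʳ-≤ (b * σ f v + a * v) _ _ (begin
            a * i + (b * σ f v + a * v)            ≡⟨ lem a i (b * σ f v) v ⟩
            a * (v + i) + b * σ f v                ≡⟨ cong (λ u → a * u + b * σ f v) (sym b+t) ⟩
            a * (b + t) + b * σ f v                ≡⟨ lem₂ a b t (b * σ f v) ⟩
            b * a + (b * σ f v + a * t)            ≤⟨ +-monoʳ-≤ (b * a) (low t z≤n t≤m) ⟩
            b * a + (b * σ f t + a * v)            ≡⟨ lem₃ b a (σ f t) (a * v) ⟩
            b * (a + σ f t) + a * v                ≡⟨ cong (λ s → b * (s + σ f t) + a * v) (sym total) ⟩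
            b * (σ f b + σ f t) + a * v            ≡⟨ cong (λ s → b * s + a * v) (trans (sym (σ-wrap f per t)) (trans (cong (σ f) b+t) (σ-+ f v i))) ⟩
            b * (σ f v + sum (seg f v i)) + a * v  ≡⟨ lem₄ b (σ f v) (sum (seg f v i)) (a * v) ⟩
            b * sum (seg f v i) + (b * σ f v + a * v) ∎)
            where
            open ≤-Reasoning
            t = v + i ∸ b
            b+t : b + t ≡ v + i
            b+t = m+[n∸m]≡n (≰⇒> ≰)
            t≤m : t ≤ m
            t≤m = ≤-trans (+-cancelˡ-≤ b t m (≤-trans (≤-reflexive b+t) (≤-trans (+-mono-≤ v≤m i≤m) (n≤1+n (m + m))))) ≤-refl
            lem : ∀ a i s v → a * i + (s + a * v) ≡ a * (v + i) + s
            lem = solve-∀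
            lem₂ : ∀ a b t s → a * (b + t) + s ≡ b * a + (s + a * t)
            lem₂ = solve-∀
            lem₃ : ∀ b a t x → b * a + (b * t + x) ≡ b * (a + t) + x
            lem₃ = solve-∀
            lem₄ : ∀ b s t x → b * (s + t) + x ≡ b * t + (b * s + x)
            lem₄ = solve-∀
        0<m : 0 < m
        0<m = <-≤-trans 0<a a≤m
        whole : sum (seg f v m) + f (v + m) ≡ a
        whole = begin
          sum (seg f v m) + f (v + m)            ≡⟨ cong (sum (seg f v m) +_) (+-identityʳ _) ⟨
          sum (seg f v m) + (f (v + m) + 0)      ≡⟨ sum-++ (seg f v m) (f (v + m) ∷ []) ⟨
          sum (seg f v m ++ f (v + m) ∷ [])      ≡⟨ cong sum (seg-++ f v m 1) ⟨
          sum (seg f v (m + 1))                  ≡⟨ cong (λ k → sum (seg f v k)) (+-comm m 1) ⟩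
          sum (seg f v b)                        ≡⟨ sum-seg-rotate per v ⟩
          σ f b                                  ≡⟨ total ⟩
          a ∎
          where open ≡-Reasoning
        a≤ : a ≤ sum (seg f v m)
        a≤ = s≤s⁻¹ (*-cancelˡ-< b a (suc (sum (seg f v m))) (begin-strict
          b * a                         ≡⟨ cong (a +_) (*-comm m a) ⟩
          a + a * m                     <⟨ +-mono-≤-< (≤-trans a≤m (n≤1+n m)) (subst (λ s → a * m < b * s) (S-seg f v m m ≤-refl) (pos′ m 0<m ≤-refl)) ⟩
          b + b * sum (seg f v m)       ≡⟨ *-suc b (sum (seg f v m)) ⟨
          b * suc (sum (seg f v m)) ∎))
          where open ≤-Reasoning
        last-zero : f (v + m) ≡ 0
        last-zero = n≤0⇒n≡0 (+-cancelˡ-≤ (sum (seg f v m)) _ _ (≤-trans (≤-reflexive whole) (≤-trans a≤ (≤-reflexive (sym (+-identityʳ _))))))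
        D : DW (seg f v m)
        D = record { len = length-seg f v m ; tot = trans (sym (+-identityʳ _)) (trans (cong (sum (seg f v m) +_) (sym last-zero)) whole) ; pos = pos′ }

      private
        module Wrap (per : Periodic m f) {j : ℕ} (total : σ f m + j ≡ a) {v c t i : ℕ} (wrap : v + i ≡ m + t)
                    (low : Lower f c t) (σc : σ f c ≡ σ f v) where
          -- For a window that runs past the end of the period: a full period changes the level by
          -- `b (a - j) - a m = a - b j`, so putting back `b j` leaves a gain of `a`.
          bound : a * i + a * v + a ≤ b * (j + sum (seg f v i)) + a * c
          bound = +-cancelʳ-≤ (b * σ f v) _ _ (begin
            a * i + a * v + a + b * σ f v                    ≡⟨ lem a i v (b * σ f v) ⟩
            a * (v + i) + a + b * σ f v                      ≡⟨ cong₂ (λ u s → a * u + a + b * s) wrap (sym σc) ⟩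
            a * (m + t) + a + b * σ f c                      ≡⟨ lem₂ a m t (b * σ f c) ⟩
            (a + m * a) + (b * σ f c + a * t)                ≤⟨ +-monoʳ-≤ (a + m * a) low ⟩
            b * a + (b * σ f t + a * c)                      ≡⟨ cong (λ x → b * x + (b * σ f t + a * c)) total ⟨
            b * (σ f m + j) + (b * σ f t + a * c)            ≡⟨ lem₃ b (σ f m) j (σ f t) (a * c) ⟩
            b * (σ f m + σ f t) + b * j + a * c              ≡⟨ cong (λ s → b * s + b * j + a * c) (trans (sym (σ-wrap f per t)) (trans (cong (σ f) (sym wrap)) (σ-+ f v i))) ⟩
            b * (σ f v + sum (seg f v i)) + b * j + a * c    ≡⟨ lem₄ b (σ f v) (sum (seg f v i)) j (a * c) ⟩
            b * (j + sum (seg f v i)) + a * c + b * σ f v ∎)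
            where
            open ≤-Reasoning
            lem : ∀ a i v s → a * i + a * v + a + s ≡ a * (v + i) + a + s
            lem = solve-∀
            lem₂ : ∀ a m t s → a * (m + t) + a + s ≡ (a + m * a) + (s + a * t)
            lem₂ = solve-∀
            lem₃ : ∀ b x j t y → b * (x + j) + (b * t + y) ≡ b * (x + t) + b * j + y
            lem₃ = solve-∀
            lem₄ : ∀ b s t j y → b * (s + t) + b * j + y ≡ b * (j + t) + y + b * s
            lem₄ = solve-∀

      -- For j = 0 the base is a lowest vertex of the period; for j > 0 the levels drift downwards and the base label is
      -- a lowest one.
      based-rotation : ∀ j → Periodic m f → σ f m + j ≡ a → ∃ λ v → ∃ λ ns → Based j (seg f v m) ns × DW ns
      based-rotation zero per total with lowest f 0 m
      ... | v , _ , v≤m , low = v , seg f v m , region , record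
        { len = length-seg f v m ; tot = trans (sum-seg-rotate per v) (trans (sym (+-identityʳ _)) total) ; pos = pos′ }
        where
        pos′ : ∀ i → 0 < i → i ≤ m → a * i < b * S (seg f v m) i
        pos′ i 0<i i≤m = ≤∧≢⇒< (subst (λ s → a * i ≤ b * s) (sym (S-seg f v m i i≤m)) weak) (λ e → no-tie (S (seg f v m) i) i 0<i i≤m (sym e))
          where
          weak : a * i ≤ b * sum (seg f v i)
          weak with v + i ≤? m
          ... | yes le = ahead f (low (v + i) z≤n le)
          ... | no ≰ = +-cancelʳ-≤ (a * v) _ _ (≤-trans (m≤m+n _ a) (Wrap.bound per {0} total (sym m+t) (low t z≤n t≤m) refl))
            where
            t = v + i ∸ m
            m+t : m + t ≡ v + i
            m+t = m+[n∸m]≡n (<⇒≤ (≰⇒> ≰))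
            t≤m : t ≤ m
            t≤m = +-cancelˡ-≤ m t m (≤-trans (≤-reflexive m+t) (+-mono-≤ v≤m i≤m))
      based-rotation (suc j) per total with lowest f 1 (m ∸ 1)
      ... | zero , () , _
      ... | suc v , _ , c≤ , low = v , suc j ∷ z′ , subst (λ z → Based (suc j) z (suc j ∷ z′)) (sym z-eq) block , D
        where
        m-1 : suc (m ∸ 1) ≡ m
        m-1 = m+[n∸m]≡n (<-≤-trans 0<a a≤m)
        v<m : v < m
        v<m = ≤-trans c≤ (≤-reflexive m-1)
        z′ = seg f (suc v) (m ∸ 1)
        low′ : ∀ w → 0 < w → w ≤ m → Lower f (suc v) w
        low′ w 0<w w≤m = low w 0<w (≤-trans w≤m (≤-reflexive (sym m-1)))
        a<b : a < b
        a<b = s≤s a≤m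
        σ-suc : σ f (suc v) ≡ σ f v + f v
        σ-suc = trans (cong (σ f) (+-comm 1 v)) (trans (σ-+ f v 1) (cong (σ f v +_) (+-identityʳ (f v))))
        -- A positive letter would put label `v` below the lowest label `suc v`. For `v = 0`, label
        -- 1 would have a positive level, while label `m` has the negative level `a - b (j + 1)`.
        fv≡0 : f v ≡ 0
        fv≡0 with f v in e
        ... | zero = refl
        ... | suc k = ⊥-elim (absurd v refl)
          where
          σ-big : b + b * σ f v ≤ b * σ f (suc v)
          σ-big = begin
            b + b * σ f v               ≤⟨ m≤m+n (b + b * σ f v) (b * k) ⟩
            b + b * σ f v + b * k       ≡⟨ lem b (σ f v) k ⟩
            b * (σ f v + suc k)         ≡⟨ cong (λ n → b * (σ f v + n)) (sym e) ⟩
            b * (σ f v + f v)           ≡⟨ cong (b *_) (sym σ-suc) ⟩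
            b * σ f (suc v) ∎
            where
            open ≤-Reasoning
            lem : ∀ b s k → b + b * s + b * k ≡ b * (s + suc k)
            lem = solve-∀
          absurd : ∀ u → u ≡ v → ⊥
          absurd (suc u) refl = <⇒≱ a<b (+-cancelʳ-≤ (b * σ f v + a * v) _ _ (begin
            b + (b * σ f v + a * v)      ≡⟨ +-assoc b _ _ ⟨
            b + b * σ f v + a * v        ≤⟨ +-monoˡ-≤ (a * v) σ-big ⟩
            b * σ f (suc v) + a * v      ≤⟨ low′ v z<s (<⇒≤ v<m) ⟩
            b * σ f v + a * suc v        ≡⟨ lem (b * σ f v) a v ⟩
            a + (b * σ f v + a * v) ∎))
            where
            open ≤-Reasoning
            lem : ∀ s a v → s + a * suc v ≡ a + (s + a * v)
            lem = solve-∀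
          absurd zero refl = <⇒≱ (+-mono-< a<b a<b) (+-cancelʳ-≤ (m * a) _ _ (begin
            b + b + m * a                               ≤⟨ +-monoˡ-≤ (m * a) (+-mono-≤ (≤-trans (m≤m+n b (b * 0)) σ-big) (≤-trans (≤-reflexive (sym (*-identityʳ b))) (*-monoʳ-≤ b {1} {suc j} (s≤s z≤n)))) ⟩
            b * σ f 1 + b * suc j + m * a               ≡⟨ lem₁ (b * σ f 1) (b * suc j) m a ⟩
            b * σ f 1 + a * m + b * suc j               ≤⟨ +-monoˡ-≤ (b * suc j) (low′ m (<-≤-trans 0<a a≤m) ≤-refl) ⟩
            b * σ f m + a * 1 + b * suc j               ≡⟨ lem₂ b (σ f m) a (suc j) ⟩
            b * (σ f m + suc j) + a                     ≡⟨ cong (λ s → b * s + a) total ⟩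
            a + m * a + a                               ≡⟨ lem₃ a (m * a) ⟩
            a + a + m * a ∎))
            where
            open ≤-Reasoning
            lem₁ : ∀ s t m a → s + t + m * a ≡ s + a * m + t
            lem₁ = solve-∀
            lem₂ : ∀ b s a j → b * s + a * 1 + b * j ≡ b * (s + j) + a
            lem₂ = solve-∀
            lem₃ : ∀ a x → a + x + a ≡ a + a + x
            lem₃ = solve-∀
        z-eq : seg f v m ≡ 0 ∷ z′
        z-eq = trans (cong (seg f v) (sym m-1)) (cong (_∷ z′) fv≡0)
        sum-z : ∀ i → suc i ≤ m → S (suc j ∷ z′) (suc i) ≡ suc j + sum (seg f v (suc i))
        sum-z i le = cong (suc j +_) (trans (S-seg f (suc v) (m ∸ 1) i (s≤s⁻¹ (≤-trans le (≤-reflexive (sym m-1))))) (cong (_+ sum (seg f (suc v) i)) (sym fv≡0)))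
        σc : σ f (suc v) ≡ σ f v
        σc = trans σ-suc (trans (cong (σ f v +_) fv≡0) (+-identityʳ _))
        weak : ∀ i → suc i ≤ m → a * suc i ≤ b * (suc j + sum (seg f v (suc i)))
        weak i i≤m with v + suc i ≤? m
        -- The minimum is at `suc v`, one fall of `a` below `v`; the restored rank contributes
        -- `b (j + 1)`, which exceeds `a`.
        ... | yes le = +-cancelˡ-≤ (b * σ f v + a * v) _ _ (begin
            b * σ f v + a * v + a * suc i                 ≡⟨ lem (b * σ f v) a v (suc i) ⟩
            b * σ f v + a * (v + suc i)                   ≡⟨ cong (λ s → b * s + a * (v + suc i)) σc ⟨
            b * σ f (suc v) + a * (v + suc i)             ≤⟨ low′ (v + suc i) (≤-trans (s≤s z≤n) (m≤n+m (suc i) v)) le ⟩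
            b * σ f (v + suc i) + a * suc v               ≡⟨ cong₂ (λ s t → b * s + t) (σ-+ f v (suc i)) (*-suc a v) ⟩
            b * (σ f v + sum (seg f v (suc i))) + (a + a * v)  ≤⟨ +-monoʳ-≤ _ (+-monoˡ-≤ (a * v) (≤-trans (<⇒≤ a<b) (m≤m+n b (b * j)))) ⟩
            b * (σ f v + sum (seg f v (suc i))) + (b + b * j + a * v)  ≡⟨ lem₂ b (σ f v) (sum (seg f v (suc i))) j (a * v) ⟩
            b * σ f v + a * v + b * (suc j + sum (seg f v (suc i))) ∎)
          where
          open ≤-Reasoning
          lem : ∀ s a v i → s + a * v + a * i ≡ s + a * (v + i)
          lem = solve-∀
          lem₂ : ∀ b s t j x → b * (s + t) + (b + b * j + x) ≡ b * s + x + b * (suc j + t)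
          lem₂ = solve-∀
        ... | no ≰ = +-cancelʳ-≤ (a * suc v) _ _ (≤-trans (≤-reflexive (lem (a * suc i) a v)) (Wrap.bound per {suc j} total (sym m+t) (low′ t (m<n⇒0<n∸m (≰⇒> ≰)) t≤m) σc))
          where
          t = v + suc i ∸ m
          m+t : m + t ≡ v + suc i
          m+t = m+[n∸m]≡n (<⇒≤ (≰⇒> ≰))
          t≤m : t ≤ m
          t≤m = +-cancelˡ-≤ m t m (≤-trans (≤-reflexive m+t) (+-mono-≤ (<⇒≤ v<m) i≤m))
          lem : ∀ x a v → x + a * suc v ≡ x + a * v + a
          lem = solve-∀
        D : DW (suc j ∷ z′)
        D = record
          { len = trans (cong suc (length-seg f (suc v) (m ∸ 1))) m-1
          ; tot = begin
              suc j + sum z′                ≡⟨ +-comm (suc j) (sum z′) ⟩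
              sum z′ + suc j                ≡⟨ cong (_+ suc j) (trans (cong sum (sym z-eq)) (sum-seg-rotate per v)) ⟩
              σ f m + suc j                 ≡⟨ total ⟩
              a ∎
          ; pos = λ { (suc i) _ le → subst (λ s → a * suc i < b * s) (sym (sum-z i le))
              (≤∧≢⇒< (weak i le) (λ e → no-tie _ (suc i) z<s le (sym e))) } }
          where open ≡-Reasoning

-- Reading a periodic word off its partition.

module PeriodicWords where

  open import Defs
  open Parents
  open Words
  open DyckWords
  open Rotation
  open CycleLemma
  open import Data.Nat
  open import Data.Nat.Properties
  open import Data.Nat.DivMod using (m%n<n; m<n⇒m%n≡m; [m+n]%n≡m%n; m≡m%n+[m/n]*n; m%n%n≡m%n)
  open import Data.Nat.Coprimality using (Coprime)
  open import Data.Nat.ListAction using (sum)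
  open import Data.Nat.ListAction.Properties using (sum-++)
  open import Data.Nat.Tactic.RingSolver using (solve-∀)
  open import Data.Bool using (true)
  open import Data.List as List using (List; _++_)
  open import Data.Product using (_×_; _,_)
  open import Data.Sum using (_⊎_; inj₁; inj₂)
  open import Data.Empty using (⊥; ⊥-elim)
  open import Relation.Nullary using (yes; no)
  open import Relation.Binary.PropositionalEquality

  based-S : ∀ {j z ns} → Based j z ns → ∀ i → S ns (suc i) ≡ j + S z (suc i)
  based-S region i = refl
  based-S block i = refl

  based-nth : ∀ {j z ns} → Based j z ns → ∀ t → nth ns (suc t) ≡ nth z (suc t)
  based-nth region t = refl
  based-nth block t = refl

  based-nth-0 : ∀ {z ns} → Based 0 z ns → nth ns 0 ≡ nth z 0
  based-nth-0 region = refl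

  based-head : ∀ {j z ns} → Based j z ns → 0 < j → nth z 0 ≡ 0
  based-head block _ = refl

  based-sum : ∀ {j z ns} → Based j z ns → sum ns ≡ sum z + j
  based-sum region = sym (+-identityʳ _)
  based-sum (block {j} {z}) = +-comm (suc j) (sum z)

  module PeriodicBase (a m : ℕ) (0<a : 0 < a) (a≤m : a ≤ m) (cop : Coprime a (suc m))
                      (g n : ℕ) (m≡ : m ≡ n * g) (1<n : 1 < n) where
    open ShiftBase a m 0<a a≤m cop public

    0<g : 0 < g
    0<g = n≢0⇒n>0 λ { refl → <⇒≢ 0<m (sym (trans m≡ (*-zeroʳ n))) }

    2g≤m : g + g ≤ m
    2g≤m = ≤-trans (≤-reflexive (cong (g +_) (sym (+-identityʳ g)))) (≤-trans (*-monoˡ-≤ g 1<n) (≤-reflexive (sym m≡)))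

    g<m : g < m
    g<m = <-≤-trans (m<m+n g 0<g) 2g≤m

    -- The label is the first of its block along an arc shorter than `g`, a notion independent of
    -- the base. Positive letters stand at starts, and at a start the letter is the rank; so the
    -- partition determines the periodic word.
    Start : List ℕ → ℕ → Set
    Start ns t = ∀ s → s < m → B ns t (t + s) ≡ true → s < g

    module _ {f : ℕ → ℕ} (per : Periodic g f) where

      periodic-m : Periodic m f
      periodic-m t = trans (cong (λ k → f (t + k)) m≡) (periodic-* per n t)

      module _ {v j : ℕ} {ns : List ℕ} (bs : Based j (seg f v m) ns) (D : DW ns) where
        private
          A = sum (seg f 0 g)
          H = h ns

        total : n * A + j ≡ a
        total = trans (cong (_+ j) (trans (sym (sum-seg-* per n v)) (cong (λ k → sum (seg f v k)) (sym m≡)))) (trans (sym (based-sum bs)) (DW.tot D))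

        -- Says `n (b A - a g) = a - b j`. The drift `b A - a g` per period is therefore positive
        -- for `j = 0` and negative for `j > 0`.
        balance : n * (b * A) + b * j ≡ a + n * (a * g)
        balance = begin
          n * (b * A) + b * j        ≡⟨ lem n b A j ⟩
          b * (n * A + j)            ≡⟨ cong (b *_) total ⟩
          a + m * a                  ≡⟨ cong (λ k → a + k * a) m≡ ⟩
          a + n * g * a              ≡⟨ lem₂ a n g ⟩
          a + n * (a * g) ∎
          where
          open ≡-Reasoning
          lem : ∀ n b A j → n * (b * A) + b * j ≡ b * (n * A + j)
          lem = solve-∀
          lem₂ : ∀ a n g → a + n * g * a ≡ a + n * (a * g)
          lem₂ = solve-∀

        drift : ∀ i → 0 < i → i + g ≤ m → H (i + g) + a * g ≡ H i + b * A
        drift (suc i) _ le = +-cancelʳ-≡ (a * suc i) _ _ (begin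
          H (suc i + g) + a * g + a * suc i        ≡⟨ lem (H (suc i + g)) a g (suc i) ⟩
          H (suc i + g) + a * (suc i + g)          ≡⟨ h-eq D (suc i + g) le ⟩
          b * S ns (suc i + g)                     ≡⟨ cong (b *_) S-shift ⟩
          b * (S ns (suc i) + A)                   ≡⟨ *-distribˡ-+ b (S ns (suc i)) A ⟩
          b * S ns (suc i) + b * A                 ≡⟨ cong (_+ b * A) (h-eq D (suc i) i≤m) ⟨
          H (suc i) + a * suc i + b * A            ≡⟨ lem₂ (H (suc i)) (a * suc i) (b * A) ⟩
          H (suc i) + b * A + a * suc i ∎)
          where
          open ≡-Reasoning
          i≤m : suc i ≤ m
          i≤m = ≤-trans (m≤m+n (suc i) g) le
          lem : ∀ u a g i → u + a * g + a * i ≡ u + a * (i + g)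
          lem = solve-∀
          lem₂ : ∀ x y z → x + y + z ≡ x + z + y
          lem₂ = solve-∀
          S-shift : S ns (suc i + g) ≡ S ns (suc i) + A
          S-shift = begin
            S ns (suc i + g)                                                ≡⟨ based-S bs (i + g) ⟩
            j + S (seg f v m) (suc i + g)                                   ≡⟨ cong (j +_) (S-seg f v m (suc i + g) le) ⟩
            j + sum (seg f v (suc i + g))                                   ≡⟨ cong (λ l → j + sum l) (seg-++ f v (suc i) g) ⟩
            j + sum (seg f v (suc i) ++ seg f (v + suc i) g)                ≡⟨ cong (j +_) (sum-++ (seg f v (suc i)) _) ⟩
            j + (sum (seg f v (suc i)) + sum (seg f (v + suc i) g))         ≡⟨ cong₂ (λ x y → j + (x + y)) (sym (S-seg f v m (suc i) i≤m)) (sum-seg-rotate per (v + suc i)) ⟩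
            j + (S (seg f v m) (suc i) + A)                                 ≡⟨ +-assoc j _ A ⟨
            j + S (seg f v m) (suc i) + A                                   ≡⟨ cong (_+ A) (based-S bs i) ⟨
            S ns (suc i) + A ∎

        rise : j ≡ 0 → ∀ i → 0 < i → i + g ≤ m → H i < H (i + g)
        rise refl i 0<i le = +-cancelʳ-< (a * g) _ _ (<-≤-trans (+-monoʳ-< (H i) ag<bA) (≤-reflexive (sym (drift i 0<i le))))
          where
          ag<bA : a * g < b * A
          ag<bA = *-cancelˡ-< n _ _ (≤-trans (m<n+m (n * (a * g)) 0<a) (≤-reflexive (trans (sym balance) (trans (cong (n * (b * A) +_) (*-zeroʳ b)) (+-identityʳ _)))))

        fall : 0 < j → ∀ i → 0 < i → i + g ≤ m → H (i + g) < H i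
        fall 0<j i 0<i le = +-cancelʳ-< (a * g) _ _ (≤-<-trans (≤-reflexive (drift i 0<i le)) (+-monoʳ-< (H i) bA<ag))
          where
          bA<ag : b * A < a * g
          bA<ag = *-cancelˡ-< n _ _ (+-cancelʳ-< a _ _ (begin-strict
            n * (b * A) + a            <⟨ +-monoʳ-< (n * (b * A)) (≤-trans (s≤s a≤m) (≤-trans (≤-reflexive (sym (*-identityʳ b))) (*-monoʳ-≤ b 0<j))) ⟩
            n * (b * A) + b * j        ≡⟨ balance ⟩
            a + n * (a * g)            ≡⟨ +-comm a _ ⟩
            n * (a * g) + a ∎))
            where open ≤-Reasoning

        -- With rising levels a child further away would have the lower label `c - g` between itself
        -- and its parent. With falling levels `x + g` would be lower than the parent `x`.
        child-distance : ∀ {x c} → j ≡ 0 ⊎ (0 < j × 0 < x) → c ≤ m → Par H x c → c ≤ x + g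
        child-distance {x} {c} (inj₁ j≡0) c≤m p = ≮⇒≥ λ far →
          let c′ = c ∸ g
              c′+g : c′ + g ≡ c
              c′+g = m∸n+n≡m (≤-trans (m≤n+m g x) (<⇒≤ far))
              x<c′ : x < c′
              x<c′ = +-cancelʳ-< g x c′ (subst (x + g <_) (sym c′+g) far)
          in <⇒≱ (subst (λ k → H c′ < H k) c′+g (rise j≡0 c′ (≤-<-trans z≤n x<c′) (≤-trans (≤-reflexive c′+g) c≤m)))
                 (between p c′ x<c′ (subst (c′ <_) c′+g (m<m+n c′ 0<g)))
        child-distance {x} {c} (inj₂ (0<j , 0<x)) c≤m p = ≮⇒≥ λ far →
          <⇒≱ (<-trans (fall 0<j x 0<x (≤-trans (<⇒≤ far) c≤m)) (smaller p)) (between p (x + g) (m<m+n x 0<g) far)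

        drift* : ∀ k i → 0 < i → i + k * g ≤ m → H (i + k * g) + k * (a * g) ≡ H i + k * (b * A)
        drift* zero i 0<i le = cong (λ u → H u + 0) (+-identityʳ i)
        drift* (suc k) i 0<i le = begin
          H (i + (g + k * g)) + (a * g + k * (a * g))     ≡⟨ cong (λ u → H u + (a * g + k * (a * g))) e ⟩
          H (i + k * g + g) + (a * g + k * (a * g))       ≡⟨ +-assoc (H (i + k * g + g)) (a * g) _ ⟨
          H (i + k * g + g) + a * g + k * (a * g)         ≡⟨ cong (_+ k * (a * g)) (drift (i + k * g) (<-≤-trans 0<i (m≤m+n i _)) (≤-trans (≤-reflexive (sym e)) le)) ⟩
          H (i + k * g) + b * A + k * (a * g)             ≡⟨ lem (H (i + k * g)) (b * A) (k * (a * g)) ⟩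
          H (i + k * g) + k * (a * g) + b * A             ≡⟨ cong (_+ b * A) (drift* k i 0<i (≤-trans (+-monoʳ-≤ i (m≤n+m (k * g) g)) le)) ⟩
          H i + k * (b * A) + b * A                       ≡⟨ lem₂ (H i) (k * (b * A)) (b * A) ⟩
          H i + (b * A + k * (b * A)) ∎
          where
          open ≡-Reasoning
          e : i + (g + k * g) ≡ i + k * g + g
          e = trans (cong (i +_) (+-comm g (k * g))) (sym (+-assoc i (k * g) g))
          lem : ∀ x y z → x + y + z ≡ x + z + y
          lem = solve-∀
          lem₂ : ∀ x y z → x + y + z ≡ x + (z + y)
          lem₂ = solve-∀

        -- The level just after a full turn minus one period is positive; this says exactly that no label between 1 and g
        -- is lower than label 1 + g.
        central-next : 0 < j → Par H 0 (suc g)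
        central-next 0<j = par z<s (subst (_< H (suc g)) (sym (h-0 D)) (h-pos D (suc g) z<s g<m)) λ k 0<k k≤g → <⇒≤ (low k 0<k (s≤s⁻¹ k≤g))
          where
          n′ = n ∸ 1
          n≡ : n ≡ suc n′
          n≡ = sym (m+[n∸m]≡n (<⇒≤ 1<n))
          fv≡0 : S ns 1 ≡ j
          fv≡0 = trans (based-S bs 0) (trans (cong (j +_) (trans (S-suc (seg f v m) 0) (based-head bs 0<j))) (+-identityʳ j))
          H1 : H 1 + a ≡ b * j
          H1 = trans (cong (H 1 +_) (sym (*-identityʳ a))) (trans (h-eq D 1 0<m) (cong (b *_) fv≡0))
          Hg : H (suc g) + n′ * (b * A) ≡ n′ * (a * g)
          Hg = +-cancelʳ-≡ (a * g + a) _ _ (begin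
            H (suc g) + n′ * (b * A) + (a * g + a)       ≡⟨ lem (H (suc g)) (n′ * (b * A)) (a * g) a ⟩
            (H (suc g) + a * g) + (n′ * (b * A) + a)     ≡⟨ cong (_+ (n′ * (b * A) + a)) (drift 1 z<s g<m) ⟩
            (H 1 + b * A) + (n′ * (b * A) + a)           ≡⟨ lem₂ (H 1) (b * A) n′ a ⟩
            suc n′ * (b * A) + (H 1 + a)                 ≡⟨ cong₂ (λ k x → k * (b * A) + x) (sym n≡) H1 ⟩
            n * (b * A) + b * j                          ≡⟨ balance ⟩
            a + n * (a * g)                              ≡⟨ cong (λ k → a + k * (a * g)) n≡ ⟩
            a + suc n′ * (a * g)                         ≡⟨ lem₃ a n′ (a * g) ⟩
            n′ * (a * g) + (a * g + a) ∎)
            where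
            open ≡-Reasoning
            lem : ∀ x y z w → x + y + (z + w) ≡ (x + z) + (y + w)
            lem = solve-∀
            lem₂ : ∀ x y k a → (x + y) + (k * y + a) ≡ suc k * y + (x + a)
            lem₂ = solve-∀
            lem₃ : ∀ a k y → a + suc k * y ≡ k * y + (y + a)
            lem₃ = solve-∀
          low : ∀ k → 0 < k → k ≤ g → H (suc g) < H k
          low k 0<k k≤g = +-cancelʳ-< (n′ * (b * A)) _ _ (begin-strict
            H (suc g) + n′ * (b * A)             ≡⟨ Hg ⟩
            n′ * (a * g)                         <⟨ m<n+m (n′ * (a * g)) (h-pos D (k + n′ * g) (<-≤-trans 0<k (m≤m+n k _)) k≤) ⟩
            H (k + n′ * g) + n′ * (a * g)        ≡⟨ drift* n′ k 0<k k≤ ⟩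
            H k + n′ * (b * A) ∎)
            where
            open ≤-Reasoning
            k≤ : k + n′ * g ≤ m
            k≤ = ≤-trans (+-monoˡ-≤ (n′ * g) k≤g) (≤-reflexive (trans (cong (_* g) (sym n≡)) (sym m≡)))

        private
          nth-z : ∀ t → t < m → nth (seg f v m) t ≡ f (v + t)
          nth-z t lt = nth-seg f v m t lt

          by-j : ∀ j → j ≡ 0 ⊎ 0 < j
          by-j zero = inj₁ refl
          by-j (suc _) = inj₂ z<s

          nth-ns : ∀ t → t < m → j ≡ 0 ⊎ (0 < j × 0 < t) → nth ns t ≡ f (v + t)
          nth-ns zero lt (inj₁ refl) = trans (based-nth-0 bs) (nth-z 0 lt)
          nth-ns (suc t) lt _ = trans (based-nth bs t) (nth-z (suc t) lt)
          nth-ns zero lt (inj₂ (_ , ()))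

          block-of : ∀ {x t s} → t < m → Par H x (suc t) → B ns t (t + s) ≡ true → Par H x (suc ((t + s) % m))
          block-of {x} {t} {s} t<m p r with B⁻ D t (t + s) r
          ... | y , q , q′ = subst (λ y → Par H y (suc ((t + s) % m))) (par-unique (subst (λ u → Par H y (suc u)) (m<n⇒m%n≡m t<m) q) p) q′

          in-block : ∀ {x t u} → t < m → u < m → Par H x (suc t) → Par H x (suc u) → B ns t u ≡ true
          in-block {x} {t} {u} t<m u<m p q = B⁺ D t u (x , subst (λ t → Par H x (suc t)) (sym (m<n⇒m%n≡m t<m)) p , subst (λ t → Par H x (suc t)) (sym (m<n⇒m%n≡m u<m)) q)

          wrap-block : ∀ {t u s} → t + s ≡ u + m → B ns t u ≡ true → B ns t (t + s) ≡ true
          wrap-block {t} {u} {s} e r = trans (cong (rel (πW ns) (idx t)) (idx-cong (trans (cong (_% m) e) ([m+n]%n≡m%n u m)))) r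

          cond : ∀ t → t < m → 0 < f (v + t) → j ≡ 0 ⊎ (0 < j × 0 < t)
          cond t t<m pos with by-j j
          ... | inj₁ j≡0 = inj₁ j≡0
          ... | inj₂ 0<j = inj₂ (0<j , n≢0⇒n>0 λ { refl → <⇒≢ pos (sym (trans (sym (nth-z 0 t<m)) (based-head bs 0<j))) })

          start₀ : ∀ t → t < m → 0 < f (v + t) → Start ns t
          start₀ t t<m pos s s<m r with t + s <? m
          ... | yes t+s<m = +-cancelˡ-≤ t _ _ (≤-trans (≤-reflexive (+-suc t s)) (child-distance (cond t t<m pos) t+s<m
                  (subst (λ u → Par H t (suc u)) (m<n⇒m%n≡m t+s<m) (block-of t<m p r))))
            where
            p : Par H t (suc t)
            p = h-rise D t<m (subst (0 <_) (sym (nth-ns t t<m (cond t t<m pos))) pos)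
          ... | no ≮ = ⊥-elim (<⇒≱ (before (block-of t<m p r)) (≤-trans (s≤s (≤-reflexive wrapped)) u<t))
            where
            p : Par H t (suc t)
            p = h-rise D t<m (subst (0 <_) (sym (nth-ns t t<m (cond t t<m pos))) pos)
            u = t + s ∸ m
            u+m : u + m ≡ t + s
            u+m = m∸n+n≡m (≮⇒≥ ≮)
            u<t : u < t
            u<t = +-cancelʳ-< m u t (subst (_< t + m) (sym u+m) (+-monoʳ-< t s<m))
            wrapped : (t + s) % m ≡ u
            wrapped = trans (cong (_% m) (sym u+m)) (trans ([m+n]%n≡m%n u m) (m<n⇒m%n≡m (<-trans u<t t<m)))

          distance : ∀ {t u} → u < t → t < m → Start ns t → B ns t u ≡ true → u + m < t + g
          distance {t} {u} u<t t<m st r = ≤-trans (≤-reflexive (cong suc (sym t+s))) (+-monoʳ-< t (st s s<m (wrap-block t+s r)))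
            where
            s = u + m ∸ t
            t+s : t + s ≡ u + m
            t+s = m+[n∸m]≡n (≤-trans (<⇒≤ t<m) (m≤n+m m u))
            s<m : s < m
            s<m = +-cancelˡ-< t s m (subst (_< t + m) (sym t+s) (+-monoˡ-< m u<t))

          too-far : ∀ {x t} → x < t → t < m → Start ns t → Par H x (suc t) → j ≡ 0 ⊎ (0 < j × 0 < x) → ⊥
          too-far {x} {t} x<t t<m st p c = <⇒≱ (+-cancelˡ-< x m (g + g) (<-≤-trans (distance x<t t<m st (in-block t<m (<-trans x<t t<m) p (par-child p)))
            (≤-trans (+-monoˡ-≤ g (<⇒≤ (child-distance c t<m p))) (≤-reflexive (+-assoc x g g))))) 2g≤m

          -- A start is the label right after its parent. Otherwise `suc x` precedes it in the
          -- block, and going around from the start back to it takes less than `g`; with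
          -- `child-distance` this gives `m < 2 g`. The central block contains the indices 0 and
          -- `g`, and no start can be within less than `g` of both.
          weight₀ : ∀ t → t < m → Start ns t → Weight ns t (f (v + t))
          weight₀ t t<m st with parent D z<s t<m
          ... | x , p with m≤n⇒m<n∨m≡n (s≤s⁻¹ (before p)) | by-j j
          weight₀ t t<m st | .t , p | inj₂ refl | inj₁ j≡0 = weight (subst (λ u → Par H t (suc u)) (sym (m<n⇒m%n≡m t<m)) p) (nth-ns t t<m (inj₁ j≡0))
          weight₀ zero t<m st | .0 , p | inj₂ refl | inj₂ 0<j = ⊥-elim (<-irrefl refl (st g g<m (in-block t<m g<m p (central-next 0<j))))
          weight₀ (suc t) t<m st | .(suc t) , p | inj₂ refl | inj₂ 0<j =
            weight (subst (λ u → Par H (suc t) (suc u)) (sym (m<n⇒m%n≡m t<m)) p) (nth-ns (suc t) t<m (inj₂ (0<j , z<s)))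
          weight₀ t t<m st | x , p | inj₁ x<t | inj₁ j≡0 = ⊥-elim (too-far x<t t<m st p (inj₁ j≡0))
          weight₀ t t<m st | suc x , p | inj₁ x<t | inj₂ 0<j = ⊥-elim (too-far x<t t<m st p (inj₂ (0<j , z<s)))
          weight₀ t t<m st | zero , p | inj₁ 0<t | inj₂ 0<j = ⊥-elim (<⇒≱ (+-cancelˡ-< g m t (subst (g + m <_) (+-comm t g)
              (distance g<t t<m st (in-block t<m g<m p (central-next 0<j))))) (<⇒≤ t<m))
            where
            g<t : g < t
            g<t = +-cancelʳ-< g g t (≤-<-trans 2g≤m (distance 0<t t<m st (in-block t<m 0<m p (par-child p))))

          f-% : ∀ t → f (v + t % m) ≡ f (v + t)
          f-% t = trans (sym (periodic-* periodic-m (t / m) (v + t % m)))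
            (cong f (trans (+-assoc v _ _) (cong (v +_) (sym (m≡m%n+[m/n]*n t m)))))

          B-% : ∀ t s → B ns (t % m) (t % m + s) ≡ B ns t (t + s)
          B-% t s = cong₂ (rel (πW ns)) (idx-cong (m%n%n≡m%n t m)) (idx-cong (trans (cong (_% m) (+-comm _ s)) (trans (sym (+-% s t m)) (cong (_% m) (+-comm s t)))))

        positive⇒start : ∀ t → 0 < f (v + t) → Start ns t
        positive⇒start t pos s s<m r = start₀ (t % m) (m%n<n t m) (subst (0 <_) (sym (f-% t)) pos) s s<m (trans (B-% t s) r)

        start⇒weight : ∀ t → Start ns t → Weight ns t (f (v + t))
        start⇒weight t st with weight₀ (t % m) (m%n<n t m) (λ s s<m r → st s s<m (trans (sym (B-% t s)) r))
        ... | weight {x} p e = weight (subst (λ u → Par H x (suc u)) (m%n%n≡m%n t m) p) (trans e (f-% t))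

-- Partitions fixed by rotation by `g` have periodic words at the centre.

module FixedPartitions where

  open import Defs
  open Parents
  open Words
  open DyckWords
  open Rotation
  open CycleLemma
  open PeriodicWords
  open Centre
  open import Data.Nat
  open import Data.Nat.Properties
  open import Data.Nat.DivMod using (m%n<n; m<n⇒m%n≡m; [m+n]%n≡m%n; [m+kn]%n≡m%n)
  open import Data.Nat.Coprimality using (Coprime)
  open import Data.Nat.ListAction using (sum)
  open import Data.Nat.Tactic.RingSolver using (solve-∀)
  open import Data.Bool using (true)
  open import Data.Fin as Fin using (Fin; toℕ)
  import Data.Fin.Properties as Fin
  open import Data.List as List using (List; []; _∷_; _++_; length)
  open import Data.List.Properties using (length-++; ∷-injectiveʳ)
  open import Data.List.Relation.Unary.All as All using (All; []; _∷_)
  open import Data.Vec as Vec using (Vec; []; _∷_; lookup; tabulate)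
  import Data.Vec.Properties as Vec
  open import Data.Product using (∃; _×_; _,_)
  open import Data.Sum using (_⊎_; inj₁; inj₂)
  open import Data.Empty using (⊥; ⊥-elim)
  open import Function using (_∘_)
  open import Relation.Nullary using (¬_; yes; no)
  open import Relation.Binary.PropositionalEquality

  ΣF : ∀ {A} → (Fin A → ℕ) → ℕ
  ΣF f = Vec.sum (tabulate f)

  ΣF-cong : ∀ {A} {f g : Fin A → ℕ} → (∀ t → f t ≡ g t) → ΣF f ≡ ΣF g
  ΣF-cong e = cong Vec.sum (Vec.tabulate-cong e)

  ΣF-+ : ∀ {A} (f g : Fin A → ℕ) → ΣF (λ t → f t + g t) ≡ ΣF f + ΣF g
  ΣF-+ {zero} f g = refl
  ΣF-+ {suc A} f g = trans (cong (f Fin.zero + g Fin.zero +_) (ΣF-+ (f ∘ Fin.suc) (g ∘ Fin.suc))) (lem (f Fin.zero) (g Fin.zero) _ _)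
    where
    lem : ∀ x y z w → x + y + (z + w) ≡ x + z + (y + w)
    lem = solve-∀

  ΣF-0 : ∀ A → ΣF {A} (λ _ → 0) ≡ 0
  ΣF-0 zero = refl
  ΣF-0 (suc A) = ΣF-0 A

  ΣF-δ : ∀ A (F : ℕ → ℕ) x → x < A → ΣF {A} (λ t → F (toℕ t) * δ (toℕ t) x) ≡ F x
  ΣF-δ (suc A) F zero lt = trans (cong₂ _+_ (trans (cong (F 0 *_) (δ-refl 0)) (*-identityʳ (F 0)))
    (trans (ΣF-cong {A} (λ t → *-zeroʳ (F (suc (toℕ t))))) (ΣF-0 A))) (+-identityʳ (F 0))
  ΣF-δ (suc A) F (suc x) (s≤s lt) = trans (cong (_+ ΣF {A} (λ t → F (suc (toℕ t)) * δ (suc (toℕ t)) (suc x))) (*-zeroʳ (F 0))) (ΣF-δ A (F ∘ suc) x lt)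

  ΣF-cnt : ∀ A (F : ℕ → ℕ) w → All (_< A) w → ΣF {A} (λ t → F (toℕ t) * cnt (toℕ t) w) ≡ sum (List.map F w)
  ΣF-cnt A F [] [] = trans (ΣF-cong {A} (λ t → *-zeroʳ (F (toℕ t)))) (ΣF-0 A)
  ΣF-cnt A F (x ∷ w) (x<A ∷ all) = trans (ΣF-cong {A} (λ t → *-distribˡ-+ (F (toℕ t)) (δ (toℕ t) x) (cnt (toℕ t) w)))
    (trans (ΣF-+ {A} (λ t → F (toℕ t) * δ (toℕ t) x) _) (cong₂ _+_ (ΣF-δ A F x x<A) (ΣF-cnt A F w all)))

  length-by-content : ∀ A w → All (_< A) w → ΣF {A} (λ t → cnt (toℕ t) w) ≡ length w
  length-by-content A w all = trans (ΣF-cong {A} (λ t → sym (+-identityʳ (cnt (toℕ t) w)))) (trans (ΣF-cnt A (λ _ → 1) w all) (ones w))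
    where
    ones : ∀ w → sum (List.map (λ _ → 1) w) ≡ length w
    ones [] = refl
    ones (x ∷ w) = cong suc (ones w)

  sum-by-content : ∀ A w → All (_< A) w → ΣF {A} (λ t → toℕ t * cnt (toℕ t) w) ≡ sum w
  sum-by-content A w all = trans (ΣF-cnt A (λ x → x) w all) (ident w)
    where
    ident : ∀ w → sum (List.map (λ x → x) w) ≡ sum w
    ident [] = refl
    ident (x ∷ w) = cong (x +_) (ident w)

  letters-≤-sum : ∀ w → All (_≤ sum w) w
  letters-≤-sum [] = []
  letters-≤-sum (x ∷ w) = m≤m+n x (sum w) ∷ All.map (λ le → ≤-trans le (m≤n+m (sum w) x)) (letters-≤-sum w)

  ΣF-lookup : ∀ {A} (c : Vec ℕ A) → ΣF (lookup c) ≡ Vec.sum c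
  ΣF-lookup c = cong Vec.sum (Vec.tabulate∘lookup c)

  one-hot : ∀ {A} (u : Vec ℕ A) → Vec.sum u ≡ 1 → ∃ λ (j : Fin A) → ∀ v → lookup u v ≡ δ (toℕ v) (toℕ j)
  one-hot (zero ∷ u) e with one-hot u e
  ... | j , f = Fin.suc j , λ { Fin.zero → refl ; (Fin.suc v) → f v }
  one-hot (suc zero ∷ u) e = Fin.zero , λ { Fin.zero → refl ; (Fin.suc v) → sum-0 u (suc-injective e) v }
  one-hot (suc (suc x) ∷ u) ()

  -- Either way the full word is `z` plus one letter `j`: for a region the appended 0 itself, for a
  -- block the rank, which replaces a 0 of `z` that the appended one restores.
  based-cnt : ∀ {j z ns} → Based j z ns → ∀ x → cnt x (ns ++ 0 ∷ []) ≡ cnt x z + δ x j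
  based-cnt (region {z}) x = trans (cnt-++ x z (0 ∷ [])) (cong (cnt x z +_) (+-identityʳ (δ x 0)))
  based-cnt (block {j} {z}) x = trans (cong (δ x (suc j) +_) (trans (cnt-++ x z (0 ∷ [])) (cong (cnt x z +_) (+-identityʳ (δ x 0)))))
    (lem (δ x (suc j)) (cnt x z) (δ x 0))
    where
    lem : ∀ x y z → x + (y + z) ≡ z + y + x
    lem = solve-∀

  module FixedBase (a m : ℕ) (0<a : 0 < a) (a≤m : a ≤ m) (cop : Coprime a (suc m))
                   (g n : ℕ) (m≡ : m ≡ n * g) (1<n : 1 < n) where
    open PeriodicBase a m 0<a a≤m cop g n m≡ 1<n public
    open SearchBase a m 0<a a≤m cop using (based-rotation; σ)

    instance
      g-nonZero : NonZero g
      g-nonZero = >-nonZero 0<g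
      n-nonZero : NonZero n
      n-nonZero = >-nonZero (<-trans z<s 1<n)

    cyclic : ∀ {ns} → DW ns → CyclicPartition m
    cyclic {ns} D = record
      { ρ = B ns
      ; ~-refl = reflexive
      ; ~-sym = λ {i} {j} r → let x , p , q = B⁻ D i j r in B⁺ D j i (x , q , p)
      ; ~-trans = λ {i} {j} {k} r s → let x , p , q = B⁻ D i j r ; y , p′ , q′ = B⁻ D j k s in
          B⁺ D i k (x , p , subst (λ y → Par (h ns) y (suc (k % m))) (par-unique p′ q) q′)
      ; periodic = λ i → trans (cong (λ k → rel (πW ns) k (idx i)) (idx-cong ([m+n]%n≡m%n i m))) (reflexive i)
      ; crossing = crossing }
      where
      reflexive : ∀ i → B ns i i ≡ true
      reflexive i = let x , p = parent D z<s (m%n<n i m) in B⁺ D i i (x , p , p)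
      -- Turning `i` to the first label makes 0 the parent of its block. The other block then has
      -- the same parent, or it crosses in the linear sense.
      crossing : ∀ {i j k l} → i < j → j < k → k < l → l < i + m → B ns i k ≡ true → B ns j l ≡ true → B ns i j ≡ true
      crossing {i} {j} {k} {l} i<j j<k k<l l<i+m r s with shift i D
      ... | ns′ , D′ , sh , _ = subst₂ (λ u w → B ns u w ≡ true) (+-identityʳ i) (i+ i<j) (trans (sym (blocks sh 0 (j ∸ i))) goal)
        where
        i+ : ∀ {k} → i < k → i + (k ∸ i) ≡ k
        i+ lt = m+[n∸m]≡n (<⇒≤ lt)
        i<k = <-trans i<j j<k
        i<l = <-trans i<k k<l
        l′<m : l ∸ i < m
        l′<m = +-cancelˡ-< i _ _ (subst (_< i + m) (sym (i+ i<l)) l<i+m)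
        k′<l′ : k ∸ i < l ∸ i
        k′<l′ = ∸-monoˡ-< k<l (<⇒≤ i<k)
        j′<k′ : j ∸ i < k ∸ i
        j′<k′ = ∸-monoˡ-< j<k (<⇒≤ i<j)
        label : ∀ {t x} → t < m → Par (h ns′) x (suc (t % m)) → Par (h ns′) x (suc t)
        label {t} {x} lt = subst (λ u → Par (h ns′) x (suc u)) (m<n⇒m%n≡m lt)
        first : ∀ {x} → Par (h ns′) x 1 → x ≡ 0
        first p = n≤0⇒n≡0 (s≤s⁻¹ (before p))
        r′ : SameBlock (h ns′) (suc (0 % m)) (suc ((k ∸ i) % m))
        r′ = B⁻ D′ 0 (k ∸ i) (trans (blocks sh 0 (k ∸ i)) (subst₂ (λ u w → B ns u w ≡ true) (sym (+-identityʳ i)) (sym (i+ i<k)) r))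
        s′ : SameBlock (h ns′) (suc ((j ∸ i) % m)) (suc ((l ∸ i) % m))
        s′ = B⁻ D′ (j ∸ i) (l ∸ i) (trans (blocks sh (j ∸ i) (l ∸ i)) (subst₂ (λ u w → B ns u w ≡ true) (sym (i+ i<j)) (sym (i+ i<l)) s))
        goal : B ns′ 0 (j ∸ i) ≡ true
        goal with r′ | s′
        ... | x , p , q | zero , p′ , q′ = B⁺ D′ 0 (j ∸ i) (0 , subst (λ x → Par (h ns′) x (suc (0 % m))) (first (label 0<m p)) p , p′)
        ... | x , p , q | suc y , p′ , q′ = ⊥-elim (noncrossing z<s
                (<-≤-trans (before (label (<-trans j′<k′ (<-trans k′<l′ l′<m)) p′)) (s≤s (<⇒≤ j′<k′))) (s≤s k′<l′)
                (subst (λ x → Par (h ns′) x (suc (k ∸ i))) (first (label 0<m p)) (label (<-trans k′<l′ l′<m) q)) (label l′<m q′))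

    shift-invariant : ∀ {v ns ns′} → Shifted v ns ns′ → Invariant (πW ns) g → Invariant (πW ns′) g
    shift-invariant {v} {ns} sh inv t t′ = trans (blocks sh (g + t) (g + t′))
      (trans (cong₂ (B ns) (lem v g t) (lem v g t′)) (trans (inv (v + t) (v + t′)) (sym (blocks sh t t′))))
      where
      lem : ∀ v g t → v + (g + t) ≡ g + (v + t)
      lem = solve-∀

    -- A base move by `g` does not change an invariant partition, and the partition determines the
    -- word.
    self-shift : ∀ {ns ns′} → DW ns → DW ns′ → Shifted g ns ns′ → Invariant (πW ns) g → ns′ ≡ ns
    self-shift D D′ sh inv = π-injective D′ D (β-ext _ _ λ t t′ → trans (blocks sh t t′) (inv t t′))

    -- Both orders of concatenation give the same word, so it equals its cyclic rotation by the
    -- length of `us`.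
    rotation-periodic : ∀ us vs → us ++ vs ≡ vs ++ us → length us ≡ g → length (us ++ vs) ≡ m → Periodic g (ext m (us ++ vs))
    rotation-periodic us vs e refl len t = trans (cong (nth z) (trans (cong (_% m) (+-comm t g)) (+-% g t m))) (go (t % m) (m%n<n t m))
      where
      z = us ++ vs
      p = length vs
      g+p : g + p ≡ m
      g+p = trans (sym (length-++ us)) len
      go : ∀ s → s < m → nth z ((g + s) % m) ≡ nth z s
      go s s<m with s <? p
      ... | yes s<p = trans (cong (nth z) (m<n⇒m%n≡m (subst (g + s <_) g+p (+-monoʳ-< g s<p)))) (trans (nth-++ʳ us vs s)
            (sym (trans (cong (λ l → nth l s) e) (nth-++ˡ vs us s s<p))))
      ... | no s≮p = trans (cong (nth z) wrapped) (trans (nth-++ˡ us vs s′ s′<g) (sym (trans (cong (λ l → nth l s) e) (trans (cong (nth (vs ++ us)) (sym p+s′)) (nth-++ʳ vs us s′)))))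
        where
        s′ = s ∸ p
        p+s′ : p + s′ ≡ s
        p+s′ = m+[n∸m]≡n (≮⇒≥ s≮p)
        s′<g : s′ < g
        s′<g = +-cancelˡ-< p s′ g (subst₂ _<_ (sym p+s′) (trans (sym g+p) (+-comm g p)) s<m)
        wrapped : (g + s) % m ≡ s′
        wrapped = trans (cong (_% m) (trans (cong (g +_) (sym p+s′)) (trans (sym (+-assoc g p s′)) (trans (cong (_+ s′) g+p) (+-comm m s′)))))
          (trans ([m+n]%n≡m%n s′ m) (m<n⇒m%n≡m (<-trans s′<g g<m)))

    record PeriodicBased (ns : List ℕ) : Set where
      constructor periodicBased
      field
        {j}     : ℕ
        {z}     : List ℕ
        based   : Based j z ns
        len-z   : length z ≡ m
        z-per   : Periodic g (ext m z)

    -- Label `g + 1` belongs to the base block, so its position has the letter 0 and the base can be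
    -- moved there. The word does not change, and with the rank removed from its head it is a
    -- product of two commuting words.
    block-periodic : ∀ {ns} → DW ns → Invariant (πW ns) g → B ns 0 g ≡ true → PeriodicBased ns
    block-periodic {ns} D inv r with split-at ns g (≤-trans (<⇒≤ g<m) (≤-reflexive (sym (DW.len D))))
    ... | [] , vs , _ , e = ⊥-elim (<⇒≢ 0<g e)
    ... | k ∷ us , [] , refl , e = ⊥-elim (<⇒≢ g<m (trans (sym e) (trans (sym (+-identityʳ _)) (DW-length (k ∷ us) [] D))))
    ... | zero ∷ us , x ∷ vs , refl , e = ⊥-elim (<-asym (h-fall-< D 0<m refl) (subst (_< h (0 ∷ us ++ x ∷ vs) 1) (sym (h-0 D)) (h-pos D 1 z<s 0<m)))
    ... | suc k ∷ us , x ∷ vs , refl , e = periodicBased {z = 0 ∷ us ++ 0 ∷ vs} (subst (λ x → Based (suc k) (0 ∷ us ++ 0 ∷ vs) (suc k ∷ us ++ x ∷ vs)) (sym x≡0) block)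
            (trans (cong suc (trans (length-++ us) (sym (length-++ us)))) (DW.len D₀)) (rotation-periodic (0 ∷ us) (0 ∷ vs) swap e (DW.len D₀))
      where
      central : Par (h ((suc k ∷ us) ++ x ∷ vs)) 0 (suc g)
      central with B⁻ D 0 g r
      ... | y , p , q = subst₂ (λ y u → Par (h ((suc k ∷ us) ++ x ∷ vs)) y (suc u)) (n≤0⇒n≡0 (s≤s⁻¹ (before (subst (λ u → Par (h ((suc k ∷ us) ++ x ∷ vs)) y (suc u)) (m<n⇒m%n≡m 0<m) p)))) (m<n⇒m%n≡m g<m) q
      x≡0 : x ≡ 0
      x≡0 = n≤0⇒n≡0 (≮⇒≥ λ pos → <⇒≢ 0<g (par-unique central (h-rise D g<m (subst (0 <_) (sym nth-g) pos))))
        where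
        nth-g : nth ((suc k ∷ us) ++ x ∷ vs) g ≡ x
        nth-g = trans (cong (nth ((suc k ∷ us) ++ x ∷ vs)) (trans (sym e) (sym (+-identityʳ _)))) (nth-++ʳ (suc k ∷ us) (x ∷ vs) 0)
      D₀ : DW ((suc k ∷ us) ++ 0 ∷ vs)
      D₀ = subst (λ x → DW ((suc k ∷ us) ++ x ∷ vs)) x≡0 D
      D₁ : DW ((suc k ∷ vs) ++ 0 ∷ us)
      D₁ = Block.rotated (suc k) us vs D₀ (subst₂ (λ x c → Par (h ((suc k ∷ us) ++ x ∷ vs)) 0 (suc c)) x≡0 (sym e) central)
      same : (suc k ∷ vs) ++ 0 ∷ us ≡ (suc k ∷ us) ++ 0 ∷ vs
      same = self-shift D₀ D₁ (subst (λ y → Shifted y _ _) e (block-shift (suc k) us vs D₀ D₁)) (subst (λ x → Invariant (πW ((suc k ∷ us) ++ x ∷ vs)) g) x≡0 inv)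
      swap : (0 ∷ us) ++ 0 ∷ vs ≡ (0 ∷ vs) ++ 0 ∷ us
      swap = cong (0 ∷_) (∷-injectiveʳ (sym same))

    region-periodic : ∀ {ns} → DW ns → Invariant (πW ns) g → (∀ k → g < k → k ≤ m → h ns g < h ns k) → PeriodicBased ns
    region-periodic {ns} D inv spine with split-at ns g (≤-trans (<⇒≤ g<m) (≤-reflexive (sym (DW.len D))))
    ... | us , vs , refl , e = periodicBased region (DW.len D) (rotation-periodic us vs (sym same) e (DW.len D))
      where
      D₁ : DW (vs ++ us)
      D₁ = Region.rotated us vs D λ i 0<i le → subst (λ x → h (us ++ vs) x < h (us ++ vs) (x + i)) (sym e)
        (spine (g + i) (m<m+n g 0<i) (subst₂ _≤_ (cong (_+ i) e) (DW-length us vs D) (+-monoʳ-≤ (length us) le)))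
      same : vs ++ us ≡ us ++ vs
      same = self-shift D D₁ (subst (λ y → Shifted y _ _) e (region-shift us vs D D₁)) inv

    -- Based at a widest block, the rotated copy of that block would cross any block hiding g from the base region.
    spine-at-widest : ∀ {ns} (D : DW ns) → Invariant (πW ns) g → ∀ L → L < g → B ns 0 L ≡ true →
      (∀ s → s < m → B ns 0 s ≡ true → s ≤ L) →
      (∀ e → ∃ λ c → B ns e c ≡ true × (∀ s → s < m → B ns c (c + s) ≡ true → s ≤ L)) →
      ∀ k → g < k → k ≤ m → h ns g < h ns k
    spine-at-widest {ns} D inv L L<g 0~L arc₀ arcs k g<k k≤m = ≰⇒> λ hk≤hg → absurd hk≤hg (argmin H (suc g) (m ∸ suc g))
      where
      H = h ns
      open CyclicPartition (cyclic D)
      par-label : ∀ {t x} → t < m → Par H x (suc (t % m)) → Par H x (suc t)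
      par-label {t} {x} lt = subst (λ u → Par H x (suc u)) (m<n⇒m%n≡m lt)
      in-block : ∀ {x t u} → t < m → u < m → Par H x (suc t) → Par H x (suc u) → B ns t u ≡ true
      in-block {x} {t} {u} t<m u<m p q = B⁺ D t u (x , subst (λ t → Par H x (suc t)) (sym (m<n⇒m%n≡m t<m)) p , subst (λ t → Par H x (suc t)) (sym (m<n⇒m%n≡m u<m)) q)
      L<m : L < m
      L<m = <-trans L<g g<m
      root-par : Par H 0 1
      root-par = par z<s (subst (_< H 1) (sym (h-0 D)) (h-pos D 1 z<s 0<m)) (λ k l u → ⊥-elim (<⇒≱ u l))
      L-par : Par H 0 (suc L)
      L-par with B⁻ D 0 L 0~L
      ... | x , p , q = subst (λ x → Par H x (suc L)) (par-unique (par-label 0<m p) root-par) (par-label L<m q)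
      absurd : H k ≤ H g → (∃ λ y → suc g ≤ y × y ≤ suc g + (m ∸ suc g) × (∀ i → suc g ≤ i → i ≤ suc g + (m ∸ suc g) → H y ≤ H i)) → ⊥
      absurd hk≤hg (zero , () , _)
      absurd hk≤hg (suc y , s≤s g≤y , y≤ , min) = from-parent (parent D z<s y<m)
        where
        y<m : y < m
        y<m = ≤-trans y≤ (≤-reflexive (m+[n∸m]≡n g<m))
        hy≤ : ∀ i → g ≤ i → i ≤ m → H (suc y) ≤ H i
        hy≤ i g≤i i≤m with m≤n⇒m<n∨m≡n g≤i
        ... | inj₁ g<i = min i g<i (≤-trans i≤m (≤-reflexive (sym (m+[n∸m]≡n g<m))))
        ... | inj₂ refl = ≤-trans (min k g<k (≤-trans k≤m (≤-reflexive (sym (m+[n∸m]≡n g<m))))) hk≤hg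
        from-parent : (∃ λ x → Par H x (suc y)) → ⊥
        from-parent (x , p) = g≁x (~-sym (crossing x<g g<y y<g+L (≤-trans (s≤s (+-monoʳ-≤ g (<⇒≤ L<g))) (≤-trans (s≤s 2g≤m) (m<n⇒m<o+n x 0<x ≤-refl))) x~y g~g+L))
          where
          m<n⇒m<o+n : ∀ x {o} → 0 < x → o ≤ m → suc o ≤ x + m
          m<n⇒m<o+n (suc x) _ le = s≤s (≤-trans le (m≤n+m m x))
          x<g : x < g
          x<g = ≰⇒> λ g≤x → <⇒≱ (smaller p) (hy≤ x g≤x (≤-trans (s≤s⁻¹ (before p)) (<⇒≤ y<m)))
          x<m : x < m
          x<m = <-trans x<g g<m
          x~y : B ns x y ≡ true
          x~y = in-block x<m y<m (par-child p) p
          L<x : L < x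
          L<x with m≤n⇒m<n∨m≡n (z≤n {x})
          ... | inj₂ refl = ⊥-elim (<⇒≱ L<g (≤-trans g≤y (arc₀ y y<m x~y)))
          ... | inj₁ 0<x = ≰⇒> λ x≤L → <⇒≱ (<-≤-trans (smaller p) (between p (suc L) (s≤s x≤L) (s≤s (<-≤-trans L<g g≤y))))
                  (between L-par x 0<x (s≤s x≤L))
          0<x : 0 < x
          0<x = ≤-<-trans z≤n L<x
          g~g+L : B ns g (g + L) ≡ true
          g~g+L = subst (λ u → B ns u (g + L) ≡ true) (+-identityʳ g) (trans (inv 0 L) 0~L)
          -- Turned back by `g`, the relation would put `x + m - g` into the base block, beyond `L`
          -- because `2 g ≤ m`.
          g≁x : ¬ B ns g x ≡ true
          g≁x r = <⇒≱ (+-cancelˡ-< x m (g + g) (≤-<-trans (≤-reflexive (sym x+)) (≤-<-trans (+-monoˡ-≤ g (arc₀ t t<m 0~t)) (≤-trans (s≤s (+-monoˡ-≤ g (<⇒≤ L<g))) (m<n+m (g + g) 0<x))))) 2g≤m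
            where
            t = x + m ∸ g
            g+t : g + t ≡ x + m
            g+t = m+[n∸m]≡n (≤-trans (<⇒≤ g<m) (m≤n+m m x))
            x+ : t + g ≡ x + m
            x+ = trans (+-comm t g) g+t
            t<m : t < m
            t<m = +-cancelˡ-< g t m (subst (_< g + m) (sym g+t) (+-monoˡ-< m x<g))
            0~t : B ns 0 t ≡ true
            0~t = trans (sym (inv 0 t)) (subst₂ (λ u w → B ns u w ≡ true) (sym (+-identityʳ g)) (sym g+t) (~-trans r (~-sym (periodic x))))
          g<y : g < y
          g<y = ≤∧≢⇒< g≤y λ { refl → g≁x (~-sym x~y) }
          offset : ∀ c t → c < m → t < m → ∃ λ s → s < m × (c + s ≡ t ⊎ c + s ≡ t + m)
          offset c t c<m t<m with c ≤? t
          ... | yes c≤t = t ∸ c , ≤-<-trans (m∸n≤m t c) t<m , inj₁ (m+[n∸m]≡n c≤t)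
          ... | no c≰t = t + m ∸ c , +-cancelˡ-< c _ m (subst (_< c + m) (sym e) (+-monoˡ-< m (≰⇒> c≰t))) , inj₂ e
            where
            e : c + (t + m ∸ c) ≡ t + m
            e = m+[n∸m]≡n (≤-trans (<⇒≤ c<m) (m≤n+m m t))
          reach : ∀ {c t s} → B ns c t ≡ true → c + s ≡ t ⊎ c + s ≡ t + m → B ns c (c + s) ≡ true
          reach {c} r (inj₁ e) = subst (λ u → B ns c u ≡ true) (sym e) r
          reach {c} {t} r (inj₂ e) = subst (λ u → B ns c u ≡ true) (sym e) (~-trans r (~-sym (periodic t)))
          -- The block of `x` and `y` fits into an arc of length `L`. That arc starts at or before
          -- `x`: wrapping past `m` would need `x + m` or `y + m` to be at most `m + L`.
          near-y : y ≤ x + L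
          near-y with arcs x
          ... | c , x~c , arc = go (c % m) (m%n<n c m) (~-trans (~-sym c~) (~-sym x~c)) arc′
            where
            c~ : B ns c (c % m) ≡ true
            c~ = trans (cong (rel (πW ns) (idx c)) (idx-cong {t′ = c} (m<n⇒m%n≡m (m%n<n c m)))) (~-refl c)
            arc′ : ∀ s → s < m → B ns (c % m) (c % m + s) ≡ true → s ≤ L
            arc′ s s<m r = arc s s<m (trans (sym (cong₂ (rel (πW ns)) (idx-cong {t′ = c} (m<n⇒m%n≡m (m%n<n c m)))
              (idx-cong (trans (cong (_% m) (+-comm (c % m) s)) (trans (sym (+-% s c m)) (cong (_% m) (+-comm s c))))))) r)
            go : ∀ c → c < m → B ns c x ≡ true → (∀ s → s < m → B ns c (c + s) ≡ true → s ≤ L) → y ≤ x + L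
            go c c<m c~x arc with offset c x c<m x<m | offset c y c<m y<m
            ... | s₁ , s₁<m , e₁ | s₂ , s₂<m , e₂ = conclude e₁ e₂ (arc s₁ s₁<m (reach c~x e₁)) (arc s₂ s₂<m (reach (~-trans c~x x~y) e₂))
              where
              x<y : x < y
              x<y = <-≤-trans x<g g≤y
              conclude : c + s₁ ≡ x ⊎ c + s₁ ≡ x + m → c + s₂ ≡ y ⊎ c + s₂ ≡ y + m → s₁ ≤ L → s₂ ≤ L → y ≤ x + L
              conclude (inj₁ e₁) (inj₁ e₂) _ s₂≤ = ≤-trans (≤-reflexive (sym e₂)) (+-mono-≤ (≤-trans (m≤m+n c s₁) (≤-reflexive e₁)) s₂≤)
              conclude (inj₂ e₁) _ s₁≤ _ = ⊥-elim (<⇒≱ (<-≤-trans (subst (m + L <_) (+-comm m x) (+-monoʳ-< m L<x)) (≤-reflexive (sym e₁))) (+-mono-≤ (<⇒≤ c<m) s₁≤))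
              conclude _ (inj₂ e₂) _ s₂≤ = ⊥-elim (<⇒≱ (<-≤-trans (subst (m + L <_) (+-comm m y) (+-monoʳ-< m (<-trans L<x x<y))) (≤-reflexive (sym e₂))) (+-mono-≤ (<⇒≤ c<m) s₂≤))
          y<g+L : y < g + L
          y<g+L = ≤-<-trans near-y (+-monoˡ-< L x<g)

    find-center : ∀ {ns} → DW ns → Invariant (πW ns) g → ∃ λ v → ∃ λ ns′ → DW ns′ × Shifted v ns ns′ × (∀ x → cnt x ns′ ≡ cnt x ns) × PeriodicBased ns′
    find-center {ns} D inv with CenterOf.center (cyclic D) g 0<g 2g≤m
        (λ {i} {j} r → subst₂ (λ u w → B ns u w ≡ true) (+-comm g i) (+-comm g j) (trans (inv i j) r))
    ... | inj₁ (v , _ , r) with shift v D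
    ...   | ns′ , D′ , sh , c = v , ns′ , D′ , sh , c , block-periodic D′ (shift-invariant sh inv)
            (trans (blocks sh 0 g) (subst (λ u → B ns u (v + g) ≡ true) (sym (+-identityʳ v)) r))
    find-center {ns} D inv | inj₂ W with shift (CenterOf.Widest.v W) D
    ...   | ns′ , D′ , sh , c = v , ns′ , D′ , sh , c , region-periodic D′ (shift-invariant sh inv)
            (spine-at-widest D′ (shift-invariant sh inv) L L<g (trans (blocks sh 0 L) (at-v v~))
              (λ s s<m r → v-arc s s<m (subst (λ u → B ns u (v + s) ≡ true) (+-identityʳ v) (trans (sym (blocks sh 0 s)) r)))
              (λ e → arc-at e (widest (v + e))))
      where
      open CenterOf.Widest W
      open CyclicPartition (cyclic D)
      at-v : ∀ {u} → B ns v u ≡ true → B ns (v + 0) u ≡ true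
      at-v {u} r = subst (λ w → B ns w u ≡ true) (sym (+-identityʳ v)) r
      arc-at : ∀ e → (∃ λ c → B ns (v + e) c ≡ true × (∀ s → s < m → B ns c (c + s) ≡ true → s ≤ L)) →
        ∃ λ c → B ns′ e c ≡ true × (∀ s → s < m → B ns′ c (c + s) ≡ true → s ≤ L)
      arc-at e (c , r , arc) = c′ , trans (blocks sh e c′) (subst (λ u → B ns (v + e) u ≡ true) (sym v+c′) (trans (+*-right c v) r)) ,
        λ s s<m q → arc s s<m (trans (sym (cong₂ (rel (πW ns)) (idx-cong ([m+kn]%n≡m%n c v m)) (idx-cong (trans (cong (_% m) (lem c (v * m) s)) ([m+kn]%n≡m%n (c + s) v m)))))
          (subst₂ (λ u w → B ns u w ≡ true) v+c′ (trans (sym (+-assoc v c′ s)) (cong (_+ s) v+c′)) (trans (sym (blocks sh c′ (c′ + s))) q)))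
        where
        c′ = c + v * (m ∸ 1)
        v+c′ : v + c′ ≡ c + v * m
        v+c′ = subst (λ M → v + (c + v * (m ∸ 1)) ≡ c + v * M) (m+[n∸m]≡n 0<m) (lem′ v c (m ∸ 1))
          where
          lem′ : ∀ v c n → v + (c + v * n) ≡ c + v * suc n
          lem′ = solve-∀
        lem : ∀ c x s → c + x + s ≡ c + s + x
        lem = solve-∀
        +*-right : ∀ c k → B ns (v + e) (c + k * m) ≡ B ns (v + e) c
        +*-right c k = cong (rel (πW ns) (idx (v + e))) (idx-cong ([m+kn]%n≡m%n c k m))

-- The bijection between fixed partitions and words of length `g`.

module Coding where

  open import Defs
  open Parents
  open Words
  open DyckWords
  open Kreweras using (sum≤weighted)
  open Ranks using (module RankBase)
  open Rotation
  open CycleLemma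
  open PeriodicWords
  open FixedPartitions
  open import Data.Nat
  open import Data.Nat.Properties
  open import Data.Nat.DivMod using (m%n<n; m<n⇒m%n≡m; [m+kn]%n≡m%n; m≡m%n+[m/n]*n; +-distrib-/-∣ʳ; m<n⇒m/n≡0; m*n/n≡m)
  open import Data.Nat.Divisibility using (divides-refl)
  open import Data.Nat.Coprimality using (Coprime)
  open import Data.Nat.ListAction using (sum)
  open import Data.Nat.ListAction.Properties using (sum-++)
  open import Data.Nat.Tactic.RingSolver using (solve-∀)
  open import Data.Bool using (true)
  open import Data.Fin as Fin using (Fin; toℕ; fromℕ<)
  import Data.Fin.Properties as Fin
  open import Data.List as List using (List; []; _∷_; _++_; length)
  open import Data.List.Properties using (length-++; ++-identityʳ)
  open import Data.List.Membership.Propositional using (_∈_)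
  open import Data.List.Relation.Unary.All as All using (All; []; _∷_)
  open import Data.List.Relation.Unary.Unique.Propositional using (Unique)
  open import Data.Vec as Vec using (Vec; []; _∷_; lookup; tabulate)
  import Data.Vec.Properties as Vec
  open import Data.Product using (∃; _×_; _,_; proj₁; proj₂)
  open import Data.Empty using (⊥; ⊥-elim)
  open import Function using (_∘_)
  open import Relation.Nullary using (¬_; yes; no)
  open import Relation.Binary.PropositionalEquality

  ΣF-* : ∀ {A} k (f : Fin A → ℕ) → ΣF (λ t → k * f t) ≡ k * ΣF f
  ΣF-* {zero} k f = sym (*-zeroʳ k)
  ΣF-* {suc A} k f = trans (cong (k * f Fin.zero +_) (ΣF-* k (f ∘ Fin.suc))) (sym (*-distribˡ-+ k (f Fin.zero) _))

  All-seg : ∀ {P : ℕ → Set} f v k → (∀ t → P (f t)) → All P (seg f v k)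
  All-seg f v zero p = []
  All-seg f v (suc k) p = p v ∷ All-seg f (suc v) k p

  nth-≤-sum : ∀ ns t → nth ns t ≤ sum ns
  nth-≤-sum [] t = z≤n
  nth-≤-sum (x ∷ ns) zero = m≤m+n x (sum ns)
  nth-≤-sum (x ∷ ns) (suc t) = ≤-trans (nth-≤-sum ns t) (m≤n+m (sum ns) x)

  δ-≤1 : ∀ x y → δ x y ≤ 1
  δ-≤1 x y with x ≟ y
  ... | yes refl = ≤-reflexive (δ-refl x)
  ... | no ne = ≤-trans (≤-reflexive (δ-≢ ne)) z≤n

  δ-determines : ∀ {A x y} → x < A → (∀ (v : Fin A) → δ (toℕ v) x ≡ δ (toℕ v) y) → x ≡ y
  δ-determines {A} {x} {y} x<A e with x ≟ y
  ... | yes eq = eq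
  ... | no ne = ⊥-elim (0≢1+n (sym (trans (sym (δ-refl x)) (trans (subst (λ u → δ u x ≡ δ u y) (Fin.toℕ-fromℕ< x<A) (e (fromℕ< x<A))) (δ-≢ ne)))))

  module ContentBase (a m : ℕ) (0<a : 0 < a) (a≤m : a ≤ m) (cop : Coprime a (suc m)) (r : Vec ℕ a)
                     (weighted : Vec.sum (tabulate (λ (t : Fin a) → suc (toℕ t) * lookup r t)) ≡ a) where
    open RankBase a m 0<a a≤m cop using (DW; module DW; Content; b)

    -- Multiplicities in the word of length `b`, its final 0 included; this makes the letter 0 occur
    -- `b - k` times.
    c : Vec ℕ (suc a)
    c = (b ∸ Vec.sum r) ∷ r

    sum-c : Vec.sum c ≡ b
    sum-c = m∸n+n≡m (≤-trans (sum≤weighted r) (≤-trans (≤-reflexive weighted) (≤-trans a≤m (n≤1+n m))))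

    FullContent : List ℕ → Set
    FullContent ns = ∀ (v : Fin (suc a)) → cnt (toℕ v) (ns ++ 0 ∷ []) ≡ lookup c v

    letters : ∀ {ns} → DW ns → All (_< suc a) (ns ++ 0 ∷ [])
    letters {ns} D = All.map (λ le → s≤s (≤-trans le (≤-reflexive (trans (sum-++ ns (0 ∷ [])) (trans (+-identityʳ _) (DW.tot D)))))) (letters-≤-sum (ns ++ 0 ∷ []))

    private
      cnt-suc : ∀ t ns → cnt (suc t) (ns ++ 0 ∷ []) ≡ cnt (suc t) ns
      cnt-suc t ns = trans (cnt-++ (suc t) ns (0 ∷ [])) (+-identityʳ _)

    full⁺ : ∀ {ns} → DW ns → Content r ns → FullContent ns
    full⁺ {ns} D co (Fin.suc t) = trans (cnt-suc (toℕ t) ns) (co t)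
    full⁺ {ns} D co Fin.zero = trans (sym (m+n∸n≡m _ (Vec.sum r))) (cong (_∸ Vec.sum r) (begin
      cnt 0 ns₀ + Vec.sum r                                              ≡⟨ cong (cnt 0 ns₀ +_) (ΣF-lookup r) ⟨
      cnt 0 ns₀ + ΣF (lookup r)                                          ≡⟨ cong (cnt 0 ns₀ +_) (ΣF-cong (λ t → trans (sym (co t)) (sym (cnt-suc (toℕ t) ns)))) ⟩
      ΣF {suc a} (λ t → cnt (toℕ t) ns₀)                                 ≡⟨ length-by-content (suc a) ns₀ (letters D) ⟩
      length ns₀                                                         ≡⟨ trans (length-++ ns) (trans (cong (_+ 1) (DW.len D)) (+-comm m 1)) ⟩
      b ∎))
      where
      open ≡-Reasoning
      ns₀ = ns ++ 0 ∷ []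

    full⁻ : ∀ {ns} → FullContent ns → Content r ns
    full⁻ {ns} fc t = trans (sym (cnt-suc (toℕ t) ns)) (fc (Fin.suc t))

    weighted-c : ΣF {suc a} (λ v → toℕ v * lookup c v) ≡ a
    weighted-c = weighted

  module CodedBase (a m : ℕ) (0<a : 0 < a) (a≤m : a ≤ m) (cop : Coprime a (suc m)) (r : Vec ℕ a)
                   (weighted : Vec.sum (tabulate (λ (t : Fin a) → suc (toℕ t) * lookup r t)) ≡ a)
                   (g n : ℕ) (m≡ : m ≡ n * g) (1<n : 1 < n) where
    open FixedBase a m 0<a a≤m cop g n m≡ 1<n
    open ContentBase a m 0<a a≤m cop r weighted
    open SearchBase a m 0<a a≤m cop using (based-rotation; σ)

    -- The word w, read periodically from position v, is the word of run lengths seen from the centre.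
    record Coded (j : ℕ) (π : Rel m) (w : List ℕ) : Set where
      constructor coded
      field
        {ns ns′} : List ℕ
        {v}      : ℕ
        D        : DW ns
        π≡       : πW ns ≡ π
        D′       : DW ns′
        sh       : Shifted v ns ns′
        based    : Based j (seg (ext g w) v m) ns′
        len      : length w ≡ g

    -- Since `n ≥ 2`, this is division with remainder: `cnt` is the quotient by `n`, and the
    -- remainders single out `j`.
    Split : ℕ → List ℕ → Set
    Split j w = ∀ (v : Fin (suc a)) → lookup c v ≡ n * cnt (toℕ v) w + δ (toℕ v) j

    qs : Vec ℕ (suc a)
    qs = Vec.map (_/ n) c

    split-quotient : ∀ {j w} → Split j w → ∀ v → cnt (toℕ v) w ≡ lookup qs v
    split-quotient {j} {w} sp v = sym (trans (Vec.lookup-map v (_/ n) c) (trans (cong (_/ n) (trans (sp v) (trans (+-comm _ (δ (toℕ v) j)) (cong (δ (toℕ v) j +_) (*-comm n _)))))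
      (trans (+-distrib-/-∣ʳ (δ (toℕ v) j) {d = n} (divides-refl (cnt (toℕ v) w)))
        (cong₂ _+_ (m<n⇒m/n≡0 (≤-<-trans (δ-≤1 (toℕ v) j) 1<n)) (m*n/n≡m (cnt (toℕ v) w) n)))))

    split-remainder : ∀ {j w} → Split j w → ∀ v → lookup c v % n ≡ δ (toℕ v) j
    split-remainder {j} {w} sp v = trans (cong (_% n) (trans (sp v) (trans (+-comm _ (δ (toℕ v) j)) (cong (δ (toℕ v) j +_) (*-comm n _)))))
      (trans ([m+kn]%n≡m%n (δ (toℕ v) j) (cnt (toℕ v) w) n) (m<n⇒m%n≡m (≤-<-trans (δ-≤1 (toℕ v) j) 1<n)))

    cnt-periods : ∀ w v x → length w ≡ g → cnt x (seg (ext g w) v m) ≡ n * cnt x w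
    cnt-periods w v x len = trans (cong (λ k → cnt x (seg (ext g w) v k)) m≡)
      (trans (cnt-seg-* (ext-periodic g w) x n v) (cong (λ l → n * cnt x l) (seg-ext g w len)))

    coded-split : ∀ {j ns′ w v} → FullContent ns′ → Based j (seg (ext g w) v m) ns′ → length w ≡ g → Split j w
    coded-split {j} {ns′} {w} {v} fc bs len u = trans (sym (fc u)) (trans (based-cnt bs (toℕ u)) (cong (_+ δ (toℕ u) j) (cnt-periods w v (toℕ u) len)))

    word-of-fixed : ∀ {π} → InX a b r π → Invariant π g → ∃ λ j → ∃ λ w → Coded j π w × j ≤ a × Split j w × HasContent qs w
    word-of-fixed {π} inX inv with InX⇒word {r} inX
    ... | ns , D , co , refl with find-center D inv
    ...   | v , ns′ , D′ , sh , cnts , periodicBased {j} {z} bs len-z z-per = j , w , coded D refl D′ sh bs′ len-w , j≤a , sp , all-w , split-quotient {j} {w} sp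
      where
      f = ext m z
      -- This is `- v` modulo `g`, so reading `w` from `v` starts at the head of `z`.
      K = (g ∸ 1) * v
      w = seg f K g
      len-w : length w ≡ g
      len-w = length-seg f K g
      K+v : K + v ≡ v * g
      K+v = trans (+-comm K v) (trans (cong (_* v) (m+[n∸m]≡n 0<g)) (*-comm g v))
      ext-w : ∀ t → ext g w (v + t) ≡ f (0 + t)
      ext-w t = trans (nth-seg f K g _ (m%n<n (v + t) g)) (trans (sym (periodic-* z-per ((v + t) / g) (K + (v + t) % g)))
        (trans (cong f (trans (+-assoc K _ _) (trans (cong (K +_) (sym (m≡m%n+[m/n]*n (v + t) g))) (trans (sym (+-assoc K v t)) (trans (cong (_+ t) K+v) (+-comm (v * g) t))))))
          (periodic-* z-per v t)))
      z-eq : seg (ext g w) v m ≡ z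
      z-eq = trans (seg-cong (ext g w) f v 0 m (λ t _ → ext-w t)) (seg-ext m z len-z)
      bs′ : Based j (seg (ext g w) v m) ns′
      bs′ = subst (λ l → Based j l ns′) (sym z-eq) bs
      sum-z : sum z + j ≡ a
      sum-z = trans (sym (based-sum bs)) (DW.tot D′)
      j≤a : j ≤ a
      j≤a = ≤-trans (m≤n+m j (sum z)) (≤-reflexive sum-z)
      fc : FullContent ns′
      fc = full⁺ D′ λ t → trans (cnts (suc (toℕ t))) (co t)
      sp : Split j w
      sp = coded-split {j} {ns′} {w} {v} fc bs′ len-w
      all-w : All (_< suc a) w
      all-w = All-seg f K g λ t → s≤s (≤-trans (nth-≤-sum z (t % m)) (≤-trans (m≤m+n (sum z) j) (≤-reflexive sum-z)))

    -- With the centre in a block, the degenerate splittings are the turns by 0 and by `m`; every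
    -- other case is one of the two moves of the base.
    based-shift : ∀ {j us vs ns₁ ns₂} → Based j (us ++ vs) ns₁ → Based j (vs ++ us) ns₂ → DW ns₁ → DW ns₂ → Shifted (length us) ns₁ ns₂
    based-shift {zero} {us} {vs} {ns₁} {ns₂} b₁ b₂ D₁ D₂ = subst₂ (Shifted (length us)) (sym (is-region b₁)) (sym (is-region b₂))
        (region-shift us vs (subst DW (is-region b₁) D₁) (subst DW (is-region b₂) D₂))
      where
      is-region : ∀ {z ns} → Based 0 z ns → ns ≡ z
      is-region region = refl
    based-shift {suc j} {[]} {vs} b₁ b₂ D₁ D₂ = subst (Shifted 0 _) (same b₁ b₂ refl) shifted-refl
      where
      same : ∀ {z z′ ns ns′} → Based (suc j) z ns → Based (suc j) (z′ ++ []) ns′ → z ≡ z′ → ns ≡ ns′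
      same {z′ = []} b₁ () refl
      same {z′ = x ∷ z′} block block refl = cong (suc j ∷_) (sym (++-identityʳ z′))
    based-shift {suc j} {u ∷ us} {[]} {ns₁} b₁ b₂ D₁ D₂ = full-turn b₁ b₂
      where
      full-turn : ∀ {ns₂} → Based (suc j) (u ∷ us ++ []) ns₁ → Based (suc j) (u ∷ us) ns₂ → Shifted (suc (length us)) ns₁ ns₂
      full-turn block block = subst₂ (λ x l → Shifted x l (suc j ∷ us)) (sym len) (cong (suc j ∷_) (sym (++-identityʳ us))) (shifted-add 1 shifted-refl)
        where
        len : suc (length us) ≡ 0 + 1 * m
        len = trans (cong (suc ∘ length) (sym (++-identityʳ us))) (trans (lens b₁) (trans (DW.len D₁) (sym (+-identityʳ m))))
          where
          lens : ∀ {z ns} → Based (suc j) z ns → length z ≡ length ns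
          lens block = refl
    based-shift {suc j} {u ∷ us} {v ∷ vs} b₁ b₂ D₁ D₂ = go b₁ b₂ D₁ D₂
      where
      go : ∀ {ns₁ ns₂} → Based (suc j) (u ∷ us ++ v ∷ vs) ns₁ → Based (suc j) (v ∷ vs ++ u ∷ us) ns₂ → DW ns₁ → DW ns₂ → Shifted (suc (length us)) ns₁ ns₂
      go block block D₁ D₂ = block-shift (suc j) us vs D₁ D₂

    rotate-based : ∀ {f j v x ns₁ ns₂} → Periodic m f → x ≤ m → Based j (seg f v m) ns₁ → Based j (seg f (v + x) m) ns₂ → DW ns₁ → DW ns₂ → Shifted x ns₁ ns₂
    rotate-based {f} {j} {v} {x} {ns₁} {ns₂} per x≤m b₁ b₂ D₁ D₂ = subst (λ y → Shifted y ns₁ ns₂) (length-seg f v x)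
        (based-shift {j} {seg f v x} {seg f (v + x) p} (subst (λ l → Based j l ns₁) eq₁ b₁) (subst (λ l → Based j l ns₂) eq₂ b₂) D₁ D₂)
      where
      p = m ∸ x
      x+p : x + p ≡ m
      x+p = m+[n∸m]≡n x≤m
      eq₁ : seg f v m ≡ seg f v x ++ seg f (v + x) p
      eq₁ = trans (cong (seg f v) (sym x+p)) (seg-++ f v x p)
      eq₂ : seg f (v + x) m ≡ seg f (v + x) p ++ seg f v x
      eq₂ = trans (cong (seg f (v + x)) (trans (sym x+p) (+-comm x p))) (trans (seg-++ f (v + x) p x)
        (cong (seg f (v + x) p ++_) (seg-cong f f (v + x + p) v x (λ t _ → trans (cong f (trans (cong (_+ t) (trans (+-assoc v x p) (cong (v +_) x+p)))
          (trans (+-assoc v m t) (trans (cong (v +_) (+-comm m t)) (sym (+-assoc v t m)))))) (per (v + t))))))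

    -- Two centred words read from the same periodic word with the same `j` differ by a move of the
    -- base by `v₂ - v₁`, represented by `x₀`. Undoing the shift to `v₂` then compares the
    -- partitions themselves.
    coded-π-unique : ∀ {j π₁ π₂ w} → Coded j π₁ w → Coded j π₂ w → π₁ ≡ π₂
    coded-π-unique {j} {w = w} (coded {ns₁} {ns₁′} {v₁} D₁ refl D₁′ sh₁ b₁ len) (coded {ns₂} {ns₂′} {v₂} D₂ refl D₂′ sh₂ b₂ _) =
        β-ext _ _ λ t t′ → trans (sym (from-v₂ ns₁ t t′)) (trans (trans (sym (blocks turned (back t) (back t′))) (blocks sh₂ (back t) (back t′))) (from-v₂ ns₂ t t′))
      where
      f = ext g w
      x₀ = v₂ + v₁ * (m ∸ 1)
      x = x₀ % m
      v₁+x₀ : v₁ + x₀ ≡ v₂ + v₁ * m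
      v₁+x₀ = subst (λ M → v₁ + (v₂ + v₁ * (m ∸ 1)) ≡ v₂ + v₁ * M) (m+[n∸m]≡n 0<m) (lem v₁ v₂ (m ∸ 1))
        where
        lem : ∀ u v n → u + (v + u * n) ≡ v + u * suc n
        lem = solve-∀
      v₁+x : v₁ + x + (x₀ / m) * m ≡ v₂ + v₁ * m
      v₁+x = trans (+-assoc v₁ x _) (trans (cong (v₁ +_) (sym (m≡m%n+[m/n]*n x₀ m))) v₁+x₀)
      per = periodic-m (ext-periodic g w)
      move : ∀ u k t → u + k * m + t ≡ u + t + k * m
      move u k t = trans (+-assoc u (k * m) t) (trans (cong (u +_) (+-comm (k * m) t)) (sym (+-assoc u t (k * m))))
      same-seg : seg f v₂ m ≡ seg f (v₁ + x) m
      same-seg = seg-cong f f v₂ (v₁ + x) m λ t _ → trans (sym (periodic-* per v₁ (v₂ + t)))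
        (trans (cong f (trans (sym (move v₂ v₁ t)) (trans (cong (_+ t) (sym v₁+x)) (move (v₁ + x) (x₀ / m) t)))) (periodic-* per (x₀ / m) (v₁ + x + t)))
      turned : Shifted v₂ ns₁ ns₂′
      turned = shifted-drop v₁ (subst (λ y → Shifted y ns₁ ns₂′) v₁+x (shifted-add (x₀ / m)
        (shifted-trans sh₁ (rotate-based per (<⇒≤ (m%n<n x₀ m)) b₁ (subst (λ l → Based j l ns₂′) same-seg b₂) D₁′ D₂′))))
      back : ℕ → ℕ
      back t = t + v₂ * (m ∸ 1)
      from-v₂ : ∀ ns t t′ → B ns (v₂ + back t) (v₂ + back t′) ≡ B ns t t′
      from-v₂ ns t t′ = trans (cong₂ (B ns) (e t) (e t′)) (β-+* (πW ns) v₂ t t′)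
        where
        e : ∀ t → v₂ + back t ≡ t + v₂ * m
        e t = subst (λ M → v₂ + (t + v₂ * (m ∸ 1)) ≡ t + v₂ * M) (m+[n∸m]≡n 0<m) (lem v₂ t (m ∸ 1))
          where
          lem : ∀ v t n → v + (t + v * n) ≡ t + v * suc n
          lem = solve-∀

    private
      start-up : ∀ {v ns ns′} → Shifted v ns ns′ → ∀ t → Start ns′ t → Start ns (v + t)
      start-up {v} {ns} sh t st s s<m r = st s s<m (trans (blocks sh t (t + s)) (subst (λ u → B ns (v + t) u ≡ true) (+-assoc v t s) r))

      start-down : ∀ {v ns ns′} → Shifted v ns ns′ → ∀ t → Start ns (v + t) → Start ns′ t
      start-down {v} {ns} sh t st s s<m r = st s s<m (subst (λ u → B ns (v + t) u ≡ true) (sym (+-assoc v t s)) (trans (sym (blocks sh t (t + s))) r))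

      weight-up : ∀ {v ns ns′ t w} → DW ns → Shifted v ns ns′ → Weight ns′ t w → Weight ns (v + t) w
      weight-up {v} {ns} {t = t} D sh wt with weight-exists D (v + t)
      ... | w₀ , wt₀ = subst (Weight ns (v + t)) (weight-unique (weights sh t w₀ wt₀) wt) wt₀

      start-+* : ∀ {ns t} k → Start ns t → Start ns (t + k * m)
      start-+* {ns} {t} k st s s<m r = st s s<m (trans (sym (β-+* (πW ns) k t (t + s))) (subst (λ u → B ns (t + k * m) u ≡ true) (lem t (k * m) s) r))
        where
        lem : ∀ t x s → t + x + s ≡ t + s + x
        lem = solve-∀

      start-+*⁻ : ∀ {ns t} k → Start ns (t + k * m) → Start ns t
      start-+*⁻ {ns} {t} k st s s<m r = st s s<m (subst (λ u → B ns (t + k * m) u ≡ true) (sym (lem t (k * m) s)) (trans (β-+* (πW ns) k t (t + s)) r))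
        where
        lem : ∀ t x s → t + x + s ≡ t + s + x
        lem = solve-∀

      letter-start : ∀ {j ns ns′ v w} → DW ns → DW ns′ → Shifted v ns ns′ → Based j (seg (ext g w) v m) ns′ →
        ∀ u → (0 < ext g w u → Start ns u) × (Start ns u → Weight ns u (ext g w u))
      letter-start {j} {ns} {ns′} {v} {w} D D′ sh bs u =
          (λ pos → start-+*⁻ v (subst (Start ns) v+t (start-up sh t (positive⇒start per bs D′ t (subst (0 <_) (sym f-eq) pos)))))
        , (λ st → weight-+* v (subst₂ (Weight ns) v+t f-eq (weight-up D sh (start⇒weight per bs D′ t (start-down sh t (subst (Start ns) (sym v+t) (start-+* v st)))))))
        where
        per = ext-periodic g w
        t = u + v * (m ∸ 1)
        v+t : v + t ≡ u + v * m
        v+t = subst (λ M → v + (u + v * (m ∸ 1)) ≡ u + v * M) (m+[n∸m]≡n 0<m) (lem v u (m ∸ 1))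
          where
          lem : ∀ v u n → v + (u + v * n) ≡ u + v * suc n
          lem = solve-∀
        f-eq : ext g w (v + t) ≡ ext g w u
        f-eq = trans (cong (ext g w) v+t) (periodic-* (periodic-m per) v u)

      same-letter : ∀ {ns t x y} → (0 < x → Start ns t) × (Start ns t → Weight ns t x) → (0 < y → Start ns t) × (Start ns t → Weight ns t y) → x ≡ y
      same-letter {x = zero} {zero} _ _ = refl
      same-letter {x = suc x} (s , w) (s′ , w′) = weight-unique (w (s z<s)) (w′ (s z<s))
      same-letter {x = zero} {suc y} (s , w) (s′ , w′) = weight-unique (w (s′ z<s)) (w′ (s′ z<s))

    -- Letter by letter: if either letter is positive, its place is a start of the common partition,
    -- and both letters are the rank there.
    coded-w-unique : ∀ {j π w₁ w₂} → Coded j π w₁ → Coded j π w₂ → w₁ ≡ w₂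
    coded-w-unique {j} {π} {w₁} {w₂} (coded {ns₁} {v = v₁} D₁ e₁ D₁′ sh₁ b₁ len₁) (coded {ns₂} {ns₂′} {v₂} D₂ e₂ D₂′ sh₂ b₂ len₂) =
        trans (sym (seg-ext g w₁ len₁)) (trans (seg-cong (ext g w₁) (ext g w₂) 0 0 g (λ t _ → same t)) (seg-ext g w₂ len₂))
      where
      ns₂≡ns₁ : ns₂ ≡ ns₁
      ns₂≡ns₁ = π-injective D₂ D₁ (trans e₂ (sym e₁))
      sh : Shifted v₂ ns₁ ns₂′
      sh = subst (λ ns → Shifted v₂ ns ns₂′) ns₂≡ns₁ sh₂
      same : ∀ t → ext g w₁ t ≡ ext g w₂ t
      same t = same-letter {ns₁} {t} (letter-start {j} {w = w₁} D₁ D₁′ sh₁ b₁ t) (letter-start {j} {w = w₂} D₁ D₂′ sh b₂ t)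

    shifted-inverse : ∀ {v ns ns′} → DW ns → DW ns′ → Shifted (v * (m ∸ 1)) ns′ ns → Shifted v ns ns′
    shifted-inverse {v} {ns} {ns′} D D′ sh = shifted
      (λ t t′ → sym (trans (blocks sh (v + t) (v + t′)) (trans (cong₂ (B ns′) (e t) (e t′)) (β-+* (πW ns′) v t t′))))
      (λ t w wt → let w₀ , wt₀ = weight-exists D′ t in
        subst (Weight ns′ t) (weight-unique (weights sh (v + t) w₀ (subst (λ u → Weight ns′ u w₀) (sym (e t)) (weight-+*⁻ v wt₀))) wt) wt₀)
      where
      e : ∀ t → v * (m ∸ 1) + (v + t) ≡ t + v * m
      e t = subst (λ M → v * (m ∸ 1) + (v + t) ≡ t + v * M) (m+[n∸m]≡n 0<m) (lem v t (m ∸ 1))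
        where
        lem : ∀ v t n → v * n + (v + t) ≡ t + v * suc n
        lem = solve-∀

    -- The content gives `n (sum w) + j = a`, which is what `based-rotation` asks for. The centred
    -- word is based at `v` and, by periodicity, also at `v + g`; hence its partition is invariant.
    -- A final shift undoes `v`.
    fixed-of-word : ∀ j w → j ≤ a → length w ≡ g → All (_< suc a) w → Split j w → ∃ λ π → InX a b r π × Invariant π g × Coded j π w
    fixed-of-word j w j≤a len all sp with based-rotation {ext g w} j (periodic-m (ext-periodic g w)) total-w
      where
      A = sum w
      σ-m : σ (ext g w) m ≡ n * A
      σ-m = trans (cong (λ k → sum (seg (ext g w) 0 k)) m≡) (trans (sum-seg-* (ext-periodic g w) n 0) (cong (λ l → n * sum l) (seg-ext g w len)))
      total-w : σ (ext g w) m + j ≡ a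
      total-w = begin
        σ (ext g w) m + j                                                           ≡⟨ cong (_+ j) σ-m ⟩
        n * A + j                                                                   ≡⟨ cong₂ (λ x y → n * x + y) (sum-by-content (suc a) w all) (ΣF-δ (suc a) (λ x → x) j (s≤s j≤a)) ⟨
        n * ΣF {suc a} (λ v → toℕ v * cnt (toℕ v) w) + ΣF {suc a} (λ v → toℕ v * δ (toℕ v) j) ≡⟨ cong (_+ ΣF {suc a} (λ v → toℕ v * δ (toℕ v) j)) (ΣF-* n (λ (v : Fin (suc a)) → toℕ v * cnt (toℕ v) w)) ⟨
        ΣF {suc a} (λ v → n * (toℕ v * cnt (toℕ v) w)) + ΣF {suc a} (λ v → toℕ v * δ (toℕ v) j) ≡⟨ ΣF-+ {suc a} (λ v → n * (toℕ v * cnt (toℕ v) w)) (λ v → toℕ v * δ (toℕ v) j) ⟨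
        ΣF {suc a} (λ v → n * (toℕ v * cnt (toℕ v) w) + toℕ v * δ (toℕ v) j)        ≡⟨ ΣF-cong {suc a} (λ v → trans (lem n (toℕ v) (cnt (toℕ v) w) (δ (toℕ v) j)) (cong (toℕ v *_) (sym (sp v)))) ⟩
        ΣF {suc a} (λ v → toℕ v * lookup c v)                                       ≡⟨ weighted-c ⟩
        a ∎
        where
        open ≡-Reasoning
        lem : ∀ n v k d → n * (v * k) + v * d ≡ v * (n * k + d)
        lem = solve-∀
    ... | v , ns′ , bs , D′ with shift (v * (m ∸ 1)) D′
    ...   | ns , D , sh , cnts = πW ns , word⇒InX {r} D co , shift-invariant sh inv′ , coded D refl D′ (shifted-inverse D D′ sh) bs len
      where
      fc : FullContent ns′
      fc u = trans (based-cnt bs (toℕ u)) (trans (cong (_+ δ (toℕ u) j) (cnt-periods w v (toℕ u) len)) (sym (sp u)))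
      co : Content r ns
      co t = trans (cnts (suc (toℕ t))) (full⁻ {ns′} fc t)
      inv′ : Invariant (πW ns′) g
      inv′ t t′ = sym (blocks (rotate-based {ext g w} {j} {v} {g} (periodic-m (ext-periodic g w)) (<⇒≤ g<m) bs
        (subst (λ l → Based j l ns′) (seg-cong (ext g w) (ext g w) v (v + g) m (λ s _ → sym (trans (cong (ext g w) (lem v g s)) (ext-periodic g w (v + s))))) bs) D′ D′) t t′)
        where
        lem : ∀ v g s → v + g + s ≡ v + s + g
        lem = solve-∀

    private
      rs : Vec ℕ (suc a)
      rs = Vec.map (_% n) c

      sum-divmod : ∀ {A} (c : Vec ℕ A) → Vec.sum c ≡ Vec.sum (Vec.map (_% n) c) + Vec.sum (Vec.map (_/ n) c) * n
      sum-divmod [] = refl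
      sum-divmod (x ∷ c) = trans (cong₂ _+_ (m≡m%n+[m/n]*n x n) (sum-divmod c)) (lem (x % n) (x / n) n (Vec.sum (Vec.map (_% n) c)) _)
        where
        lem : ∀ a b n c d → a + b * n + (c + d * n) ≡ a + c + (b + d) * n
        lem = solve-∀

    no-fixed : ¬ Vec.sum qs ≡ g → ∀ π → InX a b r π → ¬ Invariant π g
    no-fixed ne π inX inv = contradict (word-of-fixed inX inv)
      where
      contradict : (∃ λ j → ∃ λ w → Coded j π w × j ≤ a × Split j w × HasContent qs w) → ⊥
      contradict (j , w , cd , _ , sp , all , co) = ne (begin
        Vec.sum qs                              ≡⟨ ΣF-lookup qs ⟨
        ΣF (lookup qs)                          ≡⟨ ΣF-cong (λ v → sym (co v)) ⟩
        ΣF {suc a} (λ v → cnt (toℕ v) w)        ≡⟨ length-by-content (suc a) w all ⟩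
        length w                                ≡⟨ Coded.len cd ⟩
        g ∎)
        where open ≡-Reasoning

    private
      -- The multiplicities sum to `b = g n + 1`, so the remainders sum to 1: exactly one letter can
      -- be the central one.
      central-rank : Vec.sum qs ≡ g → ∃ λ (j : Fin (suc a)) → ∀ v → lookup rs v ≡ δ (toℕ v) (toℕ j)
      central-rank sum-qs = one-hot rs (+-cancelʳ-≡ (g * n) _ _ (trans (cong (λ x → Vec.sum rs + x * n) (sym sum-qs))
        (trans (sym (sum-divmod c)) (trans sum-c (cong suc (trans m≡ (*-comm n g)))))))

      module _ (j : Fin (suc a)) (hot : ∀ v → lookup rs v ≡ δ (toℕ v) (toℕ j)) where
        rem : ∀ v → lookup c v % n ≡ δ (toℕ v) (toℕ j)
        rem v = trans (sym (Vec.lookup-map v (_% n) c)) (hot v)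

        encode : ∀ π → InX a b r π → Invariant π g → ∃ λ w → w ∈ words g qs × Coded (toℕ j) π w
        encode π inX inv = convert (word-of-fixed inX inv)
          where
          convert : (∃ λ j′ → ∃ λ w → Coded j′ π w × j′ ≤ a × Split j′ w × HasContent qs w) → ∃ λ w → w ∈ words g qs × Coded (toℕ j) π w
          convert (j′ , w , cd , j′≤a , sp , co) = w , words-complete g qs w (Coded.len cd) co , subst (λ j → Coded j π w)
            (δ-determines (s≤s j′≤a) (λ v → trans (sym (split-remainder {j′} {w} sp v)) (rem v))) cd

        split-of : ∀ {w} → HasContent qs w → Split (toℕ j) w
        split-of {w} (_ , co) v = begin
          lookup c v                                        ≡⟨ m≡m%n+[m/n]*n (lookup c v) n ⟩
          lookup c v % n + lookup c v / n * n               ≡⟨ cong₂ (λ x y → x + y * n) (rem v) (trans (sym (Vec.lookup-map v (_/ n) c)) (sym (co v))) ⟩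
          δ (toℕ v) (toℕ j) + cnt (toℕ v) w * n             ≡⟨ lem (δ (toℕ v) (toℕ j)) (cnt (toℕ v) w) n ⟩
          n * cnt (toℕ v) w + δ (toℕ v) (toℕ j) ∎
          where
          open ≡-Reasoning
          lem : ∀ x y n → x + y * n ≡ n * y + x
          lem = solve-∀

        decode : Vec.sum qs ≡ g → ∀ w → w ∈ words g qs → ∃ λ π → InX a b r π × Invariant π g × Coded (toℕ j) π w
        decode sum-qs w w∈ = let len , co = words-sound g qs sum-qs w∈ in
          fixed-of-word (toℕ j) w (s≤s⁻¹ (Fin.toℕ<n j)) len (proj₁ co) (split-of co)

    fixed-count : Vec.sum qs ≡ g → ∀ L → Unique L → (∀ {π} → π ∈ L → InX a b r π × Invariant π g) →
      (∀ {π} → InX a b r π → Invariant π g → π ∈ L) → length L ≡ length (words g qs)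
    fixed-count sum-qs L uniq sound complete = count (central-rank sum-qs)
      where
      count : (∃ λ (j : Fin (suc a)) → ∀ v → lookup rs v ≡ δ (toℕ v) (toℕ j)) → length L ≡ length (words g qs)
      count (j , hot) = bijection-≡ (Coded (toℕ j)) L (words g qs) uniq (words-unique g qs)
        (λ {π} π∈ → encode j hot π (proj₁ (sound π∈)) (proj₂ (sound π∈)))
        (λ {w} w∈ → let π , inX , inv , cd = decode j hot sum-qs w w∈ in π , complete inX inv , cd)
        coded-π-unique coded-w-unique

-- Counting all partitions of a given rank profile by the cycle lemma.

module TotalCount where

  open import Defs
  open Words
  open DyckWords
  open Ranks using (module RankBase)
  open CycleLemma
  open FixedPartitions
  open Coding
  open import Data.Nat
  open import Data.Nat.Properties
  open import Data.Nat.DivMod using (m%n<n; m≡m%n+[m/n]*n)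
  open import Data.Nat.Coprimality using (Coprime)
  open import Data.Nat.ListAction using (sum)
  open import Data.Nat.ListAction.Properties using (sum-++)
  open import Data.Nat.Tactic.RingSolver using (solve-∀)
  open import Data.Fin as Fin using (Fin; toℕ)
  open import Data.List as List using (List; []; _∷_; _++_; length; upTo; cartesianProduct)
  open import Data.List.Properties using (length-++; length-map; length-upTo; ++-cancelʳ)
  open import Data.List.Membership.Propositional using (_∈_)
  open import Data.List.Membership.Propositional.Properties using (∈-upTo⁺; ∈-upTo⁻; ∈-cartesianProduct⁺; ∈-cartesianProduct⁻)
  open import Data.List.Relation.Unary.All as All using (All)
  open import Data.List.Relation.Unary.Unique.Propositional using (Unique)
  import Data.List.Relation.Unary.Unique.Propositional.Properties as Unique
  open import Data.Vec as Vec using (Vec; lookup; tabulate)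
  open import Data.Product using (∃; _×_; _,_; proj₁; proj₂)
  open import Data.Sum using (inj₁; inj₂)
  open import Relation.Nullary using (¬_)
  open import Relation.Binary.PropositionalEquality

  length-× : ∀ {A B : Set} (xs : List A) (ys : List B) → length (cartesianProduct xs ys) ≡ length xs * length ys
  length-× [] ys = refl
  length-× (x ∷ xs) ys = trans (length-++ (List.map (x ,_) ys)) (cong₂ _+_ (length-map (x ,_) ys) (length-× xs ys))

  module CycleBase (a m : ℕ) (0<a : 0 < a) (a≤m : a ≤ m) (cop : Coprime a (suc m)) (r : Vec ℕ a)
                   (weighted : Vec.sum (tabulate (λ (t : Fin a) → suc (toℕ t) * lookup r t)) ≡ a) where
    open RankBase a m 0<a a≤m cop
    open ContentBase a m 0<a a≤m cop r weighted
    open SearchBase a m 0<a a≤m cop using (dyck-rotation; σ)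

    private
      loop : List ℕ → ℕ → ℕ
      loop ns = ext b (ns ++ 0 ∷ [])

      len₀ : ∀ {ns} → DW ns → length (ns ++ 0 ∷ []) ≡ b
      len₀ {ns} D = trans (length-++ ns) (trans (cong (_+ 1) (DW.len D)) (+-comm m 1))

      sum₀ : ∀ {ns} → DW ns → sum (ns ++ 0 ∷ []) ≡ a
      sum₀ {ns} D = trans (sum-++ ns (0 ∷ [])) (trans (+-identityʳ _) (DW.tot D))

      loop-per : ∀ ns → Periodic b (loop ns)
      loop-per ns = ext-periodic b (ns ++ 0 ∷ [])

    -- Each arrangement of length `b` is a unique cyclic rotation of the full word of a unique
    -- partition; so the pairs of an offset and a partition are counted by a multinomial
    -- coefficient.
    record Rotated (vπ : ℕ × Rel m) (W : List ℕ) : Set where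
      constructor rotated
      field
        {ns} : List ℕ
        D    : DW ns
        π≡   : πW ns ≡ proj₂ vπ
        v<b  : proj₁ vπ < b
        W≡   : W ≡ seg (loop ns) (proj₁ vπ) b

    private
      S-loop : ∀ {ns} → DW ns → ∀ {i} → i ≤ m → S ns i ≡ sum (seg (loop ns) 0 i)
      S-loop {ns} D {i} i≤m = trans (sym (S-++ˡ ns (0 ∷ []) i (≤-trans i≤m (≤-reflexive (sym (DW.len D))))))
        (trans (cong (λ l → S l i) (sym (seg-ext b (ns ++ 0 ∷ []) (len₀ D)))) (S-seg (loop ns) 0 b i (≤-trans i≤m (n≤1+n m))))

      -- Both the prefix of length x and the complementary one would lie strictly above the diagonal.
      no-rotation : ∀ {ns ns′} → DW ns → DW ns′ → ∀ x → (∀ s → loop ns′ (x + s) ≡ loop ns s) → x < b → ¬ 0 < x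
      no-rotation {ns} {ns′} D D′ x e (s≤s x≤m) 0<x = <-irrefl refl (begin-strict
        a * b                                                           ≡⟨ cong (a *_) x+y ⟨
        a * (x + y)                                                     ≡⟨ *-distribˡ-+ a x y ⟩
        a * x + a * y                                                   <⟨ +-mono-< (DW.pos D′ x 0<x x≤m) (DW.pos D y (m<n⇒0<n∸m (s≤s x≤m)) y≤m) ⟩
        b * S ns′ x + b * S ns y                                        ≡⟨ *-distribˡ-+ b (S ns′ x) _ ⟨
        b * (S ns′ x + S ns y)                                          ≡⟨ cong₂ (λ u w → b * (u + w)) (S-loop D′ x≤m) (trans (S-loop D y≤m) (cong sum (seg-cong (loop ns) (loop ns′) 0 x y (λ t _ → sym (e t))))) ⟩
        b * (sum (seg (loop ns′) 0 x) + sum (seg (loop ns′) x y))       ≡⟨ cong (b *_) (sum-++ (seg (loop ns′) 0 x) _) ⟨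
        b * sum (seg (loop ns′) 0 x ++ seg (loop ns′) x y)              ≡⟨ cong (λ l → b * sum l) (seg-++ (loop ns′) 0 x y) ⟨
        b * sum (seg (loop ns′) 0 (x + y))                              ≡⟨ cong (λ k → b * sum (seg (loop ns′) 0 k)) x+y ⟩
        b * sum (seg (loop ns′) 0 b)                                    ≡⟨ cong (λ l → b * sum l) (seg-ext b (ns′ ++ 0 ∷ []) (len₀ D′)) ⟩
        b * sum (ns′ ++ 0 ∷ [])                                         ≡⟨ cong (b *_) (sum₀ D′) ⟩
        b * a                                                           ≡⟨ *-comm b a ⟩
        a * b ∎)
        where
        open ≤-Reasoning
        y = b ∸ x
        x+y : x + y ≡ b
        x+y = m+[n∸m]≡n (≤-trans x≤m (n≤1+n m))
        y≤m : y ≤ m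
        y≤m = s≤s⁻¹ (+-cancelˡ-≤ x (suc y) b (≤-trans (≤-reflexive (trans (+-suc x y) (cong suc x+y))) (+-monoˡ-≤ b 0<x)))

      aligned : ∀ {ns ns′} v x → seg (loop ns) v b ≡ seg (loop ns′) (v + x) b → ∀ s → loop ns′ (x + s) ≡ loop ns s
      aligned {ns} {ns′} v x e s = begin
        loop ns′ (x + s)                    ≡⟨ periodic-* (loop-per ns′) v (x + s) ⟨
        loop ns′ (x + s + v * b)            ≡⟨ cong (loop ns′) (trans (+-assoc x s (v * b)) (trans (cong (x +_) (sym u+)) (trans (lem x v t (q * b)) refl))) ⟩
        loop ns′ (v + x + t + q * b)        ≡⟨ periodic-* (loop-per ns′) q (v + x + t) ⟩
        loop ns′ (v + x + t)                ≡⟨ nth-seg (loop ns′) (v + x) b t (m%n<n u b) ⟨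
        nth (seg (loop ns′) (v + x) b) t    ≡⟨ cong (λ l → nth l t) e ⟨
        nth (seg (loop ns) v b) t           ≡⟨ nth-seg (loop ns) v b t (m%n<n u b) ⟩
        loop ns (v + t)                     ≡⟨ periodic-* (loop-per ns) q (v + t) ⟨
        loop ns (v + t + q * b)             ≡⟨ cong (loop ns) u+ ⟩
        loop ns (s + v * b)                 ≡⟨ periodic-* (loop-per ns) v s ⟩
        loop ns s ∎
        where
        open ≡-Reasoning
        -- This is `s - v` modulo `b`, the place in the window at which `s` is read.
        u = s + v * m
        t = u % b
        q = u / b
        u+ : v + t + q * b ≡ s + v * b
        u+ = trans (+-assoc v t (q * b)) (trans (cong (v +_) (sym (m≡m%n+[m/n]*n u b))) (lem′ v s m))
          where
          lem′ : ∀ v s m → v + (s + v * m) ≡ s + v * suc m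
          lem′ = solve-∀
        lem : ∀ x v t y → x + (v + t + y) ≡ v + x + t + y
        lem = solve-∀

      same-base : ∀ {ns ns′} → DW ns → DW ns′ → ∀ {v v′} → v ≤ v′ → v′ < b → seg (loop ns) v b ≡ seg (loop ns′) v′ b → v ≡ v′ × ns ≡ ns′
      same-base {ns} {ns′} D D′ {v} {v′} v≤v′ v′<b e = trans (sym (+-identityʳ v)) (trans (cong (v +_) (sym x≡0)) v+x) , ++-cancelʳ (0 ∷ []) ns ns′
        (trans (sym (seg-ext b _ (len₀ D))) (trans (seg-cong (loop ns) (loop ns′) 0 0 b (λ t _ → sym (trans (cong (λ x → loop ns′ (x + t)) (sym x≡0)) (al t)))) (seg-ext b _ (len₀ D′))))
        where
        x = v′ ∸ v
        v+x : v + x ≡ v′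
        v+x = m+[n∸m]≡n v≤v′
        al : ∀ s → loop ns′ (x + s) ≡ loop ns s
        al = aligned {ns} {ns′} v x (trans e (cong (λ k → seg (loop ns′) k b) (sym v+x)))
        x≡0 : x ≡ 0
        x≡0 = n≤0⇒n≡0 (≮⇒≥ (no-rotation D D′ x al (≤-<-trans (m∸n≤m v′ v) v′<b)))

    rotated-injective : ∀ {p p′ W} → Rotated p W → Rotated p′ W → p ≡ p′
    rotated-injective {v , π} {v′ , π′} (rotated D refl v<b e) (rotated D′ refl v′<b e′) with ≤-total v v′
    ... | inj₁ le = let v≡ , ns≡ = same-base D D′ le v′<b (trans (sym e) e′) in cong₂ _,_ v≡ (cong πW ns≡)
    ... | inj₂ le = let v≡ , ns≡ = same-base D′ D le v<b (trans (sym e′) e) in cong₂ _,_ (sym v≡) (cong πW (sym ns≡))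

    rotated-functional : ∀ {p W W′} → Rotated p W → Rotated p W′ → W ≡ W′
    rotated-functional (rotated D π≡ _ e) (rotated D′ π≡′ _ e′) =
      trans e (trans (cong (λ ns → seg (loop ns) _ b) (π-injective D D′ (trans π≡ (sym π≡′)))) (sym e′))

    word-of-partition : ∀ {v π} → v < b → InX a b r π → ∃ λ W → W ∈ words b c × Rotated (v , π) W
    word-of-partition {v} {π} v<b inX = convert (InX⇒word {r} inX)
      where
      convert : (∃ λ ns → DW ns × Content r ns × πW ns ≡ π) → ∃ λ W → W ∈ words b c × Rotated (v , π) W
      convert (ns , D , co , e) = W , words-complete b c W (length-seg (loop ns) v b) (all , cnts) , rotated D e v<b refl
        where
        W = seg (loop ns) v b
        all : All (_< suc a) W
        all = All-seg (loop ns) v b λ t → s≤s (≤-trans (nth-≤-sum (ns ++ 0 ∷ []) (t % b)) (≤-reflexive (sum₀ D)))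
        cnts : ∀ t → cnt (toℕ t) W ≡ lookup c t
        cnts t = trans (cnt-seg-rotate (loop-per ns) (toℕ t) v) (trans (cong (cnt (toℕ t)) (seg-ext b (ns ++ 0 ∷ []) (len₀ D))) (full⁺ D co t))

    partition-of-word : ∀ {W} → W ∈ words b c → ∃ λ v → ∃ λ π → InX a b r π × Rotated (v , π) W
    partition-of-word {W} W∈ = convert (words-sound b c sum-c W∈)
      where
      f = ext b W
      convert : length W ≡ b × HasContent c W → ∃ λ v → ∃ λ π → InX a b r π × Rotated (v , π) W
      convert (len , all , co) = finish (dyck-rotation {f} (ext-periodic b W) (trans (cong sum (seg-ext b W len)) sum-W))
        where
        sum-W : sum W ≡ a
        sum-W = trans (sym (sum-by-content (suc a) W all)) (trans (ΣF-cong {suc a} (λ v → cong (toℕ v *_) (co v))) weighted-c)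
        finish : (∃ λ v → v < b × DW (seg f v m) × f (v + m) ≡ 0) → ∃ λ v → ∃ λ π → InX a b r π × Rotated (v , π) W
        finish (v₀ , v₀<b , D , z) = v , πW ns , word⇒InX {r} D (full⁻ {ns} fc) , rotated D refl (m%n<n (v₀ * m) b) W≡
          where
          ns = seg f v₀ m
          -- This is `- v₀` modulo `b`, the rotation that undoes the start at `v₀`.
          v = (v₀ * m) % b
          q = (v₀ * m) / b
          ns₀ : ns ++ 0 ∷ [] ≡ seg f v₀ b
          ns₀ = sym (trans (cong (seg f v₀) (+-comm 1 m)) (trans (seg-++ f v₀ m 1) (cong (λ x → ns ++ x ∷ []) z)))
          fc : FullContent ns
          fc t = trans (cong (cnt (toℕ t)) ns₀) (trans (cnt-seg-rotate (ext-periodic b W) (toℕ t) v₀) (trans (cong (cnt (toℕ t)) (seg-ext b W len)) (co t)))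
          loop-f : ∀ t → loop ns t ≡ f (v₀ + t)
          loop-f t = trans (cong (λ l → nth l (t % b)) ns₀) (trans (nth-seg f v₀ b (t % b) (m%n<n t b))
            (trans (sym (periodic-* (ext-periodic b W) (t / b) (v₀ + t % b))) (cong f (trans (+-assoc v₀ _ _) (cong (v₀ +_) (sym (m≡m%n+[m/n]*n t b)))))))
          v₀+v : v₀ + v + q * b ≡ v₀ * b
          v₀+v = trans (+-assoc v₀ v (q * b)) (trans (cong (v₀ +_) (sym (m≡m%n+[m/n]*n (v₀ * m) b))) (sym (*-suc v₀ m)))
          W≡ : W ≡ seg (loop ns) v b
          W≡ = trans (sym (seg-ext b W len)) (seg-cong f (loop ns) 0 v b λ t _ → sym (begin
            loop ns (v + t)               ≡⟨ loop-f (v + t) ⟩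
            f (v₀ + (v + t))              ≡⟨ periodic-* (ext-periodic b W) q (v₀ + (v + t)) ⟨
            f (v₀ + (v + t) + q * b)      ≡⟨ cong f (trans (lem v₀ v t (q * b)) (cong (t +_) v₀+v)) ⟩
            f (t + v₀ * b)                ≡⟨ periodic-* (ext-periodic b W) v₀ t ⟩
            f t ∎))
            where
            open ≡-Reasoning
            lem : ∀ x v t y → x + (v + t) + y ≡ t + (x + v + y)
            lem = solve-∀

    total-count : ∀ L → Unique L → (∀ {π} → π ∈ L → InX a b r π) → (∀ {π} → InX a b r π → π ∈ L) → b * length L ≡ length (words b c)
    total-count L uniq sound complete = trans (sym (trans (length-× (upTo b) L) (cong (_* length L) (length-upTo b))))
      (bijection-≡ Rotated (cartesianProduct (upTo b) L) (words b c) (Unique.cartesianProduct⁺ (Unique.upTo⁺ b) uniq) (words-unique b c)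
        (λ { {v , π} p → let v∈ , π∈ = ∈-cartesianProduct⁻ (upTo b) L p in word-of-partition (∈-upTo⁻ v∈) (sound π∈) })
        (λ {W} W∈ → let v , π , inX , rot = partition-of-word W∈ in (v , π) , ∈-cartesianProduct⁺ (∈-upTo⁺ (Rotated.v<b rot)) (complete inX) , rot)
        rotated-injective rotated-functional)

-- Comparison of the values of `X` with the numbers of fixed partitions.

open import Defs
open Polynomial
open QMultinomial using (qfacts)
open Kreweras
open Evaluation
open Words
open Rotation
open FixedPartitions
open Coding
open TotalCount
open import Level using (0ℓ)
open import Data.Nat as ℕ using (ℕ; zero; suc; _+_; _*_; _∸_; _≤_; _<_; z≤n; s≤s; z<s; NonZero; >-nonZero; _!; _/_; _%_)
open import Data.Nat.Properties
open import Data.Nat.DivMod using (m%n<n; m≡m%n+[m/n]*n)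
open import Data.Nat.Divisibility using (_∣_; divides; ∣⇒≤; m%n≡0⇒n∣m; n∣m*n)
open import Data.Nat.GCD using (gcd; gcd[m,n]∣m; gcd[m,n]∣n; gcd-greatest; gcd-GCD; c*gcd[m,n]≡gcd[cm,cn]; module Bézout)
open import Data.Nat.Coprimality using (Coprime)
import Data.Nat.ListAction as ListAction
open import Data.Nat.Tactic.RingSolver using (solve-∀)
open import Data.Fin using (Fin; toℕ)
open import Data.List as List using (List; []; _∷_; length)
open import Data.List.Membership.Propositional using (_∈_)
open import Data.List.Relation.Unary.Any using (here)
open import Data.List.Relation.Unary.Unique.Propositional using (Unique)
open import Data.Vec using (Vec; lookup; tabulate; sum)
import Data.Vec as Vec
import Data.Vec.Properties as Vec
open import Data.Product using (Σ; _×_; _,_; proj₁; proj₂)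
open import Data.Empty using (⊥-elim)
open import Relation.Nullary using (¬_; Dec; yes; no)
import Relation.Binary.PropositionalEquality as ≡
open ≡ using (_≡_)
open import Algebra.Bundles using (CommutativeRing)

module _ {m : ℕ} .{{_ : NonZero m}} (R : Rel m) where

  invariant-+ : ∀ {u v} → Invariant R u → Invariant R v → Invariant R (u + v)
  invariant-+ {u} {v} iu iv t t′ = ≡.trans (≡.cong₂ (β R) (+-assoc u v t) (+-assoc u v t′)) (≡.trans (iu (v + t) (v + t′)) (iv t t′))

  invariant-− : ∀ {u v} → Invariant R (u + v) → Invariant R v → Invariant R u
  invariant-− {u} {v} iuv iv t t′ = ≡.trans (≡.sym (iv (u + t) (u + t′))) (≡.trans (≡.cong₂ (β R) (lem v u t) (lem v u t′)) (iuv t t′))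
    where
    lem : ∀ v u t → v + (u + t) ≡ u + v + t
    lem = solve-∀

  invariant-* : ∀ k {u} → Invariant R u → Invariant R (k * u)
  invariant-* zero iu t t′ = ≡.refl
  invariant-* (suc k) {u} iu = invariant-+ {u} {k * u} iu (invariant-* k iu)

  invariant-m : Invariant R m
  invariant-m t t′ = ≡.trans (≡.cong₂ (β R) (lem m t) (lem m t′)) (β-+* R 1 t t′)
    where
    lem : ∀ m t → m + t ≡ t + 1 * m
    lem = solve-∀

  -- The translations that leave a partition invariant are closed under sums and differences and
  -- include `m`.
  invariant-gcd : ∀ d → Invariant R d → Invariant R (gcd d m)
  invariant-gcd d id with Bézout.identity (gcd-GCD d m)
  ... | Bézout.Identity.+- x y e = invariant-− {gcd d m} {y * m} (≡.subst (Invariant R) (≡.sym e) (invariant-* x id)) (invariant-* y invariant-m)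
  ... | Bézout.Identity.-+ x y e = invariant-− {gcd d m} {x * d} (≡.subst (Invariant R) (≡.sym e) (invariant-* y invariant-m)) (invariant-* x id)

module Sieving (a m′ : ℕ) (0<a : 0 < a) (a≤m : a ≤ suc m′) (cop : Coprime a (suc (suc m′))) (r : Vec ℕ a)
               (weighted : sum (tabulate (λ (t : Fin a) → suc (toℕ t) * lookup r t)) ≡ a)
               (X : Poly) (X-eq : X *ₚ krewDen (suc (suc m′)) r ≋ krewNum (suc (suc m′)))
               (R : CommutativeRing 0ℓ 0ℓ) (dom : RingEval.IsChar0Domain R)
               (ζ : CommutativeRing.Carrier R) (prim : RingEval.IsPrimitiveRoot R (suc m′) ζ)
               (d : ℕ) (L : List (Rel (suc m′))) (enum : EnumeratesFixed a (suc (suc m′)) r d L) where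
  private
    m = suc m′
    b = suc m
    open CommutativeRing R using (Carrier; _≈_; 1#; 0#; setoid; refl; sym; trans; reflexive) renaming (_*_ to _⊛_)
    open Eval R
    open Domain dom
    open ContentBase a m 0<a a≤m cop r weighted

    g = gcd d m
    ω = pow ζ d
    cs = Vec.toList c

    X-facts : X *ₚ qfacts cs ≋ qfact m
    X-facts = ≋-trans (*ₚ-congʳ X (≋-sym (krewDen-qfacts b r))) X-eq

    g∣d : g ∣ d
    g∣d = gcd[m,n]∣m d m

    quotient-of : ∀ {x y} → x ∣ y → ℕ
    quotient-of = _∣_.quotient

    unique-L : Unique L
    unique-L = proj₁ enum

    sound : ∀ {π} → π ∈ L → InX a b r π × Invariant π g
    sound {π} π∈ = let inX , fix = proj₁ (proj₂ enum π) π∈ in inX , invariant-gcd π d (rot-fixed⇒invariant d π fix)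

    complete : ∀ {π} → InX a b r π → Invariant π g → π ∈ L
    complete {π} inX inv = proj₂ (proj₂ enum π) (inX , invariant⇒rot-fixed d π
      (≡.subst (Invariant π) (≡.sym (_∣_.equality g∣d)) (invariant-* π (quotient-of g∣d) inv)))

    pow-m : ∀ k → pow ζ (k * m) ≈ 1#
    pow-m k = trans (pow-* ζ m k) (trans (pow-cong k (proj₁ prim)) (pow-1# k))

    pow-% : ∀ x → pow ζ x ≈ pow ζ (x % m)
    pow-% x = trans (reflexive (≡.cong (pow ζ) (m≡m%n+[m/n]*n x m))) (trans (pow-+ ζ (x % m) (x / m * m))
      (trans (CommutativeRing.*-congˡ R (pow-m (x / m))) (CommutativeRing.*-identityʳ R _)))

    conclude : ∀ M F → 0 < F → eval X ω ⊛ ιℕ F ≈ ιℕ M → length L * F ≡ M → eval X ω ≈ ιℕ (length L)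
    conclude M F 0<F e e′ = *-cancelʳ (ι-nonzero F 0<F) (trans e (trans (reflexive (≡.cong ιℕ (≡.sym e′))) (ι-* (length L) F)))

    -- Here `ω = 1`. The value of `X` times the product of the factorials is `m !`; the count
    -- satisfies the same equation after `b` is cancelled from both sides.
    trivial : g ≡ m → eval X ω ≈ ιℕ (length L)
    trivial g≡m = conclude (m !) (facts cs) (facts-pos cs)
        (trans (trans (CommutativeRing.*-congˡ R (sym (eval-qfacts-1 ω≈1 cs))) (sym (eval-* X (qfacts cs) ω)))
          (trans (eval-cong ω X-facts) (eval-qfact-1 ω≈1 m)))
        (*-cancelˡ-≡ (length L * facts cs) (m !) b (≡.trans (≡.sym (*-assoc b (length L) (facts cs)))
          (≡.trans (≡.cong (_* facts cs) count) (words-count b c sum-c))))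
      where
      ω≈1 : ω ≈ 1#
      ω≈1 = trans (reflexive (≡.cong (pow ζ) (≡.trans (_∣_.equality g∣d) (≡.cong (quotient-of g∣d *_) g≡m)))) (pow-m (quotient-of g∣d))
      count : b * length L ≡ length (words b c)
      count = CycleBase.total-count a m 0<a a≤m cop r weighted L unique-L (λ π∈ → proj₁ (sound π∈))
        (λ {π} inX → complete inX (≡.subst (Invariant π) (≡.sym g≡m) (invariant-m π)))

    module _ (n : ℕ) (m≡ : m ≡ n * g) (1<n : 1 < n) where
      instance
        n-nz : NonZero n
        n-nz = >-nonZero (<-trans z<s 1<n)

      order : pow ω n ≈ 1#
      order = trans (sym (pow-* ζ d n)) (trans (reflexive (≡.cong (pow ζ) (≡.trans (≡.cong (n *_) (_∣_.equality g∣d)) (≡.trans (lem n k g) (≡.cong (k *_) (≡.sym m≡)))))) (pow-m k))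
        where
        k = quotient-of g∣d
        lem : ∀ n k g → n * (k * g) ≡ k * (n * g)
        lem = solve-∀

      -- If the `j`-th power of `ω` is 1, then `m` divides `j d`. It also divides `j m`, hence their
      -- greatest common divisor `j g`, which is less than `m`.
      minimal : ∀ j → 0 < j → j < n → ¬ pow ω j ≈ 1#
      minimal j 0<j j<n e = <⇒≱ jg<m (∣⇒≤ {{>-nonZero 0<jg}} m∣jg)
        where
        0<g : 0 < g
        0<g = n≢0⇒n>0 λ g≡0 → 1+n≢0 (≡.trans m≡ (≡.trans (≡.cong (n *_) g≡0) (*-zeroʳ n)))
        0<jg : 0 < j * g
        0<jg = *-mono-< 0<j 0<g
        jg<m : j * g < m
        jg<m = ≡.subst (j * g <_) (≡.sym m≡) (*-monoˡ-< g {{>-nonZero 0<g}} j<n)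
        jd%m : (j * d) % m ≡ 0
        jd%m = n≤0⇒n≡0 (≮⇒≥ λ pos → proj₂ prim ((j * d) % m) pos (m%n<n (j * d) m)
          (trans (sym (pow-% (j * d))) (trans (pow-* ζ d j) e)))
        m∣jg : m ∣ j * g
        m∣jg = ≡.subst (m ∣_) (≡.sym (c*gcd[m,n]≡gcd[cm,cn] j d m)) (gcd-greatest (m%n≡0⇒n∣m (j * d) m jd%m) (n∣m*n j))

      open Root n 1<n ω order minimal
      open CodedBase a m 0<a a≤m cop r weighted g n m≡ 1<n using (qs; no-fixed; fixed-count)

      gn : m ≡ g * n
      gn = ≡.trans m≡ (*-comm n g)

      sum-cs : ListAction.sum cs ≡ suc (g * n)
      sum-cs = ≡.trans (sum-toList c) (≡.trans sum-c (≡.cong suc gn))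

      X-facts′ : X *ₚ qfacts cs ≋ qfact (g * n)
      X-facts′ = ≡.subst (λ k → X *ₚ qfacts cs ≋ qfact k) gn X-facts

      quots-qs : quots cs ≡ Vec.toList qs
      quots-qs = ≡.sym (Vec.toList-map (ℕ._/ n) c)

      sum-quots : ListAction.sum (quots cs) ≡ sum qs
      sum-quots = ≡.trans (≡.cong ListAction.sum quots-qs) (sum-toList qs)

      attained : sum qs ≡ g → eval X ω ≈ ιℕ (length L)
      attained e = conclude (g !) (facts (quots cs)) (facts-pos (quots cs)) (value-multinomial g cs sum-cs X X-facts′ (≡.trans sum-quots e))
        (≡.trans (≡.cong₂ _*_ (fixed-count e L unique-L sound complete) (≡.cong facts quots-qs)) (words-count g qs e))

      missed : ¬ sum qs ≡ g → eval X ω ≈ ιℕ (length L)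
      missed ne = trans (value-vanishes g cs sum-cs X X-facts′ (λ e → ne (≡.trans (≡.sym sum-quots) e)))
        (reflexive (≡.cong (λ L → ιℕ (length L)) (≡.sym (empty L sound))))
        where
        empty : ∀ L → (∀ {π} → π ∈ L → InX a b r π × Invariant π g) → L ≡ []
        empty [] s = ≡.refl
        empty (π ∷ L) s = ⊥-elim (no-fixed ne π (proj₁ (s (here ≡.refl))) (proj₂ (s (here ≡.refl))))

      nontrivial : Dec (sum qs ≡ g) → eval X ω ≈ ιℕ (length L)
      nontrivial (yes e) = attained e
      nontrivial (no ne) = missed ne

    by-order : g ∣ m → eval X ω ≈ ιℕ (length L)
    by-order (divides zero e) = ⊥-elim (1+n≢0 e)
    -- The quotient of `m` by `g` is the order of `ω`; order 1 is the total count.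
    by-order (divides (suc zero) e) = trivial (≡.sym (≡.trans e (+-identityʳ g)))
    by-order (divides (suc (suc n)) e) = nontrivial (suc (suc n)) e (s≤s (s≤s z≤n)) (_ ℕ.≟ g)

  value : eval X ω ≈ ιℕ (length L)
  value = by-order (gcd[m,n]∣n d m)

theorem5p1 : (a b : ℕ) → 0 < a → a < b → Coprime a b →
    (r : Vec ℕ a) → sum (tabulate (λ (t : Fin a) → suc (toℕ t) * lookup r t)) ≡ a →
    Σ Poly (λ X →
    ((X *ₚ krewDen b r) ≈ₚ krewNum b)
    × ((R : CommutativeRing 0ℓ 0ℓ) → RingEval.IsChar0Domain R →
    (ζ : CommutativeRing.Carrier R) → RingEval.IsPrimitiveRoot R (b ∸ 1) ζ →
    (d : ℕ) → (L : List (Rel (b ∸ 1))) → EnumeratesFixed a b r d L →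
    CommutativeRing._≈_ R (RingEval.eval R X (RingEval.pow R ζ d))
    (RingEval.ιℕ R (length L))))
theorem5p1 a (suc zero) 0<a (s≤s a≤0) cop r weighted = ⊥-elim (<⇒≱ 0<a a≤0)
theorem5p1 a (suc (suc m)) 0<a (s≤s a≤m) cop r weighted =
  proj₁ X , at (proj₂ X) , Sieving.value a m 0<a a≤m cop r weighted (proj₁ X) (proj₂ X)
  where X = krew a (suc m) a≤m cop r weighted
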